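{- Let $M(x)=\sum_{n} M_n x^n$, where $M_n$ is the number of rooted simple 4-regular planar maps with $n$ vertices. Then $M(x)$ is an algebraic function, and it is expressible as the solution of a system of algebraic equations from which its coefficients can be effectively computed.
   Context: A planar map is a connected graph (possibly with multiple edges and loops) embedded in the sphere, considered up to orientation-preserving homeomorphism. A map is rooted if one edge $uv$ is distinguished and directed from $u$ to $v$; the face to the right of the root edge is the root (outer) face. A map is simple if its underlying graph has no loops and no multiple edges, and 4-regular if every vertex has degree 4. -}

module Defs where

open import Data.Nat using (ℕ; zero; suc; _∸_; _*_)
open import Data.Integer using (ℤ; +_; 0ℤ) renaming (_+_ to _+ℤ_; _*_ to _*ℤ_)
open import Data.Fin using (Fin)
open import Data.List using (List; []; _∷_; upTo; map; foldr)
open import Data.Product using (Σ; ∃; _×_; _,_)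
open import Relation.Binary.PropositionalEquality using (_≡_; _≢_)
open import Relation.Nullary using (¬_)
open import Function using (_∘_)
open import Function.Bundles using (_↔_; Inverse)

-- Combinatorial maps (rotation systems) on a finite set of darts.
-- A map with N darts is a pair (σ, α) of permutations of Fin N:
--   σ = rotation around vertices (vertices = σ-cycles),
--   α = fixed-point-free involution (edges = α-cycles),
--   faces = cycles of σ ∘ α; connected = ⟨σ,α⟩ transitive;
--   planar (sphere) = Euler: V − E + F = 2.

iter : ∀ {N} → (Fin N → Fin N) → ℕ → Fin N → Fin N
iter f zero    d = d
iter f (suc k) d = f (iter f k d)

SameOrbit : ∀ {N} → (Fin N → Fin N) → Fin N → Fin N → Set
SameOrbit f d e = ∃ λ k → iter f k d ≡ e

-- reachability by words in σ and α (transitivity of the group ⟨σ,α⟩;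
-- inverses are not needed since the permutations have finite order)
data Reach {N} (σ α : Fin N → Fin N) (d : Fin N) : Fin N → Set where
  here : Reach σ α d d
  viaσ : ∀ {e} → Reach σ α d e → Reach σ α d (σ e)
  viaα : ∀ {e} → Reach σ α d e → Reach σ α d (α e)

HasOrbits : ∀ {N} → (Fin N → Fin N) → ℕ → Set
HasOrbits {N} f k =
  Σ (Fin k → Fin N) λ rep →
    (∀ e → ∃ λ i → SameOrbit f (rep i) e) ×
    (∀ i j → SameOrbit f (rep i) (rep j) → i ≡ j)

-- A rooted simple 4-regular planar map with n vertices, encoded on the
-- dart set Fin (4n) (4-regular with n vertices ⇒ 2n edges, 4n darts).
record RootedS4Map (n : ℕ) : Set where
  field
    σ α        : Fin (4 * n) → Fin (4 * n)
    root       : Fin (4 * n)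
    α-invol    : ∀ d → α (α d) ≡ d
    α-fpf      : ∀ d → α d ≢ d
    -- every vertex has degree exactly 4 (σ is a bijection, all cycles of length 4)
    σ-order4   : ∀ d → iter σ 4 d ≡ d
    σ-noshort  : ∀ d → iter σ 2 d ≢ d
    connected  : ∀ d e → Reach σ α d e
    -- V = n vertices (σ-cycles, automatic here), E = 2n edges, so
    -- Euler's formula V − E + F = 2 on the sphere means F = n + 2 faces
    planar     : HasOrbits (σ ∘ α) (n Data.Nat.+ 2)
    loopless   : ∀ d → ¬ SameOrbit σ d (α d)
    no-multi   : ∀ d e → e ≢ d → e ≢ α d →
                 SameOrbit σ d e → ¬ SameOrbit σ (α d) (α e)

-- isomorphism of rooted maps: dart bijection commuting with σ and α,
-- sending root to root (orientation preserving by construction)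
RootedIso : ∀ {n} → RootedS4Map n → RootedS4Map n → Set
RootedIso {n} m m' =
  Σ (Fin (4 * n) ↔ Fin (4 * n)) λ φ →
    let f = Inverse.to φ in
    (∀ d → f (RootedS4Map.σ m d) ≡ RootedS4Map.σ m' (f d)) ×
    (∀ d → f (RootedS4Map.α m d) ≡ RootedS4Map.α m' (f d)) ×
    (f (RootedS4Map.root m) ≡ RootedS4Map.root m')

CountsRootedS4Maps : ℕ → ℕ → Set
CountsRootedS4Maps n k =
  Σ (Fin k → RootedS4Map n) λ rep →
    (∀ m → ∃ λ i → RootedIso m (rep i)) ×
    (∀ i j → RootedIso (rep i) (rep j) → i ≡ j)

Series : Set
Series = ℕ → ℤ

sumℤ : List ℤ → ℤ
sumℤ = foldr _+ℤ_ 0ℤ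

_⊕_ : Series → Series → Series
(f ⊕ g) n = f n +ℤ g n

_⊗_ : Series → Series → Series
(f ⊗ g) n = sumℤ (map (λ i → f i *ℤ g (n ∸ i)) (upTo (suc n)))

zeroS : Series
zeroS _ = 0ℤ

coeff : List ℤ → ℕ → ℤ
coeff []       _       = 0ℤ
coeff (c ∷ cs) zero    = c
coeff (c ∷ cs) (suc k) = coeff cs k

-- P(x,y) = Σ_j P_j(x) y^j, given as the list [P_0, P_1, ...];
-- evalP P F = P(x, F(x)) as a formal power series (Horner)
evalP : List (List ℤ) → Series → Series
evalP []       F = zeroS
evalP (p ∷ ps) F = coeff p ⊕ (F ⊗ evalP ps F)

NonZeroPoly : List (List ℤ) → Set
NonZeroPoly P = ∃ λ j → ∃ λ i → coeff (lookupD P j) i ≢ 0ℤ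
  where
  lookupD : List (List ℤ) → ℕ → List ℤ
  lookupD []       _       = []
  lookupD (p ∷ ps) zero    = p
  lookupD (p ∷ ps) (suc j) = lookupD ps j

Algebraic : Series → Set
Algebraic F = ∃ λ P → NonZeroPoly P × (∀ n → evalP P F n ≡ 0ℤ)

{-# OPTIONS --safe #-}

-- Cut a rooted 4-regular planar map open at its root vertex. What remains is a planar region with four
-- legs; peel it by always exploring its first leg, which is either joined to another leg, cutting the region
-- into two, or ends at a new vertex, whose three other darts become legs. This encodes the map by a tree.
-- Conversely a tree is glued back into a map, and Euler's formula is what excludes that peeling ever joins
-- legs of two different boundary cycles.
--
-- The map is simple exactly when no two darts of a vertex clash, that is, are joined to each other or end at
-- a common vertex. Trees can be rotated, so a clash of any two consecutive legs is counted like a clash of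
-- the first two, and a clash of the first two legs splits off a smaller region. Inclusion-exclusion over
-- the clashes of the three new legs turns the peeling recurrence into the loop equation
-- l A(h+1) = u (A ⊠ A)(h) + g A(h+2) of all 4-regular maps, h being half the number of legs, with weights
-- that depend on A 1 only. For a series t given by a quadratic equation over these weights, it is solved by
-- c - v c (c - 1) with c = 1 + w z c². Hence A 1, A 2 and the count M of the scattered four-legged regions
-- are rational in Z and t, t is algebraic, and eliminating t gives an equation of degree 4 for M.

module Submission where

-- Simplicity constrains pairs of darts at one vertex, and the three darts of a vertex just peeled
-- may meet again deep inside the remaining region, so peeling alone does not see it. What makes
-- inclusion-exclusion feasible is that clashing is transitive on the legs of a region and that two
-- crossing clashes merge into one: few patterns remain, and rotation brings each of them to legs 0,
-- 1, 2. The weights of the loop equation contain `A 1`, itself one of the unknowns, but there is no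
-- circle. For any series `k` the weights built from `k` admit exactly one solution with constant
-- term 1, known in closed form. Taking for `k` the series `κ` made of the counts identifies the
-- counts with the closed form; its entry of index 1 then expresses `A 1` by `t`, and the quadratic
-- equation of `t` becomes a polynomial one over the integers. A tree names no darts, so simplicity
-- and clashes are read off a realisation by permutations. Their independence of the choice comes
-- from realising the tree in the product of two realisations, and injectivity of rotation from the
-- fact that legs and `α` determine the tree.

module Trees where

  open import Data.Nat using (ℕ; zero; suc; _+_; _∸_; _≤_; z≤n; s≤s)
  import Data.Nat.Properties as ℕ
  open import Data.List using (List; []; _∷_; _++_; length; concatMap)
  import Data.List.Properties as List
  open import Data.List.Membership.Propositional using (_∈_)
  open import Data.List.Relation.Unary.Any using (here; there)
  open import Data.List.Relation.Binary.Permutation.Propositional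
    using (_↭_; ↭-refl; ↭-sym; ↭-trans; ↭-reflexive; prep)
  import Data.List.Relation.Binary.Permutation.Propositional.Properties as ↭
  open import Data.Product using (∃; _×_; _,_)
  open import Data.Empty using (⊥; ⊥-elim)
  open import Relation.Binary.PropositionalEquality

  -- Peeling trees, their realisations by permutations, and the rotation of legs.

  data Tree : Set where
    nil  : Tree
    join : Tree → Tree → Tree
    new  : Tree → Tree

  edges : Tree → ℕ
  edges nil        = 0
  edges (join l r) = suc (edges l + edges r)
  edges (new t)    = suc (edges t)

  legs : Tree → ℕ
  legs nil        = 0
  legs (join l r) = suc (legs l + suc (legs r))
  -- Three darts of the vertex have replaced the single leg that reaches it.
  legs (new t)    = legs t ∸ 2

  dbl : ℕ → ℕ
  dbl zero    = zero
  dbl (suc n) = suc (suc (dbl n))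

  dbl-+ : ∀ m n → dbl (m + n) ≡ dbl m + dbl n
  dbl-+ zero    n = refl
  dbl-+ (suc m) n = cong (λ k → suc (suc k)) (dbl-+ m n)

  dbl-inj : ∀ {m n} → dbl m ≡ dbl n → m ≡ n
  dbl-inj {zero}  {zero}  _ = refl
  dbl-inj {suc m} {suc n} p = cong suc (dbl-inj (ℕ.suc-injective (ℕ.suc-injective p)))

  -- The indices are half the number of legs and the number of vertices. In `new` the inner region
  -- has three darts of the vertex among its legs and by parity at least one more, hence half-length
  -- at least 2.
  data WF : Tree → ℕ → ℕ → Set where
    nil  : WF nil 0 0
    join : ∀ {l r i j m k} → WF l i m → WF r j k → WF (join l r) (suc (i + j)) (m + k)
    new  : ∀ {t h n} → WF t (suc (suc h)) n → WF (new t) (suc h) (suc n)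

  -- The result has the legs of `l`, then a leg `u`, then the legs of `r`, then a last leg joined to
  -- `u`. Since only first legs are peeled, the legs of `l` must be peeled off before the join
  -- becomes visible.
  joinLast : Tree → Tree → Tree
  joinLast nil        r = join r nil
  joinLast (join a b) r = join a (joinLast b r)
  joinLast (new t)    r = new (joinLast t r)

  iterate : {A : Set} → (A → A) → ℕ → A → A
  iterate f zero    x = x
  iterate f (suc k) x = iterate f k (f x)

  rotateBy : ℕ → Tree → Tree
  -- Replaces the last three legs, which are darts `σ e`, `σ (σ e)`, `σ (σ (σ e))` of one vertex, by
  -- a single last leg that ends at its fourth dart `e`.
  newLast  : ℕ → Tree → Tree
  -- The first leg is joined to a leg `u`, and the number of legs of `r` tells where `u` stands:
  -- with 0 or 2 it is the last or the first of the three darts, with 1 the middle one, which parity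
  -- excludes, and with more it precedes them. In the cases 0 and 2 the first leg now reaches the
  -- vertex, which is entered at `u` instead of `e`, and `e` is joined to the new last leg.
  newLastJoin : ℕ → Tree → Tree → Tree → ℕ → Tree

  -- The first argument is fuel, to be at least the number of edges.
  rotateBy zero    t          = t
  rotateBy (suc f) nil        = nil
  rotateBy (suc f) (join l r) = joinLast l r
  rotateBy (suc f) (new t)    = newLast f (rotateBy f (rotateBy f (rotateBy f t)))

  newLast f nil        = nil
  newLast f (new t)    = new (newLast f t)
  newLast f (join l r) = newLastJoin f l r (newLast f r) (legs r)

  newLastJoin f l r r′ 0 = new (join (iterate (rotateBy f) (legs l ∸ 2) l) nil)
  newLastJoin f l r r′ 1 = nil
  newLastJoin f l r r′ 2 = new (joinLast r l)
  newLastJoin f l r r′ (suc (suc (suc _))) = join l r′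

  rotate : Tree → Tree
  rotate t = rotateBy (edges t) t

  split-++ : {A : Set} (xs : List A) {u : A} {ys s t : List A} →
    xs ++ u ∷ ys ≡ s ++ t → length t ≤ length ys →
    ∃ λ ys′ → ys ≡ ys′ ++ t × s ≡ xs ++ u ∷ ys′
  split-++ [] {s = []} {x ∷ t} refl le = ⊥-elim (ℕ.<-irrefl refl le)
  split-++ [] {s = x ∷ s} refl le = s , refl , refl
  split-++ (x ∷ xs) {u} {ys} {s = []} {t = t} refl le =
    ⊥-elim (ℕ.<-irrefl refl (ℕ.≤-trans (s≤s (ℕ.≤-trans (ℕ.m≤n+m (length ys) (length xs))
      (ℕ.≤-trans (ℕ.+-monoʳ-≤ (length xs) (ℕ.n≤1+n _)) (ℕ.≤-reflexive (sym (List.length-++ xs)))))) le))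
  split-++ (x ∷ xs) {s = y ∷ s} {t} eq le with List.∷-injective eq
  ... | refl , eq′ with split-++ xs {s = s} {t} eq′ le
  ... | ys′ , p , q = ys′ , p , cong (x ∷_) q

  ++-unsnoc : {A : Set} (xs : List A) {u : A} {s ts : List A} {b : A} →
    xs ++ u ∷ [] ≡ s ++ ts ++ b ∷ [] → xs ≡ s ++ ts × u ≡ b
  ++-unsnoc xs {u} {s} {ts} {b} eq =
    List.∷ʳ-injective xs (s ++ ts) (trans eq (sym (List.++-assoc s ts (b ∷ []))))

  module Realisation {D : Set} (σ α : D → D) where

    block : D → List D
    block e = e ∷ σ e ∷ σ (σ e) ∷ σ (σ (σ e)) ∷ []

    darts : List D → List D
    darts = concatMap block

    -- Real t w es: peeling the legs w, always the first one, explores the vertices entered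
    -- at es and has shape t.
    data Real : Tree → List D → List D → Set where
      nil  : Real nil [] []
      join : ∀ {l r d u xs ys es fs} → α d ≡ u → α u ≡ d →
             Real l xs es → Real r ys fs → Real (join l r) (d ∷ xs ++ u ∷ ys) (es ++ fs)
      new  : ∀ {t d e xs es} → α d ≡ e → α e ≡ d →
             Real t (σ e ∷ σ (σ e) ∷ σ (σ (σ e)) ∷ xs) es → Real (new t) (d ∷ xs) (e ∷ es)

    darts-++ : ∀ es fs → darts (es ++ fs) ≡ darts es ++ darts fs
    darts-++ es fs = List.concatMap-++ block es fs

    real-legs : ∀ {t w es} → Real t w es → legs t ≡ length w
    real-legs nil = refl
    real-legs (join {xs = xs} _ _ p q) =
      cong suc (trans (cong₂ _+_ (real-legs p) (cong suc (real-legs q))) (sym (List.length-++ xs)))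
    real-legs (new _ _ p) = cong (_∸ 2) (real-legs p)

    -- A join separates the other legs into two regions and a new vertex trades one leg for three,
    -- so parity is inherited from `nil`. This parity later forbids most ways in which two legs
    -- could meet.
    real-even : ∀ {t w es} → Real t w es → ∃ λ h → length w ≡ dbl h × WF t h (length es)
    real-even nil = 0 , refl , nil
    real-even (join {xs = xs} {es = es} _ _ p q) with real-even p | real-even q
    ... | i , pi , wi | j , qj , wj =
      suc (i + j) ,
      cong suc (trans (List.length-++ xs) (trans (ℕ.+-suc _ _)
        (cong suc (trans (cong₂ _+_ pi qj) (sym (dbl-+ i j)))))) ,
      subst (WF _ _) (sym (List.length-++ es)) (join wi wj)
    real-even (new _ _ p) with real-even p
    ... | suc (suc h) , eq , w =
      suc h , cong suc (ℕ.suc-injective (ℕ.suc-injective (ℕ.suc-injective eq))) , new w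

    real-wf : ∀ {t w es h} → Real t w es → length w ≡ dbl h → WF t h (length es)
    real-wf p eq with real-even p
    ... | h′ , eq′ , w with dbl-inj (trans (sym eq) eq′)
    ... | refl = w

    join-↭ : ∀ d u xs ys es fs → (d ∷ xs ++ u ∷ ys) ++ darts (es ++ fs) ↭
             d ∷ u ∷ (xs ++ darts es) ++ (ys ++ darts fs)
    join-↭ d u xs ys es fs = prep d (↭-trans (↭.++⁺ʳ (darts (es ++ fs)) (↭.shift u xs ys))
      (prep u (↭-trans (↭-reflexive (trans (cong ((xs ++ ys) ++_) (darts-++ es fs)) (List.++-assoc xs ys _)))
        (↭-trans (↭.++⁺ˡ xs (↭.shifts ys (darts es)))
          (↭-reflexive (sym (List.++-assoc xs (darts es) _)))))))

    new-↭ : ∀ d e xs es → (d ∷ xs) ++ darts (e ∷ es) ↭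
            d ∷ e ∷ (σ e ∷ σ (σ e) ∷ σ (σ (σ e)) ∷ xs) ++ darts es
    new-↭ d e xs es = prep d (↭.shifts xs (block e))

    -- Each dart of the support lies on exactly one peeled edge. Hence `edges` depends on the darts
    -- alone and survives rotation, which keeps the fuel of `rotateBy` sufficient.
    real-edges : ∀ {t w es} → Real t w es → dbl (edges t) ≡ length (w ++ darts es)
    real-edges nil = refl
    real-edges (join {l} {r} {d} {u} {xs} {ys} {es} {fs} _ _ p q) = trans
      (cong (λ n → suc (suc n)) (trans (dbl-+ (edges l) _) (trans (cong₂ _+_ (real-edges p) (real-edges q))
        (sym (List.length-++ (xs ++ darts es))))))
      (sym (↭.↭-length (join-↭ d u xs ys es fs)))
    real-edges (new {d = d} {e} {xs} {es} _ _ p) =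
      trans (cong (λ n → suc (suc n)) (real-edges p)) (sym (↭.↭-length (new-↭ d e xs es)))

    Coincident : List D → D → D → Set
    Coincident es x y = ∃ λ e → e ∈ es × x ∈ block e × y ∈ block e

    -- After a rotation a vertex may be entered at another of its darts, so lists of vertices are
    -- compared by the darts they cover and by which darts share a vertex.
    record _≋_ (es fs : List D) : Set where
      constructor mk≋
      field
        darts↭ : darts es ↭ darts fs
        to     : ∀ {x y} → Coincident es x y → Coincident fs x y
        from   : ∀ {x y} → Coincident fs x y → Coincident es x y
    open _≋_ public

    ≋-refl : ∀ {es} → es ≋ es
    ≋-refl = mk≋ ↭-refl (λ c → c) (λ c → c)

    ≋-sym : ∀ {es fs} → es ≋ fs → fs ≋ es
    ≋-sym (mk≋ p f g) = mk≋ (↭-sym p) g f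

    ≋-trans : ∀ {es fs gs} → es ≋ fs → fs ≋ gs → es ≋ gs
    ≋-trans (mk≋ p f g) (mk≋ p′ f′ g′) = mk≋ (↭-trans p p′) (λ c → f′ (f c)) (λ c → g (g′ c))

    darts-↭ : ∀ {es fs} → es ↭ fs → darts es ↭ darts fs
    darts-↭ _↭_.refl          = ↭-refl
    darts-↭ (_↭_.prep e p)    = ↭.++⁺ˡ (block e) (darts-↭ p)
    darts-↭ (_↭_.swap e f p)  = ↭-trans (↭.shifts (block e) (block f)) (↭.++⁺ˡ (block f) (↭.++⁺ˡ (block e) (darts-↭ p)))
    darts-↭ (_↭_.trans p q)   = ↭-trans (darts-↭ p) (darts-↭ q)

    ↭⇒≋ : ∀ {es fs} → es ↭ fs → es ≋ fs
    ↭⇒≋ p = mk≋ (darts-↭ p)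
      (λ (e , m , c) → e , ↭.∈-resp-↭ p m , c) (λ (e , m , c) → e , ↭.∈-resp-↭ (↭-sym p) m , c)

    coincident-∷ : ∀ {es fs} e → (∀ {x y} → Coincident es x y → Coincident fs x y) →
                   ∀ {x y} → Coincident (e ∷ es) x y → Coincident (e ∷ fs) x y
    coincident-∷ e f (_ , here refl , c) = e , here refl , c
    coincident-∷ e f (g , there m , c) with f (g , m , c)
    ... | g′ , m′ , c′ = g′ , there m′ , c′

    ≋-∷ : ∀ {es fs} e → es ≋ fs → (e ∷ es) ≋ (e ∷ fs)
    ≋-∷ e (mk≋ p f g) = mk≋ (↭.++⁺ˡ (block e) p) (coincident-∷ e f) (coincident-∷ e g)

    ≋-++ˡ : ∀ es {fs gs} → fs ≋ gs → (es ++ fs) ≋ (es ++ gs)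
    ≋-++ˡ []       p = p
    ≋-++ˡ (e ∷ es) p = ≋-∷ e (≋-++ˡ es p)

    ≋-++-comm : ∀ es fs → (es ++ fs) ≋ (fs ++ es)
    ≋-++-comm es fs = ↭⇒≋ (↭.++-comm es fs)

    module _ (σ⁴ : ∀ x → σ (σ (σ (σ x))) ≡ x) where

      block-turn : ∀ e → block e ↭ block (σ e)
      block-turn e = ↭-sym (subst (λ z → σ e ∷ σ (σ e) ∷ σ (σ (σ e)) ∷ z ∷ [] ↭ block e) (sym (σ⁴ e))
        (↭-sym (↭.∷↭∷ʳ e (σ e ∷ σ (σ e) ∷ σ (σ (σ e)) ∷ []))))

      ≋-turn : ∀ e es → (e ∷ es) ≋ (σ e ∷ es)
      ≋-turn e es = mk≋ (↭.++⁺ʳ (darts es) (block-turn e)) f g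
        where
        f : ∀ {x y} → Coincident (e ∷ es) x y → Coincident (σ e ∷ es) x y
        f (_ , here refl , p , q) = σ e , here refl , ↭.∈-resp-↭ (block-turn e) p , ↭.∈-resp-↭ (block-turn e) q
        f (g , there m , c) = g , there m , c
        g : ∀ {x y} → Coincident (σ e ∷ es) x y → Coincident (e ∷ es) x y
        g (_ , here refl , p , q) =
          e , here refl , ↭.∈-resp-↭ (↭-sym (block-turn e)) p , ↭.∈-resp-↭ (↭-sym (block-turn e)) q
        g (h , there m , c) = h , there m , c

      joinLast-real : ∀ {l r xs ys es fs u v} → Real l xs es → Real r ys fs → α u ≡ v → α v ≡ u →
        ∃ λ gs → Real (joinLast l r) (xs ++ u ∷ ys ++ v ∷ []) gs × gs ≋ (es ++ fs)
      joinLast-real {fs = fs} nil q uv vu = fs ++ [] , join uv vu q nil , ↭⇒≋ (↭-reflexive (List.++-identityʳ fs))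
      joinLast-real {fs = fs} (join {d = d} {xs = xs} {es = es} dz zd p p′) q uv vu with joinLast-real p′ q uv vu
      ... | gs , r , eq = es ++ gs ,
            subst (λ w → Real _ (d ∷ w) _) (sym (List.++-assoc xs _ _)) (join dz zd p r) ,
            ≋-trans (≋-++ˡ es eq) (↭⇒≋ (↭-reflexive (sym (List.++-assoc es _ fs))))
      joinLast-real (new de ed p) q uv vu with joinLast-real p q uv vu
      ... | gs , r , eq = _ , new de ed r , ≋-∷ _ eq

      suc-dbl : ∀ {m n} → suc (dbl m) ≡ dbl n → ⊥
      suc-dbl {zero}  {suc n} ()
      suc-dbl {suc m} {suc n} p = suc-dbl {m} {n} (ℕ.suc-injective (ℕ.suc-injective p))

      real-not-odd : ∀ {t w es} h → Real t w es → length w ≡ suc (dbl h) → ⊥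
      real-not-odd h p eq with real-even p
      ... | i , q , _ = suc-dbl {h} {i} (trans (sym eq) q)

      edges-≋ : ∀ {t t′ w w′ es es′} → Real t w es → Real t′ w′ es′ → length w ≡ length w′ → es ≋ es′ →
                edges t ≡ edges t′
      edges-≋ {w = w} {w′} {es} {es′} p q eq r = dbl-inj (trans (real-edges p) (trans (trans (List.length-++ w)
        (trans (cong₂ _+_ eq (↭.↭-length (darts↭ r))) (sym (List.length-++ w′)))) (sym (real-edges q))))

      turned-edges : ∀ {f t t′ x s es gs} → Real t (x ∷ s) es → Real t′ (s ++ x ∷ []) gs → gs ≋ es →
                     edges t ≤ f → edges t′ ≤ f
      turned-edges {x = x} {s} p q r = subst (_≤ _)
        (edges-≋ p q (trans (ℕ.+-comm 1 (length s)) (sym (List.length-++ s))) (≋-sym r))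

      rotateBy-real : ∀ f {t x s es} → edges t ≤ f → Real t (x ∷ s) es →
        ∃ λ gs → Real (rotateBy f t) (s ++ x ∷ []) gs × gs ≋ es
      iterate-real : ∀ f {t xs ys es} → edges t ≤ f → Real t (xs ++ ys) es →
        ∃ λ gs → Real (iterate (rotateBy f) (length xs) t) (ys ++ xs) gs × gs ≋ es
      newLast-real : ∀ f {t w es s e v} → edges t ≤ f → Real t w es →
        w ≡ s ++ σ e ∷ σ (σ e) ∷ σ (σ (σ e)) ∷ [] → α v ≡ e → α e ≡ v →
        ∃ λ gs → Real (newLast f t) (s ++ v ∷ []) gs × gs ≋ (e ∷ es)

      rotateBy-real (suc f) {x = x} le (join {u = u} {xs = xs} {ys = ys} du ud p q) with joinLast-real p q ud du
      ... | gs , r , eq = gs , subst (λ w → Real _ w gs) (sym (List.++-assoc xs (u ∷ ys) _)) r , eq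
      rotateBy-real (suc f) {s = s} (s≤s le) (new {t} {d} {e} {es = es} de ed p)
        with rotateBy-real f le p
      ... | g₁ , p₁ , q₁
        with turned-edges p p₁ q₁ le
      ... | le₁
        with rotateBy-real f le₁ p₁
      ... | g₂ , p₂ , q₂
        with turned-edges p₁ p₂ q₂ le₁
      ... | le₂
        with rotateBy-real f le₂ p₂
      ... | g₃ , p₃ , q₃
        with newLast-real f {s = s} (turned-edges p₂ p₃ q₃ le₂) p₃
               (trans (List.++-assoc (s ++ _ ∷ []) _ _) (List.++-assoc s _ _)) de ed
      ... | g₄ , p₄ , q₄ = g₄ , p₄ , ≋-trans q₄ (≋-∷ e (≋-trans q₃ (≋-trans q₂ q₁)))

      iterate-real f {xs = []} {ys} le p = _ , subst (λ w → Real _ w _) (sym (List.++-identityʳ ys)) p , ≋-refl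
      iterate-real f {xs = x ∷ xs} {ys} le p with rotateBy-real f le p
      ... | g₁ , p₁ , q₁
        with iterate-real f {xs = xs} {ys ++ x ∷ []}
               (turned-edges p p₁ q₁ le)
               (subst (λ w → Real _ w _) (List.++-assoc xs ys _) p₁)
      ... | g₂ , p₂ , q₂ = g₂ , subst (λ w → Real _ w _) (List.++-assoc ys _ xs) p₂ , ≋-trans q₂ q₁

      newLast-real f {s = []} le (new _ _ p) refl ve ev = ⊥-elim (real-not-odd 2 p refl)
      newLast-real f {s = d ∷ s} le (new {e = g} dg gd p) refl ve ev
        with newLast-real f {s = σ g ∷ σ (σ g) ∷ σ (σ (σ g)) ∷ s} (ℕ.≤-trans (ℕ.n≤1+n _) le) p refl ve ev
      ... | gs , q , eq = g ∷ gs , new dg gd q , ≋-trans (≋-∷ g eq) (↭⇒≋ (_↭_.swap g _ ↭-refl))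
      newLast-real f {s = []} {e} le P@(join _ _ _ _) eq ve ev = ⊥-elim (real-not-odd 1 P (cong length eq))
      newLast-real f {s = d ∷ s} {e} {v} le (join {l} {r} {xs = xs} {ys = ys} dz zd p q) eq ve ev
        with legs r | real-legs q | List.∷-injective eq
      -- The leg joined to `d` is `σ (σ (σ e))`. Entered there, the vertex offers `e`, `σ e`,
      -- `σ (σ e)`, the first of which is joined to `v`; the rotations of `l` bring the other two in
      -- front of `s`.
      newLast-real f {s = d ∷ s} {e} {v} le (join {l} {r} {xs = xs} {ys = []} {es} {fs} dz zd p nil) eq ve ev
        | _ | refl | refl , eq′ with ++-unsnoc xs {s = s} {σ e ∷ σ (σ e) ∷ []} eq′
      ... | refl , refl
        with iterate-real f {xs = s} (ℕ.≤-trans (ℕ.≤-trans (ℕ.m≤m+n _ _) (ℕ.n≤1+n _)) le) p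
      ... | gs , p₁ , q₁ =
        σ (σ (σ e)) ∷ gs ++ [] ,
        new dz zd (subst₂ (λ k z → Real (join (iterate (rotateBy f) k l) nil)
                       (σ (σ (σ (σ e))) ∷ σ (σ (σ (σ (σ e)))) ∷ z ∷ s ++ v ∷ []) (gs ++ []))
             len (cong (λ z → σ (σ z)) (sym (σ⁴ e)))
             (subst (λ z → Real _ (z ∷ σ z ∷ σ (σ e) ∷ s ++ v ∷ []) (gs ++ [])) (sym (σ⁴ e))
               (join ev ve p₁ nil))) ,
        ≋-trans (≋-sym (≋-trans (≋-turn e _) (≋-trans (≋-turn (σ e) _) (≋-turn (σ (σ e)) _))))
                (≋-∷ e (≋-trans (↭⇒≋ (↭-reflexive (List.++-identityʳ gs)))
                  (≋-trans q₁ (↭⇒≋ (↭-reflexive (sym (List.++-identityʳ es)))))))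
        where
        len : length s ≡ legs l ∸ 2
        len = sym (trans (cong (_∸ 2) (trans (real-legs p) (List.length-++ s))) (ℕ.m+n∸n≡m (length s) 2))
      newLast-real f {s = d ∷ s} le (join {ys = y ∷ []} dz zd p q) eq ve ev
        | _ | refl | refl , eq′ = ⊥-elim (real-not-odd 0 q refl)
      -- The leg joined to `d` is `σ e`, so the vertex offers `σ (σ e)`, `σ (σ (σ e))`, `e`, and the
      -- edge from `e` to `v` separates the first two from `s`.
      newLast-real f {s = d ∷ s} {e} {v} le (join {l} {r} {xs = xs} {ys = y ∷ y′ ∷ []} {es} {fs} dz zd p q) eq ve ev
        | _ | refl | refl , eq′
        with ++-unsnoc (xs ++ _ ∷ y ∷ []) {s = s} {σ e ∷ σ (σ e) ∷ []} (trans (List.++-assoc xs _ _) eq′)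
      ... | eq₂ , refl with ++-unsnoc (xs ++ _ ∷ []) {s = s} {σ e ∷ []} (trans (List.++-assoc xs _ _) eq₂)
      ... | eq₁ , refl with List.∷ʳ-injective xs s eq₁
      ... | refl , refl with joinLast-real q p ev ve
      ... | gs , p₁ , q₁ = σ e ∷ gs ,
        new dz zd (subst (λ z → Real _ (σ (σ e) ∷ σ (σ (σ e)) ∷ z ∷ s ++ v ∷ []) gs) (sym (σ⁴ e)) p₁) ,
        ≋-trans (≋-sym (≋-turn e _)) (≋-∷ e (≋-trans q₁ (≋-++-comm fs es)))
      newLast-real f {s = d ∷ s} {e} {v} le (join {l} {r} {xs = xs} {ys = y ∷ y′ ∷ y″ ∷ ys} {es} {fs} dz zd p q) eq ve ev
        | _ | refl | refl , eq′ with split-++ xs {s = s} eq′ (s≤s (s≤s (s≤s z≤n)))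
      ... | ys′ , yseq , refl
        with newLast-real f (ℕ.≤-trans (ℕ.≤-trans (ℕ.m≤n+m _ _) (ℕ.n≤1+n _)) le) q yseq ve ev
      ... | gs , p₁ , q₁ = es ++ gs ,
        subst (λ w → Real _ (d ∷ w) _) (sym (List.++-assoc xs _ _)) (join dz zd p p₁) ,
        ≋-trans (≋-++ˡ es q₁) (↭⇒≋ (↭.shift e es fs))

-- Uniqueness of the tree of a realisation, clashes, and transfer between realisations.

module Models where

  open Trees
  open import Data.Nat using (ℕ; suc; _+_)
  import Data.Nat.Properties as ℕ
  open import Data.List using (List; []; _∷_; _++_; length; map; zip)
  import Data.List.Properties as List
  open import Data.List.Membership.Propositional using (_∈_; _∉_)
  import Data.List.Membership.Propositional.Properties as ∈
  open import Data.List.Relation.Unary.Any using (here; there)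
  open import Data.List.Relation.Unary.All as All using (All; []; _∷_)
  import Data.List.Relation.Unary.All.Properties as All
  open import Data.List.Relation.Unary.AllPairs using ([]; _∷_)
  open import Data.List.Relation.Unary.Unique.Propositional using (Unique)
  open import Data.List.Relation.Binary.Permutation.Propositional using (_↭_; ↭-sym; ↭⇒↭ₛ)
  import Data.List.Relation.Binary.Permutation.Propositional.Properties as ↭
  import Data.List.Relation.Binary.Permutation.Setoid.Properties as ↭ₛ
  open import Data.Product using (∃; _×_; _,_; proj₁; proj₂)
  open import Data.Sum using (_⊎_; inj₁; inj₂)
  open import Data.Empty using (⊥; ⊥-elim)
  open import Relation.Nullary using (¬_)
  open import Relation.Binary.PropositionalEquality

  module _ {A : Set} where

    unique-↭ : ∀ {xs ys : List A} → xs ↭ ys → Unique xs → Unique ys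
    unique-↭ p = ↭ₛ.Unique-resp-↭ (setoid A) (↭⇒↭ₛ p)

    unique-∉ : ∀ {x} {xs : List A} → Unique (x ∷ xs) → x ∉ xs
    unique-∉ (p ∷ _) m = All.lookup p m refl

    unique-tail : ∀ {x} {xs : List A} → Unique (x ∷ xs) → Unique xs
    unique-tail (_ ∷ p) = p

    unique-++ʳ : ∀ xs {ys : List A} → Unique (xs ++ ys) → Unique ys
    unique-++ʳ []       p       = p
    unique-++ʳ (x ∷ xs) (_ ∷ p) = unique-++ʳ xs p

    unique-++ˡ : ∀ xs {ys : List A} → Unique (xs ++ ys) → Unique xs
    unique-++ˡ []       p       = []
    unique-++ˡ (x ∷ xs) (q ∷ p) = All.++⁻ˡ xs q ∷ unique-++ˡ xs p

    unique-disjoint : ∀ xs {ys : List A} {x} → Unique (xs ++ ys) → x ∈ xs → x ∈ ys → ⊥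
    unique-disjoint (x ∷ xs) p       (here refl) m = unique-∉ p (∈.∈-++⁺ʳ xs m)
    unique-disjoint (x ∷ xs) (_ ∷ p) (there n)   m = unique-disjoint xs p n m

    unique-split : ∀ xs {ys xs′ ys′ : List A} {u} → xs ++ u ∷ ys ≡ xs′ ++ u ∷ ys′ → Unique (xs ++ u ∷ ys) →
                   xs ≡ xs′ × ys ≡ ys′
    unique-split []       {xs′ = []}      eq p = refl , List.∷-injectiveʳ eq
    unique-split []       {xs′ = y ∷ xs′} refl p = ⊥-elim (unique-∉ p (∈.∈-++⁺ʳ xs′ (here refl)))
    unique-split (x ∷ xs) {xs′ = []}      refl p = ⊥-elim (unique-∉ p (∈.∈-++⁺ʳ xs (here refl)))
    unique-split (x ∷ xs) {xs′ = y ∷ xs′} eq (_ ∷ p) with List.∷-injective eq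
    ... | refl , eq′ with unique-split xs eq′ p
    ... | q , r = cong (x ∷_) q , r

    zip-proj₁ : ∀ {B : Set} (xs : List A) (ys : List B) → length xs ≡ length ys → map proj₁ (zip xs ys) ≡ xs
    zip-proj₁ []       []       _ = refl
    zip-proj₁ (x ∷ xs) (y ∷ ys) p = cong (x ∷_) (zip-proj₁ xs ys (ℕ.suc-injective p))

    zip-proj₂ : ∀ {B : Set} (xs : List A) (ys : List B) → length xs ≡ length ys → map proj₂ (zip xs ys) ≡ ys
    zip-proj₂ []       []       _ = refl
    zip-proj₂ (x ∷ xs) (y ∷ ys) p = cong (y ∷_) (zip-proj₂ xs ys (ℕ.suc-injective p))

    zip-++ : ∀ {B : Set} (xs : List A) {xs′} (ys : List B) {ys′} → length xs ≡ length ys →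
             zip (xs ++ xs′) (ys ++ ys′) ≡ zip xs ys ++ zip xs′ ys′
    zip-++ []       []       _ = refl
    zip-++ (x ∷ xs) (y ∷ ys) p = cong ((x , y) ∷_) (zip-++ xs ys (ℕ.suc-injective p))

  unique-map-injective : ∀ {A B : Set} (f : A → B) {xs x y} → Unique (map f xs) →
                         x ∈ xs → y ∈ xs → f x ≡ f y → x ≡ y
  unique-map-injective f p (here refl) (here refl) eq = refl
  unique-map-injective f {xs = x ∷ xs} p (here refl) (there n) eq =
    ⊥-elim (unique-∉ p (subst (_∈ map f xs) (sym eq) (∈.∈-map⁺ f n)))
  unique-map-injective f {xs = x ∷ xs} p (there m) (here refl) eq =
    ⊥-elim (unique-∉ p (subst (_∈ map f xs) eq (∈.∈-map⁺ f m)))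
  unique-map-injective f (_ ∷ p) (there m) (there n) eq = unique-map-injective f p m n eq

  module Explored {D : Set} (σ α : D → D) where
    open Realisation σ α public

    support : List D → List D → List D
    support w es = w ++ darts es

    block⊆darts : ∀ {e es x} → e ∈ es → x ∈ block e → x ∈ darts es
    block⊆darts (here refl) m = ∈.∈-++⁺ˡ m
    block⊆darts {es = f ∷ es} (there n) m = ∈.∈-++⁺ʳ (block f) (block⊆darts n m)

    darts⇒block : ∀ es {x} → x ∈ darts es → ∃ λ e → e ∈ es × x ∈ block e
    darts⇒block (f ∷ es) m with ∈.∈-++⁻ (block f) m
    ... | inj₁ n = f , here refl , n
    ... | inj₂ n with darts⇒block es n
    ... | e , p , q = e , there p , q

    coincident⇒support : ∀ {w es x y} → Coincident es x y → x ∈ support w es × y ∈ support w es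
    coincident⇒support {w} (e , m , p , q) =
      ∈.∈-++⁺ʳ w (block⊆darts m p) , ∈.∈-++⁺ʳ w (block⊆darts m q)

    unique-joinˡ : ∀ {d u xs ys es fs} → Unique (support (d ∷ xs ++ u ∷ ys) (es ++ fs)) → Unique (support xs es)
    unique-joinˡ {d} {u} {xs} {ys} {es} {fs} p =
      unique-++ˡ (support xs es) (unique-++ʳ (d ∷ u ∷ []) (unique-↭ (join-↭ d u xs ys es fs) p))

    unique-joinʳ : ∀ {d u xs ys es fs} → Unique (support (d ∷ xs ++ u ∷ ys) (es ++ fs)) → Unique (support ys fs)
    unique-joinʳ {d} {u} {xs} {ys} {es} {fs} p =
      unique-++ʳ (d ∷ u ∷ support xs es) (unique-↭ (join-↭ d u xs ys es fs) p)

    disjoint-join : ∀ {d u xs ys es fs x} → Unique (support (d ∷ xs ++ u ∷ ys) (es ++ fs)) →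
                    x ∈ support xs es → x ∈ support ys fs → ⊥
    disjoint-join {d} {u} {xs} {ys} {es} {fs} p =
      unique-disjoint (support xs es) (unique-++ʳ (d ∷ u ∷ []) (unique-↭ (join-↭ d u xs ys es fs) p))

    unique-new : ∀ {d e xs es} → Unique (support (d ∷ xs) (e ∷ es)) →
                 Unique (support (σ e ∷ σ (σ e) ∷ σ (σ (σ e)) ∷ xs) es)
    unique-new {d} {e} {xs} {es} p = unique-++ʳ (d ∷ e ∷ []) (unique-↭ (new-↭ d e xs es) p)

    -- Outside the support `α` is arbitrary. Inside, the peeled edges exhaust the darts, and each of
    -- them records both directions of `α`.
    real-α : ∀ {t w es x} → Real t w es → x ∈ support w es → α (α x) ≡ x × α x ∈ support w es
    real-α (join {d = d} {u} {xs} {ys} {es} {fs} du ud p q) m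
      with ∈.∈-++⁻ (d ∷ u ∷ support xs es) (↭.∈-resp-↭ (join-↭ d u xs ys es fs) m)
    ... | inj₁ (here refl) = trans (cong α du) ud ,
          ↭.∈-resp-↭ (↭-sym (join-↭ d u xs ys es fs)) (there (here du))
    ... | inj₁ (there (here refl)) = trans (cong α ud) du ,
          ↭.∈-resp-↭ (↭-sym (join-↭ d u xs ys es fs)) (here ud)
    ... | inj₁ (there (there n)) with real-α p n
    ... | eq , k = eq , ↭.∈-resp-↭ (↭-sym (join-↭ d u xs ys es fs)) (there (there (∈.∈-++⁺ˡ k)))
    real-α (join {d = d} {u} {xs} {ys} {es} {fs} du ud p q) m | inj₂ n with real-α q n
    ... | eq , k = eq , ↭.∈-resp-↭ (↭-sym (join-↭ d u xs ys es fs)) (there (there (∈.∈-++⁺ʳ (support xs es) k)))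
    real-α (new {d = d} {e} {xs} {es} de ed p) m with ↭.∈-resp-↭ (new-↭ d e xs es) m
    ... | here refl = trans (cong α de) ed , ↭.∈-resp-↭ (↭-sym (new-↭ d e xs es)) (there (here de))
    ... | there (here refl) = trans (cong α ed) de , ↭.∈-resp-↭ (↭-sym (new-↭ d e xs es)) (here ed)
    ... | there (there n) with real-α p n
    ... | eq , k = eq , ↭.∈-resp-↭ (↭-sym (new-↭ d e xs es)) (there (there k))

    real-α-fpf : ∀ {t w es x} → Real t w es → Unique (support w es) → x ∈ support w es → α x ≢ x
    real-α-fpf (join {d = d} {u} {xs} {ys} {es} {fs} du ud p q) uq m
      with unique-↭ (join-↭ d u xs ys es fs) uq | ∈.∈-++⁻ (d ∷ u ∷ support xs es) (↭.∈-resp-↭ (join-↭ d u xs ys es fs) m)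
    ... | uq′ | inj₁ (here refl) = λ eq → unique-∉ uq′ (here (trans (sym eq) du))
    ... | uq′ | inj₁ (there (here refl)) = λ eq → unique-∉ uq′ (here (trans (sym ud) eq))
    ... | uq′ | inj₁ (there (there n)) = real-α-fpf p (unique-joinˡ {d} {u} {xs} {ys} {es} {fs} uq) n
    ... | uq′ | inj₂ n = real-α-fpf q (unique-joinʳ {d} {u} {xs} {ys} {es} {fs} uq) n
    real-α-fpf (new {d = d} {e} {xs} {es} de ed p) uq m
      with unique-↭ (new-↭ d e xs es) uq | ↭.∈-resp-↭ (new-↭ d e xs es) m
    ... | uq′ | here refl = λ eq → unique-∉ uq′ (here (trans (sym eq) de))
    ... | uq′ | there (here refl) = λ eq → unique-∉ uq′ (here (trans (sym ed) eq))
    ... | uq′ | there (there n) = real-α-fpf p (unique-new {d} {e} {xs} {es} uq) n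

    private
      -- Peeling is deterministic: `α d` is either another leg or a dart of a new vertex. Without
      -- repeated darts the two exclude each other, and the place of `u` among the legs is fixed.
      determined : ∀ {t t′ w w′ es es′} → Real t w es → Real t′ w′ es′ → w ≡ w′ →
                   Unique (support w es) → Unique (support w′ es′) → t ≡ t′ × es ≡ es′
      determined nil nil _ _ _ = refl , refl
      determined (join {d = d} {u} {xs} {ys} {es} {fs} du _ p q)
                 (join {u = u′} {xs′} {ys′} {es′} {fs′} du′ _ p′ q′) eq uq uq′ with List.∷-injective eq
      ... | refl , eq′ with trans (sym du) du′
      ... | refl with unique-split xs eq′ (unique-++ˡ (xs ++ u ∷ ys) (unique-tail uq))
      ... | refl , refl
          with determined p p′ refl (unique-joinˡ {d} {u} {xs} {ys} {es} {fs} uq) (unique-joinˡ {d} {u} {xs} {ys} {es′} {fs′} uq′)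
             | determined q q′ refl (unique-joinʳ {d} {u} {xs} {ys} {es} {fs} uq) (unique-joinʳ {d} {u} {xs} {ys} {es′} {fs′} uq′)
      ... | refl , refl | refl , refl = refl , refl
      determined (join {d = d} {u} {xs} {ys} du _ _ _) (new {e = e} {xs = xs′} de _ _) eq uq uq′
        with List.∷-injective eq
      ... | refl , refl with trans (sym du) de
      ... | refl = ⊥-elim (unique-disjoint (d ∷ xs ++ u ∷ ys) uq′ (there (∈.∈-++⁺ʳ xs (here refl))) (here refl))
      determined (new {e = e} de _ _) (join {d = d} {u} {xs} {ys} du _ _ _) eq uq uq′
        with List.∷-injective eq
      ... | refl , refl with trans (sym du) de
      ... | refl = ⊥-elim (unique-disjoint (d ∷ xs ++ u ∷ ys) uq (there (∈.∈-++⁺ʳ xs (here refl))) (here refl))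
      determined (new {d = d} {e} {xs} {es} de _ p) (new {es = es′} de′ _ p′) eq uq uq′ with List.∷-injective eq
      ... | refl , refl with trans (sym de) de′
      ... | refl with determined p p′ refl (unique-new {d} {e} {xs} {es} uq) (unique-new {d} {e} {xs} {es′} uq′)
      ... | refl , refl = refl , refl

    real-determined : ∀ {t t′ w es es′} → Real t w es → Real t′ w es′ →
                      Unique (support w es) → Unique (support w es′) → t ≡ t′
    real-determined p q u v = proj₁ (determined p q refl u v)

    -- Legs x and y of which at most one may be attached to a vertex of a simple map.
    Clash : List D → D → D → Set
    Clash es x y = α x ≡ y ⊎ Coincident es (α x) (α y)

    Simple : List D → Set
    Simple es = ∀ {x y} → x ≢ y → Coincident es x y → ¬ Clash es x y

    clash-≋ : ∀ {es fs x y} → es ≋ fs → Clash es x y → Clash fs x y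
    clash-≋ eq (inj₁ p) = inj₁ p
    clash-≋ eq (inj₂ c) = inj₂ (to eq c)

    simple-≋ : ∀ {es fs} → es ≋ fs → Simple es → Simple fs
    simple-≋ eq s x≢y c k = s x≢y (from eq c) (clash-≋ (≋-sym eq) k)

  -- A tree realised in two maps is realised in their product, along which everything is transported.
  module Product {D D′ : Set} (σ α : D → D) (σ′ α′ : D′ → D′) where
    module M  = Explored σ α
    module M′ = Explored σ′ α′
    σ×α× : (D → D) → (D′ → D′) → D × D′ → D × D′
    σ×α× f g (x , y) = f x , g y
    module P  = Explored (σ×α× σ σ′) (σ×α× α α′)

    real-length : ∀ {t w w′ es es′} → M.Real t w es → M′.Real t w′ es′ → length w ≡ length w′
    real-length p q = trans (sym (M.real-legs p)) (M′.real-legs q)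

    real-length-vertices : ∀ {t w w′ es es′} → M.Real t w es → M′.Real t w′ es′ → length es ≡ length es′
    real-length-vertices M.nil M′.nil = refl
    real-length-vertices (M.join {es = es} _ _ p q) (M′.join {es = es′} _ _ p′ q′) =
      trans (List.length-++ es) (trans (cong₂ _+_ (real-length-vertices p p′) (real-length-vertices q q′))
        (sym (List.length-++ es′)))
    real-length-vertices (M.new _ _ p) (M′.new _ _ p′) = cong suc (real-length-vertices p p′)

    real-zip : ∀ {t w w′ es es′} → M.Real t w es → M′.Real t w′ es′ → P.Real t (zip w w′) (zip es es′)
    real-zip M.nil M′.nil = P.nil
    real-zip (M.join {xs = xs} {es = es} du ud p q) (M′.join {xs = xs′} {es = es′} du′ ud′ p′ q′) =
      subst₂ (P.Real _) (cong (_ ∷_) (sym (zip-++ xs xs′ (real-length p p′))))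
        (sym (zip-++ es es′ (real-length-vertices p p′)))
        (P.join (cong₂ _,_ du du′) (cong₂ _,_ ud ud′) (real-zip p p′) (real-zip q q′))
    real-zip (M.new de ed p) (M′.new de′ ed′ p′) =
      P.new (cong₂ _,_ de de′) (cong₂ _,_ ed ed′) (real-zip p p′)

  module Morphism {D D′ : Set} (σ α : D → D) (σ′ α′ : D′ → D′) (f : D → D′)
    (f-σ : ∀ x → σ′ (f x) ≡ f (σ x)) (f-α : ∀ x → α′ (f x) ≡ f (α x)) where
    module M  = Explored σ α
    module M′ = Explored σ′ α′

    map-block : ∀ e → map f (M.block e) ≡ M′.block (f e)
    map-block e = cong (f e ∷_) (cong₂ _∷_ (sym p) (cong₂ _∷_ (sym q) (cong (_∷ []) (sym r))))
      where p = f-σ e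
            q = trans (cong σ′ p) (f-σ (σ e))
            r = trans (cong σ′ q) (f-σ (σ (σ e)))

    map-darts : ∀ es → map f (M.darts es) ≡ M′.darts (map f es)
    map-darts []       = refl
    map-darts (e ∷ es) = trans (List.map-++ f (M.block e) (M.darts es)) (cong₂ _++_ (map-block e) (map-darts es))

    map-support : ∀ w es → map f (M.support w es) ≡ M′.support (map f w) (map f es)
    map-support w es = trans (List.map-++ f w (M.darts es)) (cong (map f w ++_) (map-darts es))

    real-map : ∀ {t w es} → M.Real t w es → M′.Real t (map f w) (map f es)
    real-map M.nil = M′.nil
    real-map (M.join {xs = xs} {ys} {es} {fs} du ud p q) =
      subst₂ (M′.Real _) (cong (_ ∷_) (sym (List.map-++ f xs (_ ∷ ys)))) (sym (List.map-++ f es fs))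
        (M′.join (trans (f-α _) (cong f du)) (trans (f-α _) (cong f ud)) (real-map p) (real-map q))
    real-map (M.new {t} {e = e} {xs} {es} de ed p) =
      M′.new (trans (f-α _) (cong f de)) (trans (f-α _) (cong f ed))
        (subst (λ w → M′.Real t (w ++ map f xs) (map f es)) (List.∷-injectiveʳ (map-block e)) (real-map p))

    coincident-map : ∀ {es x y} → M.Coincident es x y → M′.Coincident (map f es) (f x) (f y)
    coincident-map {x = x} {y} (e , m , p , q) = f e , ∈.∈-map⁺ f m ,
      subst (f x ∈_) (map-block e) (∈.∈-map⁺ f p) , subst (f y ∈_) (map-block e) (∈.∈-map⁺ f q)

    coincident-map⁻ : ∀ {es x′ y′} → M′.Coincident (map f es) x′ y′ →
                      ∃ λ x → ∃ λ y → x′ ≡ f x × y′ ≡ f y × M.Coincident es x y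
    coincident-map⁻ {x′ = x′} {y′} (_ , m , p , q) with ∈.∈-map⁻ f m
    ... | e , n , refl with ∈.∈-map⁻ f (subst (x′ ∈_) (sym (map-block e)) p) | ∈.∈-map⁻ f (subst (y′ ∈_) (sym (map-block e)) q)
    ... | x , p′ , refl | y , q′ , refl = x , y , refl , refl , e , n , p′ , q′

    module _ {t w es} (real : M.Real t w es) (uniq : Unique (M′.support (map f w) (map f es))) where

      -- A repetition-free image makes `f` injective on the support, which is all that is needed for
      -- the projections of a product to reflect clashes and simplicity.
      injective : ∀ {x y} → x ∈ M.support w es → y ∈ M.support w es → f x ≡ f y → x ≡ y
      injective = unique-map-injective f (subst Unique (sym (map-support w es)) uniq)

      clash-map : ∀ {x y} → M.Clash es x y → M′.Clash (map f es) (f x) (f y)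
      clash-map (inj₁ p) = inj₁ (trans (f-α _) (cong f p))
      clash-map (inj₂ c) = inj₂ (subst₂ (M′.Coincident _) (sym (f-α _)) (sym (f-α _)) (coincident-map c))

      clash-map⁻ : ∀ {x y} → x ∈ M.support w es → y ∈ M.support w es →
                   M′.Clash (map f es) (f x) (f y) → M.Clash es x y
      clash-map⁻ m n (inj₁ p) = inj₁ (injective (proj₂ (M.real-α real m)) n (trans (sym (f-α _)) p))
      clash-map⁻ m n (inj₂ c) with coincident-map⁻ c
      ... | x , y , p , q , c′ with M.coincident⇒support {w} c′
      ... | xm , ym = inj₂ (subst₂ (M.Coincident es)
        (sym (injective (proj₂ (M.real-α real m)) xm (trans (sym (f-α _)) p)))
        (sym (injective (proj₂ (M.real-α real n)) ym (trans (sym (f-α _)) q))) c′)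

      simple-map : M.Simple es → M′.Simple (map f es)
      simple-map s x≢y c k with coincident-map⁻ c
      ... | x , y , refl , refl , c′ with M.coincident⇒support {w} c′
      ... | xm , ym = s (λ eq → x≢y (cong f eq)) c′ (clash-map⁻ xm ym k)

      simple-map⁻ : M′.Simple (map f es) → M.Simple es
      simple-map⁻ s x≢y c k with M.coincident⇒support {w} c
      ... | xm , ym = s (λ eq → x≢y (injective xm ym eq)) (coincident-map c) (clash-map k)

  module Transfer {D D′ : Set} {σ α : D → D} {σ′ α′ : D′ → D′} {t : Tree} {w w′ es es′}
    (real : Realisation.Real σ α t w es) (real′ : Realisation.Real σ′ α′ t w′ es′)
    (uniq : Unique (Explored.support σ α w es)) (uniq′ : Unique (Explored.support σ′ α′ w′ es′)) where

    open Product σ α σ′ α′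
    private
      R : P.Real t (zip w w′) (zip es es′)
      R = real-zip real real′

      module F = Morphism (σ×α× σ σ′) (σ×α× α α′) σ α proj₁ (λ _ → refl) (λ _ → refl)
      module G = Morphism (σ×α× σ σ′) (σ×α× α α′) σ′ α′ proj₂ (λ _ → refl) (λ _ → refl)

      es₁ : map proj₁ (zip es es′) ≡ es
      es₁ = zip-proj₁ es es′ (real-length-vertices real real′)
      es₂ : map proj₂ (zip es es′) ≡ es′
      es₂ = zip-proj₂ es es′ (real-length-vertices real real′)

      U : Unique (M.support (map proj₁ (zip w w′)) (map proj₁ (zip es es′)))
      U = subst₂ (λ w es → Unique (M.support w es)) (sym (zip-proj₁ w w′ (real-length real real′))) (sym es₁) uniq
      U′ : Unique (M′.support (map proj₂ (zip w w′)) (map proj₂ (zip es es′)))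
      U′ = subst₂ (λ w es → Unique (M′.support w es)) (sym (zip-proj₂ w w′ (real-length real real′))) (sym es₂) uniq′

    -- Backwards along the first projection of the common product, then forwards along the second.
    transfer-clash : ∀ {x y x′ y′} → (x , x′) ∈ zip w w′ → (y , y′) ∈ zip w w′ →
                     M.Clash es x y → M′.Clash es′ x′ y′
    transfer-clash {x} {y} {x′} {y′} m n k = subst (λ es → M′.Clash es x′ y′) es₂
      (G.clash-map R U′ (F.clash-map⁻ R U (∈.∈-++⁺ˡ m) (∈.∈-++⁺ˡ n) (subst (λ es → M.Clash es x y) (sym es₁) k)))

    transfer-simple : M.Simple es → M′.Simple es′
    transfer-simple s = subst (λ es → M′.Simple es) es₂
      (G.simple-map R U′ (F.simple-map⁻ R U (subst (λ es → M.Simple es) (sym es₁) s)))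

-- Standard realisations on natural numbers, and decidability of simplicity and clashes.

module Charts where

  open Trees
  open Models
  open import Data.Nat using (ℕ; zero; suc; _+_; _≤_; _<_; z≤n; s≤s; _≟_)
  import Data.Nat.Properties as ℕ
  open import Data.List using (List; []; _∷_; _++_; length; zip; upTo)
  import Data.List.Properties as List
  open import Data.List.Membership.Propositional using (_∈_; find; lose)
  import Data.List.Membership.Propositional.Properties as ∈
  open import Data.List.Membership.DecPropositional _≟_ using (_∈?_)
  open import Data.List.Relation.Unary.Any as Any using (here; there)
  open import Data.List.Relation.Unary.All as All using (All; []; _∷_)
  open import Data.List.Relation.Unary.AllPairs using ([]; _∷_)
  open import Data.List.Relation.Unary.Unique.Propositional using (Unique)
  import Data.List.Relation.Unary.Unique.Propositional.Properties as Unique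
  open import Data.List.Relation.Binary.Permutation.Propositional
    using (_↭_; ↭-refl; ↭-sym; ↭-trans; ↭-reflexive; prep)
  import Data.List.Relation.Binary.Permutation.Propositional.Properties as ↭
  open import Data.Product using (∃; _×_; _,_; proj₁; proj₂)
  open import Data.Empty using (⊥; ⊥-elim)
  open import Relation.Nullary using (Dec; yes; no)
  open import Relation.Nullary.Decidable using (map′; _×-dec_; _⊎-dec_; ¬?; _→-dec_)
  open import Relation.Binary.PropositionalEquality

  quad : ℕ → ℕ
  quad zero    = zero
  quad (suc n) = suc (suc (suc (suc (quad n))))

  -- One rotation for all charts: it turns each block of four consecutive numbers that starts at a
  -- multiple of four.
  σ₄ : ℕ → ℕ
  σ₄ 0 = 1
  σ₄ 1 = 2
  σ₄ 2 = 3
  σ₄ 3 = 0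
  σ₄ (suc (suc (suc (suc x)))) = suc (suc (suc (suc (σ₄ x))))

  σ₄⁴ : ∀ x → σ₄ (σ₄ (σ₄ (σ₄ x))) ≡ x
  σ₄⁴ 0 = refl
  σ₄⁴ 1 = refl
  σ₄⁴ 2 = refl
  σ₄⁴ 3 = refl
  σ₄⁴ (suc (suc (suc (suc x)))) = cong (λ y → suc (suc (suc (suc y)))) (σ₄⁴ x)

  upFrom : ℕ → ℕ → List ℕ
  upFrom m zero    = []
  upFrom m (suc n) = m ∷ upFrom (suc m) n

  upFrom-++ : ∀ k m n → upFrom (quad k) (quad m) ++ upFrom (quad (k + m)) (quad n) ≡ upFrom (quad k) (quad (m + n))
  upFrom-++ k zero    n = cong (λ k → upFrom (quad k) (quad n)) (ℕ.+-identityʳ k)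
  upFrom-++ k (suc m) n = cong (λ r → quad k ∷ 1 + quad k ∷ 2 + quad k ∷ 3 + quad k ∷ r)
    (trans (cong (λ j → upFrom (quad (suc k)) (quad m) ++ upFrom (quad j) (quad n)) (ℕ.+-suc k m)) (upFrom-++ (suc k) m n))

  upFrom-≥ : ∀ m n {x} → x ∈ upFrom m n → m ≤ x
  upFrom-≥ m (suc n) (here refl) = ℕ.≤-refl
  upFrom-≥ m (suc n) (there p)   = ℕ.<⇒≤ (upFrom-≥ (suc m) n p)

  upFrom-unique : ∀ m n → Unique (upFrom m n)
  upFrom-unique m zero    = []
  upFrom-unique m (suc n) =
    All.tabulate (λ {x} p eq → ℕ.<-irrefl eq (upFrom-≥ (suc m) n p)) ∷ upFrom-unique (suc m) n

  unique-++ : {A : Set} {xs ys : List A} → Unique xs → Unique ys → (∀ {x} → x ∈ xs → x ∈ ys → ⊥) → Unique (xs ++ ys)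
  unique-++ p q r = Unique.++⁺ p q (λ (m , n) → r m n)

  flat : {A : Set} → List (A × A) → List A
  flat []            = []
  flat ((a , b) ∷ E) = a ∷ b ∷ flat E

  flat-++ : {A : Set} (E F : List (A × A)) → flat (E ++ F) ≡ flat E ++ flat F
  flat-++ []      F = refl
  flat-++ (_ ∷ E) F = cong (λ z → _ ∷ _ ∷ z) (flat-++ E F)

  partner : List (ℕ × ℕ) → ℕ → ℕ
  partner []            x = x
  partner ((a , b) ∷ E) x with x ≟ a | x ≟ b
  ... | yes _ | _     = b
  ... | no _  | yes _ = a
  ... | no _  | no _  = partner E x

  ∈-flat : ∀ {E : List (ℕ × ℕ)} {a b} → (a , b) ∈ E → a ∈ flat E × b ∈ flat E
  ∈-flat (here refl) = here refl , there (here refl)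
  ∈-flat (there m) with ∈-flat m
  ... | p , q = there (there p) , there (there q)

  partner-∈ : ∀ {E a b} → Unique (flat E) → (a , b) ∈ E → partner E a ≡ b × partner E b ≡ a
  partner-∈ {(a , b) ∷ E} u (here refl) = p , q
    where
    p : partner ((a , b) ∷ E) a ≡ b
    p with a ≟ a | a ≟ b
    ... | yes _ | _ = refl
    ... | no n  | _ = ⊥-elim (n refl)
    q : partner ((a , b) ∷ E) b ≡ a
    q with b ≟ a | b ≟ b
    ... | yes refl | _ = refl
    ... | no _  | yes _ = refl
    ... | no _  | no n = ⊥-elim (n refl)
  partner-∈ {(c , d) ∷ E} u@(_ ∷ _ ∷ v) (there m) with ∈-flat m
  ... | am , bm = trans (skip am) (proj₁ (partner-∈ v m)) , trans (skip bm) (proj₂ (partner-∈ v m))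
    where
    skip : ∀ {x} → x ∈ flat E → partner ((c , d) ∷ E) x ≡ partner E x
    skip {x} k with x ≟ c | x ≟ d
    ... | yes refl | _ = ⊥-elim (unique-∉ u (there k))
    ... | no _ | yes refl = ⊥-elim (unique-∉ (unique-tail u) k)
    ... | no _ | no _ = refl

  split-length : {A : Set} (w : List A) (m : ℕ) {n : ℕ} → length w ≡ m + suc n →
    ∃ λ xs → ∃ λ u → ∃ λ ys → w ≡ xs ++ u ∷ ys × length xs ≡ m × length ys ≡ n
  split-length (u ∷ ys) zero    p = [] , u , ys , refl , refl , ℕ.suc-injective p
  split-length (x ∷ w)  (suc m) p with split-length w m (ℕ.suc-injective p)
  ... | xs , u , ys , q , r , s = x ∷ xs , u , ys , cong (x ∷_) q , cong suc r , s

  σ₄-quad : ∀ k → σ₄ (quad k) ≡ suc (quad k) × σ₄ (suc (quad k)) ≡ suc (suc (quad k)) ×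
            σ₄ (suc (suc (quad k))) ≡ suc (suc (suc (quad k)))
  σ₄-quad zero    = refl , refl , refl
  σ₄-quad (suc k) with σ₄-quad k
  ... | p , q , r = cong 4+_ p , cong 4+_ q , cong 4+_ r
    where 4+_ : ℕ → ℕ
          4+ x = suc (suc (suc (suc x)))

  module Layout where
    open Realisation σ₄ (λ x → x) using (block; darts; darts-++; join-↭; new-↭)

    block-quad : ∀ k → block (quad k) ≡ upFrom (quad k) 4
    block-quad k with σ₄-quad k
    ... | p , q , r = cong (quad k ∷_) (cong₂ _∷_ p (cong₂ _∷_ pq (cong (_∷ []) (trans (cong σ₄ pq) r))))
      where pq = trans (cong σ₄ p) q

    -- The edges `E` are laid out before any `α` exists, and every `α` that matches them realises
    -- the tree. Vertices fill consecutive blocks from block `k` on; `k + m` in the case of `join`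
    -- starts the second region right after the first.
    layout : ∀ {t h n} → WF t h n → ∀ w → length w ≡ dbl h → ∀ k →
      ∃ λ E → ∃ λ es →
        (∀ α → (∀ {a b} → (a , b) ∈ E → α a ≡ b × α b ≡ a) → Realisation.Real σ₄ α t w es) ×
        flat E ↭ w ++ darts es × darts es ≡ upFrom (quad k) (quad n)
    layout nil [] _ k = [] , [] , (λ _ _ → Realisation.nil) , ↭-refl , refl
    layout (join {i = i} {j} {m} {n} p q) (d ∷ w) eq k
      with split-length w (dbl i) (trans (ℕ.suc-injective eq) (trans (cong suc (dbl-+ i j)) (sym (ℕ.+-suc _ _))))
    ... | xs , u , ys , refl , lx , ly with layout p xs lx k | layout q ys ly (k + m)
    ... | E , es , re , pe , de | F , fs , rf , pf , df =
      (d , u) ∷ E ++ F , es ++ fs ,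
      (λ α h → Realisation.join (proj₁ (h (here refl))) (proj₂ (h (here refl)))
         (re α (λ m → h (there (∈.∈-++⁺ˡ m)))) (rf α (λ m → h (there (∈.∈-++⁺ʳ E m))))) ,
      ↭-trans (prep d (prep u (↭-trans (↭-reflexive (flat-++ E F)) (↭.++⁺ pe pf)))) (↭-sym (join-↭ d u xs ys es fs)) ,
      trans (darts-++ es fs) (trans (cong₂ _++_ de df) (upFrom-++ k m n))
    layout (new p) (d ∷ s) eq k
      with layout p (σ₄ (quad k) ∷ σ₄ (σ₄ (quad k)) ∷ σ₄ (σ₄ (σ₄ (quad k))) ∷ s) (cong (λ n → suc (suc n)) eq) (suc k)
    ... | E , es , re , pe , de =
      (d , quad k) ∷ E , quad k ∷ es ,
      (λ α h → Realisation.new (proj₁ (h (here refl))) (proj₂ (h (here refl))) (re α (λ m → h (there m)))) ,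
      ↭-trans (prep d (prep (quad k) pe)) (↭-sym (new-↭ d (quad k) s es)) ,
      cong₂ _++_ (block-quad k) de

  record Chart (t : Tree) : Set where
    field
      w es : List ℕ
      α    : ℕ → ℕ
      real : Realisation.Real σ₄ α t w es
      uniq : Unique (Explored.support σ₄ α w es)

  -- With the legs below `quad k` and the vertices from there on, no dart is repeated. The exact
  -- list of darts matters once a chart is turned into a map on a finite set, where legs and
  -- vertices must exhaust an initial segment.
  chart-on : ∀ {t h n} → WF t h n → ∀ w → length w ≡ dbl h → Unique w → ∀ k → (∀ {x} → x ∈ w → x < quad k) →
    ∃ λ α → ∃ λ es → Realisation.Real σ₄ α t w es × Unique (Explored.support σ₄ α w es) ×
      Explored.darts σ₄ α es ≡ upFrom (quad k) (quad n)
  chart-on {n = n} wf w len u k bound with Layout.layout wf w len k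
  ... | E , es , r , p , d = partner E , es , r (partner E) (partner-∈ (unique-↭ (↭-sym p) U)) , U , d
    where
    U : Unique (w ++ Realisation.darts σ₄ (λ x → x) es)
    U = subst (λ z → Unique (w ++ z)) (sym d) (unique-++ u (upFrom-unique (quad k) (quad n))
          (λ m m′ → ℕ.<⇒≱ (bound m) (upFrom-≥ (quad k) (quad n) m′)))

  dbl≤quad : ∀ h → dbl h ≤ quad h
  dbl≤quad zero    = z≤n
  dbl≤quad (suc h) = s≤s (s≤s (ℕ.≤-trans (dbl≤quad h) (ℕ.≤-trans (ℕ.n≤1+n _) (ℕ.n≤1+n _))))

  infix 4 _[_]=_
  data _[_]=_ {A : Set} : List A → ℕ → A → Set where
    zero : ∀ {x xs} → (x ∷ xs) [ zero ]= x
    suc  : ∀ {x xs i y} → xs [ i ]= y → (x ∷ xs) [ suc i ]= y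

  at-index : {A : Set} (xs : List A) (i : ℕ) → i < length xs → ∃ λ x → xs [ i ]= x
  at-index (x ∷ xs) zero    _       = x , zero
  at-index (x ∷ xs) (suc i) (s≤s p) with at-index xs i p
  ... | y , q = y , suc q

  at-bound : {A : Set} {xs : List A} {i : ℕ} {x : A} → xs [ i ]= x → i < length xs
  at-bound zero    = s≤s z≤n
  at-bound (suc p) = s≤s (at-bound p)

  at-∈ : {A : Set} {xs : List A} {i : ℕ} {x : A} → xs [ i ]= x → x ∈ xs
  at-∈ zero    = here refl
  at-∈ (suc p) = there (at-∈ p)

  at-++ˡ : {A : Set} {xs : List A} {ys : List A} {i : ℕ} {x : A} → xs [ i ]= x → (xs ++ ys) [ i ]= x
  at-++ˡ zero    = zero
  at-++ˡ (suc p) = suc (at-++ˡ p)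

  at-last : {A : Set} (xs : List A) {x : A} → (xs ++ x ∷ []) [ length xs ]= x
  at-last []       = zero
  at-last (y ∷ xs) = suc (at-last xs)

  at-zip : {A B : Set} {xs : List A} {ys : List B} {i : ℕ} {x : A} {y : B} →
           xs [ i ]= x → ys [ i ]= y → (x , y) ∈ zip xs ys
  at-zip zero    zero    = here refl
  at-zip (suc p) (suc q) = there (at-zip p q)

  -- Asking for some chart is as good as asking for all realisations, by `Transfer`; the existential
  -- form is the one that any single model can establish.
  SimpleTree : Tree → Set
  SimpleTree t = ∃ λ (c : Chart t) → Explored.Simple σ₄ (Chart.α c) (Chart.es c)

  ClashTree : ℕ → ℕ → Tree → Set
  ClashTree i j t = ∃ λ (c : Chart t) → ∃ λ x → ∃ λ y →
    Chart.w c [ i ]= x × Chart.w c [ j ]= y × Explored.Clash σ₄ (Chart.α c) (Chart.es c) x y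

  chart : ∀ {t h n} → WF t h n → Chart t
  chart {h = h} wf with chart-on wf (upTo (dbl h)) (List.length-upTo (dbl h)) (Unique.upTo⁺ (dbl h)) h
                          (λ m → ℕ.≤-trans (∈.∈-upTo⁻ m) (dbl≤quad h))
  ... | α , es , r , u , _ = record { real = r ; uniq = u }

  module AnyModel {D : Set} {σ α : D → D} {t : Tree} {w es : List D} (real : Realisation.Real σ α t w es)
    (uniq : Unique (Explored.support σ α w es)) where
    open Explored σ α

    private
      standard : Chart t
      standard = chart (proj₂ (proj₂ (real-even real)))
      open Chart standard using () renaming (real to real₀; uniq to uniq₀; w to w₀)

    same-length : ∀ {w′ es′ α′} → Realisation.Real σ₄ α′ t w′ es′ → length w ≡ length w′
    same-length r = trans (sym (real-legs real)) (Realisation.real-legs _ _ r)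

    clash⁺ : ∀ {i j x y} → w [ i ]= x → w [ j ]= y → Clash es x y → ClashTree i j t
    clash⁺ {i} {j} p q k
      with at-index w₀ i (subst (i <_) (same-length real₀) (at-bound p))
         | at-index w₀ j (subst (j <_) (same-length real₀) (at-bound q))
    ... | x₀ , p₀ | y₀ , q₀ =
      standard , x₀ , y₀ , p₀ , q₀ , Transfer.transfer-clash real real₀ uniq uniq₀ (at-zip p p₀) (at-zip q q₀) k

    clash⁻ : ∀ {i j x y} → w [ i ]= x → w [ j ]= y → ClashTree i j t → Clash es x y
    clash⁻ p q (c , x₀ , y₀ , p₀ , q₀ , k) =
      Transfer.transfer-clash (Chart.real c) real (Chart.uniq c) uniq (at-zip p₀ p) (at-zip q₀ q) k

    simple⁺ : Simple es → SimpleTree t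
    simple⁺ s = standard , Transfer.transfer-simple real real₀ uniq uniq₀ s

    simple⁻ : SimpleTree t → Simple es
    simple⁻ (c , s) = Transfer.transfer-simple (Chart.real c) real (Chart.uniq c) uniq s

  module _ (α : ℕ → ℕ) where
    open Explored σ₄ α

    coincident? : ∀ es x y → Dec (Coincident es x y)
    coincident? es x y = map′ find (λ (_ , m , pq) → lose m pq)
      (Any.any? (λ e → (x ∈? block e) ×-dec (y ∈? block e)) es)

    clash? : ∀ es x y → Dec (Clash es x y)
    clash? es x y = (α x ≟ y) ⊎-dec coincident? es (α x) (α y)

    simple? : ∀ es → Dec (Simple es)
    simple? es = map′
      (λ a {x} {y} x≢y (e , m , p , q) → All.lookup (All.lookup (All.lookup a m) p) q x≢y)
      (λ s → All.tabulate (λ m → All.tabulate (λ p → All.tabulate (λ q x≢y → s x≢y (_ , m , p , q)))))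
      (All.all? (λ e → All.all? (λ x → All.all? (λ y → ¬? (x ≟ y) →-dec ¬? (clash? es x y)) (block e)) (block e)) es)

  simpleTree? : ∀ {t h n} → WF t h n → Dec (SimpleTree t)
  simpleTree? wf = map′ simple⁺ simple⁻ (simple? (Chart.α (chart wf)) (Chart.es (chart wf)))
    where open AnyModel (Chart.real (chart wf)) (Chart.uniq (chart wf))

  clashTree? : ∀ {t h n} → WF t h n → ∀ i j → Dec (ClashTree i j t)
  clashTree? {h = h} wf i j with i ℕ.<? length (Chart.w (chart wf)) | j ℕ.<? length (Chart.w (chart wf))
  ... | yes p | yes q = map′ (clash⁺ ip jq) (clash⁻ ip jq) (clash? (Chart.α (chart wf)) _ _ _)
    where open AnyModel (Chart.real (chart wf)) (Chart.uniq (chart wf))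
          ip = proj₂ (at-index _ i p)
          jq = proj₂ (at-index _ j q)
  ... | no p | _ = no λ (c , _ , _ , ip , _ , _) → p (subst (i <_) (sym (same-length (Chart.real c))) (at-bound ip))
    where open AnyModel (Chart.real (chart wf)) (Chart.uniq (chart wf))
  ... | yes _ | no q = no λ (c , _ , _ , _ , jq , _) → q (subst (j <_) (sym (same-length (Chart.real c))) (at-bound jq))
    where open AnyModel (Chart.real (chart wf)) (Chart.uniq (chart wf))

-- Rotation is a bijection compatible with simplicity and clashes; local effect of `join` and `new`.

module Rotation where

  open Trees
  open Models
  open Charts
  open import Data.Nat using (ℕ; zero; suc; _∸_; _<_)
  import Data.Nat.Properties as ℕ
  open import Data.List using (List; []; _∷_; _++_; length; upTo)
  import Data.List.Properties as List
  open import Data.List.Membership.Propositional using (_∈_; _∉_)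
  import Data.List.Membership.Propositional.Properties as ∈
  open import Data.List.Relation.Unary.Any using (here; there)
  open import Data.List.Relation.Unary.Unique.Propositional using (Unique)
  import Data.List.Relation.Unary.Unique.Propositional.Properties as Unique
  open import Data.List.Relation.Binary.Permutation.Propositional using (_↭_; ↭-sym)
  import Data.List.Relation.Binary.Permutation.Propositional.Properties as ↭
  open import Data.Product using (∃; _×_; _,_; proj₁; proj₂)
  open import Data.Sum using (_⊎_; inj₁; inj₂)
  open import Data.Empty using (⊥; ⊥-elim)
  open import Relation.Nullary using (¬_)
  open import Relation.Binary.PropositionalEquality

  abstract
    -- A full turn less one step. It inverts `rotate` because a full turn restores the order of the
    -- legs, and these determine the tree.
    unrotate : Tree → Tree
    unrotate t = iterate rotate (legs t ∸ 1) t

    unrotate-iterate : ∀ t → unrotate t ≡ iterate rotate (legs t ∸ 1) t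
    unrotate-iterate t = refl

  module Local {D : Set} (σ α : D → D) where
    open Explored σ α

    triple : D → List D
    triple e = σ e ∷ σ (σ e) ∷ σ (σ (σ e)) ∷ []

    leg∉darts : ∀ w es {x} → Unique (support w es) → x ∈ w → x ∈ darts es → ⊥
    leg∉darts w es = unique-disjoint w

    same-block : ∀ {es e f x} → Unique (darts es) → e ∈ es → f ∈ es → x ∈ block e → x ∈ block f → e ≡ f
    same-block u (here refl) (here refl) p q = refl
    same-block {g ∷ es} u (here refl) (there n) p q = ⊥-elim (unique-disjoint (block g) u p (block⊆darts n q))
    same-block {g ∷ es} u (there m) (here refl) p q = ⊥-elim (unique-disjoint (block g) u q (block⊆darts m p))
    same-block {g ∷ es} u (there m) (there n) p q = same-block (unique-++ʳ (block g) u) m n p q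

    module _ {t w es} (real : Real t w es) (uniq : Unique (support w es)) where

      clash-sym : ∀ {x y} → x ∈ w → Clash es x y → Clash es y x
      clash-sym m (inj₁ refl) = inj₁ (proj₁ (real-α real (∈.∈-++⁺ˡ m)))
      clash-sym m (inj₂ (e , k , p , q)) = inj₂ (e , k , q , p)

      -- A leg joined to another leg ends at no explored vertex, so two successive clashes either
      -- take place at one common vertex or lead back to the start.
      clash-trans : ∀ {x y z} → x ∈ w → y ∈ w → z ∈ w → x ≢ z → Clash es x y → Clash es y z → Clash es x z
      clash-trans xm ym zm x≢z (inj₁ refl) (inj₁ q) =
        ⊥-elim (x≢z (trans (sym (proj₁ (real-α real (∈.∈-++⁺ˡ xm)))) q))
      clash-trans xm ym zm x≢z (inj₁ refl) (inj₂ (e , m , p , q)) = ⊥-elim (leg∉darts w es uniq xm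
        (block⊆darts m (subst (_∈ block e) (proj₁ (real-α real (∈.∈-++⁺ˡ xm))) p)))
      clash-trans xm ym zm x≢z (inj₂ (e , m , p , q)) (inj₁ refl) = ⊥-elim (leg∉darts w es uniq zm (block⊆darts m q))
      clash-trans xm ym zm x≢z (inj₂ (e , m , p , q)) (inj₂ (f , n , r , s))
        with same-block (unique-++ʳ w uniq) m n q r
      ... | refl = inj₂ (e , m , p , s)

    module JoinLocal {l r d u xs ys es fs} (du : α d ≡ u) (ud : α u ≡ d) (p : Real l xs es) (q : Real r ys fs)
      (uniq : Unique (support (d ∷ xs ++ u ∷ ys) (es ++ fs))) where

      clashˡ : ∀ {x y} → x ∈ support xs es → Clash (es ++ fs) x y → Clash es x y
      clashˡ m (inj₁ eq) = inj₁ eq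
      clashˡ m (inj₂ (e , k , r , s)) with ∈.∈-++⁻ es k
      ... | inj₁ n = inj₂ (e , n , r , s)
      ... | inj₂ n = ⊥-elim (disjoint-join {d} {u} {xs} {ys} {es} {fs} uniq (proj₂ (real-α p m)) (∈.∈-++⁺ʳ ys (block⊆darts n r)))

      clashʳ : ∀ {x y} → x ∈ support ys fs → Clash (es ++ fs) x y → Clash fs x y
      clashʳ m (inj₁ eq) = inj₁ eq
      clashʳ m (inj₂ (e , k , r , s)) with ∈.∈-++⁻ es k
      ... | inj₁ n = ⊥-elim (disjoint-join {d} {u} {xs} {ys} {es} {fs} uniq (∈.∈-++⁺ʳ xs (block⊆darts n r)) (proj₂ (real-α q m)))
      ... | inj₂ n = inj₂ (e , n , r , s)

      coincidentˡ : ∀ {x y} → Coincident es x y → Coincident (es ++ fs) x y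
      coincidentˡ (e , m , c) = e , ∈.∈-++⁺ˡ m , c

      coincidentʳ : ∀ {x y} → Coincident fs x y → Coincident (es ++ fs) x y
      coincidentʳ (e , m , c) = e , ∈.∈-++⁺ʳ es m , c

      clashˡ⁻ : ∀ {x y} → Clash es x y → Clash (es ++ fs) x y
      clashˡ⁻ (inj₁ p) = inj₁ p
      clashˡ⁻ (inj₂ c) = inj₂ (coincidentˡ c)

      clashʳ⁻ : ∀ {x y} → Clash fs x y → Clash (es ++ fs) x y
      clashʳ⁻ (inj₁ p) = inj₁ p
      clashʳ⁻ (inj₂ c) = inj₂ (coincidentʳ c)

      no-clash-across : ∀ {x y} → x ∈ support xs es → y ∈ support ys fs → ¬ Clash (es ++ fs) x y
      no-clash-across {x} {y} m n k with clashˡ m k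
      ... | inj₁ refl = disjoint-join {d} {u} {xs} {ys} {es} {fs} uniq (proj₂ (real-α p m)) n
      ... | inj₂ (e , k′ , _ , s) =
        disjoint-join {d} {u} {xs} {ys} {es} {fs} uniq (∈.∈-++⁺ʳ xs (block⊆darts k′ s)) (proj₂ (real-α q n))

      no-clash-joined : ∀ {y} → y ≢ u → ¬ Clash (es ++ fs) d y
      no-clash-joined y≢u (inj₁ eq) = y≢u (trans (sym eq) du)
      no-clash-joined y≢u (inj₂ (e , m , r , _)) = leg∉darts (d ∷ xs ++ u ∷ ys) (es ++ fs) uniq (there (∈.∈-++⁺ʳ xs (here refl)))
        (block⊆darts m (subst (_∈ block e) du r))

      simple-join⁺ : Simple es → Simple fs → Simple (es ++ fs)
      simple-join⁺ s s′ x≢y (e , m , a , b) k with ∈.∈-++⁻ es m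
      ... | inj₁ n = s x≢y (e , n , a , b) (clashˡ (∈.∈-++⁺ʳ xs (block⊆darts n a)) k)
      ... | inj₂ n = s′ x≢y (e , n , a , b) (clashʳ (∈.∈-++⁺ʳ ys (block⊆darts n a)) k)

      simple-joinˡ : Simple (es ++ fs) → Simple es
      simple-joinˡ s x≢y c k = s x≢y (coincidentˡ c) (clashˡ⁻ k)

      simple-joinʳ : Simple (es ++ fs) → Simple fs
      simple-joinʳ s x≢y c k = s x≢y (coincidentʳ c) (clashʳ⁻ k)

    module NewLocal {t d e s es} (de : α d ≡ e) (ed : α e ≡ d) (p : Real t (σ e ∷ σ (σ e) ∷ σ (σ (σ e)) ∷ s) es)
      (uniq : Unique (support (d ∷ s) (e ∷ es))) where

      inner : List D
      inner = support (σ e ∷ σ (σ e) ∷ σ (σ (σ e)) ∷ s) es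

      uniq′ : Unique (d ∷ e ∷ inner)
      uniq′ = unique-↭ (new-↭ d e s es) uniq

      d∉ : d ∉ inner
      d∉ m = unique-∉ uniq′ (there m)

      e∉ : e ∉ inner
      e∉ = unique-∉ (unique-tail uniq′)

      triple⊆ : ∀ {x} → x ∈ triple e → x ∈ inner
      triple⊆ m = ∈.∈-++⁺ˡ {xs = triple e} {s ++ darts es} m

      leg⊆ : ∀ {x} → x ∈ s → x ∈ inner
      leg⊆ m = ∈.∈-++⁺ˡ (∈.∈-++⁺ʳ (triple e) m)

      in-triple : ∀ {x} → x ∈ inner → x ∈ block e → x ∈ triple e
      in-triple m (here refl) = ⊥-elim (e∉ m)
      in-triple m (there n)   = n

      clash⁺ : ∀ {x y} → Clash es x y → Clash (e ∷ es) x y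
      clash⁺ (inj₁ q) = inj₁ q
      clash⁺ (inj₂ (f , m , c)) = inj₂ (f , there m , c)

      clash-triple : ∀ {x y} → α x ∈ triple e → α y ∈ triple e → Clash (e ∷ es) x y
      clash-triple m n = inj₂ (e , here refl , there m , there n)

      clash⁻ : ∀ {x y} → x ∈ inner → y ∈ inner → Clash (e ∷ es) x y →
               Clash es x y ⊎ (α x ∈ triple e × α y ∈ triple e)
      clash⁻ m n (inj₁ q) = inj₁ (inj₁ q)
      clash⁻ m n (inj₂ (f , there k , c)) = inj₁ (inj₂ (f , k , c))
      clash⁻ m n (inj₂ (f , here refl , a , b)) =
        inj₂ (in-triple (proj₂ (real-α p m)) a , in-triple (proj₂ (real-α p n)) b)

      clash-first⁺ : ∀ {y} → α y ∈ triple e → Clash (e ∷ es) d y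
      clash-first⁺ m = inj₂ (e , here refl , here de , there m)

      clash-first⁻ : ∀ {y} → y ∈ s → Clash (e ∷ es) d y → α y ∈ triple e
      clash-first⁻ m (inj₁ eq) = ⊥-elim (e∉ (subst (_∈ inner) (trans (sym eq) de) (leg⊆ m)))
      clash-first⁻ m (inj₂ (f , here refl , a , b)) = in-triple (proj₂ (real-α p (leg⊆ m))) b
      clash-first⁻ m (inj₂ (f , there k , a , b)) =
        ⊥-elim (e∉ (∈.∈-++⁺ʳ (triple e ++ s) (block⊆darts k (subst (_∈ block f) de a))))

      Spread : Set
      Spread = ∀ {x y} → x ≢ y → x ∈ triple e → y ∈ triple e → ¬ Clash es x y

      -- The dart `e` is joined to the leg `d`, which belongs to no explored vertex, so at the new
      -- vertex only the three other darts can violate simplicity. A violation at an old vertex that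
      -- uses two edges to the new one is a clash of two of these three darts, seen from the far
      -- end.
      simple-new⁺ : Simple es → Spread → Simple (e ∷ es)
      simple-new⁺ smp spr x≢y (f , there m , a , b) k
        with clash⁻ (∈.∈-++⁺ʳ (triple e ++ s) (block⊆darts m a)) (∈.∈-++⁺ʳ (triple e ++ s) (block⊆darts m b)) k
      ... | inj₁ k′ = smp x≢y (f , m , a , b) k′
      ... | inj₂ (a′ , b′) = spr (λ eq → x≢y (trans (sym αα) (trans (cong α eq) ββ))) a′ b′
              (inj₂ (f , m , subst (_∈ block f) (sym αα) a , subst (_∈ block f) (sym ββ) b))
        where αα = proj₁ (real-α p (∈.∈-++⁺ʳ (triple e ++ s) (block⊆darts m a)))
              ββ = proj₁ (real-α p (∈.∈-++⁺ʳ (triple e ++ s) (block⊆darts m b)))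
      simple-new⁺ smp spr x≢y (_ , here refl , here refl , here refl) k = x≢y refl
      simple-new⁺ smp spr x≢y (_ , here refl , here refl , there b) (inj₁ eq) =
        d∉ (subst (_∈ inner) (trans (sym eq) ed) (triple⊆ b))
      simple-new⁺ smp spr x≢y (_ , here refl , here refl , there b) (inj₂ (f , m , a′ , _)) =
        leg∉darts (d ∷ s) (e ∷ es) uniq (here refl) (block⊆darts {es = e ∷ es} m (subst (_∈ block f) ed a′))
      simple-new⁺ smp spr {x} x≢y (_ , here refl , there a , here refl) (inj₁ eq) =
        d∉ (subst (_∈ inner) (trans (trans (sym (proj₁ (real-α p (triple⊆ a)))) (cong α eq)) ed) (triple⊆ a))
      simple-new⁺ smp spr x≢y (_ , here refl , there a , here refl) (inj₂ (f , m , _ , b′)) =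
        leg∉darts (d ∷ s) (e ∷ es) uniq (here refl) (block⊆darts {es = e ∷ es} m (subst (_∈ block f) ed b′))
      simple-new⁺ smp spr {x} {y} x≢y (_ , here refl , there a , there b) k with clash⁻ (triple⊆ a) (triple⊆ b) k
      ... | inj₁ k′ = spr x≢y a b k′
      ... | inj₂ (a′ , b′) = spr (λ eq → real-α-fpf p (unique-tail (unique-tail uniq′)) (triple⊆ a) (sym eq)) a a′ (inj₁ refl)

      simple-new⁻ : Simple (e ∷ es) → Simple es × Spread
      simple-new⁻ smp = (λ x≢y (f , m , c) k → smp x≢y (f , there m , c) (clash⁺ k)) ,
                        λ x≢y a b k → smp x≢y (e , here refl , there a , there b) (clash⁺ k)

  module Turn {D : Set} (σ α : D → D) (σ⁴ : ∀ x → σ (σ (σ (σ x))) ≡ x) where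
    open Explored σ α

    abstract
      rotate-real : ∀ {t x s es} → Real t (x ∷ s) es → ∃ λ gs → Real (rotate t) (s ++ x ∷ []) gs × gs ≋ es
      rotate-real = rotateBy-real σ⁴ _ ℕ.≤-refl

      rotate-iterate-real : ∀ xs {t ys es} → Real t (xs ++ ys) es →
        ∃ λ gs → Real (iterate rotate (length xs) t) (ys ++ xs) gs × gs ≋ es
      rotate-iterate-real [] {ys = ys} p = _ , subst (λ w → Real _ w _) (sym (List.++-identityʳ ys)) p , ≋-refl
      rotate-iterate-real (x ∷ xs) {ys = ys} p with rotate-real p
      ... | g₁ , p₁ , q₁ with rotate-iterate-real xs {ys = ys ++ x ∷ []} (subst (λ w → Real _ w _) (List.++-assoc xs ys _) p₁)
      ... | g₂ , p₂ , q₂ = g₂ , subst (λ w → Real _ w _) (List.++-assoc ys _ xs) p₂ , ≋-trans q₂ q₁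

      unrotate-real : ∀ {t x s es} → Real t (s ++ x ∷ []) es → ∃ λ gs → Real (unrotate t) (x ∷ s) gs × gs ≋ es
      unrotate-real {t} {x} {s} p with rotate-iterate-real s {ys = x ∷ []} p
      ... | gs , q , eq = gs , subst (λ t → Real t (x ∷ s) gs) (sym (unrotate-iterate t)) (subst (λ n → Real (iterate rotate n t) (x ∷ s) gs)
          (sym (trans (cong (_∸ 1) (trans (real-legs p) (List.length-++ s))) (ℕ.m+n∸n≡m (length s) 1))) q) , eq

    turn-↭ : ∀ x (s es : List D) {gs} → gs ≋ es → support (x ∷ s) es ↭ support (s ++ x ∷ []) gs
    turn-↭ x s es eq = ↭.++⁺ (↭.∷↭∷ʳ x s) (↭-sym (darts↭ eq))

  record Modelled (t : Tree) (h n : ℕ) : Set where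
    field
      w es : List ℕ
      α    : ℕ → ℕ
      real : Realisation.Real σ₄ α t w es
      uniq : Unique (Explored.support σ₄ α w es)
      len  : length w ≡ dbl h

  abstract
    model : ∀ {t h n} → WF t h n → Modelled t h n
    model {h = h} wf with chart-on wf (upTo (dbl h)) (List.length-upTo (dbl h)) (Unique.upTo⁺ (dbl h)) h
                            (λ m → ℕ.≤-trans (∈.∈-upTo⁻ m) (dbl≤quad h))
    ... | α , es , r , u , _ = record { real = r ; uniq = u ; len = List.length-upTo (dbl h) }

  wf-unique : ∀ {t h n h′ n′} → WF t h n → WF t h′ n′ → h ≡ h′ × n ≡ n′
  wf-unique nil nil = refl , refl
  wf-unique (join p q) (join p′ q′) with wf-unique p p′ | wf-unique q q′
  ... | refl , refl | refl , refl = refl , refl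
  wf-unique (new p) (new p′) with wf-unique p p′
  ... | refl , refl = refl , refl

  -- Every vertex contributes four darts, so vertex lists with the same darts have the same length.
  real-wf′ : ∀ {α t h n w es t′ w′ es′} → WF t h n → Realisation.Real σ₄ α t w es → Realisation.Real σ₄ α t′ w′ es′ →
             length w ≡ length w′ → Realisation._≋_ σ₄ α es′ es → WF t′ h n
  real-wf′ {α} {h = h} {es = es} {es′ = es′} wf p q eq r with Realisation.real-even σ₄ α p
  ... | i , pi , wi with wf-unique wf wi
  ... | refl , refl = subst (WF _ h) quarter (Realisation.real-wf σ₄ α q (trans (sym eq) pi))
    where
    length-darts : ∀ es → length (Realisation.darts σ₄ α es) ≡ quad (length es)
    length-darts []       = refl
    length-darts (e ∷ es) = cong (λ n → suc (suc (suc (suc n)))) (length-darts es)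
    quad-inj : ∀ {m n} → quad m ≡ quad n → m ≡ n
    quad-inj {zero}  {zero}  _ = refl
    quad-inj {suc m} {suc n} p = cong suc (quad-inj (ℕ.suc-injective (ℕ.suc-injective (ℕ.suc-injective (ℕ.suc-injective p)))))
    quarter : length es′ ≡ length es
    quarter = quad-inj (trans (sym (length-darts es′))
      (trans (↭.↭-length (Realisation.darts↭ r)) (length-darts es)))

  snoc-view : {A : Set} (w : List A) {n : ℕ} → length w ≡ suc n → ∃ λ s → ∃ λ x → w ≡ s ++ x ∷ []
  snoc-view (x ∷ [])     _ = [] , x , refl
  snoc-view (x ∷ y ∷ w)  p with snoc-view (y ∷ w) refl
  ... | s , z , q = x ∷ s , z , cong (x ∷_) q

  length-snoc : {A : Set} (x : A) (s : List A) → length (x ∷ s) ≡ length (s ++ x ∷ [])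
  length-snoc x s = trans (ℕ.+-comm 1 (length s)) (sym (List.length-++ s))

  module _ {t h n} (wf : WF t (suc h) n) where

    rotate-wf : WF (rotate t) (suc h) n
    rotate-wf with model wf
    ... | record { w = x ∷ s ; α = α ; real = real } with Turn.rotate-real σ₄ α σ₄⁴ real
    ... | gs , p , q = real-wf′ wf real p (length-snoc x s) q

    unrotate-wf : WF (unrotate t) (suc h) n
    unrotate-wf with model wf
    ... | record { w = w ; α = α ; real = real ; len = len } with snoc-view w len
    ... | s , x , refl with Turn.unrotate-real σ₄ α σ₄⁴ real
    ... | gs , p , q = real-wf′ wf real p (sym (length-snoc x s)) q

    -- Both trees are realised on the same legs by the same `α`, with permuted darts, so
    -- `real-determined` applies.
    unrotate-rotate : unrotate (rotate t) ≡ t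
    unrotate-rotate with model wf
    ... | record { w = x ∷ s ; es = es ; α = α ; real = real ; uniq = uniq } with Turn.rotate-real σ₄ α σ₄⁴ real
    ... | gs , p , q with Turn.unrotate-real σ₄ α σ₄⁴ p
    ... | gs′ , p′ , q′ = Explored.real-determined σ₄ α p′ real
          (unique-↭ (↭.++⁺ˡ (x ∷ s) (↭-sym (Realisation.darts↭ (Realisation.≋-trans σ₄ α q′ q)))) uniq) uniq

    rotate-unrotate : rotate (unrotate t) ≡ t
    rotate-unrotate with model wf
    ... | record { w = w ; es = es ; α = α ; real = real ; uniq = uniq ; len = len } with snoc-view w len
    ... | s , x , refl with Turn.unrotate-real σ₄ α σ₄⁴ real
    ... | gs , p , q with Turn.rotate-real σ₄ α σ₄⁴ p
    ... | gs′ , p′ , q′ = Explored.real-determined σ₄ α p′ real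
          (unique-↭ (↭.++⁺ˡ (s ++ x ∷ []) (↭-sym (Realisation.darts↭ (Realisation.≋-trans σ₄ α q′ q)))) uniq) uniq

    rotate-simple⁺ : SimpleTree t → SimpleTree (rotate t)
    rotate-simple⁺ s with model wf
    ... | record { w = x ∷ xs ; es = es ; α = α ; real = real ; uniq = uniq } with Turn.rotate-real σ₄ α σ₄⁴ real
    ... | gs , p , q = AnyModel.simple⁺ p (unique-↭ (Turn.turn-↭ σ₄ α σ₄⁴ x xs es q) uniq)
          (Explored.simple-≋ σ₄ α (Realisation.≋-sym σ₄ α q) (AnyModel.simple⁻ real uniq s))

    rotate-simple⁻ : SimpleTree (rotate t) → SimpleTree t
    rotate-simple⁻ s with model wf
    ... | record { w = x ∷ xs ; es = es ; α = α ; real = real ; uniq = uniq } with Turn.rotate-real σ₄ α σ₄⁴ real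
    ... | gs , p , q = AnyModel.simple⁺ real uniq (Explored.simple-≋ σ₄ α q
            (AnyModel.simple⁻ p (unique-↭ (Turn.turn-↭ σ₄ α σ₄⁴ x xs es q) uniq) s))

    private
      shift-at : {A : Set} {x : A} (s : List A) {i : ℕ} → length (x ∷ s) ≡ dbl (suc h) → i < suc (dbl h) →
                 ∃ λ y → (s ++ x ∷ []) [ i ]= y × (x ∷ s) [ suc i ]= y
      shift-at s {i} eq lt with at-index s i (subst (i <_) (sym (ℕ.suc-injective eq)) lt)
      ... | y , p = y , at-++ˡ p , suc p

    rotate-clash⁺ : ∀ {i j} → i < suc (dbl h) → j < suc (dbl h) → ClashTree (suc i) (suc j) t → ClashTree i j (rotate t)
    rotate-clash⁺ i< j< k with model wf
    ... | record { w = x ∷ xs ; es = es ; α = α ; real = real ; uniq = uniq ; len = len }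
        with Turn.rotate-real σ₄ α σ₄⁴ real | shift-at xs len i< | shift-at xs len j<
    ... | gs , p , q | y , a , b | z , c , d = AnyModel.clash⁺ p (unique-↭ (Turn.turn-↭ σ₄ α σ₄⁴ x xs es q) uniq) a c
          (Explored.clash-≋ σ₄ α (Realisation.≋-sym σ₄ α q) (AnyModel.clash⁻ real uniq b d k))

    rotate-clash⁻ : ∀ {i j} → i < suc (dbl h) → j < suc (dbl h) → ClashTree i j (rotate t) → ClashTree (suc i) (suc j) t
    rotate-clash⁻ i< j< k with model wf
    ... | record { w = x ∷ xs ; es = es ; α = α ; real = real ; uniq = uniq ; len = len }
        with Turn.rotate-real σ₄ α σ₄⁴ real | shift-at xs len i< | shift-at xs len j<
    ... | gs , p , q | y , a , b | z , c , d = AnyModel.clash⁺ real uniq b d (Explored.clash-≋ σ₄ α q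
            (AnyModel.clash⁻ p (unique-↭ (Turn.turn-↭ σ₄ α σ₄⁴ x xs es q) uniq) a c k))

    private
      last-at : {A : Set} {x : A} (s : List A) → length (x ∷ s) ≡ dbl (suc h) → (s ++ x ∷ []) [ suc (dbl h) ]= x
      last-at {x = x} s eq = subst (λ n → (s ++ x ∷ []) [ n ]= x) (ℕ.suc-injective eq) (at-last s)

    -- Leg 0 has moved to the end, where its index is the number of legs minus one.
    rotate-clash-last⁺ : ∀ {i} → i < suc (dbl h) → ClashTree (suc i) 0 t → ClashTree i (suc (dbl h)) (rotate t)
    rotate-clash-last⁺ i< k with model wf
    ... | record { w = x ∷ xs ; es = es ; α = α ; real = real ; uniq = uniq ; len = len }
        with Turn.rotate-real σ₄ α σ₄⁴ real | shift-at xs len i<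
    ... | gs , p , q | y , a , b = AnyModel.clash⁺ p (unique-↭ (Turn.turn-↭ σ₄ α σ₄⁴ x xs es q) uniq) a (last-at xs len)
          (Explored.clash-≋ σ₄ α (Realisation.≋-sym σ₄ α q) (AnyModel.clash⁻ real uniq b zero k))

    rotate-clash-last⁻ : ∀ {i} → i < suc (dbl h) → ClashTree i (suc (dbl h)) (rotate t) → ClashTree (suc i) 0 t
    rotate-clash-last⁻ i< k with model wf
    ... | record { w = x ∷ xs ; es = es ; α = α ; real = real ; uniq = uniq ; len = len }
        with Turn.rotate-real σ₄ α σ₄⁴ real | shift-at xs len i<
    ... | gs , p , q | y , a , b = AnyModel.clash⁺ real uniq b zero (Explored.clash-≋ σ₄ α q
            (AnyModel.clash⁻ p (unique-↭ (Turn.turn-↭ σ₄ α σ₄⁴ x xs es q) uniq) a (last-at xs len) k))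

  at-≢ : {A : Set} {xs : List A} {i j : ℕ} {x y : A} → Unique xs → i ≢ j → xs [ i ]= x → xs [ j ]= y → x ≢ y
  at-≢ u i≢j zero    zero    = ⊥-elim (i≢j refl)
  at-≢ u i≢j zero    (suc q) refl = unique-∉ u (at-∈ q)
  at-≢ u i≢j (suc p) zero    refl = unique-∉ u (at-∈ p)
  at-≢ u i≢j (suc p) (suc q) = at-≢ (unique-tail u) (λ eq → i≢j (cong suc eq)) p q

  clashTree-sym : ∀ {t i j} → ClashTree i j t → ClashTree j i t
  clashTree-sym (c , x , y , p , q , k) =
    c , y , x , q , p , Local.clash-sym σ₄ (Chart.α c) (Chart.real c) (Chart.uniq c) (at-∈ p) k

  clashTree-trans : ∀ {t i j k} → i ≢ k → ClashTree i j t → ClashTree j k t → ClashTree i k t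
  clashTree-trans {i = i} {k = k} i≢k K@(c , x , y , p , q , kl) (c′ , y₂ , z₂ , p₂ , q₂ , kl₂)
    with at-index (Chart.w c) k (subst (k <_) (AnyModel.same-length (Chart.real c′) (Chart.uniq c′) (Chart.real c)) (at-bound q₂))
  ... | z , r = c , x , z , p , r ,
    Local.clash-trans σ₄ (Chart.α c) (Chart.real c) (Chart.uniq c) (at-∈ p) (at-∈ q) (at-∈ r)
      (at-≢ (unique-++ˡ (Chart.w c) (Chart.uniq c)) i≢k p r) kl
      (AnyModel.clash⁻ (Chart.real c) (Chart.uniq c) q r (c′ , y₂ , z₂ , p₂ , q₂ , kl₂))

  module _ {l r h n} (wf : WF (join l r) h n) where

    simple-join⁺ : SimpleTree l → SimpleTree r → SimpleTree (join l r)
    simple-join⁺ sl sr with model wf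
    ... | record { α = α ; real = R@(Realisation.join {d = d} {u} {xs} {ys} {es} {fs} du ud p q) ; uniq = uniq } =
      AnyModel.simple⁺ R uniq (Local.JoinLocal.simple-join⁺ σ₄ α du ud p q uniq
        (AnyModel.simple⁻ p (Explored.unique-joinˡ σ₄ α {d} {u} {xs} {ys} {es} {fs} uniq) sl)
        (AnyModel.simple⁻ q (Explored.unique-joinʳ σ₄ α {d} {u} {xs} {ys} {es} {fs} uniq) sr))

    simple-join⁻ : SimpleTree (join l r) → SimpleTree l × SimpleTree r
    simple-join⁻ s with model wf
    ... | record { α = α ; real = R@(Realisation.join {d = d} {u} {xs} {ys} {es} {fs} du ud p q) ; uniq = uniq } =
      AnyModel.simple⁺ p (Explored.unique-joinˡ σ₄ α {d} {u} {xs} {ys} {es} {fs} uniq)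
        (Local.JoinLocal.simple-joinˡ σ₄ α du ud p q uniq (AnyModel.simple⁻ R uniq s)) ,
      AnyModel.simple⁺ q (Explored.unique-joinʳ σ₄ α {d} {u} {xs} {ys} {es} {fs} uniq)
        (Local.JoinLocal.simple-joinʳ σ₄ α du ud p q uniq (AnyModel.simple⁻ R uniq s))

  SpreadTree : Tree → Set
  SpreadTree t = ¬ ClashTree 0 1 t × ¬ ClashTree 1 2 t × ¬ ClashTree 0 2 t

  module _ {D : Set} {σ α : D → D} {t a b c s es} (real : Realisation.Real σ α t (a ∷ b ∷ c ∷ s) es)
    (uniq : Unique (Explored.support σ α (a ∷ b ∷ c ∷ s) es)) where
    open Explored σ α

    spread⁺ : (∀ {x y} → x ≢ y → x ∈ a ∷ b ∷ c ∷ [] → y ∈ a ∷ b ∷ c ∷ [] → ¬ Clash es x y) → SpreadTree t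
    spread⁺ h =
      (λ k → h (at-≢ u (λ ()) zero (suc zero)) (here refl) (there (here refl)) (clash⁻ zero (suc zero) k)) ,
      (λ k → h (at-≢ u (λ ()) (suc zero) (suc (suc zero))) (there (here refl)) (there (there (here refl)))
                (clash⁻ (suc zero) (suc (suc zero)) k)) ,
      (λ k → h (at-≢ u (λ ()) zero (suc (suc zero))) (here refl) (there (there (here refl)))
                (clash⁻ zero (suc (suc zero)) k))
      where open AnyModel real uniq
            u = unique-++ˡ (a ∷ b ∷ c ∷ s) uniq

    spread⁻ : SpreadTree t → ∀ {x y} → x ≢ y → x ∈ a ∷ b ∷ c ∷ [] → y ∈ a ∷ b ∷ c ∷ [] → ¬ Clash es x y
    spread⁻ (p , q , r) ne (here refl) (here refl) k = ne refl
    spread⁻ (p , q , r) ne (here refl) (there (here refl)) k = p (AnyModel.clash⁺ real uniq zero (suc zero) k)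
    spread⁻ (p , q , r) ne (here refl) (there (there (here refl))) k =
      r (AnyModel.clash⁺ real uniq zero (suc (suc zero)) k)
    spread⁻ (p , q , r) ne (there (here refl)) (here refl) k =
      p (clashTree-sym (AnyModel.clash⁺ real uniq (suc zero) zero k))
    spread⁻ (p , q , r) ne (there (here refl)) (there (here refl)) k = ne refl
    spread⁻ (p , q , r) ne (there (here refl)) (there (there (here refl))) k =
      q (AnyModel.clash⁺ real uniq (suc zero) (suc (suc zero)) k)
    spread⁻ (p , q , r) ne (there (there (here refl))) (here refl) k =
      r (clashTree-sym (AnyModel.clash⁺ real uniq (suc (suc zero)) zero k))
    spread⁻ (p , q , r) ne (there (there (here refl))) (there (here refl)) k =
      q (clashTree-sym (AnyModel.clash⁺ real uniq (suc (suc zero)) (suc zero) k))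
    spread⁻ (p , q , r) ne (there (there (here refl))) (there (there (here refl))) k = ne refl

  module _ {t h n} (wf : WF (new t) h n) where

    simple-new⁺ : SimpleTree t → SpreadTree t → SimpleTree (new t)
    simple-new⁺ st sp with model wf
    ... | record { α = α ; real = R@(Realisation.new {d = d} {e} {xs} {es} de ed p) ; uniq = uniq } =
      AnyModel.simple⁺ R uniq (Local.NewLocal.simple-new⁺ σ₄ α de ed p uniq (AnyModel.simple⁻ p u st) (spread⁻ p u sp))
      where u = Explored.unique-new σ₄ α {d} {e} {xs} {es} uniq

    simple-new⁻ : SimpleTree (new t) → SimpleTree t × SpreadTree t
    simple-new⁻ s with model wf
    ... | record { α = α ; real = R@(Realisation.new {d = d} {e} {xs} {es} de ed p) ; uniq = uniq }
        with Local.NewLocal.simple-new⁻ σ₄ α de ed p uniq (AnyModel.simple⁻ R uniq s)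
    ... | a , b = AnyModel.simple⁺ p u a , spread⁺ p u b
      where u = Explored.unique-new σ₄ α {d} {e} {xs} {es} uniq

-- Decomposition of the regions whose legs 0 and 1 clash.

module HeadClashes where

  open Trees
  open Models
  open Charts
  open Rotation
  open import Data.Nat using (ℕ; zero; suc; _+_; _∸_)
  import Data.Nat.Properties as ℕ
  open import Data.List using (List; []; _∷_; _++_; length)
  import Data.List.Properties as List
  open import Data.List.Membership.Propositional using (_∈_; _∉_)
  import Data.List.Membership.Propositional.Properties as ∈
  open import Data.List.Relation.Unary.Any using (here; there)
  open import Data.List.Relation.Unary.Unique.Propositional using (Unique)
  open import Data.List.Relation.Binary.Permutation.Propositional using (_↭_; ↭-sym; ↭-trans)
  import Data.List.Relation.Binary.Permutation.Propositional.Properties as ↭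
  open import Data.Product using (∃; _×_; _,_; proj₁; proj₂)
  open import Data.Sum using (inj₁; inj₂)
  open import Data.Empty using (⊥-elim)
  open import Relation.Nullary using (¬_)
  open import Relation.Binary.PropositionalEquality

  Region : ℕ → ℕ → Tree → Set
  Region h n t = WF t h n × SimpleTree t

  unrotate-simple : ∀ {t h n} → WF t (suc h) n → SimpleTree t → SimpleTree (unrotate t)
  unrotate-simple wf s = rotate-simple⁻ (unrotate-wf wf) (subst SimpleTree (sym (rotate-unrotate wf)) s)

  rotate-region : ∀ {t h n} → Region (suc h) n t → Region (suc h) n (rotate t)
  rotate-region (wf , s) = rotate-wf wf , rotate-simple⁺ wf s

  unrotate-region : ∀ {t h n} → Region (suc h) n t → Region (suc h) n (unrotate t)
  unrotate-region (wf , s) = unrotate-wf wf , unrotate-simple wf s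

  rotate³ unrotate³ : Tree → Tree
  rotate³ t = rotate (rotate (rotate t))
  unrotate³ t = unrotate (unrotate (unrotate t))

  rotate³-region : ∀ {t h n} → Region (suc h) n t → Region (suc h) n (rotate³ t)
  rotate³-region s = rotate-region (rotate-region (rotate-region s))

  unrotate³-region : ∀ {t h n} → Region (suc h) n t → Region (suc h) n (unrotate³ t)
  unrotate³-region s = unrotate-region (unrotate-region (unrotate-region s))

  rotate³-unrotate³ : ∀ {t h n} → WF t (suc h) n → rotate³ (unrotate³ t) ≡ t
  rotate³-unrotate³ wf = trans (cong (λ x → rotate (rotate x)) (rotate-unrotate (unrotate-wf (unrotate-wf wf))))
    (trans (cong rotate (rotate-unrotate (unrotate-wf wf))) (rotate-unrotate wf))

  unrotate³-rotate³ : ∀ {t h n} → WF t (suc h) n → unrotate³ (rotate³ t) ≡ t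
  unrotate³-rotate³ wf = trans (cong (λ x → unrotate (unrotate x)) (unrotate-rotate (rotate-wf (rotate-wf wf))))
    (trans (cong unrotate (unrotate-rotate (rotate-wf wf))) (unrotate-rotate wf))

  nil-region : Region 0 0 nil
  nil-region = nil , record { real = Realisation.nil {α = λ x → x} ; uniq = Data.List.Relation.Unary.AllPairs.[] } ,
    λ { _ (_ , () , _) }
    where import Data.List.Relation.Unary.AllPairs

  wf-nil : ∀ {h n} → WF nil h n → h ≡ 0 × n ≡ 0
  wf-nil nil = refl , refl

  wf-join-nilʳ : ∀ {l h n} → WF (join l nil) (suc h) n → WF l h n
  wf-join-nilʳ (join {i = i} {m = m} p nil) = subst₂ (WF _) (sym (ℕ.+-identityʳ i)) (sym (ℕ.+-identityʳ m)) p

  join-region : ∀ {l r i j m n} → Region i m l → Region j n r → Region (suc (i + j)) (m + n) (join l r)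
  join-region (wl , sl) (wr , sr) = join wl wr , simple-join⁺ (join wl wr) sl sr

  join-region⁻ : ∀ {l r i j m n h k} → WF l i m → WF r j n → Region h k (join l r) → Region i m l × Region j n r
  join-region⁻ wl wr (wf , s) with simple-join⁻ wf s
  ... | sl , sr = (wl , sl) , (wr , sr)

  join-nil-region : ∀ {l h n} → Region h n l → Region (suc h) n (join l nil)
  join-nil-region {l} {h} {n} s = subst₂ (λ h n → Region (suc h) n (join l nil)) (ℕ.+-identityʳ h) (ℕ.+-identityʳ n)
    (join-region s nil-region)

  module Cases {D : Set} (σ α : D → D) where
    open Explored σ α
    open Local σ α

    real-[] : ∀ {t es} → Real t [] es → t ≡ nil × es ≡ []
    real-[] nil = refl , refl

    -- If the partner of the first leg is itself a leg, then peeling cannot have met a new vertex: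
    -- its entering dart would occur twice in the support.
    joined : ∀ {t w es d u} xs {ys} → Real t w es → w ≡ d ∷ xs ++ u ∷ ys → Unique (support w es) → α d ≡ u →
      ∃ λ l → ∃ λ r → ∃ λ es₁ → ∃ λ es₂ → t ≡ join l r × Real l xs es₁ × Real r ys es₂ × es ≡ es₁ ++ es₂
    joined xs (join {xs = xs′} du ud p q) eq uniq du′ with List.∷-injective eq
    ... | refl , eq′ with trans (sym du) du′
    ... | refl with unique-split xs′ eq′ (unique-++ˡ (xs′ ++ _ ∷ _) (unique-tail uniq))
    ... | refl , refl = _ , _ , _ , _ , refl , p , q , refl
    joined {d = d} {u} xs (new de ed p) refl uniq du′ with trans (sym de) du′
    ... | refl = ⊥-elim (unique-disjoint (d ∷ xs ++ u ∷ _) uniq (there (∈.∈-++⁺ʳ xs (here refl))) (here refl))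

    join-nil-nil : ∀ {t a b es} → Real t (a ∷ b ∷ []) es → Unique (support (a ∷ b ∷ []) es) → α a ≡ b → t ≡ join nil nil
    join-nil-nil p uniq ab with joined [] p refl uniq ab
    ... | l , r , _ , _ , refl , p₁ , p₂ , _ with real-[] p₁ | real-[] p₂
    ... | refl , _ | refl , _ = refl

    real-join-nil-nil : ∀ {w a b es} → Real (join nil nil) w es → w ≡ a ∷ b ∷ [] → α a ≡ b × α b ≡ a
    real-join-nil-nil (join du ud nil nil) refl = du , ud

    module JoinMore {l r d u xs ys es fs} (du : α d ≡ u) (ud : α u ≡ d) (p : Real l xs es) (q : Real r ys fs)
      (uniq : Unique (support (d ∷ xs ++ u ∷ ys) (es ++ fs))) where
      open JoinLocal {d = d} {u} {xs} {ys} {es} {fs} du ud p q uniq public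

      private
        uniq′ : Unique (d ∷ u ∷ support xs es ++ support ys fs)
        uniq′ = unique-↭ (join-↭ d u xs ys es fs) uniq

      u∉ˡ : u ∉ support xs es
      u∉ˡ m = unique-∉ (unique-tail uniq′) (∈.∈-++⁺ˡ m)

      u∉ʳ : u ∉ support ys fs
      u∉ʳ m = unique-∉ (unique-tail uniq′) (∈.∈-++⁺ʳ (support xs es) m)

      d∉ˡ : d ∉ support xs es
      d∉ˡ m = unique-∉ uniq′ (there (∈.∈-++⁺ˡ m))

      d∉ʳ : d ∉ support ys fs
      d∉ʳ m = unique-∉ uniq′ (there (∈.∈-++⁺ʳ (support xs es) m))

      no-clash-uˡ : ∀ {x} → x ∈ support xs es → ¬ Clash (es ++ fs) x u
      no-clash-uˡ m (inj₁ eq) = u∉ˡ (subst (_∈ support xs es) eq (proj₂ (real-α p m)))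
      no-clash-uˡ m (inj₂ (e , k , _ , b)) = leg∉darts (d ∷ xs ++ u ∷ ys) (es ++ fs) uniq (here refl)
        (block⊆darts k (subst (_∈ block e) ud b))

      no-clash-uʳ : ∀ {x} → x ∈ support ys fs → ¬ Clash (es ++ fs) x u
      no-clash-uʳ m (inj₁ eq) = u∉ʳ (subst (_∈ support ys fs) eq (proj₂ (real-α q m)))
      no-clash-uʳ m (inj₂ (e , k , _ , b)) = leg∉darts (d ∷ xs ++ u ∷ ys) (es ++ fs) uniq (here refl)
        (block⊆darts k (subst (_∈ block e) ud b))

  module RotatedThrice {α : ℕ → ℕ} {t a b c y s es} (p : Realisation.Real σ₄ α t (a ∷ b ∷ c ∷ y ∷ s) es)
    (uniq : Unique (Explored.support σ₄ α (a ∷ b ∷ c ∷ y ∷ s) es)) where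
    open Explored σ₄ α
    open Turn σ₄ α σ₄⁴

    private rot = rotate-iterate-real (a ∷ b ∷ c ∷ []) {ys = y ∷ s} p

    gs : List ℕ
    gs = proj₁ rot

    real : Real (rotate³ t) (y ∷ s ++ a ∷ b ∷ c ∷ []) gs
    real = proj₁ (proj₂ rot)

    gs≋es : gs ≋ es
    gs≋es = proj₂ (proj₂ rot)

    unique : Unique (support (y ∷ s ++ a ∷ b ∷ c ∷ []) gs)
    unique = unique-↭ (↭.++⁺ (↭.++-comm (a ∷ b ∷ c ∷ []) (y ∷ s)) (↭-sym (darts↭ gs≋es))) uniq

  -- The three ways in which legs 0 and 1 of a region can clash: they are joined, or they end at a
  -- vertex whose other two darts are both outside, respectively both inside, the digon cut out by the legs.
  data HeadClash (h : ℕ) : ℕ → Tree → Set where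
    paired : ∀ {n r} → Region h n r → HeadClash h n (join nil r)
    digon  : ∀ {n l} → Region (suc h) n l → ¬ ClashTree 0 1 l →
             HeadClash h (suc n) (new (unrotate³ (join (rotate (rotate l)) nil)))
    pocket : ∀ {m n l r} → Region h m l → Region 1 n r → ¬ ClashTree 0 1 r →
             HeadClash h (suc (m + n)) (new (unrotate³ (join l r)))

  -- A model of `new t` with legs `d`, `y`, `s`, where `d` reaches the vertex at `e` and `y` reaches
  -- its last dart `σ₄ (σ₄ (σ₄ e))`. Cutting that second edge leaves the legs `s`, `σ₄ e`,
  -- `σ₄ (σ₄ e)`, and `l` is this region with the two darts of the vertex turned to the front.
  record DigonModel (h : ℕ) (t l : Tree) : Set where
    field
      {d y} : ℕ
      {s es} : List ℕ
      {e} : ℕ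
      {α} : ℕ → ℕ
      de : α d ≡ e
      ed : α e ≡ d
      p : Realisation.Real σ₄ α t (σ₄ e ∷ σ₄ (σ₄ e) ∷ σ₄ (σ₄ (σ₄ e)) ∷ y ∷ s) es
      uniq : Unique (Explored.support σ₄ α (d ∷ y ∷ s) (e ∷ es))
      len : length s ≡ dbl h
      gs₁ : List ℕ
      l₁ : Tree
      q : Realisation.Real σ₄ α l₁ (s ++ σ₄ e ∷ σ₄ (σ₄ e) ∷ []) gs₁
      yu : α y ≡ σ₄ (σ₄ (σ₄ e))
      uy : α (σ₄ (σ₄ (σ₄ e))) ≡ y
      gs₁≋ : Realisation._≋_ σ₄ α (gs₁ ++ []) es
      gs₀ : List ℕ
      q₀ : Realisation.Real σ₄ α l (σ₄ e ∷ σ₄ (σ₄ e) ∷ s) gs₀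
      gs₀≋ : Realisation._≋_ σ₄ α gs₀ gs₁

    open Explored σ₄ α public
    open Local σ₄ α public
    module N = NewLocal de ed p uniq
    uniq₁ : Unique (support (y ∷ (s ++ σ₄ e ∷ σ₄ (σ₄ e) ∷ []) ++ σ₄ (σ₄ (σ₄ e)) ∷ []) (gs₁ ++ []))
    uniq₁ = unique-↭ (↭.++⁺ (↭-trans (↭.++-comm (triple e) (y ∷ s))
              (Data.List.Relation.Binary.Permutation.Propositional.↭-reflexive
                (cong (y ∷_) (sym (List.++-assoc s (σ₄ e ∷ σ₄ (σ₄ e) ∷ []) _)))))
              (↭-sym (darts↭ gs₁≋))) (unique-new {d} {e} {y ∷ s} {es} uniq)
      where import Data.List.Relation.Binary.Permutation.Propositional
    module J = Cases.JoinMore σ₄ α {d = y} {xs = s ++ σ₄ e ∷ σ₄ (σ₄ e) ∷ []} {es = gs₁} {[]} yu uy q Realisation.nil uniq₁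
    uniq₀ : Unique (support (σ₄ e ∷ σ₄ (σ₄ e) ∷ s) gs₀)
    uniq₀ = unique-↭ (↭.++⁺ (↭.++-comm s (σ₄ e ∷ σ₄ (σ₄ e) ∷ [])) (↭-sym (darts↭ gs₀≋)))
              (unique-joinˡ {y} {σ₄ (σ₄ (σ₄ e))} {s ++ σ₄ e ∷ σ₄ (σ₄ e) ∷ []} {[]} {gs₁} {[]} uniq₁)

    clash₀ : ∀ {x z} → x ∈ support (s ++ σ₄ e ∷ σ₄ (σ₄ e) ∷ []) gs₁ → Clash es x z → Clash gs₀ x z
    clash₀ m k = clash-≋ (≋-sym gs₀≋) (J.clashˡ m (clash-≋ (≋-sym gs₁≋) k))

    clash₀⁻ : ∀ {x z} → Clash gs₀ x z → Clash es x z
    clash₀⁻ k = clash-≋ gs₁≋ (J.clashˡ⁻ (clash-≋ gs₀≋ k))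

  -- Now `y` reaches `σ₄ e`, the dart next to `e` on the other side. The edge separates the
  -- remaining legs `s`, which bound `l`, from the other two darts of the vertex, which are enclosed
  -- and bound `r`.
  record PocketModel (h : ℕ) (t l r : Tree) : Set where
    field
      {d y} : ℕ
      {s es} : List ℕ
      {e} : ℕ
      {α} : ℕ → ℕ
      de : α d ≡ e
      ed : α e ≡ d
      p : Realisation.Real σ₄ α t (σ₄ e ∷ σ₄ (σ₄ e) ∷ σ₄ (σ₄ (σ₄ e)) ∷ y ∷ s) es
      uniq : Unique (Explored.support σ₄ α (d ∷ y ∷ s) (e ∷ es))
      len : length s ≡ dbl h
      gs₁ gs₂ : List ℕ
      q : Realisation.Real σ₄ α l s gs₁
      q′ : Realisation.Real σ₄ α r (σ₄ (σ₄ e) ∷ σ₄ (σ₄ (σ₄ e)) ∷ []) gs₂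
      yu : α y ≡ σ₄ e
      uy : α (σ₄ e) ≡ y
      gs≋ : Realisation._≋_ σ₄ α (gs₁ ++ gs₂) es

    open Explored σ₄ α public
    open Local σ₄ α public
    module N = NewLocal de ed p uniq
    uniq₁ : Unique (support (y ∷ s ++ σ₄ e ∷ σ₄ (σ₄ e) ∷ σ₄ (σ₄ (σ₄ e)) ∷ []) (gs₁ ++ gs₂))
    uniq₁ = unique-↭ (↭.++⁺ (↭.++-comm (triple e) (y ∷ s)) (↭-sym (darts↭ gs≋))) (unique-new {d} {e} {y ∷ s} {es} uniq)
    module J = Cases.JoinMore σ₄ α {d = y} {xs = s} {ys = σ₄ (σ₄ e) ∷ σ₄ (σ₄ (σ₄ e)) ∷ []} {gs₁} {gs₂} yu uy q q′ uniq₁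
    uniqˡ : Unique (support s gs₁)
    uniqˡ = unique-joinˡ {y} {σ₄ e} {s} {σ₄ (σ₄ e) ∷ σ₄ (σ₄ (σ₄ e)) ∷ []} {gs₁} {gs₂} uniq₁
    uniqʳ : Unique (support (σ₄ (σ₄ e) ∷ σ₄ (σ₄ (σ₄ e)) ∷ []) gs₂)
    uniqʳ = unique-joinʳ {y} {σ₄ e} {s} {σ₄ (σ₄ e) ∷ σ₄ (σ₄ (σ₄ e)) ∷ []} {gs₁} {gs₂} uniq₁

  digon-model : ∀ {h n t} → WF (new t) (suc h) n → ∀ {l} → rotate³ t ≡ join (rotate (rotate l)) nil →
                WF l (suc h) (n ∸ 1) → DigonModel h t l
  digon-model {h} {t = t} wf {l} eq wl with model wf
  ... | record { w = d ∷ y ∷ s ; α = α ; real = Realisation.new {e = e} {es = es} de ed p ; uniq = uniq ; len = len } = go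
    where
    open Explored σ₄ α
    module R = RotatedThrice p (unique-new {d} {e} {y ∷ s} {es} uniq)
    go : DigonModel h t l
    go with subst (λ t → Real t (y ∷ s ++ σ₄ e ∷ σ₄ (σ₄ e) ∷ σ₄ (σ₄ (σ₄ e)) ∷ []) R.gs) eq R.real | R.gs≋es
    ... | P | gs≋ = split P refl gs≋
      where
      split : ∀ {w gs} → Real (join (rotate (rotate l)) nil) w gs → w ≡ y ∷ s ++ σ₄ e ∷ σ₄ (σ₄ e) ∷ σ₄ (σ₄ (σ₄ e)) ∷ [] →
              gs ≋ es → DigonModel h t l
      split (join {xs = xs} {es = gs₁} yu uy q nil) weq gs≋ with List.∷-injective weq
      ... | refl , weq′ with ++-unsnoc xs {s = s} {σ₄ e ∷ σ₄ (σ₄ e) ∷ []} weq′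
      ... | refl , refl with Turn.unrotate-real σ₄ α σ₄⁴ {s = s ++ σ₄ e ∷ []}
                               (subst (λ w → Real (rotate (rotate l)) w gs₁) (sym (List.++-assoc s _ _)) q)
      ... | g₁ , r₁ , e₁ with Turn.unrotate-real σ₄ α σ₄⁴ {s = σ₄ (σ₄ e) ∷ s} r₁
      ... | g₂ , r₂ , e₂ = record
        { de = de ; ed = ed ; p = p ; uniq = uniq ; len = ℕ.suc-injective (ℕ.suc-injective len)
        ; gs₁ = gs₁ ; q = q ; yu = yu ; uy = uy ; gs₁≋ = gs≋ ; gs₀ = g₂
        ; q₀ = subst (λ t → Real t _ g₂)
            (trans (cong unrotate (unrotate-rotate (rotate-wf wl))) (unrotate-rotate wl)) r₂
        ; gs₀≋ = ≋-trans e₂ e₁ }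

  pocket-model : ∀ {h n t} → WF (new t) (suc h) n → ∀ {l r m} → rotate³ t ≡ join l r →
                 WF r 1 m → PocketModel h t l r
  pocket-model {h} {t = t} wf {l} {r} eq wr with model wf
  ... | record { w = d ∷ y ∷ s ; α = α ; real = Realisation.new {e = e} {es = es} de ed p ; uniq = uniq ; len = len } = go
    where
    open Explored σ₄ α
    module R = RotatedThrice p (unique-new {d} {e} {y ∷ s} {es} uniq)
    go : PocketModel h t l r
    go with subst (λ t → Real t (y ∷ s ++ σ₄ e ∷ σ₄ (σ₄ e) ∷ σ₄ (σ₄ (σ₄ e)) ∷ []) R.gs) eq R.real | R.gs≋es
    ... | P | gs≋ = split P refl gs≋
      where
      split : ∀ {w gs} → Real (join l r) w gs → w ≡ y ∷ s ++ σ₄ e ∷ σ₄ (σ₄ e) ∷ σ₄ (σ₄ (σ₄ e)) ∷ [] →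
              gs ≋ es → PocketModel h t l r
      split (join {xs = xs} {ys} {gs₁} {gs₂} yu uy q q′) weq gs≋ with List.∷-injective weq | real-even q′
      ... | refl , weq′ | i , len′ , wi with wf-unique wi wr
      split (join {xs = xs} {a ∷ b ∷ []} {gs₁} {gs₂} yu uy q q′) weq gs≋
          | refl , weq′ | i , len′ , wi | refl , _
        with ++-unsnoc (xs ++ _ ∷ a ∷ []) {s = s} {σ₄ e ∷ σ₄ (σ₄ e) ∷ []} (trans (List.++-assoc xs _ _) weq′)
      ... | eq₂ , refl with ++-unsnoc (xs ++ _ ∷ []) {s = s} {σ₄ e ∷ []} (trans (List.++-assoc xs _ _) eq₂)
      ... | eq₁ , refl with List.∷ʳ-injective xs s eq₁
      ... | refl , refl = record
        { de = de ; ed = ed ; p = p ; uniq = uniq ; len = ℕ.suc-injective (ℕ.suc-injective len)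
        ; gs₁ = gs₁ ; gs₂ = gs₂ ; q = q ; q′ = q′ ; yu = yu ; uy = uy ; gs≋ = gs≋ }

  new-wf⁻ : ∀ {t h n} → WF (new t) (suc h) (suc n) → WF t (suc (suc h)) n
  new-wf⁻ (new p) = p

  module _ {h l T} (M : DigonModel h T l) where
    open DigonModel M
    private
      u₁ : Unique N.inner
      u₁ = unique-tail (unique-tail N.uniq′)

    -- The dart joined to the leg `y` clashes with neither of the other two, which leaves a single
    -- pair, namely legs 0 and 1 of `l`.
    digon-spread : ¬ ClashTree 0 1 l → SpreadTree T
    digon-spread ok =
      (λ k → ok (AnyModel.clash⁺ q₀ uniq₀ zero (suc zero)
         (clash₀ b₀∈ (AnyModel.clash⁻ p u₁ zero (suc zero) k)))) ,
      (λ k → J.no-clash-uˡ b₁∈ (clash-≋ (≋-sym gs₁≋) (AnyModel.clash⁻ p u₁ (suc zero) (suc (suc zero)) k))) ,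
      (λ k → J.no-clash-uˡ b₀∈ (clash-≋ (≋-sym gs₁≋) (AnyModel.clash⁻ p u₁ zero (suc (suc zero)) k)))
      where
      b₀∈ : σ₄ e ∈ support (s ++ σ₄ e ∷ σ₄ (σ₄ e) ∷ []) gs₁
      b₀∈ = ∈.∈-++⁺ˡ (∈.∈-++⁺ʳ s (here refl))
      b₁∈ : σ₄ (σ₄ e) ∈ support (s ++ σ₄ e ∷ σ₄ (σ₄ e) ∷ []) gs₁
      b₁∈ = ∈.∈-++⁺ˡ (∈.∈-++⁺ʳ s (there (here refl)))

    digon-clash : ClashTree 0 1 (new T)
    digon-clash = AnyModel.clash⁺ (Realisation.new de ed p) uniq zero (suc zero)
      (N.clash-first⁺ (subst (_∈ triple e) (sym yu) (there (there (here refl)))))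

  module _ {h l r T} (M : PocketModel h T l r) where
    open PocketModel M
    private
      u₁ : Unique N.inner
      u₁ = unique-tail (unique-tail N.uniq′)

    pocket-spread : ¬ ClashTree 0 1 r → SpreadTree T
    pocket-spread ok =
      (λ k → J.no-clash-uʳ (here refl) (clash-≋ (≋-sym gs≋)
         (clash-sym p u₁ (here refl) (AnyModel.clash⁻ p u₁ zero (suc zero) k)))) ,
      (λ k → ok (AnyModel.clash⁺ q′ uniqʳ zero (suc zero) (J.clashʳ (here refl) (clash-≋ (≋-sym gs≋)
         (AnyModel.clash⁻ p u₁ (suc zero) (suc (suc zero)) k))))) ,
      (λ k → J.no-clash-uʳ (there (here refl)) (clash-≋ (≋-sym gs≋)
         (clash-sym p u₁ (here refl) (AnyModel.clash⁻ p u₁ zero (suc (suc zero)) k))))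

    pocket-clash : ClashTree 0 1 (new T)
    pocket-clash = AnyModel.clash⁺ (Realisation.new de ed p) uniq zero (suc zero)
      (N.clash-first⁺ (subst (_∈ triple e) (sym yu) (here refl)))

  digon-tree : Tree → Tree
  digon-tree l = unrotate³ (join (rotate (rotate l)) nil)

  digon-turned : ∀ {h n l} → Region (suc h) n l → Region (suc (suc h)) n (join (rotate (rotate l)) nil)
  digon-turned reg = join-nil-region (rotate-region (rotate-region reg))

  pocket-turned : ∀ {h m n l r} → Region h m l → Region 1 n r → Region (suc (suc h)) (m + n) (join l r)
  pocket-turned {h} {m} {n} {l} {r} p q = subst (λ i → Region (suc i) (m + n) (join l r)) (ℕ.+-comm h 1) (join-region p q)

  abstract
    digon-model′ : ∀ {h n l} → Region (suc h) n l → DigonModel h (digon-tree l) l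
    digon-model′ reg = digon-model (new (proj₁ (unrotate³-region (digon-turned reg))))
      (rotate³-unrotate³ (proj₁ (digon-turned reg))) (proj₁ reg)

    pocket-model′ : ∀ {h m n l r} → Region h m l → Region 1 n r → PocketModel h (unrotate³ (join l r)) l r
    pocket-model′ p q = pocket-model (new (proj₁ (unrotate³-region (pocket-turned p q))))
      (rotate³-unrotate³ (proj₁ (pocket-turned p q))) (proj₁ q)

  new-region : ∀ {h n t} → Region (suc (suc h)) n t → SpreadTree t → Region (suc h) (suc n) (new t)
  new-region (wf , s) spread = new wf , simple-new⁺ (new wf) s spread

  paired-clash : ∀ {h n r} → WF r h n → ClashTree 0 1 (join nil r)
  paired-clash wf with model (join nil wf)
  ... | record { real = R@(Realisation.join du ud Realisation.nil q) ; uniq = uniq } =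
    AnyModel.clash⁺ R uniq zero (suc zero) (inj₁ du)

  headClash⁺ : ∀ {h n t} → HeadClash h n t → Region (suc h) n t × ClashTree 0 1 t
  headClash⁺ (paired r)        = join-region nil-region r , paired-clash (proj₁ r)
  headClash⁺ (digon l ok)      = new-region (unrotate³-region (digon-turned l)) (digon-spread M ok) , digon-clash M
    where M = digon-model′ l
  headClash⁺ (pocket l r ok)   = new-region (unrotate³-region (pocket-turned l r)) (pocket-spread M ok) , pocket-clash M
    where M = pocket-model′ l r

  -- If leg 0 is joined, its partner must be leg 1. Otherwise leg 1 ends at one of the three other
  -- darts of the vertex that leg 0 reaches; turning it to the front of the inner region exposes
  -- this edge as a `join`.
  headClash⁻ : ∀ {h n t} → Region (suc h) n t → ClashTree 0 1 t → HeadClash h n t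
  headClash⁻ {h} {n} {t} reg@(wf , simple) k with model wf
  ... | record { w = .(d ∷ u ∷ ys) ; α = α ; real = R@(Realisation.join {l} {r} {d} {u} {[]} {ys} du ud p q) ; uniq = uniq }
      with Cases.real-[] σ₄ α p | wf
  ... | refl , _ | join nil wr = paired (proj₂ (join-region⁻ nil wr reg))
  headClash⁻ {h} {n} {t} reg@(wf , simple) k
      | record { w = .(d ∷ y ∷ xs ++ u ∷ ys) ; α = α ; real = R@(Realisation.join {l} {r} {d} {u} {y ∷ xs} {ys} du ud p q) ; uniq = uniq }
      = ⊥-elim (Local.JoinLocal.no-clash-joined σ₄ α du ud p q uniq
          (λ { refl → unique-∉ (unique-tail (unique-++ˡ (d ∷ y ∷ xs ++ u ∷ ys) uniq)) (∈.∈-++⁺ʳ xs (here refl)) })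
          (AnyModel.clash⁻ R uniq zero (suc zero) k))
  headClash⁻ {h} {suc n} {new t} reg@(wf , simple) k
      | record { w = d ∷ y ∷ s ; α = α ; real = R@(Realisation.new {e = e} {es = es} de ed p) ; uniq = uniq ; len = len }
      = go (N.clash-first⁻ (here refl) (AnyModel.clash⁻ R uniq zero (suc zero) k))
    where
    open Explored σ₄ α
    open Cases σ₄ α
    module N = Local.NewLocal σ₄ α de ed p uniq
    u₁ = unique-new {d} {e} {y ∷ s} {es} uniq
    module Q = RotatedThrice p u₁
    wt : WF t (suc (suc h)) n
    wt = new-wf⁻ wf
    st : SimpleTree t
    st = proj₁ (simple-new⁻ wf simple)
    spread : SpreadTree t
    spread = proj₂ (simple-new⁻ wf simple)
    turned : Region (suc (suc h)) n (rotate³ t)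
    turned = rotate³-region (wt , st)
    go : α y ∈ Local.triple σ₄ α e → HeadClash h (suc n) (new t)
    go (here yu) with joined s Q.real refl Q.unique yu
    ... | l , r , g₁ , g₂ , eq , p₁ , p₂ , geq =
      subst₂ (λ n t → HeadClash h (suc n) (new t)) (sym n≡) (trans (cong unrotate³ (sym eq)) (unrotate³-rotate³ wt))
        (pocket (proj₁ parts) (proj₂ parts)
          (λ c → proj₁ (proj₂ spread) (AnyModel.clash⁺ p u₁ (suc zero) (suc (suc zero))
             (clash-≋ Q.gs≋es (subst (λ g → Clash g _ _) (sym geq)
               (clashʳ⁻′ (AnyModel.clash⁻ p₂ uniqʳ zero (suc zero) c)))))))
      where
      reg′ : Region (suc (suc h)) n (join l r)
      reg′ = subst (Region (suc (suc h)) n) eq turned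
      wl : WF l h (length g₁)
      wl = real-wf p₁ (ℕ.suc-injective (ℕ.suc-injective len))
      wr : WF r 1 (length g₂)
      wr = real-wf p₂ refl
      parts : Region h (length g₁) l × Region 1 (length g₂) r
      parts = join-region⁻ wl wr reg′
      n≡ : n ≡ length g₁ + length g₂
      n≡ = proj₂ (wf-unique (proj₁ reg′) (join wl wr))
      uniqʳ : Unique (support (σ₄ (σ₄ e) ∷ σ₄ (σ₄ (σ₄ e)) ∷ []) g₂)
      uniqʳ = unique-joinʳ {y} {σ₄ e} {s} {_} {g₁} {g₂} (subst (λ g → Unique (support (y ∷ s ++ σ₄ e ∷ σ₄ (σ₄ e) ∷ σ₄ (σ₄ (σ₄ e)) ∷ []) g)) geq Q.unique)
      clashʳ⁻′ : ∀ {x z} → Clash g₂ x z → Clash (g₁ ++ g₂) x z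
      clashʳ⁻′ (inj₁ q) = inj₁ q
      clashʳ⁻′ (inj₂ (f , m , c)) = inj₂ (f , ∈.∈-++⁺ʳ g₁ m , c)
    -- Joined to the middle dart, `y` would cut off a region whose only leg is the last dart of the
    -- vertex.
    go (there (here yu)) with joined (s ++ σ₄ e ∷ []) Q.real (cong (y ∷_) (sym (List.++-assoc s _ _))) Q.unique yu
    ... | l , r , g₁ , g₂ , eq , p₁ , p₂ , geq = ⊥-elim (real-not-odd σ₄⁴ 0 p₂ refl)
    go (there (there (here yu))) with joined (s ++ σ₄ e ∷ σ₄ (σ₄ e) ∷ []) Q.real (cong (y ∷_) (sym (List.++-assoc s _ _))) Q.unique yu
    ... | l , r , g₁ , g₂ , eq , p₁ , p₂ , geq with real-[] p₂
    ... | refl , refl with Turn.unrotate-real σ₄ α σ₄⁴ {s = s ++ σ₄ e ∷ []}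
                               (subst (λ w → Real l w g₁) (sym (List.++-assoc s _ _)) p₁)
    ... | h₁ , r₁ , e₁ with Turn.unrotate-real σ₄ α σ₄⁴ {s = σ₄ (σ₄ e) ∷ s} r₁
    ... | h₂ , r₂ , e₂ = subst (λ t → HeadClash h (suc n) (new t))
          (trans (cong unrotate³ (trans (cong (λ l → join l nil)
            (trans (cong rotate (rotate-unrotate (unrotate-wf wl))) (rotate-unrotate wl))) (sym eq))) (unrotate³-rotate³ wt))
          (digon (unrotate-region (unrotate-region (wl , proj₁ (simple-join⁻ (proj₁ (subst (Region (suc (suc h)) n) eq turned)) (proj₂ (subst (Region (suc (suc h)) n) eq turned))))))
            (λ c → proj₁ spread (AnyModel.clash⁺ p u₁ zero (suc zero)
               (clash-≋ (≋-trans e₂ (≋-trans e₁ (≋-trans (≋-sym g₁≋) Q.gs≋es)))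
                 (AnyModel.clash⁻ r₂ uniq₀ zero (suc zero) c)))))
      where
      wl : WF l (suc h) n
      wl = wf-join-nilʳ (subst (λ t → WF t (suc (suc h)) n) eq (proj₁ turned))
      g₁≋ : Q.gs ≋ g₁
      g₁≋ = subst (_≋ g₁) (sym (trans geq (List.++-identityʳ g₁))) ≋-refl
      uniq₀ : Unique (support (σ₄ e ∷ σ₄ (σ₄ e) ∷ s) h₂)
      uniq₀ = unique-↭ (↭.++⁺ (↭.++-comm s (σ₄ e ∷ σ₄ (σ₄ e) ∷ [])) (↭-sym (darts↭ (≋-trans e₂ e₁))))
        (unique-joinˡ {y} {σ₄ (σ₄ (σ₄ e))} {s ++ σ₄ e ∷ σ₄ (σ₄ e) ∷ []} {[]} {g₁} {[]}
          (subst₂ (λ w g → Unique (support w g)) (cong (y ∷_) (sym (List.++-assoc s _ _))) geq Q.unique))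

-- Clashes of legs 0 and 2, and of two disjoint pairs among four legs.

module SkipClashes where

  open Trees
  open Models
  open Charts
  open Rotation
  open HeadClashes
  open import Data.Nat using (ℕ; zero; suc; _+_)
  import Data.Nat.Properties as ℕ
  open import Data.List using (List; []; _∷_; _++_; length)
  open import Data.List.Membership.Propositional using (_∈_; _∉_)
  import Data.List.Membership.Propositional.Properties as ∈
  open import Data.List.Relation.Unary.Any using (here; there)
  open import Data.List.Relation.Unary.Unique.Propositional using (Unique)
  open import Data.List.Relation.Binary.Permutation.Propositional using (_↭_; ↭-sym)
  import Data.List.Relation.Binary.Permutation.Propositional.Properties as ↭
  open import Data.Product using (∃; _×_; _,_; proj₁; proj₂)
  open import Data.Sum using (_⊎_; inj₁; inj₂)
  open import Data.Empty using (⊥; ⊥-elim)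
  open import Relation.Binary.PropositionalEquality

  -- By parity legs 0 and 2 cannot be joined to each other, and leg 2 can only reach the dart
  -- opposite to the one reached by leg 0. This edge separates leg 1 together with one dart of the
  -- vertex, the legs of `l`, from the later legs together with the other dart, the legs of `r`.
  data SkipClash (h : ℕ) : ℕ → Tree → Set where
    skip : ∀ {m n l r} → Region 1 m l → Region (suc h) n r → SkipClash h (suc (m + n)) (new (unrotate (join l r)))

  record SkipModel (h : ℕ) (t l r : Tree) : Set where
    field
      {d y z} : ℕ
      {s es} : List ℕ
      {e} : ℕ
      {α} : ℕ → ℕ
      de : α d ≡ e
      ed : α e ≡ d
      p : Realisation.Real σ₄ α t (σ₄ e ∷ σ₄ (σ₄ e) ∷ σ₄ (σ₄ (σ₄ e)) ∷ y ∷ z ∷ s) es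
      uniq : Unique (Explored.support σ₄ α (d ∷ y ∷ z ∷ s) (e ∷ es))
      len : length s ≡ suc (dbl h)
      gs₁ gs₂ : List ℕ
      q : Realisation.Real σ₄ α l (σ₄ (σ₄ (σ₄ e)) ∷ y ∷ []) gs₁
      q′ : Realisation.Real σ₄ α r (s ++ σ₄ e ∷ []) gs₂
      bz : α (σ₄ (σ₄ e)) ≡ z
      zb : α z ≡ σ₄ (σ₄ e)
      gs≋ : Realisation._≋_ σ₄ α (gs₁ ++ gs₂) es

    open Explored σ₄ α public
    open Local σ₄ α public
    module N = NewLocal de ed p uniq
    uniq₁ : Unique (support (σ₄ (σ₄ e) ∷ (σ₄ (σ₄ (σ₄ e)) ∷ y ∷ []) ++ z ∷ s ++ σ₄ e ∷ []) (gs₁ ++ gs₂))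
    uniq₁ = unique-↭ (↭.++⁺ (↭.∷↭∷ʳ (σ₄ e) (σ₄ (σ₄ e) ∷ σ₄ (σ₄ (σ₄ e)) ∷ y ∷ z ∷ s)) (↭-sym (darts↭ gs≋)))
              (unique-new {d} {e} {y ∷ z ∷ s} {es} uniq)
    module J = Cases.JoinMore σ₄ α {d = σ₄ (σ₄ e)} {z} {σ₄ (σ₄ (σ₄ e)) ∷ y ∷ []} {s ++ σ₄ e ∷ []} {gs₁} {gs₂} bz zb q q′ uniq₁
    uniqˡ : Unique (support (σ₄ (σ₄ (σ₄ e)) ∷ y ∷ []) gs₁)
    uniqˡ = unique-joinˡ {σ₄ (σ₄ e)} {z} {σ₄ (σ₄ (σ₄ e)) ∷ y ∷ []} {s ++ σ₄ e ∷ []} {gs₁} {gs₂} uniq₁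
    uniqʳ : Unique (support (s ++ σ₄ e ∷ []) gs₂)
    uniqʳ = unique-joinʳ {σ₄ (σ₄ e)} {z} {σ₄ (σ₄ (σ₄ e)) ∷ y ∷ []} {s ++ σ₄ e ∷ []} {gs₁} {gs₂} uniq₁
    b₀∈ : σ₄ e ∈ support (s ++ σ₄ e ∷ []) gs₂
    b₀∈ = ∈.∈-++⁺ˡ (∈.∈-++⁺ʳ s (here refl))
    across : ∀ {x} → x ∈ support (σ₄ (σ₄ (σ₄ e)) ∷ y ∷ []) gs₁ → x ∈ support (s ++ σ₄ e ∷ []) gs₂ → ⊥
    across = disjoint-join {σ₄ (σ₄ e)} {z} {σ₄ (σ₄ (σ₄ e)) ∷ y ∷ []} {s ++ σ₄ e ∷ []} {gs₁} {gs₂} uniq₁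

  skip-model : ∀ {h n t} → WF (new t) (suc (suc h)) n → ∀ {l r m} → rotate t ≡ join l r → WF l 1 m → SkipModel h t l r
  skip-model {h} {t = t} wf {l} {r} eq wl with model wf
  ... | record { w = d ∷ y ∷ z ∷ s ; α = α ; real = Realisation.new {e = e} {es = es} de ed p ; uniq = uniq ; len = len } = go
    where
    open Explored σ₄ α
    go : SkipModel h t l r
    go with Turn.rotate-real σ₄ α σ₄⁴ p
    ... | gs , P , gs≋ = split (subst (λ t → Real t _ gs) eq P) refl gs≋
      where
      split : ∀ {w gs} → Real (join l r) w gs → w ≡ σ₄ (σ₄ e) ∷ σ₄ (σ₄ (σ₄ e)) ∷ y ∷ z ∷ s ++ σ₄ e ∷ [] →
              gs ≋ es → SkipModel h t l r
      split (join {xs = xs} {ys} {gs₁} {gs₂} bz zb q q′) weq gs≋ with real-even q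
      ... | i , len′ , wi with wf-unique wi wl
      split (join {xs = a ∷ b ∷ []} {ys} {gs₁} {gs₂} bz zb q q′) refl gs≋ | i , len′ , wi | refl , _ = record
        { de = de ; ed = ed ; p = p ; uniq = uniq ; len = ℕ.suc-injective (ℕ.suc-injective (ℕ.suc-injective len))
        ; gs₁ = gs₁ ; gs₂ = gs₂ ; q = q ; q′ = q′ ; bz = bz ; zb = zb ; gs≋ = gs≋ }

  skip-turned : ∀ {h m n l r} → Region 1 m l → Region (suc h) n r → Region (suc (suc (suc h))) (m + n) (join l r)
  skip-turned p q = join-region p q

  abstract
    skip-model′ : ∀ {h m n l r} → Region 1 m l → Region (suc h) n r → SkipModel h (unrotate (join l r)) l r
    skip-model′ p q = skip-model (new (proj₁ (unrotate-region (skip-turned p q))))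
      (rotate-unrotate (proj₁ (skip-turned p q))) (proj₁ p)

  module _ {h l r T} (M : SkipModel h T l r) where
    open SkipModel M
    private
      u₁ : Unique N.inner
      u₁ = unique-tail (unique-tail N.uniq′)

      R : Real (new T) (d ∷ y ∷ z ∷ s) (e ∷ es)
      R = Realisation.new de ed p

      b₀≢z : σ₄ e ≢ z
      b₀≢z eq = J.u∉ʳ (subst (_∈ support (s ++ σ₄ e ∷ []) gs₂) eq b₀∈)

    -- No condition on `l` and `r` arises: the middle dart is joined to the leg `z`, and this edge
    -- keeps the other two darts on different sides.
    skip-spread : SpreadTree T
    skip-spread =
      (λ k → J.no-clash-joined b₀≢z (clash-≋ (≋-sym gs≋)
         (clash-sym p u₁ (here refl) (AnyModel.clash⁻ p u₁ zero (suc zero) k)))) ,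
      (λ k → J.no-clash-joined (λ eq → J.u∉ˡ (here (sym eq))) (clash-≋ (≋-sym gs≋)
         (AnyModel.clash⁻ p u₁ (suc zero) (suc (suc zero)) k))) ,
      (λ k → J.no-clash-across (here refl) b₀∈ (clash-≋ (≋-sym gs≋)
         (clash-sym p u₁ (here refl) (AnyModel.clash⁻ p u₁ zero (suc (suc zero)) k))))

    skip-clash : ClashTree 0 2 (new T)
    skip-clash = AnyModel.clash⁺ R uniq zero (suc (suc zero))
      (N.clash-first⁺ (subst (_∈ triple e) (sym zb) (there (here refl))))

    private
      y-end : α y ∈ triple e → l ≡ join nil nil
      y-end (here eq) = ⊥-elim (across (proj₂ (real-α q (there (here refl)))) (subst (_∈ support (s ++ σ₄ e ∷ []) gs₂) (sym eq) b₀∈))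
      y-end (there (here eq)) = ⊥-elim (J.d∉ˡ (subst (_∈ support (σ₄ (σ₄ (σ₄ e)) ∷ y ∷ []) gs₁) eq (proj₂ (real-α q (there (here refl))))))
      y-end (there (there (here eq))) = Cases.join-nil-nil σ₄ α q uniqˡ
        (trans (cong α (sym eq)) (proj₁ (real-α q (there (here refl)))))

      y-end⁻ : l ≡ join nil nil → α y ∈ triple e
      y-end⁻ refl = there (there (here (proj₂ (Cases.real-join-nil-nil σ₄ α q refl))))

    private
      module Four {x} (s≡ : s ≡ x ∷ []) where
        at₃ : (d ∷ y ∷ z ∷ s) [ 3 ]= x
        at₃ = subst (λ s → (d ∷ y ∷ z ∷ s) [ 3 ]= x) (sym s≡) (suc (suc (suc zero)))

        q″ : Real r (x ∷ σ₄ e ∷ []) gs₂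
        q″ = subst (λ s → Real r (s ++ σ₄ e ∷ []) gs₂) s≡ q′

        uniq″ : Unique (support (x ∷ σ₄ e ∷ []) gs₂)
        uniq″ = subst (λ s → Unique (support (s ++ σ₄ e ∷ []) gs₂)) s≡ uniqʳ

        x∈ : x ∈ support (s ++ σ₄ e ∷ []) gs₂
        x∈ = subst (λ s → x ∈ support (s ++ σ₄ e ∷ []) gs₂) (sym s≡) (here refl)

        x∈inner : x ∈ N.inner
        x∈inner = N.leg⊆ (subst (λ s → x ∈ y ∷ z ∷ s) (sym s≡) (there (there (here refl))))

        x-end : α x ∈ triple e → r ≡ join nil nil
        x-end (here eq) = Cases.join-nil-nil σ₄ α q″ uniq″ eq
        x-end (there (here eq)) = ⊥-elim (J.d∉ʳ (subst (_∈ support (s ++ σ₄ e ∷ []) gs₂) eq (proj₂ (real-α q′ x∈))))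
        x-end (there (there (here eq))) =
          ⊥-elim (across (here refl) (subst (_∈ support (s ++ σ₄ e ∷ []) gs₂) eq (proj₂ (real-α q′ x∈))))

        clash₁₃⁺ : l ≡ join nil nil → r ≡ join nil nil → ClashTree 1 3 (new T)
        clash₁₃⁺ eq refl = AnyModel.clash⁺ R uniq (suc zero) at₃
          (N.clash-triple (y-end⁻ eq) (here (proj₁ (Cases.real-join-nil-nil σ₄ α q″ refl))))

        clash₁₃⁻ : ClashTree 1 3 (new T) → l ≡ join nil nil × r ≡ join nil nil
        clash₁₃⁻ k with N.clash⁻ (N.leg⊆ (here refl)) x∈inner (AnyModel.clash⁻ R uniq (suc zero) at₃ k)
        ... | inj₁ k′ = ⊥-elim (J.no-clash-across (there (here refl)) x∈ (clash-≋ (≋-sym gs≋) k′))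
        ... | inj₂ (m , n) = y-end m , x-end n

      singleton : ∀ {A : Set} {s : List A} → length s ≡ 1 → ∃ λ x → s ≡ x ∷ []
      singleton {s = x ∷ []} _ = x , refl

    skip-clash₁₃⁺ : h ≡ 0 → l ≡ join nil nil → r ≡ join nil nil → ClashTree 1 3 (new T)
    skip-clash₁₃⁺ refl = Four.clash₁₃⁺ (proj₂ (singleton len))

    -- Legs 1 and 3 lie on different sides of the separating edge, so they can only clash at its
    -- vertex. Each then reaches the dart on its own side, and all four legs end at that vertex.
    skip-clash₁₃⁻ : h ≡ 0 → ClashTree 1 3 (new T) → l ≡ join nil nil × r ≡ join nil nil
    skip-clash₁₃⁻ refl = Four.clash₁₃⁻ (proj₂ (singleton len))

    skip-clash₀₁⁺ : l ≡ join nil nil → ClashTree 0 1 (new T)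
    skip-clash₀₁⁺ eq = AnyModel.clash⁺ R uniq zero (suc zero) (N.clash-first⁺ (y-end⁻ eq))

    -- The only dart of the vertex that leg 1 can reach is the one sharing its side, with which it
    -- forms the two legs of `l`.
    skip-clash₀₁⁻ : ClashTree 0 1 (new T) → l ≡ join nil nil
    skip-clash₀₁⁻ k = y-end (N.clash-first⁻ (here refl) (AnyModel.clash⁻ R uniq zero (suc zero) k))

  skipClash⁺ : ∀ {h n t} → SkipClash h n t → Region (suc (suc h)) n t × ClashTree 0 2 t
  skipClash⁺ (skip p q) = new-region (unrotate-region (skip-turned p q)) (skip-spread M) , skip-clash M
    where M = skip-model′ p q

  skipClash⁻ : ∀ {h n t} → Region (suc (suc h)) n t → ClashTree 0 2 t → SkipClash h n t
  skipClash⁻ {h} {n} {t} reg@(wf , simple) k with model wf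
  ... | record { α = α ; real = R@(Realisation.join {d = d} {u} {[]} {y ∷ ys} du ud p q) ; uniq = uniq }
      = ⊥-elim (Local.JoinLocal.no-clash-joined σ₄ α du ud p q uniq
          (λ { refl → unique-∉ (unique-tail (unique-++ˡ (d ∷ u ∷ y ∷ ys) uniq)) (here refl) })
          (AnyModel.clash⁻ R uniq zero (suc (suc zero)) k))
  ... | record { α = α ; real = R@(Realisation.join {xs = x ∷ []} du ud p q) ; uniq = uniq }
      = ⊥-elim (Realisation.real-not-odd σ₄ α σ₄⁴ 0 p refl)
  ... | record { α = α ; real = R@(Realisation.join {d = d} {u} {x ∷ x′ ∷ xs} {ys} du ud p q) ; uniq = uniq }
      = ⊥-elim (Local.JoinLocal.no-clash-joined σ₄ α du ud p q uniq
          (λ { refl → unique-∉ (unique-tail (unique-tail (unique-++ˡ (d ∷ x ∷ x′ ∷ xs ++ u ∷ ys) uniq))) (∈.∈-++⁺ʳ xs (here refl)) })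
          (AnyModel.clash⁻ R uniq zero (suc (suc zero)) k))
  skipClash⁻ {h} {suc n} {new t} reg@(wf , simple) k
      | record { w = d ∷ y ∷ z ∷ s ; α = α ; real = R@(Realisation.new {e = e} {es = es} de ed p) ; uniq = uniq ; len = len }
      = go (N.clash-first⁻ (there (here refl)) (AnyModel.clash⁻ R uniq zero (suc (suc zero)) k))
    where
    open Explored σ₄ α
    open Cases σ₄ α
    module N = Local.NewLocal σ₄ α de ed p uniq
    u₁ = unique-new {d} {e} {y ∷ z ∷ s} {es} uniq
    wt : WF t (suc (suc (suc h))) n
    wt = new-wf⁻ wf
    st : SimpleTree t
    st = proj₁ (simple-new⁻ wf simple)
    turned : Region (suc (suc (suc h))) n (rotate t)
    turned = rotate-region (wt , st)
    zα : α (α z) ≡ z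
    zα = proj₁ (real-α p (N.leg⊆ (there (here refl))))
    go : α z ∈ Local.triple σ₄ α e → SkipClash h (suc n) (new t)
    go (here eq) with joined (σ₄ (σ₄ e) ∷ σ₄ (σ₄ (σ₄ e)) ∷ y ∷ []) p refl u₁ (trans (cong α (sym eq)) zα)
    ... | _ , _ , _ , _ , _ , p₁ , _ = ⊥-elim (real-not-odd σ₄⁴ 1 p₁ refl)
    go (there (here eq)) with Turn.rotate-real σ₄ α σ₄⁴ p
    ... | gs , P , gs≋ with joined (σ₄ (σ₄ (σ₄ e)) ∷ y ∷ []) P refl (unique-↭ (Turn.turn-↭ σ₄ α σ₄⁴ _ _ es gs≋) u₁)
                              (trans (cong α (sym eq)) zα)
    ... | l , r , g₁ , g₂ , teq , p₁ , p₂ , geq =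
      subst₂ (λ n t → SkipClash h (suc n) (new t)) (sym n≡) (trans (cong unrotate (sym teq)) (unrotate-rotate wt))
        (skip (proj₁ parts) (proj₂ parts))
      where
      reg′ : Region (suc (suc (suc h))) n (join l r)
      reg′ = subst (Region (suc (suc (suc h))) n) teq turned
      wl : WF l 1 (length g₁)
      wl = real-wf p₁ refl
      wr : WF r (suc h) (length g₂)
      wr = real-wf p₂ (trans (sym (length-snoc (σ₄ e) s)) (ℕ.suc-injective (ℕ.suc-injective len)))
      parts : Region 1 (length g₁) l × Region (suc h) (length g₂) r
      parts = join-region⁻ wl wr reg′
      n≡ : n ≡ length g₁ + length g₂
      n≡ = proj₂ (wf-unique (proj₁ reg′) (join wl wr))
    go (there (there (here eq))) with Turn.rotate-iterate-real σ₄ α σ₄⁴ (σ₄ e ∷ σ₄ (σ₄ e) ∷ []) {ys = σ₄ (σ₄ (σ₄ e)) ∷ y ∷ z ∷ s} p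
    ... | gs , P , gs≋ with joined (y ∷ []) P refl
                              (unique-↭ (↭.++⁺ (↭.++-comm (σ₄ e ∷ σ₄ (σ₄ e) ∷ []) (σ₄ (σ₄ (σ₄ e)) ∷ y ∷ z ∷ s)) (↭-sym (darts↭ gs≋))) u₁)
                              (trans (cong α (sym eq)) zα)
    ... | _ , _ , _ , _ , _ , p₁ , _ = ⊥-elim (real-not-odd σ₄⁴ 0 p₁ refl)

  paired-clash₂₃⁺ : ∀ {h n r} → WF r (suc h) n → ClashTree 0 1 r → ClashTree 2 3 (join nil r)
  paired-clash₂₃⁺ wf k with model (join nil wf)
  ... | record { α = α ; real = R@(Realisation.join {d = d} {u} {[]} {a ∷ b ∷ ys} {[]} {fs} du ud Realisation.nil q) ; uniq = uniq } =
    AnyModel.clash⁺ R uniq (suc (suc zero)) (suc (suc (suc zero)))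
      (Local.JoinLocal.clashʳ⁻ σ₄ α du ud Realisation.nil q uniq
        (AnyModel.clash⁻ q (Explored.unique-joinʳ σ₄ α {d} {u} {[]} {a ∷ b ∷ ys} {[]} {fs} uniq) zero (suc zero) k))

  paired-clash₂₃⁻ : ∀ {h n r} → WF r (suc h) n → ClashTree 2 3 (join nil r) → ClashTree 0 1 r
  paired-clash₂₃⁻ wf k with model (join nil wf)
  ... | record { α = α ; real = R@(Realisation.join {d = d} {u} {[]} {a ∷ b ∷ ys} {[]} {fs} du ud Realisation.nil q) ; uniq = uniq } =
    AnyModel.clash⁺ q (Explored.unique-joinʳ σ₄ α {d} {u} {[]} {a ∷ b ∷ ys} {[]} {fs} uniq) zero (suc zero)
      (Local.JoinLocal.clashʳ σ₄ α du ud Realisation.nil q uniq (here refl)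
        (AnyModel.clash⁻ R uniq (suc (suc zero)) (suc (suc (suc zero))) k))

  pair : ∀ {A : Set} {s : List A} → length s ≡ 2 → ∃ λ x → ∃ λ y → s ≡ x ∷ y ∷ []
  pair {s = x ∷ y ∷ []} _ = x , y , refl

  module _ {l r T} (M : PocketModel 1 T l r) where
    open PocketModel M
    private
      R : Real (new T) (d ∷ y ∷ s) (e ∷ es)
      R = Realisation.new de ed p

      module Two {c c′} (s≡ : s ≡ c ∷ c′ ∷ []) where
        at₂ : (d ∷ y ∷ s) [ 2 ]= c
        at₂ = subst (λ s → (d ∷ y ∷ s) [ 2 ]= c) (sym s≡) (suc (suc zero))
        at₃ : (d ∷ y ∷ s) [ 3 ]= c′
        at₃ = subst (λ s → (d ∷ y ∷ s) [ 3 ]= c′) (sym s≡) (suc (suc (suc zero)))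
        at₀ : s [ 0 ]= c
        at₀ = subst (_[ 0 ]= c) (sym s≡) zero
        at₁ : s [ 1 ]= c′
        at₁ = subst (_[ 1 ]= c′) (sym s≡) (suc zero)

        c∈ : c ∈ support s gs₁
        c∈ = ∈.∈-++⁺ˡ (at-∈ at₀)

        outside : α c ∉ triple e
        outside (here eq) = J.u∉ˡ (subst (_∈ support s gs₁) eq (proj₂ (real-α q c∈)))
        outside (there m) = disjoint-join {y} {σ₄ e} {s} {σ₄ (σ₄ e) ∷ σ₄ (σ₄ (σ₄ e)) ∷ []} {gs₁} {gs₂} uniq₁
          (proj₂ (real-α q c∈)) (∈.∈-++⁺ˡ m)

        clash₂₃⁺ : ClashTree 0 1 l → ClashTree 2 3 (new T)
        clash₂₃⁺ k = AnyModel.clash⁺ R uniq at₂ at₃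
          (N.clash⁺ (clash-≋ gs≋ (J.clashˡ⁻ (AnyModel.clash⁻ q uniqˡ at₀ at₁ k))))

        clash₂₃⁻ : ClashTree 2 3 (new T) → ClashTree 0 1 l
        clash₂₃⁻ k with N.clash⁻ (N.leg⊆ (there (at-∈ at₀))) (N.leg⊆ (there (at-∈ at₁))) (AnyModel.clash⁻ R uniq at₂ at₃ k)
        ... | inj₁ k′ = AnyModel.clash⁺ q uniqˡ at₀ at₁ (J.clashˡ c∈ (clash-≋ (≋-sym gs≋) k′))
        ... | inj₂ (m , _) = ⊥-elim (outside m)

    pocket-clash₂₃⁺ : ClashTree 0 1 l → ClashTree 2 3 (new T)
    pocket-clash₂₃⁺ = Two.clash₂₃⁺ (proj₂ (proj₂ (pair len)))

    pocket-clash₂₃⁻ : ClashTree 2 3 (new T) → ClashTree 0 1 l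
    pocket-clash₂₃⁻ = Two.clash₂₃⁻ (proj₂ (proj₂ (pair len)))

  -- In a digon over this region, legs 2 and 3 both end at the vertex of the digon. That clash is
  -- not present in the region itself and is the one exception in tracking legs 2 and 3 through the
  -- decomposition.
  nested : Tree
  nested = join (join nil nil) nil

  module _ {l T} (M : DigonModel 1 T l) where
    open DigonModel M
    private
      R : Real (new T) (d ∷ y ∷ s) (e ∷ es)
      R = Realisation.new de ed p

      module Two {c c′} (s≡ : s ≡ c ∷ c′ ∷ []) where
        at₂ : (d ∷ y ∷ s) [ 2 ]= c
        at₂ = subst (λ s → (d ∷ y ∷ s) [ 2 ]= c) (sym s≡) (suc (suc zero))
        at₃ : (d ∷ y ∷ s) [ 3 ]= c′
        at₃ = subst (λ s → (d ∷ y ∷ s) [ 3 ]= c′) (sym s≡) (suc (suc (suc zero)))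
        at₂₀ : (σ₄ e ∷ σ₄ (σ₄ e) ∷ s) [ 2 ]= c
        at₂₀ = subst (λ s → (σ₄ e ∷ σ₄ (σ₄ e) ∷ s) [ 2 ]= c) (sym s≡) (suc (suc zero))
        at₃₀ : (σ₄ e ∷ σ₄ (σ₄ e) ∷ s) [ 3 ]= c′
        at₃₀ = subst (λ s → (σ₄ e ∷ σ₄ (σ₄ e) ∷ s) [ 3 ]= c′) (sym s≡) (suc (suc (suc zero)))
        q₁ : Real l (σ₄ e ∷ σ₄ (σ₄ e) ∷ c ∷ c′ ∷ []) gs₀
        q₁ = subst (λ s → Real l (σ₄ e ∷ σ₄ (σ₄ e) ∷ s) gs₀) s≡ q₀
        u₁ : Unique (support (σ₄ e ∷ σ₄ (σ₄ e) ∷ c ∷ c′ ∷ []) gs₀)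
        u₁ = subst (λ s → Unique (support (σ₄ e ∷ σ₄ (σ₄ e) ∷ s) gs₀)) s≡ uniq₀
        c∈s : c ∈ s
        c∈s = subst (c ∈_) (sym s≡) (here refl)
        c′∈s : c′ ∈ s
        c′∈s = subst (c′ ∈_) (sym s≡) (there (here refl))

        αc : α (α c) ≡ c
        αc = proj₁ (real-α q₁ (there (there (here refl))))
        αc′ : α (α c′) ≡ c′
        αc′ = proj₁ (real-α q₁ (there (there (there (here refl)))))

        not-b₂ : ∀ {x} → x ∈ s → α x ≢ σ₄ (σ₄ (σ₄ e))
        not-b₂ {x} m eq = J.u∉ˡ (subst (_∈ support (s ++ σ₄ e ∷ σ₄ (σ₄ e) ∷ []) gs₁) eq
          (proj₂ (real-α q (∈.∈-++⁺ˡ (∈.∈-++⁺ˡ m)))))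

        c≢c′ : c ≢ c′
        c≢c′ eq = unique-∉ (unique-tail (unique-tail u₁)) (here eq)

        ends : α c ∈ triple e → α c′ ∈ triple e → l ≡ nested
        ends (here p) (here p′) = ⊥-elim (c≢c′ (trans (sym αc) (trans (cong α (trans p (sym p′))) αc′)))
        ends (here p) (there (here p′)) with Cases.joined σ₄ α (σ₄ (σ₄ e) ∷ []) q₁ refl u₁ (trans (cong α (sym p)) αc)
        ... | _ , _ , _ , _ , _ , p₁ , _ = ⊥-elim (real-not-odd σ₄⁴ 0 p₁ refl)
        ends (there (here p)) (here p′)
          with Cases.joined σ₄ α (σ₄ (σ₄ e) ∷ c ∷ []) q₁ refl u₁ (trans (cong α (sym p′)) αc′)
        ... | l₁ , r₁ , g₁ , g₂ , refl , p₁ , p₂ , geq with Cases.real-[] σ₄ α p₂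
        ... | refl , refl = cong (λ l → join l nil) (Cases.join-nil-nil σ₄ α p₁
          (unique-joinˡ {σ₄ e} {c′} {σ₄ (σ₄ e) ∷ c ∷ []} {[]} {g₁} {[]}
            (subst (λ g → Unique (support (σ₄ e ∷ σ₄ (σ₄ e) ∷ c ∷ c′ ∷ []) g)) geq u₁)) (trans (cong α (sym p)) αc))
        ends (there (here p)) (there (here p′)) = ⊥-elim (c≢c′ (trans (sym αc) (trans (cong α (trans p (sym p′))) αc′)))
        ends (there (there (here p))) _ = ⊥-elim (not-b₂ c∈s p)
        ends _ (there (there (here p))) = ⊥-elim (not-b₂ c′∈s p)

        nested-ends : ∀ {w g} → Real nested w g → w ≡ σ₄ e ∷ σ₄ (σ₄ e) ∷ c ∷ c′ ∷ [] → α c ≡ σ₄ (σ₄ e) × α c′ ≡ σ₄ e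
        nested-ends (Realisation.join du ud (Realisation.join du′ ud′ Realisation.nil Realisation.nil) Realisation.nil) refl = ud′ , ud

        clash₂₃⁺ : ClashTree 2 3 l → ClashTree 2 3 (new T)
        clash₂₃⁺ k = AnyModel.clash⁺ R uniq at₂ at₃ (N.clash⁺ (clash₀⁻ (AnyModel.clash⁻ q₀ uniq₀ at₂₀ at₃₀ k)))

        clash₂₃-nested : l ≡ nested → ClashTree 2 3 (new T)
        clash₂₃-nested refl with nested-ends q₁ refl
        ... | p , p′ = AnyModel.clash⁺ R uniq at₂ at₃ (N.clash-triple (there (here p)) (here p′))

        clash₂₃⁻ : ClashTree 2 3 (new T) → ClashTree 2 3 l ⊎ l ≡ nested
        clash₂₃⁻ k with N.clash⁻ (N.leg⊆ (there c∈s)) (N.leg⊆ (there c′∈s)) (AnyModel.clash⁻ R uniq at₂ at₃ k)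
        ... | inj₁ k′ = inj₁ (AnyModel.clash⁺ q₀ uniq₀ at₂₀ at₃₀ (clash₀ (∈.∈-++⁺ˡ (∈.∈-++⁺ˡ c∈s)) k′))
        ... | inj₂ (m , n) = inj₂ (ends m n)

    digon-clash₂₃⁺ : ClashTree 2 3 l → ClashTree 2 3 (new T)
    digon-clash₂₃⁺ = Two.clash₂₃⁺ (proj₂ (proj₂ (pair len)))

    digon-clash₂₃-nested : l ≡ nested → ClashTree 2 3 (new T)
    digon-clash₂₃-nested = Two.clash₂₃-nested (proj₂ (proj₂ (pair len)))

    digon-clash₂₃⁻ : ClashTree 2 3 (new T) → ClashTree 2 3 l ⊎ l ≡ nested
    digon-clash₂₃⁻ = Two.clash₂₃⁻ (proj₂ (proj₂ (pair len)))

-- Finite counts, bijections, convolutions and sums of indicators.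

module Counting where

  open Models using (unique-∉; unique-tail)
  open import Data.Nat using (ℕ; zero; suc; _+_; _*_; _≤_; z≤n; s≤s)
  import Data.Nat.Properties as ℕ
  open import Data.Bool using (if_then_else_)
  open import Data.List using (List; []; _∷_; _++_; length; map; filter; deduplicate; cartesianProduct)
  import Data.List.Properties as List
  open import Data.List.Membership.Propositional using (_∈_)
  import Data.List.Membership.Propositional.Properties as ∈
  open import Data.List.Relation.Unary.Any using (here; there)
  open import Data.List.Relation.Unary.All as All using (All; []; _∷_)
  open import Data.List.Relation.Unary.AllPairs using ([]; _∷_)
  open import Data.List.Relation.Unary.Unique.Propositional using (Unique)
  import Data.List.Relation.Unary.Unique.Propositional.Properties as Unique
  import Data.List.Relation.Unary.Unique.DecPropositional.Properties as DecUnique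
  open import Data.List.Relation.Binary.Permutation.Propositional using (_↭_)
  import Data.List.Relation.Binary.Permutation.Propositional.Properties as ↭
  open import Data.Product using (∃; _×_; _,_; proj₂)
  open import Data.Sum using (_⊎_; inj₁; inj₂; [_,_])
  open import Data.Empty using (⊥; ⊥-elim)
  open import Relation.Nullary using (¬_; Dec; yes; no; does)
  open import Relation.Binary using (DecidableEquality)
  open import Relation.Binary.PropositionalEquality hiding ([_])

  record Count {A : Set} (P : A → Set) (k : ℕ) : Set where
    constructor count
    field
      list     : List A
      unique   : Unique list
      sound    : ∀ {x} → x ∈ list → P x
      complete : ∀ {x} → P x → x ∈ list
      size     : length list ≡ k
  open Count

  ∈-split : {A : Set} {x : A} {ys : List A} → x ∈ ys → ∃ λ zs → ys ↭ x ∷ zs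
  ∈-split {x = x} m with ∈.∈-∃++ m
  ... | as , bs , refl = as ++ bs , ↭.shift x as bs

  unique-⊆-length : {A : Set} {xs ys : List A} → Unique xs → (∀ {x} → x ∈ xs → x ∈ ys) → length xs ≤ length ys
  unique-⊆-length {xs = []}     u sub = z≤n
  unique-⊆-length {xs = x ∷ xs} u sub with ∈-split (sub (here refl))
  ... | zs , p = subst (_ ≤_) (sym (↭.↭-length p)) (s≤s (unique-⊆-length (unique-tail u) λ m →
      drop m (↭.∈-resp-↭ p (sub (there m)))))
    where
    drop : ∀ {y} → y ∈ xs → y ∈ x ∷ zs → y ∈ zs
    drop m (here refl) = ⊥-elim (unique-∉ u m)
    drop m (there n)   = n

  module _ {A : Set} {P Q : A → Set} where

    count-≡ : ∀ {k l} → Count P k → Count Q l → (∀ {x} → P x → Q x) → (∀ {x} → Q x → P x) → k ≡ l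
    count-≡ p q f g = trans (sym (size p)) (trans (ℕ.≤-antisym
      (unique-⊆-length (unique p) (λ m → complete q (f (sound p m))))
      (unique-⊆-length (unique q) (λ m → complete p (g (sound q m))))) (size q))

    count-⇔ : ∀ {k} → Count P k → (∀ {x} → P x → Q x) → (∀ {x} → Q x → P x) → Count Q k
    count-⇔ p f g = count (list p) (unique p) (λ m → f (sound p m)) (λ m → complete p (g m)) (size p)

    count-⊎ : ∀ {k l} → Count P k → Count Q l → (∀ {x} → P x → Q x → ⊥) → Count (λ x → P x ⊎ Q x) (k + l)
    count-⊎ p q d = count (list p ++ list q)
      (Unique.++⁺ (unique p) (unique q) (λ (m , n) → d (sound p m) (sound q n)))
      (λ m → [ (λ m → inj₁ (sound p m)) , (λ m → inj₂ (sound q m)) ] (∈.∈-++⁻ (list p) m))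
      [ (λ m → ∈.∈-++⁺ˡ (complete p m)) , (λ m → ∈.∈-++⁺ʳ (list p) (complete q m)) ]
      (trans (List.length-++ (list p)) (cong₂ _+_ (size p) (size q)))

  count-∅ : {A : Set} {P : A → Set} → (∀ {x} → ¬ P x) → Count P 0
  count-∅ h = count [] [] (λ ()) (λ p → ⊥-elim (h p)) refl

  count-single : {A : Set} (a : A) → Count (_≡ a) 1
  count-single a = count (a ∷ []) ([] ∷ []) (λ { (here p) → p }) (λ { refl → here refl }) refl

  module _ {A B : Set} {P : A → Set} (f : A → B) where

    unique-map : ∀ {xs} → Unique xs → (∀ {x y} → x ∈ xs → y ∈ xs → f x ≡ f y → x ≡ y) → Unique (map f xs)
    unique-map {[]}     u inj = []
    unique-map {x ∷ xs} u@(_ ∷ u′) inj = All.tabulate fresh ∷ unique-map u′ (λ m n → inj (there m) (there n))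
      where
      fresh : ∀ {y} → y ∈ map f xs → f x ≢ y
      fresh m eq with ∈.∈-map⁻ f m
      ... | z , n , refl = unique-∉ u (subst (_∈ xs) (sym (inj (here refl) (there n) eq)) n)

    count-map : ∀ {k} → Count P k → (∀ {x y} → P x → P y → f x ≡ f y → x ≡ y) → Count (λ y → ∃ λ x → P x × y ≡ f x) k
    count-map p inj = count (map f (list p))
      (unique-map (unique p) (λ m n → inj (sound p m) (sound p n)))
      (λ m → let (x , n , eq) = ∈.∈-map⁻ f m in x , sound p n , eq)
      (λ { (x , px , refl) → ∈.∈-map⁺ f (complete p px) })
      (trans (List.length-map f (list p)) (size p))

  count-bij : {A B : Set} {P : A → Set} {Q : B → Set} {k : ℕ} (f : A → B) (g : B → A) →
    (∀ {x} → P x → Q (f x)) → (∀ {y} → Q y → P (g y)) →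
    (∀ {x} → P x → g (f x) ≡ x) → (∀ {y} → Q y → f (g y) ≡ y) → Count P k → Count Q k
  count-bij f g pf qg gf fg p = count-⇔
    (count-map f p (λ px py eq → trans (sym (gf px)) (trans (cong g eq) (gf py))))
    (λ { (x , px , refl) → pf px }) (λ {y} q → g y , qg q , sym (fg q))

  count-× : {A B : Set} {P : A → Set} {Q : B → Set} {k l : ℕ} → Count P k → Count Q l →
            Count (λ (x , y) → P x × Q y) (k * l)
  count-× p q = count (cartesianProduct (list p) (list q))
    (Unique.cartesianProduct⁺ (unique p) (unique q))
    (λ m → let (a , b) = ∈.∈-cartesianProduct⁻ (list p) (list q) m in sound p a , sound q b)
    (λ (a , b) → ∈.∈-cartesianProduct⁺ (complete p a) (complete q b))
    (trans (length-cartesianProduct (list p) (list q)) (cong₂ _*_ (size p) (size q)))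
    where
    length-cartesianProduct : ∀ {A B : Set} (xs : List A) (ys : List B) →
                              length (cartesianProduct xs ys) ≡ length xs * length ys
    length-cartesianProduct []       ys = refl
    length-cartesianProduct (x ∷ xs) ys = trans (List.length-++ (map (x ,_) ys))
      (cong₂ _+_ (List.length-map (x ,_) ys) (length-cartesianProduct xs ys))

  -- The recursion takes off the first index exactly as the product of series does, so that counts
  -- by pairs translate into products by a direct induction.
  Σ⁺ : ℕ → (ℕ → ℕ → ℕ) → ℕ
  Σ⁺ zero    f = f 0 0
  Σ⁺ (suc n) f = f 0 (suc n) + Σ⁺ n (λ i j → f (suc i) j)

  count-Σ⁺ : {A : Set} (n : ℕ) {R : ℕ → ℕ → A → Set} {f : ℕ → ℕ → ℕ} → (∀ i j → Count (R i j) (f i j)) →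
    (∀ {i j i′ j′ x} → R i j x → R i′ j′ x → i ≡ i′) →
    Count (λ x → ∃ λ i → ∃ λ j → i + j ≡ n × R i j x) (Σ⁺ n f)
  count-Σ⁺ zero    {R} c d = count-⇔ (c 0 0) (λ r → 0 , 0 , refl , r) back
    where
    back : ∀ {x} → (∃ λ i → ∃ λ j → i + j ≡ 0 × R i j x) → R 0 0 x
    back (zero , zero , _ , r) = r
  count-Σ⁺ (suc n) {R} c d = count-⇔
    (count-⊎ (c 0 (suc n)) (count-Σ⁺ n (λ i j → c (suc i) j) (λ r r′ → ℕ.suc-injective (d r r′)))
      (λ { r (i , j , _ , r′) → ℕ.0≢1+n (d r r′) }))
    to from
    where
    to : ∀ {x} → R 0 (suc n) x ⊎ (∃ λ i → ∃ λ j → i + j ≡ n × R (suc i) j x) → ∃ λ i → ∃ λ j → i + j ≡ suc n × R i j x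
    to (inj₁ r)                = 0 , suc n , refl , r
    to (inj₂ (i , j , eq , r)) = suc i , j , cong suc eq , r
    from : ∀ {x} → (∃ λ i → ∃ λ j → i + j ≡ suc n × R i j x) → R 0 (suc n) x ⊎ (∃ λ i → ∃ λ j → i + j ≡ n × R (suc i) j x)
    from (zero , _ , refl , r) = inj₁ r
    from (suc i , j , eq , r)  = inj₂ (i , j , ℕ.suc-injective eq , r)

  indicator : {P : Set} → Dec P → ℕ
  indicator d = if does d then 1 else 0

  -- Linear relations between counts are obtained by summing pointwise relations between indicators
  -- over one list; with all terms of one sign moved to one side, no subtraction occurs.
  tally : {A : Set} → (A → ℕ) → List A → ℕ
  tally f []       = 0
  tally f (x ∷ xs) = f x + tally f xs

  tally-+ : {A : Set} (f g : A → ℕ) (xs : List A) → tally (λ x → f x + g x) xs ≡ tally f xs + tally g xs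
  tally-+ f g []       = refl
  tally-+ f g (x ∷ xs) = trans (cong (f x + g x +_) (tally-+ f g xs)) (interchange (f x) (g x) _ _)
    where
    interchange : ∀ a b c d → a + b + (c + d) ≡ a + c + (b + d)
    interchange a b c d = trans (ℕ.+-assoc a b _) (trans (cong (a +_) (trans (sym (ℕ.+-assoc b c d))
      (trans (cong (_+ d) (ℕ.+-comm b c)) (ℕ.+-assoc c b d)))) (sym (ℕ.+-assoc a c _)))

  tally-cong : {A : Set} {f g : A → ℕ} (xs : List A) → (∀ {x} → x ∈ xs → f x ≡ g x) → tally f xs ≡ tally g xs
  tally-cong []       h = refl
  tally-cong (x ∷ xs) h = cong₂ _+_ (h (here refl)) (tally-cong xs (λ m → h (there m)))

  tally-1 : {A : Set} (xs : List A) → tally (λ _ → 1) xs ≡ length xs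
  tally-1 []       = refl
  tally-1 (x ∷ xs) = cong suc (tally-1 xs)

  tally-filter : {A : Set} {Q : A → Set} (Q? : ∀ x → Dec (Q x)) (xs : List A) →
                 length (filter Q? xs) ≡ tally (λ x → indicator (Q? x)) xs
  tally-filter Q? [] = refl
  tally-filter Q? (x ∷ xs) with Q? x
  ... | yes _ = cong suc (tally-filter Q? xs)
  ... | no _  = tally-filter Q? xs

  count-filter : {A : Set} {P Q : A → Set} (Q? : ∀ x → Dec (Q x)) {k : ℕ} (p : Count P k) →
                 Count (λ x → P x × Q x) (tally (λ x → indicator (Q? x)) (list p))
  count-filter Q? p = count (filter Q? (list p)) (Unique.filter⁺ Q? (unique p))
    (λ m → let (n , q) = ∈.∈-filter⁻ Q? m in sound p n , q)
    (λ (px , qx) → ∈.∈-filter⁺ Q? (complete p px) qx)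
    (tally-filter Q? (list p))

  count-finite : {A : Set} (_≟_ : DecidableEquality A) {P : A → Set} (P? : ∀ x → Dec (P x)) (xs : List A) →
                 (∀ {x} → P x → x ∈ xs) → ∃ λ k → Count P k
  count-finite _≟_ P? xs h = _ , count (deduplicate _≟_ (filter P? xs)) (DecUnique.deduplicate-! _≟_ _)
    (λ m → proj₂ (∈.∈-filter⁻ P? {xs = xs} (∈.∈-deduplicate⁻ _≟_ (filter P? xs) m)))
    (λ p → ∈.∈-deduplicate⁺ _≟_ (∈.∈-filter⁺ P? (h p) p)) refl

-- Recurrences for the numbers of simple regions and of their clashes.

module Recurrences where

  open Trees
  open Charts
  open Rotation
  open HeadClashes
  open SkipClashes
  open Counting
  open Count
  open import Data.Nat using (ℕ; zero; suc; _+_; _*_; _≤_; z≤n; s≤s; _≡ᵇ_)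
  import Data.Nat.Properties as ℕ
  open import Data.Nat.Tactic.RingSolver using (solve-∀)
  open import Data.Bool using (Bool; true; false; not; _∧_; _∨_; if_then_else_; T)
  import Data.Bool.Properties as Bool
  open import Data.List using (List; []; _∷_; _++_; length; map; cartesianProductWith)
  open import Data.List.Membership.Propositional using (_∈_)
  import Data.List.Membership.Propositional.Properties as ∈
  open import Data.List.Relation.Unary.Any using (here; there)
  open import Data.Vec using (Vec; []; _∷_)
  open import Data.Product using (∃; _×_; _,_; proj₁; proj₂)
  open import Data.Sum using (_⊎_; inj₁; inj₂)
  open import Data.Empty using (⊥; ⊥-elim)
  open import Data.Unit using (tt)
  open import Relation.Nullary using (¬_; Dec; yes; no; does)
  open import Relation.Nullary.Decidable using (map′; _×-dec_; _⊎-dec_; ¬?; dec-true)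
  open import Relation.Binary using (DecidableEquality)
  open import Relation.Binary.PropositionalEquality

  _≟ᵗ_ : DecidableEquality Tree
  nil      ≟ᵗ nil        = yes refl
  nil      ≟ᵗ join _ _   = no λ ()
  nil      ≟ᵗ new _      = no λ ()
  join _ _ ≟ᵗ nil        = no λ ()
  join l r ≟ᵗ join l′ r′ = map′ (λ { (refl , refl) → refl }) (λ { refl → refl , refl }) ((l ≟ᵗ l′) ×-dec (r ≟ᵗ r′))
  join _ _ ≟ᵗ new _      = no λ ()
  new _    ≟ᵗ nil        = no λ ()
  new _    ≟ᵗ join _ _   = no λ ()
  new t    ≟ᵗ new t′     = map′ (cong new) (λ { refl → refl }) (t ≟ᵗ t′)

  treesOfDepth : ℕ → List Tree
  treesOfDepth zero    = nil ∷ []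
  treesOfDepth (suc k) = nil ∷ map new (treesOfDepth k) ++ cartesianProductWith join (treesOfDepth k) (treesOfDepth k)

  ∈-treesOfDepth : ∀ {t k} → edges t ≤ k → t ∈ treesOfDepth k
  ∈-treesOfDepth {nil}      {zero}  _ = here refl
  ∈-treesOfDepth {nil}      {suc k} _ = here refl
  ∈-treesOfDepth {new t}    {suc k} (s≤s p) = there (∈.∈-++⁺ˡ (∈.∈-map⁺ new (∈-treesOfDepth p)))
  ∈-treesOfDepth {join l r} {suc k} (s≤s p) = there (∈.∈-++⁺ʳ (map new (treesOfDepth k))
    (∈.∈-cartesianProductWith⁺ join (∈-treesOfDepth (ℕ.≤-trans (ℕ.m≤m+n _ _) p))
      (∈-treesOfDepth (ℕ.≤-trans (ℕ.m≤n+m _ _) p))))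

  wf-edges : ∀ {t h n} → WF t h n → edges t ≡ h + (n + n)
  wf-edges nil = refl
  wf-edges (join {i = i} {j} {m} {k} p q) = cong suc (trans (cong₂ _+_ (wf-edges p) (wf-edges q)) (lemma i j m k))
    where
    lemma : ∀ i j m k → i + (m + m) + (j + (k + k)) ≡ i + j + (m + k + (m + k))
    lemma = solve-∀
  wf-edges (new {h = h} {n} p) = cong suc (trans (wf-edges p) (lemma h n))
    where
    lemma : ∀ h n → suc (suc h) + (n + n) ≡ h + (suc n + suc n)
    lemma = solve-∀

  wf? : ∀ t → Dec (∃ λ h → ∃ λ n → WF t h n)
  wf? nil = yes (0 , 0 , nil)
  wf? (join l r) = map′ (λ ((_ , _ , p) , (_ , _ , q)) → _ , _ , join p q)
    (λ { (_ , _ , join p q) → (_ , _ , p) , (_ , _ , q) }) (wf? l ×-dec wf? r)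
  wf? (new t) with wf? t
  ... | no ¬p = no λ { (_ , _ , new p) → ¬p (_ , _ , p) }
  ... | yes (0 , _ , p) = no λ { (_ , _ , new q) → λ-⊥ (proj₁ (wf-unique p q)) }
    where λ-⊥ : ∀ {h} → 0 ≡ suc (suc h) → ⊥
          λ-⊥ ()
  ... | yes (1 , _ , p) = no λ { (_ , _ , new q) → λ-⊥ (proj₁ (wf-unique p q)) }
    where λ-⊥ : ∀ {h} → 1 ≡ suc (suc h) → ⊥
          λ-⊥ ()
  ... | yes (suc (suc h) , n , p) = yes (_ , _ , new p)

  wfAt? : ∀ h n t → Dec (WF t h n)
  wfAt? h n t with wf? t
  ... | no ¬p = no λ p → ¬p (_ , _ , p)
  ... | yes (h′ , n′ , p) = map′ (λ { (refl , refl) → p }) (wf-unique p) ((h′ ℕ.≟ h) ×-dec (n′ ℕ.≟ n))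

  region? : ∀ h n t → Dec (Region h n t)
  region? h n t with wfAt? h n t
  ... | no ¬p = no λ (p , _) → ¬p p
  ... | yes p = map′ (p ,_) proj₂ (simpleTree? p)

  clashes? : ∀ i j t → Dec (ClashTree i j t)
  clashes? i j t with wf? t
  ... | yes (_ , _ , p) = clashTree? p i j
  ... | no ¬p = no λ (c , _) → ¬p (_ , _ , proj₂ (proj₂ (Realisation.real-even σ₄ (Chart.α c) (Chart.real c))))

  abstract
    -- Kept abstract so that the enumeration is not evaluated; facts about `a` are derived from
    -- `regions`.
    regions-exist : ∀ h n → ∃ λ k → Count (Region h n) k
    regions-exist h n = count-finite _≟ᵗ_ (region? h n) (treesOfDepth (h + (n + n)))
      (λ (p , _) → ∈-treesOfDepth (ℕ.≤-reflexive (wf-edges p)))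

  a : ℕ → ℕ → ℕ
  a h n = proj₁ (regions-exist h n)

  regions : ∀ h n → Count (Region h n) (a h n)
  regions h n = proj₂ (regions-exist h n)

  N : ∀ {Q : Tree → Set} → (∀ t → Dec (Q t)) → ℕ → ℕ → ℕ
  N Q? h n = tally (λ t → indicator (Q? t)) (list (regions h n))

  countN : ∀ {Q : Tree → Set} (Q? : ∀ t → Dec (Q t)) h n → Count (λ t → Region h n t × Q t) (N Q? h n)
  countN Q? h n = count-filter Q? (regions h n)

  -- Verification by truth table: evaluation over all assignments proves the Boolean identities
  -- below.
  ∀ᵇ : ∀ n → (Vec Bool n → Bool) → Bool
  ∀ᵇ zero    f = f []
  ∀ᵇ (suc n) f = ∀ᵇ n (λ v → f (true ∷ v)) ∧ ∀ᵇ n (λ v → f (false ∷ v))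

  ∀ᵇ-sound : ∀ n (f : Vec Bool n → Bool) → ∀ᵇ n f ≡ true → ∀ v → f v ≡ true
  ∀ᵇ-sound zero    f p []          = p
  ∀ᵇ-sound (suc n) f p (true ∷ v)  = ∀ᵇ-sound n _ (Bool.∧-conicalˡ _ _ p) v
  ∀ᵇ-sound (suc n) f p (false ∷ v) = ∀ᵇ-sound n _ (Bool.∧-conicalʳ (∀ᵇ n (λ v → f (true ∷ v))) _ p) v

  imp : Bool → Bool → Bool → Bool
  imp x y z = not (x ∧ y) ∨ z

  dec-imp : ∀ {P Q R : Set} (p : Dec P) (q : Dec Q) (r : Dec R) → (P → Q → R) → imp (does p) (does q) (does r) ≡ true
  dec-imp (yes p) (yes q) r h = dec-true r (h p q)
  dec-imp (yes p) (no _)  r h = refl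
  dec-imp (no _)  q       r h = refl

  ∧-intro : ∀ {x y} → x ≡ true → y ≡ true → x ∧ y ≡ true
  ∧-intro refl refl = refl

  ind : Bool → ℕ
  ind b = if b then 1 else 0

  from-check : ∀ c m n → not c ∨ (m ≡ᵇ n) ≡ true → c ≡ true → m ≡ n
  from-check true m n p refl = ℕ.≡ᵇ⇒≡ m n (subst T (sym p) tt)

  -- Möbius inversion over the set partitions of three, respectively four, legs.
  möbius₃ : ∀ x y z → imp x y z ∧ imp y z x ∧ imp x z y ≡ true →
    ind (not x ∧ not y ∧ not z) + (ind x + (ind y + ind z)) ≡ 1 + (ind (x ∧ y) + ind (x ∧ y))
  möbius₃ x y z = from-check (imp x y z ∧ imp y z x ∧ imp x z y) _ _ (∀ᵇ-sound 3
    (λ { (x ∷ y ∷ z ∷ []) → not (imp x y z ∧ imp y z x ∧ imp x z y) ∨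
           (ind (not x ∧ not y ∧ not z) + (ind x + (ind y + ind z)) ≡ᵇ 1 + (ind (x ∧ y) + ind (x ∧ y))) })
    refl (x ∷ y ∷ z ∷ []))

  -- Twelve instances of transitivity, three for each triple of legs. The last conjunct is
  -- planarity: crossing clashes of the two opposite pairs force all four legs together.
  transitive₄ : (b₀₁ b₁₂ b₂₃ b₃₀ b₀₂ b₁₃ : Bool) → Bool
  transitive₄ b₀₁ b₁₂ b₂₃ b₃₀ b₀₂ b₁₃ =
    imp b₀₁ b₁₂ b₀₂ ∧ imp b₁₂ b₀₂ b₀₁ ∧ imp b₀₁ b₀₂ b₁₂ ∧
    imp b₁₂ b₂₃ b₁₃ ∧ imp b₂₃ b₁₃ b₁₂ ∧ imp b₁₂ b₁₃ b₂₃ ∧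
    imp b₂₃ b₃₀ b₀₂ ∧ imp b₃₀ b₀₂ b₂₃ ∧ imp b₂₃ b₀₂ b₃₀ ∧
    imp b₃₀ b₀₁ b₁₃ ∧ imp b₀₁ b₁₃ b₃₀ ∧ imp b₃₀ b₁₃ b₀₁ ∧ imp b₀₂ b₁₃ b₀₁

  -- Pairs have Möbius value -1 and triples 2, a triple being detected by two consecutive clashes.
  -- The class of all four legs has value -6 and the crossing pairing has value 1; they occur
  -- together, since either is detected by `b₀₂ ∧ b₁₃`, which leaves -5, the Möbius number of the
  -- noncrossing partitions of four points. Negative terms stand on the left.
  möbius₄-lhs möbius₄-rhs : (b₀₁ b₁₂ b₂₃ b₃₀ b₀₂ b₁₃ : Bool) → ℕ
  möbius₄-lhs b₀₁ b₁₂ b₂₃ b₃₀ b₀₂ b₁₃ =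
    ind (not b₀₁ ∧ not b₁₂ ∧ not b₂₃ ∧ not b₃₀ ∧ not b₀₂ ∧ not b₁₃) +
    (ind b₀₁ + (ind b₁₂ + (ind b₂₃ + (ind b₃₀ + (ind b₀₂ + (ind b₁₃ +
    (ind (b₀₂ ∧ b₁₃) + (ind (b₀₂ ∧ b₁₃) + (ind (b₀₂ ∧ b₁₃) + (ind (b₀₂ ∧ b₁₃) + ind (b₀₂ ∧ b₁₃)))))))))))
  möbius₄-rhs b₀₁ b₁₂ b₂₃ b₃₀ b₀₂ b₁₃ =
    1 + (ind (b₀₁ ∧ b₁₂) + (ind (b₀₁ ∧ b₁₂) + (ind (b₁₂ ∧ b₂₃) + (ind (b₁₂ ∧ b₂₃) +
    (ind (b₂₃ ∧ b₃₀) + (ind (b₂₃ ∧ b₃₀) + (ind (b₃₀ ∧ b₀₁) + (ind (b₃₀ ∧ b₀₁) +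
    (ind (b₀₁ ∧ b₂₃) + ind (b₁₂ ∧ b₃₀))))))))))

  möbius₄ : ∀ b₀₁ b₁₂ b₂₃ b₃₀ b₀₂ b₁₃ → transitive₄ b₀₁ b₁₂ b₂₃ b₃₀ b₀₂ b₁₃ ≡ true →
    möbius₄-lhs b₀₁ b₁₂ b₂₃ b₃₀ b₀₂ b₁₃ ≡ möbius₄-rhs b₀₁ b₁₂ b₂₃ b₃₀ b₀₂ b₁₃
  möbius₄ b₀₁ b₁₂ b₂₃ b₃₀ b₀₂ b₁₃ = from-check (transitive₄ b₀₁ b₁₂ b₂₃ b₃₀ b₀₂ b₁₃) _ _ (∀ᵇ-sound 6
    (λ { (b₀₁ ∷ b₁₂ ∷ b₂₃ ∷ b₃₀ ∷ b₀₂ ∷ b₁₃ ∷ []) → not (transitive₄ b₀₁ b₁₂ b₂₃ b₃₀ b₀₂ b₁₃) ∨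
      (möbius₄-lhs b₀₁ b₁₂ b₂₃ b₃₀ b₀₂ b₁₃ ≡ᵇ möbius₄-rhs b₀₁ b₁₂ b₂₃ b₃₀ b₀₂ b₁₃) })
    refl (b₀₁ ∷ b₁₂ ∷ b₂₃ ∷ b₃₀ ∷ b₀₂ ∷ b₁₃ ∷ []))

  spread? : ∀ t → Dec (SpreadTree t)
  spread? t = ¬? (clashes? 0 1 t) ×-dec ¬? (clashes? 1 2 t) ×-dec ¬? (clashes? 0 2 t)

  β γ ς : ℕ → ℕ → ℕ
  β = N (clashes? 0 1)
  γ = N (λ t → ¬? (clashes? 0 1 t))
  ς = N spread?

  shift : (ℕ → ℕ) → ℕ → ℕ
  shift f zero    = 0
  shift f (suc n) = f n

  count-shift : {P : ℕ → Tree → Set} {f : ℕ → ℕ} → (∀ n → Count (P n) (f n)) →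
                ∀ n → Count (λ t → ∃ λ m → n ≡ suc m × P m t) (shift f n)
  count-shift c zero    = count-∅ λ { (_ , () , _) }
  count-shift c (suc n) = count-⇔ (c n) (λ p → n , refl , p) λ { (_ , refl , p) → p }

  N-complement : ∀ {Q : Tree → Set} (Q? : ∀ t → Dec (Q t)) h n → N (λ t → ¬? (Q? t)) h n + N Q? h n ≡ a h n
  N-complement Q? h n = trans (sym (tally-+ _ _ (list (regions h n))))
    (trans (tally-cong (list (regions h n)) (λ {t} _ → lemma (Q? t))) (trans (tally-1 (list (regions h n))) (size (regions h n))))
    where
    lemma : ∀ {P : Set} (p : Dec P) → indicator (¬? p) + indicator p ≡ 1
    lemma (yes _) = refl
    lemma (no _)  = refl

  γ+β : ∀ h n → γ h n + β h n ≡ a h n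
  γ+β = N-complement (clashes? 0 1)

  N-rotate : ∀ {Q Q′ : Tree → Set} (Q? : ∀ t → Dec (Q t)) (Q′? : ∀ t → Dec (Q′ t)) h n →
    (∀ {t} → Region (suc h) n t → Q t → Q′ (rotate t)) → (∀ {t} → Region (suc h) n t → Q′ (rotate t) → Q t) →
    N Q? (suc h) n ≡ N Q′? (suc h) n
  N-rotate {Q′ = Q′} Q? Q′? h n f g = count-≡
    (count-bij rotate unrotate (λ (r , q) → rotate-region r , f r q)
      (λ (r , q) → unrotate-region r , g (unrotate-region r) (subst Q′ (sym (rotate-unrotate (proj₁ r))) q))
      (λ (r , _) → unrotate-rotate (proj₁ r)) (λ (r , _) → rotate-unrotate (proj₁ r)) (countN Q? (suc h) n))
    (countN Q′? (suc h) n) (λ p → p) (λ p → p)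

  clash₁₂-count : ∀ h n → N (clashes? 1 2) (suc (suc h)) n ≡ β (suc (suc h)) n
  clash₁₂-count h n = N-rotate (clashes? 1 2) (clashes? 0 1) (suc h) n
    (λ r → rotate-clash⁺ (proj₁ r) (s≤s z≤n) (s≤s (s≤s z≤n)))
    (λ r → rotate-clash⁻ (proj₁ r) (s≤s z≤n) (s≤s (s≤s z≤n)))

  triple? : ∀ t → Dec (ClashTree 0 1 t × ClashTree 1 2 t)
  triple? t = clashes? 0 1 t ×-dec clashes? 1 2 t

  tally-1+ : {A : Set} (f : A → ℕ) (xs : List A) → tally (λ x → 1 + f x) xs ≡ length xs + tally f xs
  tally-1+ f xs = trans (tally-+ (λ _ → 1) f xs) (cong (_+ tally f xs) (tally-1 xs))

  spread-count : ∀ h n → ς h n + (β h n + (N (clashes? 1 2) h n + N (clashes? 0 2) h n)) ≡ a h n + (N triple? h n + N triple? h n)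
  spread-count h n = begin
    ς h n + (β h n + (N (clashes? 1 2) h n + N (clashes? 0 2) h n))
      ≡⟨ sym (trans (tally-+ _ _ xs) (cong (ς h n +_) (trans (tally-+ _ _ xs) (cong (β h n +_) (tally-+ _ _ xs))))) ⟩
    tally (λ t → indicator (spread? t) + (i01 t + (i12 t + i02 t))) xs
      ≡⟨ tally-cong xs (λ {t} _ → möbius₃ (does (clashes? 0 1 t)) (does (clashes? 1 2 t)) (does (clashes? 0 2 t))
           (∧-intro (dec-imp (clashes? 0 1 t) (clashes? 1 2 t) (clashes? 0 2 t) (clashTree-trans (λ ())))
           (∧-intro (dec-imp (clashes? 1 2 t) (clashes? 0 2 t) (clashes? 0 1 t) (λ p q → clashTree-trans (λ ()) q (clashTree-sym p)))
                    (dec-imp (clashes? 0 1 t) (clashes? 0 2 t) (clashes? 1 2 t) (λ p q → clashTree-trans (λ ()) (clashTree-sym p) q))))) ⟩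
    tally (λ t → 1 + (i3 t + i3 t)) xs
      ≡⟨ trans (tally-1+ _ xs) (cong₂ _+_ (size (regions h n)) (tally-+ i3 i3 xs)) ⟩
    a h n + (N triple? h n + N triple? h n) ∎
    where
    open ≡-Reasoning
    xs = list (regions h n)
    i01 i12 i02 i3 : Tree → ℕ
    i01 t = indicator (clashes? 0 1 t)
    i12 t = indicator (clashes? 1 2 t)
    i02 t = indicator (clashes? 0 2 t)
    i3 t = indicator (triple? t)

  a-0-0 : a 0 0 ≡ 1
  a-0-0 = count-≡ (regions 0 0) (count-single nil) (λ { (nil , _) → refl }) (λ { refl → nil-region })

  a-0-suc : ∀ n → a 0 (suc n) ≡ 0
  a-0-suc n = count-≡ (regions 0 (suc n)) (count-∅ {P = λ _ → ⊥} (λ ())) (λ { (() , _) }) (λ ())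

  Pairs : (ℕ → ℕ → Tree → Tree → Set) → ℕ → Tree × Tree → Set
  Pairs R n (l , r) = ∃ λ m → ∃ λ k → m + k ≡ n × R m k l r

  convolution : (f g : ℕ → ℕ) → ℕ → ℕ
  convolution f g n = Σ⁺ n (λ m k → f m * g k)

  count-pairs : ∀ {P Q : ℕ → Tree → Set} {f g : ℕ → ℕ} → (∀ n → Count (P n) (f n)) → (∀ n → Count (Q n) (g n)) →
    (∀ {m m′ t} → P m t → P m′ t → m ≡ m′) → ∀ n → Count (Pairs (λ m k l r → P m l × Q k r) n) (convolution f g n)
  count-pairs p q u n = count-Σ⁺ n (λ m k → count-× (p m) (q k)) (λ (x , _) (y , _) → u x y)

  -- The two ways to peel the first leg. The second demands spread darts, and this demand is what
  -- keeps the recurrence from closing on `a` directly.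
  a-suc : ∀ h n → a (suc h) n ≡ Σ⁺ h (λ i j → convolution (a i) (a j) n) + shift (ς (suc (suc h))) n
  a-suc h n = count-≡ (regions (suc h) n)
    (count-⊎
      (count-map (λ (l , r) → join l r) (count-Σ⁺ h
        (λ i j → count-pairs (regions i) (regions j) (λ (p , _) (q , _) → proj₂ (wf-unique p q)) n)
        (λ { (_ , _ , _ , (p , _) , _) (_ , _ , _ , (q , _) , _) → proj₁ (wf-unique p q) }))
        (λ { _ _ refl → refl }))
      (count-shift (λ m → count-map new (countN spread? (suc (suc h)) m) (λ { _ _ refl → refl })) n)
      (λ { (_ , _ , refl) (_ , _ , _ , _ , ()) }))
    to from
    where
    to : ∀ {t} → Region (suc h) n t → _
    to {join l r} reg@(join p q , _) with join-region⁻ p q reg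
    ... | rl , rr = inj₁ ((l , r) , (_ , _ , refl , _ , _ , refl , rl , rr) , refl)
    to {new t} (new p , s) with simple-new⁻ (new p) s
    ... | s′ , spread = inj₂ (_ , refl , t , ((p , s′) , spread) , refl)
    from : ∀ {t} → _ → Region (suc h) n t
    from (inj₁ (_ , (_ , _ , refl , _ , _ , refl , rl , rr) , refl)) = join-region rl rr
    from (inj₂ (_ , refl , _ , (r , spread) , refl)) = new-region r spread

  unrotate³-injective : ∀ {s t h n m} → WF s (suc h) n → WF t (suc h) m → unrotate³ s ≡ unrotate³ t → s ≡ t
  unrotate³-injective p q eq = trans (sym (rotate³-unrotate³ p)) (trans (cong rotate³ eq) (rotate³-unrotate³ q))

  unrotate-injective : ∀ {s t h n m} → WF s (suc h) n → WF t (suc h) m → unrotate s ≡ unrotate t → s ≡ t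
  unrotate-injective p q eq = trans (sym (rotate-unrotate p)) (trans (cong rotate eq) (rotate-unrotate q))

  rotate-injective : ∀ {s t h n m} → WF s (suc h) n → WF t (suc h) m → rotate s ≡ rotate t → s ≡ t
  rotate-injective p q eq = trans (sym (unrotate-rotate p)) (trans (cong unrotate eq) (unrotate-rotate q))

  new-injective : ∀ {s t} → _≡_ {A = Tree} (new s) (new t) → s ≡ t
  new-injective refl = refl

  join-injective : ∀ {l r l′ r′} → _≡_ {A = Tree} (join l r) (join l′ r′) → l ≡ l′ × r ≡ r′
  join-injective refl = refl , refl

  digonTree : Tree → Tree
  digonTree l = new (digon-tree l)

  pocketTree skipTree : Tree × Tree → Tree
  pocketTree (l , r) = new (unrotate³ (join l r))
  skipTree (l , r) = new (unrotate (join l r))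

  -- The predicates restrict the three kinds of parts of a head clash, so that one bijection serves
  -- both for head clashes alone and for those where legs 2 and 3 clash as well.
  module HeadCount (h : ℕ) {A B P : Tree → Set} {fA fB fP : ℕ → ℕ}
    (cA : ∀ n → Count (λ t → Region h n t × A t) (fA n))
    (cB : ∀ n → Count (λ t → Region (suc h) n t × ¬ ClashTree 0 1 t × B t) (fB n))
    (cP : ∀ n → Count (λ t → Region h n t × P t) (fP n)) where

    PocketPair : ℕ → ℕ → Tree → Tree → Set
    PocketPair m k l r = (Region h m l × P l) × (Region 1 k r × ¬ ClashTree 0 1 r)

    DigonShape PocketShape : ℕ → Tree → Set
    DigonShape n t = ∃ λ m → n ≡ suc m × ∃ λ l → (Region (suc h) m l × ¬ ClashTree 0 1 l × B l) × t ≡ digonTree l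
    PocketShape n t = ∃ λ m → n ≡ suc m × ∃ λ (lr : Tree × Tree) →
      Pairs PocketPair m lr × t ≡ pocketTree lr

    Shapes : ℕ → Tree → Set
    Shapes n t =
      (∃ λ r → (Region h n r × A r) × t ≡ join nil r) ⊎
      DigonShape n t ⊎ PocketShape n t

    count-shapes : ∀ n → Count (Shapes n) (fA n + (shift fB n + shift (convolution fP (γ 1)) n))
    count-shapes n = count-⊎ (count-map (join nil) (cA n) (λ { _ _ refl → refl }))
      (count-⊎
        (count-shift (λ m → count-map digonTree (cB m) digon-inj) n)
        (count-shift (λ m → count-map pocketTree
           (count-pairs cP (countN (λ t → ¬? (clashes? 0 1 t)) 1) (λ ((p , _) , _) ((q , _) , _) → proj₂ (wf-unique p q)) m)
           pocket-inj) n)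
        disjoint)
      (λ { (_ , _ , refl) (inj₁ (_ , _ , _ , _ , ())) ; (_ , _ , refl) (inj₂ (_ , _ , _ , _ , ())) })
      where
      digon-inj : ∀ {m l l′} → Region (suc h) m l × ¬ ClashTree 0 1 l × B l → Region (suc h) m l′ × ¬ ClashTree 0 1 l′ × B l′ →
                  digonTree l ≡ digonTree l′ → l ≡ l′
      digon-inj (p , _) (q , _) eq = rotate-injective (proj₁ p) (proj₁ q) (rotate-injective (rotate-wf (proj₁ p)) (rotate-wf (proj₁ q))
        (proj₁ (join-injective (unrotate³-injective (proj₁ (digon-turned p)) (proj₁ (digon-turned q)) (new-injective eq)))))
      pocket-inj : ∀ {m} {x y : Tree × Tree} → Pairs PocketPair m x → Pairs PocketPair m y →
        pocketTree x ≡ pocketTree y → x ≡ y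
      pocket-inj {x = _ , _} {_ , _} (_ , _ , refl , (p , _) , (p′ , _)) (_ , _ , _ , (q , _) , (q′ , _)) eq
        with join-injective (unrotate³-injective (proj₁ (pocket-turned p p′)) (proj₁ (pocket-turned q q′)) (new-injective eq))
      ... | refl , refl = refl
      disjoint : ∀ {t} → DigonShape n t → PocketShape n t → ⊥
      disjoint {t} (_ , _ , l , (p , _) , refl) (_ , _ , _ , (_ , _ , _ , (q , _) , (q′ , _)) , eq)
        with join-injective (unrotate³-injective (proj₁ (digon-turned p)) (proj₁ (pocket-turned q q′)) (new-injective eq))
      -- A common tree would force the enclosed region of the pocket to be `nil`, which has no legs,
      -- while it must have two.
      ... | _ , refl with wf-nil (proj₁ q′)
      ... | () , _

    to-headClash : ∀ {n t} → Shapes n t → HeadClash h n t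
    to-headClash (inj₁ (_ , (r , _) , refl)) = paired r
    to-headClash (inj₂ (inj₁ (_ , refl , _ , (r , ok , _) , refl))) = digon r ok
    to-headClash (inj₂ (inj₂ (_ , refl , _ , (_ , _ , refl , (p , _) , (q , ok)) , refl))) = pocket p q ok

  data Always : Set where
    always : Always

  count-always : ∀ h n → Count (λ t → Region h n t × Always) (a h n)
  count-always h n = count-⇔ (regions h n) (_, always) proj₁

  β-suc : ∀ h n → β (suc h) n ≡ a h n + (shift (γ (suc h)) n + shift (convolution (a h) (γ 1)) n)
  β-suc h n = count-≡ (countN (clashes? 0 1) (suc h) n) (count-shapes n)
    (λ (r , k) → to (headClash⁻ r k)) (λ s → headClash⁺ (to-headClash s))
    where
    open HeadCount h (count-always h)
      (λ n → count-⇔ (countN (λ t → ¬? (clashes? 0 1 t)) (suc h) n) (λ (r , k) → r , k , always) (λ (r , k , _) → r , k))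
      (count-always h)
    to : ∀ {t} → HeadClash h n t → Shapes n t
    to (paired r)       = inj₁ (_ , (r , always) , refl)
    to (digon r ok)     = inj₂ (inj₁ (_ , refl , _ , (r , ok , always) , refl))
    to (pocket p q ok)  = inj₂ (inj₂ (_ , refl , _ , (_ , _ , refl , (p , always) , (q , ok)) , refl))

  skip-injective : ∀ {h m n m′ n′ l r l′ r′} → Region 1 m l → Region (suc h) n r → Region 1 m′ l′ → Region (suc h) n′ r′ →
    skipTree (l , r) ≡ skipTree (l′ , r′) → l ≡ l′ × r ≡ r′
  skip-injective p q p′ q′ eq =
    join-injective (unrotate-injective (proj₁ (skip-turned p q)) (proj₁ (skip-turned p′ q′)) (new-injective eq))

  clash₀₂-count : ∀ h n → N (clashes? 0 2) (suc (suc h)) n ≡ shift (convolution (a 1) (a (suc h))) n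
  clash₀₂-count h n = count-≡ (countN (clashes? 0 2) (suc (suc h)) n)
    (count-shift (λ m → count-map skipTree
      (count-pairs (regions 1) (regions (suc h)) (λ (p , _) (q , _) → proj₂ (wf-unique p q)) m) inj) n)
    (λ (r , k) → to (skipClash⁻ r k)) from
    where
    SkipPair : ℕ → ℕ → Tree → Tree → Set
    SkipPair m k l r = Region 1 m l × Region (suc h) k r
    SkipShape : Tree → Set
    SkipShape t = ∃ λ m → n ≡ suc m × ∃ λ (lr : Tree × Tree) → Pairs SkipPair m lr × t ≡ skipTree lr
    inj : ∀ {m} {x y : Tree × Tree} → Pairs SkipPair m x → Pairs SkipPair m y →
      skipTree x ≡ skipTree y → x ≡ y
    inj {x = _ , _} {_ , _} (_ , _ , _ , p , p′) (_ , _ , _ , q , q′) eq with skip-injective p p′ q q′ eq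
    ... | refl , refl = refl
    to : ∀ {t} → SkipClash h n t → SkipShape t
    to (skip p q) = _ , refl , _ , (_ , _ , refl , p , q) , refl
    from : ∀ {t} → SkipShape t → Region (suc (suc h)) n t × ClashTree 0 2 t
    from (_ , refl , _ , (_ , _ , refl , p , q) , refl) = skipClash⁺ (skip p q)

  edge : Tree
  edge = join nil nil

  abstract
    edge-region : Region 1 0 edge
    edge-region = join-nil-region nil-region

  wf-edge : ∀ {n} → WF edge 1 n → n ≡ 0
  wf-edge p = proj₂ (wf-unique p (proj₁ edge-region))

  -- By transitivity legs 0 and 2 clash too, which gives the shape of a skip clash; that leg 1 takes
  -- part makes the enclosed region a single edge, and only the other region is free.
  triple-count : ∀ h n → N triple? (suc (suc h)) n ≡ shift (a (suc h)) n
  triple-count h n = count-≡ (countN triple? (suc (suc h)) n)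
    (count-shift (λ m → count-map (λ r → skipTree (edge , r)) (regions (suc h) m)
      (λ p q eq → proj₂ (skip-injective edge-region p edge-region q eq))) n)
    to from
    where
    EdgeShape : Tree → Set
    EdgeShape t = ∃ λ m → n ≡ suc m × ∃ λ r → Region (suc h) m r × t ≡ skipTree (edge , r)
    to : ∀ {t} → Region (suc (suc h)) n t × ClashTree 0 1 t × ClashTree 1 2 t → EdgeShape t
    to (r , k , k′) = go (skipClash⁻ r (clashTree-trans (λ ()) k k′)) k
      where
      narrow : ∀ {m m′ l r} → Region 1 m l → Region (suc h) m′ r → l ≡ edge → n ≡ suc (m + m′) → EdgeShape (skipTree (l , r))
      narrow p q refl eq = _ , trans eq (cong (λ m → suc (m + _)) (wf-edge (proj₁ p))) , _ , q , refl
      go : ∀ {t} → SkipClash h n t → ClashTree 0 1 t → EdgeShape t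
      go (skip p q) k = narrow p q (skip-clash₀₁⁻ (skip-model′ p q) k) refl
    from : ∀ {t} → EdgeShape t → Region (suc (suc h)) n t × ClashTree 0 1 t × ClashTree 1 2 t
    from (_ , refl , r , q , refl) =
      proj₁ (skipClash⁺ (skip edge-region q)) , k₀₁ , clashTree-trans (λ ()) (clashTree-sym k₀₁) (proj₂ (skipClash⁺ (skip edge-region q)))
      where k₀₁ = skip-clash₀₁⁺ (skip-model′ edge-region q) refl

  ς-count : ∀ h n → ς (suc (suc h)) n + (β (suc (suc h)) n + (β (suc (suc h)) n + shift (convolution (a 1) (a (suc h))) n)) ≡
            a (suc (suc h)) n + (shift (a (suc h)) n + shift (a (suc h)) n)
  ς-count h n = trans (cong (λ z → ς (suc (suc h)) n + (β (suc (suc h)) n + z))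
      (cong₂ _+_ (sym (clash₁₂-count h n)) (sym (clash₀₂-count h n))))
    (trans (spread-count (suc (suc h)) n) (cong (a (suc (suc h)) n +_) (cong₂ _+_ (triple-count h n) (triple-count h n))))

  δ : ℕ → ℕ
  δ zero    = 1
  δ (suc _) = 0

  abstract
    nested-region : Region 2 0 nested
    nested-region = join-nil-region edge-region

  nested-spread : ¬ ClashTree 0 1 nested
  nested-spread k with headClash⁻ nested-region k
  ... | ()

  -- Two rotations carry `nested` to itself and legs 2, 3 to legs 0, 1.
  nested-clash₂₃ : ¬ ClashTree 2 3 nested
  nested-clash₂₃ k = nested-spread (rotate-clash⁺ (proj₁ (rotate-region nested-region)) (s≤s z≤n) (s≤s (s≤s z≤n))
    (rotate-clash⁺ (proj₁ nested-region) (s≤s (s≤s z≤n)) (s≤s (s≤s (s≤s z≤n))) k))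

  both? : ∀ t → Dec (ClashTree 0 1 t × ClashTree 2 3 t)
  both? t = clashes? 0 1 t ×-dec clashes? 2 3 t

  -- The regions over which a digon has clashes at both pairs of legs: legs 0 and 1 must be spread
  -- for the digon to be simple, and legs 2 and 3 clash either already or by way of `nested`.
  other? : ∀ t → Dec (¬ ClashTree 0 1 t × (ClashTree 2 3 t ⊎ t ≡ nested))
  other? t = ¬? (clashes? 0 1 t) ×-dec (clashes? 2 3 t ⊎-dec (t ≟ᵗ nested))

  -- This gives `both?` in terms of `other?`, while `other-count` ties their sum to `β 2`; the two
  -- relations together determine both counts.
  both-count : ∀ n → N both? 2 n ≡ β 1 n + (shift (N other? 2) n + shift (convolution (β 1) (γ 1)) n)
  both-count n = count-≡ (countN both? 2 n) (count-shapes n) (λ (r , k , k′) → to (headClash⁻ r k) k′)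
    (λ s → let (r , k) = headClash⁺ (to-headClash s) in r , k , from s)
    where
    open HeadCount 1 {ClashTree 0 1} {λ t → ClashTree 2 3 t ⊎ t ≡ nested} {ClashTree 0 1}
      (countN (clashes? 0 1) 1) (countN other? 2) (countN (clashes? 0 1) 1)
    to : ∀ {t} → HeadClash 1 n t → ClashTree 2 3 t → Shapes n t
    to (paired r)      k = inj₁ (_ , (r , paired-clash₂₃⁻ (proj₁ r) k) , refl)
    to (digon r ok)    k = inj₂ (inj₁ (_ , refl , _ , (r , ok , digon-clash₂₃⁻ (digon-model′ r) k) , refl))
    to (pocket p q ok) k = inj₂ (inj₂ (_ , refl , _ , (_ , _ , refl , (p , pocket-clash₂₃⁻ (pocket-model′ p q) k) , (q , ok)) , refl))
    from : ∀ {t} → Shapes n t → ClashTree 2 3 t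
    from (inj₁ (_ , (r , k) , refl)) = paired-clash₂₃⁺ (proj₁ r) k
    from (inj₂ (inj₁ (_ , refl , _ , (r , ok , inj₁ k) , refl))) = digon-clash₂₃⁺ (digon-model′ r) k
    from (inj₂ (inj₁ (_ , refl , _ , (r , ok , inj₂ eq) , refl))) = digon-clash₂₃-nested (digon-model′ r) eq
    from (inj₂ (inj₂ (_ , refl , _ , (_ , _ , refl , (p , k) , (q , ok)) , refl))) = pocket-clash₂₃⁺ (pocket-model′ p q) k

  nested-count : ∀ n → N (_≟ᵗ nested) 2 n ≡ δ n
  nested-count zero    = count-≡ (countN (_≟ᵗ nested) 2 0) (count-single nested) proj₂ (λ { refl → nested-region , refl })
  nested-count (suc n) = count-≡ (countN (_≟ᵗ nested) 2 (suc n)) (count-∅ {P = λ _ → ⊥} (λ ()))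
    (λ { ((p , _) , refl) → ℕ.0≢1+n (sym (proj₂ (wf-unique p (proj₁ nested-region)))) }) (λ ())

  clash₁₂-count′ : ∀ n → N (clashes? 1 2) 2 n ≡ β 2 n
  clash₁₂-count′ = clash₁₂-count 0

  clash₂₃-count : ∀ n → N (clashes? 2 3) 2 n ≡ β 2 n
  clash₂₃-count n = trans (N-rotate (clashes? 2 3) (clashes? 1 2) 1 n
    (λ r → rotate-clash⁺ (proj₁ r) (s≤s (s≤s z≤n)) (s≤s (s≤s (s≤s z≤n))))
    (λ r → rotate-clash⁻ (proj₁ r) (s≤s (s≤s z≤n)) (s≤s (s≤s (s≤s z≤n))))) (clash₁₂-count′ n)

  other-count : ∀ n → N other? 2 n + N both? 2 n ≡ β 2 n + δ n
  other-count n = trans (sym (tally-+ _ _ xs)) (trans (tally-cong xs (λ {t} _ → lemma (clashes? 0 1 t) (clashes? 2 3 t) (t ≟ᵗ nested)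
      (λ { refl → nested-spread , nested-clash₂₃ })))
    (trans (tally-+ _ _ xs) (cong₂ _+_ (clash₂₃-count n) (nested-count n))))
    where
    xs = list (regions 2 n)
    lemma : ∀ {P Q R : Set} (p : Dec P) (q : Dec Q) (r : Dec R) → (R → ¬ P × ¬ Q) →
            indicator (¬? p ×-dec (q ⊎-dec r)) + indicator (p ×-dec q) ≡ indicator q + indicator r
    lemma p       q       (yes r) h with h r
    lemma (yes p) q       (yes r) h | ¬p , ¬q = ⊥-elim (¬p p)
    lemma (no _)  (yes q) (yes r) h | ¬p , ¬q = ⊥-elim (¬q q)
    lemma (no _)  (no _)  (yes r) h | _ = refl
    lemma (yes _) (yes _) (no _) h = refl
    lemma (yes _) (no _)  (no _) h = refl
    lemma (no _)  (yes _) (no _) h = refl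
    lemma (no _)  (no _)  (no _) h = refl

-- Inclusion-exclusion for four legs closed by the root vertex.

module FourLegs where

  open Trees
  open Charts
  open Rotation
  open HeadClashes
  open SkipClashes
  open Counting
  open Recurrences
  open Count
  open import Data.Nat using (ℕ; zero; suc; _+_; z≤n; s≤s)
  open import Data.List using (List)
  import Data.Bool
  open import Data.Product using (∃; _×_; _,_; proj₁; proj₂)
  open import Relation.Nullary using (¬_; Dec; does)
  open import Relation.Nullary.Decidable using (_×-dec_; ¬?)
  open import Relation.Binary.PropositionalEquality

  -- What closing the legs by the root vertex demands beyond simplicity of the region: a clash of
  -- two legs becomes a loop at the root or a double edge from it.
  Scattered : Tree → Set
  Scattered t = ¬ ClashTree 0 1 t × ¬ ClashTree 1 2 t × ¬ ClashTree 2 3 t × ¬ ClashTree 3 0 t ×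
                ¬ ClashTree 0 2 t × ¬ ClashTree 1 3 t

  scattered? : ∀ t → Dec (Scattered t)
  scattered? t = ¬? (clashes? 0 1 t) ×-dec ¬? (clashes? 1 2 t) ×-dec ¬? (clashes? 2 3 t) ×-dec
                 ¬? (clashes? 3 0 t) ×-dec ¬? (clashes? 0 2 t) ×-dec ¬? (clashes? 1 3 t)

  ε : ℕ → ℕ
  ε = N scattered? 2

  private

    two? : ∀ i j k l t → Dec (ClashTree i j t × ClashTree k l t)
    two? i j k l t = clashes? i j t ×-dec clashes? k l t

    0< : ∀ {n} → 0 Data.Nat.< suc n
    0< = s≤s z≤n
    1< : ∀ {n} → 1 Data.Nat.< suc (suc n)
    1< = s≤s 0<
    2< : ∀ {n} → 2 Data.Nat.< suc (suc (suc n))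
    2< = s≤s 1<

    module _ {n t} (r : Region 2 n t) where
      wf : WF t 2 n
      wf = proj₁ r

      r₁₂ : ClashTree 1 2 t → ClashTree 0 1 (rotate t)
      r₁₂ = rotate-clash⁺ wf 0< 1<
      r₂₃ : ClashTree 2 3 t → ClashTree 1 2 (rotate t)
      r₂₃ = rotate-clash⁺ wf 1< 2<
      r₁₃ : ClashTree 1 3 t → ClashTree 0 2 (rotate t)
      r₁₃ = rotate-clash⁺ wf 0< 2<
      r₃₀ : ClashTree 3 0 t → ClashTree 2 3 (rotate t)
      r₃₀ = rotate-clash-last⁺ wf 2<
      r₀₁ : ClashTree 0 1 t → ClashTree 3 0 (rotate t)
      r₀₁ k = clashTree-sym (rotate-clash-last⁺ wf 0< (clashTree-sym k))

      u₁₂ : ClashTree 0 1 (rotate t) → ClashTree 1 2 t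
      u₁₂ = rotate-clash⁻ wf 0< 1<
      u₂₃ : ClashTree 1 2 (rotate t) → ClashTree 2 3 t
      u₂₃ = rotate-clash⁻ wf 1< 2<
      u₁₃ : ClashTree 0 2 (rotate t) → ClashTree 1 3 t
      u₁₃ = rotate-clash⁻ wf 0< 2<
      u₃₀ : ClashTree 2 3 (rotate t) → ClashTree 3 0 t
      u₃₀ = rotate-clash-last⁻ wf 2<
      u₀₁ : ClashTree 3 0 (rotate t) → ClashTree 0 1 t
      u₀₁ k = clashTree-sym (rotate-clash-last⁻ wf 0< (clashTree-sym k))

  clash₃₀-count : ∀ n → N (clashes? 3 0) 2 n ≡ β 2 n
  clash₃₀-count n = trans (N-rotate (clashes? 3 0) (clashes? 2 3) 1 n r₃₀ u₃₀) (clash₂₃-count n)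

  clash₁₃-count : ∀ n → N (clashes? 1 3) 2 n ≡ N (clashes? 0 2) 2 n
  clash₁₃-count n = N-rotate (clashes? 1 3) (clashes? 0 2) 1 n r₁₃ u₁₃

  triple₁₂₃ : ∀ n → N (two? 1 2 2 3) 2 n ≡ N (two? 0 1 1 2) 2 n
  triple₁₂₃ n = N-rotate (two? 1 2 2 3) (two? 0 1 1 2) 1 n
    (λ r (k , l) → r₁₂ r k , r₂₃ r l) (λ r (k , l) → u₁₂ r k , u₂₃ r l)

  triple₂₃₀ : ∀ n → N (two? 2 3 3 0) 2 n ≡ N (two? 1 2 2 3) 2 n
  triple₂₃₀ n = N-rotate (two? 2 3 3 0) (two? 1 2 2 3) 1 n
    (λ r (k , l) → r₂₃ r k , r₃₀ r l) (λ r (k , l) → u₂₃ r k , u₃₀ r l)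

  triple₃₀₁ : ∀ n → N (two? 3 0 0 1) 2 n ≡ N (two? 2 3 3 0) 2 n
  triple₃₀₁ n = N-rotate (two? 3 0 0 1) (two? 2 3 3 0) 1 n
    (λ r (k , l) → r₃₀ r k , r₀₁ r l) (λ r (k , l) → u₃₀ r k , u₀₁ r l)

  opposite-count : ∀ n → N (two? 1 2 3 0) 2 n ≡ N (two? 0 1 2 3) 2 n
  opposite-count n = N-rotate (two? 1 2 3 0) (two? 0 1 2 3) 1 n
    (λ r (k , l) → r₁₂ r k , r₃₀ r l) (λ r (k , l) → u₁₂ r k , u₃₀ r l)

  -- A clash of legs 0 and 2 separates leg 1 from leg 3, so that these can only clash at the same
  -- vertex.
  cross⇒₀₁ : ∀ {n t} → Region 2 n t → ClashTree 0 2 t → ClashTree 1 3 t → ClashTree 0 1 t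
  cross⇒₀₁ r k k′ with skipClash⁻ r k
  ... | skip p q = skip-clash₀₁⁺ (skip-model′ p q) (proj₁ (skip-clash₁₃⁻ (skip-model′ p q) refl k′))

  -- Crossing clashes bring all four legs to one vertex, and both regions beside the separating edge
  -- shrink to edges: a single region, with one vertex.
  cross-count : ∀ n → N (two? 0 2 1 3) 2 n ≡ shift δ n
  cross-count n = count-≡ (countN (two? 0 2 1 3) 2 n) (count-shift single n) to from
    where
    Edges : ℕ → Tree → Set
    Edges m t = m ≡ 0 × t ≡ skipTree (edge , edge)
    single : ∀ m → Count (Edges m) (δ m)
    single zero    = count-⇔ (count-single (skipTree (edge , edge))) (refl ,_) proj₂
    single (suc m) = count-∅ λ { (() , _) }
    to : ∀ {t} → Region 2 n t × ClashTree 0 2 t × ClashTree 1 3 t → ∃ λ m → n ≡ suc m × Edges m t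
    to (r , k , k′) = go (skipClash⁻ r k) k′
      where
      narrow : ∀ {m m′ l r} → Region 1 m l → Region 1 m′ r → l ≡ edge × r ≡ edge → n ≡ suc (m + m′) →
               ∃ λ m → n ≡ suc m × Edges m (skipTree (l , r))
      narrow p q (refl , refl) eq =
        0 , trans eq (cong suc (cong₂ _+_ (wf-edge (proj₁ p)) (wf-edge (proj₁ q)))) , refl , refl
      go : ∀ {t} → SkipClash 0 n t → ClashTree 1 3 t → ∃ λ m → n ≡ suc m × Edges m t
      go (skip p q) k = narrow p q (skip-clash₁₃⁻ (skip-model′ p q) refl k) refl
    from : ∀ {t} → (∃ λ m → n ≡ suc m × Edges m t) → Region 2 n t × ClashTree 0 2 t × ClashTree 1 3 t
    from (_ , refl , refl , refl) = proj₁ (skipClash⁺ (skip edge-region edge-region)) ,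
      proj₂ (skipClash⁺ (skip edge-region edge-region)) , skip-clash₁₃⁺ (skip-model′ edge-region edge-region) refl refl refl

  tally₁₂ : {A : Set} (f₁ f₂ f₃ f₄ f₅ f₆ f₇ f₈ f₉ f₁₀ f₁₁ f₁₂ : A → ℕ) (xs : List A) →
    tally (λ x → f₁ x + (f₂ x + (f₃ x + (f₄ x + (f₅ x + (f₆ x + (f₇ x + (f₈ x + (f₉ x + (f₁₀ x + (f₁₁ x + f₁₂ x))))))))))) xs ≡
    tally f₁ xs + (tally f₂ xs + (tally f₃ xs + (tally f₄ xs + (tally f₅ xs + (tally f₆ xs + (tally f₇ xs + (tally f₈ xs +
      (tally f₉ xs + (tally f₁₀ xs + (tally f₁₁ xs + tally f₁₂ xs))))))))))
  tally₁₂ f₁ f₂ f₃ f₄ f₅ f₆ f₇ f₈ f₉ f₁₀ f₁₁ f₁₂ xs =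
    step f₁ (step f₂ (step f₃ (step f₄ (step f₅ (step f₆ (step f₇ (step f₈ (step f₉ (step f₁₀ (tally-+ f₁₁ f₁₂ xs))))))))))
    where
    step : ∀ f {g n} → tally g xs ≡ n → tally (λ x → f x + g x) xs ≡ tally f xs + n
    step f {g} eq = trans (tally-+ f g xs) (cong (tally f xs +_) eq)

  -- `möbius₄` summed over all regions. Rotation identifies the four consecutive clashes with `b`,
  -- the two opposite ones with `s`, the four triples, each taken twice, with `t`, and the two
  -- noncrossing pairings with `p`.
  ε-count : ∀ n → let b = β 2 n ; s = N (clashes? 0 2) 2 n ; x = shift δ n ; t = shift (a 1) n ; p = N both? 2 n in
    ε n + (b + (b + (b + (b + (s + (s + (x + (x + (x + (x + x)))))))))) ≡
    a 2 n + (t + (t + (t + (t + (t + (t + (t + (t + (p + p)))))))))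
  ε-count n = begin
    ε n + (β 2 n + (β 2 n + (β 2 n + (β 2 n + (s + (s + (x + (x + (x + (x + x))))))))))
      ≡⟨ cong (ε n +_) (cong (β 2 n +_) (cong₂ _+_ (sym (clash₁₂-count′ n)) (cong₂ _+_ (sym (clash₂₃-count n))
           (cong₂ _+_ (sym (clash₃₀-count n)) (cong (s +_) (cong₂ _+_ (sym (clash₁₃-count n))
             (cong₂ _+_ x= (cong₂ _+_ x= (cong₂ _+_ x= (cong₂ _+_ x= x=)))))))))) ⟩
    ε n + (β 2 n + (N (clashes? 1 2) 2 n + (N (clashes? 2 3) 2 n + (N (clashes? 3 0) 2 n + (s + (N (clashes? 1 3) 2 n +
      (x′ + (x′ + (x′ + (x′ + x′))))))))))
      ≡⟨ sym (tally₁₂ _ _ _ _ _ _ _ _ _ _ _ _ xs) ⟩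
    tally (λ t → möbius₄-lhs (does (clashes? 0 1 t)) (does (clashes? 1 2 t)) (does (clashes? 2 3 t))
                   (does (clashes? 3 0 t)) (does (clashes? 0 2 t)) (does (clashes? 1 3 t))) xs
      ≡⟨ tally-cong xs (λ {t} m → möbius₄ (does (clashes? 0 1 t)) (does (clashes? 1 2 t)) (does (clashes? 2 3 t))
                   (does (clashes? 3 0 t)) (does (clashes? 0 2 t)) (does (clashes? 1 3 t)) (transitive t (sound (regions 2 n) m))) ⟩
    tally (λ t → möbius₄-rhs (does (clashes? 0 1 t)) (does (clashes? 1 2 t)) (does (clashes? 2 3 t))
                   (does (clashes? 3 0 t)) (does (clashes? 0 2 t)) (does (clashes? 1 3 t))) xs
      ≡⟨ tally₁₁ ⟩
    a 2 n + (t₀ + (t₀ + (t₁ + (t₁ + (t₂ + (t₂ + (t₃ + (t₃ + (p + N (two? 1 2 3 0) 2 n)))))))))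
      ≡⟨ cong (a 2 n +_) (cong₂ _+_ e₀ (cong₂ _+_ e₀ (cong₂ _+_ e₁ (cong₂ _+_ e₁ (cong₂ _+_ e₂ (cong₂ _+_ e₂
           (cong₂ _+_ e₃ (cong₂ _+_ e₃ (cong (p +_) (opposite-count n)))))))))) ⟩
    a 2 n + (t + (t + (t + (t + (t + (t + (t + (t + (p + p))))))))) ∎
    where
    open ≡-Reasoning
    xs = list (regions 2 n)
    s = N (clashes? 0 2) 2 n
    x = shift δ n
    x′ = N (two? 0 2 1 3) 2 n
    x= : x ≡ x′
    x= = sym (cross-count n)
    t = shift (a 1) n
    p = N both? 2 n
    t₀ = N triple? 2 n
    t₁ = N (two? 1 2 2 3) 2 n
    t₂ = N (two? 2 3 3 0) 2 n
    t₃ = N (two? 3 0 0 1) 2 n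
    e₀ : t₀ ≡ t
    e₀ = triple-count 0 n
    e₁ : t₁ ≡ t
    e₁ = trans (triple₁₂₃ n) e₀
    e₂ : t₂ ≡ t
    e₂ = trans (triple₂₃₀ n) e₁
    e₃ : t₃ ≡ t
    e₃ = trans (triple₃₀₁ n) e₂
    tally₁₁ = trans (tally-1+ _ xs) (cong₂ _+_ (size (regions 2 n))
      (step _ (step _ (step _ (step _ (step _ (step _ (step _ (step _ (tally-+ _ _ xs))))))))))
      where
      step : ∀ f {g n} → tally g xs ≡ n → tally (λ x → f x + g x) xs ≡ tally f xs + n
      step f {g} eq = trans (tally-+ f g xs) (cong (tally f xs +_) eq)
    transitive : ∀ t → Region 2 n t → transitive₄ (does (clashes? 0 1 t)) (does (clashes? 1 2 t)) (does (clashes? 2 3 t))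
                   (does (clashes? 3 0 t)) (does (clashes? 0 2 t)) (does (clashes? 1 3 t)) ≡ Data.Bool.true
    transitive t r =
      ∧-intro (dec-imp c₀₁ c₁₂ c₀₂ (λ p q → clashTree-trans (λ ()) p q))
      (∧-intro (dec-imp c₁₂ c₀₂ c₀₁ (λ p q → clashTree-trans (λ ()) q (clashTree-sym p)))
      (∧-intro (dec-imp c₀₁ c₀₂ c₁₂ (λ p q → clashTree-trans (λ ()) (clashTree-sym p) q))
      (∧-intro (dec-imp c₁₂ c₂₃ c₁₃ (λ p q → clashTree-trans (λ ()) p q))
      (∧-intro (dec-imp c₂₃ c₁₃ c₁₂ (λ p q → clashTree-trans (λ ()) q (clashTree-sym p)))
      (∧-intro (dec-imp c₁₂ c₁₃ c₂₃ (λ p q → clashTree-trans (λ ()) (clashTree-sym p) q))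
      (∧-intro (dec-imp c₂₃ c₃₀ c₀₂ (λ p q → clashTree-sym (clashTree-trans (λ ()) p q)))
      (∧-intro (dec-imp c₃₀ c₀₂ c₂₃ (λ p q → clashTree-sym (clashTree-trans (λ ()) p q)))
      (∧-intro (dec-imp c₂₃ c₀₂ c₃₀ (λ p q → clashTree-sym (clashTree-trans (λ ()) q p)))
      (∧-intro (dec-imp c₃₀ c₀₁ c₁₃ (λ p q → clashTree-sym (clashTree-trans (λ ()) p q)))
      (∧-intro (dec-imp c₀₁ c₁₃ c₃₀ (λ p q → clashTree-sym (clashTree-trans (λ ()) p q)))
      (∧-intro (dec-imp c₃₀ c₁₃ c₀₁ (λ p q → clashTree-sym (clashTree-trans (λ ()) q p)))
               (dec-imp c₀₂ c₁₃ c₀₁ (cross⇒₀₁ r)))))))))))))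
      where
      c₀₁ = clashes? 0 1 t
      c₁₂ = clashes? 1 2 t
      c₂₃ = clashes? 2 3 t
      c₃₀ = clashes? 3 0 t
      c₀₂ = clashes? 0 2 t
      c₁₃ = clashes? 1 3 t

-- The ring of formal power series, truncated agreement and fixed points.

module FormalSeries where

  open import Algebra.Bundles using (CommutativeRing)
  open import Algebra.Structures
  open import Data.Nat using (ℕ; zero; suc; _<_; _≤_; z≤n; s≤s)
  import Data.Nat.Properties as ℕ
  open import Data.Product using (_,_)
  open import Level using (0ℓ)
  import Relation.Binary.PropositionalEquality as ≡
  open import Relation.Binary.Structures using (IsEquivalence)
  import Relation.Binary.Reasoning.Setoid

  module PowerSeries (R : CommutativeRing 0ℓ 0ℓ) where
    open CommutativeRing R hiding (zero)
    open Relation.Binary.Reasoning.Setoid setoid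

    Ser : Set
    Ser = ℕ → Carrier

    tail : Ser → Ser
    tail f n = f (suc n)

    infixl 6 _⊞_
    infixl 7 _⊠_ _·_
    infix 4 _≋_

    _⊞_ _⊠_ : Ser → Ser → Ser
    (f ⊞ g) n = f n + g n
    (f ⊠ g) zero    = f 0 * g 0
    (f ⊠ g) (suc n) = f 0 * g (suc n) + (tail f ⊠ g) n

    _·_ : Carrier → Ser → Ser
    (c · f) n = c * f n

    neg : Ser → Ser
    neg f n = - f n

    constant : Carrier → Ser
    constant c zero    = c
    constant c (suc _) = 0#

    _≋_ : Ser → Ser → Set
    f ≋ g = ∀ n → f n ≈ g n

    ≋-isEquivalence : IsEquivalence _≋_
    ≋-isEquivalence = record
      { refl = λ _ → refl ; sym = λ p n → sym (p n) ; trans = λ p q n → trans (p n) (q n) }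

    infix 4 _≈[_]_
    _≈[_]_ : Ser → ℕ → Ser → Set
    f ≈[ n ] g = ∀ {k} → k < n → f k ≈ g k

    -- Agreement up to a given order is the metric in which fixed points are constructed and
    -- solutions compared.
    ⊠-local : ∀ {f f′ g g′ n} → f ≈[ n ] f′ → g ≈[ n ] g′ → (f ⊠ g) ≈[ n ] (f′ ⊠ g′)
    ⊠-local p q {zero}  k<n = *-cong (p k<n) (q k<n)
    ⊠-local {n = suc n} p q {suc k} (s≤s k<n) = +-cong (*-cong (p (s≤s z≤n)) (q (s≤s k<n)))
      (⊠-local {n = n} (λ j<n → p (s≤s j<n)) (λ j<n → q (ℕ.≤-trans j<n (ℕ.n≤1+n n))) k<n)

    ⊠-cong : ∀ {f f′ g g′} → f ≋ f′ → g ≋ g′ → f ⊠ g ≋ f′ ⊠ g′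
    ⊠-cong p q n = ⊠-local (λ {k} _ → p k) (λ {k} _ → q k) (ℕ.n<1+n n)

    -- The product is defined by recursion on its left factor; this mirror recursion on the right
    -- one is what yields commutativity.
    ⊠-suc : ∀ f g n → (f ⊠ g) (suc n) ≈ f (suc n) * g 0 + (f ⊠ tail g) n
    ⊠-suc f g zero    = +-comm _ _
    ⊠-suc f g (suc n) = begin
      f 0 * g (suc (suc n)) + (tail f ⊠ g) (suc n)                                ≈⟨ +-congˡ (⊠-suc (tail f) g n) ⟩
      f 0 * g (suc (suc n)) + (f (suc (suc n)) * g 0 + (tail f ⊠ tail g) n)        ≈⟨ sym (+-assoc _ _ _) ⟩
      f 0 * g (suc (suc n)) + f (suc (suc n)) * g 0 + (tail f ⊠ tail g) n          ≈⟨ +-congʳ (+-comm _ _) ⟩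
      f (suc (suc n)) * g 0 + f 0 * g (suc (suc n)) + (tail f ⊠ tail g) n          ≈⟨ +-assoc _ _ _ ⟩
      f (suc (suc n)) * g 0 + (f ⊠ tail g) (suc n)                                ∎

    ⊠-comm : ∀ f g → f ⊠ g ≋ g ⊠ f
    ⊠-comm f g zero    = *-comm _ _
    ⊠-comm f g (suc n) = trans (⊠-suc f g n) (+-cong (*-comm _ _) (⊠-comm f (tail g) n))

    ⊠-distribʳ : ∀ f g h → (g ⊞ h) ⊠ f ≋ (g ⊠ f) ⊞ (h ⊠ f)
    ⊠-distribʳ f g h zero    = distribʳ _ _ _
    ⊠-distribʳ f g h (suc n) = begin
      (g 0 + h 0) * f (suc n) + ((tail g ⊞ tail h) ⊠ f) n
        ≈⟨ +-cong (distribʳ _ _ _) (⊠-distribʳ f (tail g) (tail h) n) ⟩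
      g 0 * f (suc n) + h 0 * f (suc n) + ((tail g ⊠ f) n + (tail h ⊠ f) n)
        ≈⟨ +-assoc _ _ _ ⟩
      g 0 * f (suc n) + (h 0 * f (suc n) + ((tail g ⊠ f) n + (tail h ⊠ f) n))
        ≈⟨ +-congˡ (trans (sym (+-assoc _ _ _)) (trans (+-congʳ (+-comm _ _)) (+-assoc _ _ _))) ⟩
      g 0 * f (suc n) + ((tail g ⊠ f) n + (h 0 * f (suc n) + (tail h ⊠ f) n))
        ≈⟨ sym (+-assoc _ _ _) ⟩
      g 0 * f (suc n) + (tail g ⊠ f) n + (h 0 * f (suc n) + (tail h ⊠ f) n) ∎

    ·-⊠ : ∀ c f g → (c · f) ⊠ g ≋ c · (f ⊠ g)
    ·-⊠ c f g zero    = *-assoc _ _ _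
    ·-⊠ c f g (suc n) = trans (+-cong (*-assoc _ _ _) (·-⊠ c (tail f) g n)) (sym (distribˡ _ _ _))

    ⊠-assoc : ∀ f g h → (f ⊠ g) ⊠ h ≋ f ⊠ (g ⊠ h)
    ⊠-assoc f g h zero    = *-assoc _ _ _
    ⊠-assoc f g h (suc n) = begin
      f 0 * g 0 * h (suc n) + (((f 0 · tail g) ⊞ (tail f ⊠ g)) ⊠ h) n
        ≈⟨ +-cong (*-assoc _ _ _) (⊠-distribʳ h (f 0 · tail g) (tail f ⊠ g) n) ⟩
      f 0 * (g 0 * h (suc n)) + (((f 0 · tail g) ⊠ h) n + ((tail f ⊠ g) ⊠ h) n)
        ≈⟨ +-congˡ (+-cong (·-⊠ (f 0) (tail g) h n) (⊠-assoc (tail f) g h n)) ⟩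
      f 0 * (g 0 * h (suc n)) + (f 0 * (tail g ⊠ h) n + (tail f ⊠ (g ⊠ h)) n)
        ≈⟨ sym (+-assoc _ _ _) ⟩
      f 0 * (g 0 * h (suc n)) + f 0 * (tail g ⊠ h) n + (tail f ⊠ (g ⊠ h)) n
        ≈⟨ +-congʳ (sym (distribˡ _ _ _)) ⟩
      f 0 * (g ⊠ h) (suc n) + (tail f ⊠ (g ⊠ h)) n ∎

    constant-⊠ : ∀ c f → constant c ⊠ f ≋ c · f
    constant-⊠ c f zero    = refl
    constant-⊠ c f (suc n) = trans (+-congˡ (zero-⊠ f n)) (+-identityʳ _)
      where
      zero-⊠ : ∀ f n → (tail (constant c) ⊠ f) n ≈ 0#
      zero-⊠ f zero    = zeroˡ _
      zero-⊠ f (suc n) = trans (+-cong (zeroˡ _) (zero-⊠ f n)) (+-identityˡ _)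

    series : CommutativeRing 0ℓ 0ℓ
    series = record
      { Carrier = Ser ; _≈_ = _≋_ ; _+_ = _⊞_ ; _*_ = _⊠_ ; -_ = neg ; 0# = constant 0# ; 1# = constant 1#
      ; isCommutativeRing = record
        { isRing = record
          { +-isAbelianGroup = record
            { isGroup = record
              { isMonoid = record
                { isSemigroup = record
                  { isMagma = record
                    { isEquivalence = ≋-isEquivalence ; ∙-cong = λ p q n → +-cong (p n) (q n) }
                  ; assoc = λ f g h n → +-assoc _ _ _ }
                ; identity = (λ f n → trans (+-congʳ (zero-at n)) (+-identityˡ _)) ,
                             (λ f n → trans (+-congˡ (zero-at n)) (+-identityʳ _)) }
              ; inverse = (λ f n → trans (-‿inverseˡ _) (sym (zero-at n))) ,
                          (λ f n → trans (-‿inverseʳ _) (sym (zero-at n)))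
              ; ⁻¹-cong = λ p n → -‿cong (p n) }
            ; comm = λ f g n → +-comm _ _ }
          ; *-cong = ⊠-cong
          ; *-assoc = ⊠-assoc
          ; *-identity = one-⊠ , (λ f n → trans (⊠-comm f (constant 1#) n) (one-⊠ f n))
          ; distrib = (λ f g h n → trans (⊠-comm f (g ⊞ h) n) (trans (⊠-distribʳ f g h n)
                         (+-cong (⊠-comm g f n) (⊠-comm h f n)))) , ⊠-distribʳ }
        ; *-comm = ⊠-comm } }
      where
      zero-at : ∀ n → constant 0# n ≈ 0#
      zero-at zero    = refl
      zero-at (suc n) = refl
      one-⊠ : ∀ f → constant 1# ⊠ f ≋ f
      one-⊠ f n = trans (constant-⊠ 1# f n) (*-identityˡ _)

    infixr 5 _∷ˢ_
    _∷ˢ_ : Carrier → Ser → Ser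
    (c ∷ˢ f) zero    = c
    (c ∷ˢ f) (suc n) = f n

    -- The fixed point of the contraction f ↦ c + z G(f).
    module Fix (c : Carrier) (G : Ser → Ser) (local : ∀ {f g n} → f ≈[ n ] g → G f ≈[ n ] G g) where

      approx : ℕ → Ser
      approx zero    = constant 0#
      approx (suc n) = c ∷ˢ G (approx n)

      approx-step : ∀ n → approx n ≈[ n ] approx (suc n)
      approx-step (suc n) {zero}  _         = refl
      approx-step (suc n) {suc k} (s≤s k<n) = local (approx-step n) k<n

      approx-stable : ∀ {m n} → m ≤ n → approx m ≈[ m ] approx n
      approx-stable {m} {n} m≤n with ℕ.m≤n⇒∃[o]m+o≡n m≤n
      ... | o , ≡.refl = go o
        where
        go : ∀ o → approx m ≈[ m ] approx (m Data.Nat.+ o)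
        go zero    {k} k<m = reflexive (≡.cong (λ j → approx j k) (≡.sym (ℕ.+-identityʳ m)))
        go (suc o) {k} k<m = trans (go o k<m) (trans (approx-step (m Data.Nat.+ o) (ℕ.≤-trans k<m (ℕ.m≤m+n m o)))
          (reflexive (≡.cong (λ j → approx j k) (≡.sym (ℕ.+-suc m o)))))

      -- Each iteration settles one more coefficient, so that of index `n` is final after `suc n`
      -- steps.
      solution : Ser
      solution n = approx (suc n) n

      solution-approx : ∀ n → solution ≈[ n ] approx n
      solution-approx n {k} k<n = approx-stable k<n (ℕ.n<1+n k)

      solution-tail : tail solution ≋ G solution
      solution-tail n = local (λ k<n → sym (solution-approx (suc n) k<n)) (ℕ.n<1+n n)

    Z : Ser
    Z = 0# ∷ˢ constant 1#

    Z-⊠ : ∀ f → Z ⊠ f ≋ 0# ∷ˢ f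
    Z-⊠ f zero    = zeroˡ _
    Z-⊠ f (suc n) = trans (+-cong (zeroˡ _) (trans (constant-⊠ 1# f n) (*-identityˡ _))) (+-identityˡ _)

    Z-local : ∀ {f g n} → f ≈[ n ] g → (Z ⊠ f) ≈[ suc n ] (Z ⊠ g)
    Z-local {f} {g} p {zero}  _         = trans (Z-⊠ f 0) (sym (Z-⊠ g 0))
    Z-local {f} {g} p {suc k} (s≤s k<n) = trans (Z-⊠ f (suc k)) (trans (p k<n) (sym (Z-⊠ g (suc k))))

    -- Removes a cleared denominator: with constant term 1 the lowest coefficient of the product is
    -- that of `g`, which therefore vanishes, and the tail of `g` satisfies the same hypothesis.
    unit-cancel : ∀ f g → f 0 ≈ 1# → (∀ n → (f ⊠ g) n ≈ 0#) → ∀ n → g n ≈ 0#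
    unit-cancel f g f0 h zero    = trans (sym (*-identityˡ _)) (trans (*-congʳ (sym f0)) (h 0))
    unit-cancel f g f0 h (suc n) = unit-cancel f (tail g) f0 (λ m → begin
      (f ⊠ tail g) m                     ≈⟨ sym (+-identityˡ _) ⟩
      0# + (f ⊠ tail g) m                ≈⟨ +-congʳ (sym (trans (*-congˡ g0) (zeroʳ _))) ⟩
      f (suc m) * g 0 + (f ⊠ tail g) m   ≈⟨ sym (⊠-suc f g m) ⟩
      (f ⊠ g) (suc m)                    ≈⟨ h (suc m) ⟩
      0#                                 ∎) n
      where
      g0 : g 0 ≈ 0#
      g0 = trans (sym (*-identityˡ _)) (trans (*-congʳ (sym f0)) (h 0))

-- The loop equation: closed form and uniqueness of its solution.

module LoopEquation where

  open FormalSeries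
  open import Algebra.Bundles using (CommutativeRing)
  open import Algebra.Bundles.Raw using (RawRing)
  import Algebra.Solver.Ring
  import Algebra.Solver.Ring.AlmostCommutativeRing as ACR
  import Algebra.Properties.Ring
  open import Data.Nat using (ℕ; zero; suc; _≤_; z≤n; s≤s)
  import Data.Nat.Properties as ℕ
  open import Data.Integer using (ℤ; +_; 0ℤ; 1ℤ)
  import Data.Integer as ℤ
  import Data.Integer.Properties as ℤ
  open import Data.Maybe using (Maybe; just; nothing)
  open import Level using (0ℓ)
  open import Relation.Nullary using (yes; no)
  import Relation.Binary.PropositionalEquality as ≡

  -- The homomorphism from ℤ lets the ring solver take integer coefficients.
  record ℤ-Algebra : Set₁ where
    field
      ring : CommutativeRing 0ℓ 0ℓ
    open CommutativeRing ring public hiding (ring)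
    field
      ⟨_⟩ : ℤ → Carrier
      ⟨+⟩ : ∀ m n → ⟨ m ℤ.+ n ⟩ ≈ ⟨ m ⟩ + ⟨ n ⟩
      ⟨*⟩ : ∀ m n → ⟨ m ℤ.* n ⟩ ≈ ⟨ m ⟩ * ⟨ n ⟩
      ⟨-⟩ : ∀ m → ⟨ ℤ.- m ⟩ ≈ - ⟨ m ⟩
      ⟨0⟩ : ⟨ 0ℤ ⟩ ≈ 0#
      ⟨1⟩ : ⟨ 1ℤ ⟩ ≈ 1#

    private
      ℤ-raw : RawRing 0ℓ 0ℓ
      ℤ-raw = CommutativeRing.rawRing ℤ.+-*-commutativeRing

      almost : ACR.AlmostCommutativeRing 0ℓ 0ℓ
      almost = ACR.fromCommutativeRing ring

      morphism : ℤ-raw ACR.-Raw-AlmostCommutative⟶ almost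
      morphism = record { ⟦_⟧ = ⟨_⟩ ; +-homo = ⟨+⟩ ; *-homo = ⟨*⟩ ; -‿homo = ⟨-⟩ ; 0-homo = ⟨0⟩ ; 1-homo = ⟨1⟩ }

      equal? : ∀ m n → Maybe (⟨ m ⟩ ≈ ⟨ n ⟩)
      equal? m n with m ℤ.≟ n
      ... | yes ≡.refl = just refl
      ... | no _       = nothing

    open Algebra.Solver.Ring ℤ-raw almost morphism equal? public
      using (Polynomial; solve; con; _:+_; _:*_; _:-_; :-_; _:=_)

    open Algebra.Properties.Ring (CommutativeRing.ring ring) public using (x≈y⇒x∙y⁻¹≈ε; x∙y⁻¹≈ε⇒x≈y)

    diff : ∀ {x y} → x ≈ y → x - y ≈ 0#
    diff = x≈y⇒x∙y⁻¹≈ε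

    undiff : ∀ {x y} → x - y ≈ 0# → x ≈ y
    undiff = x∙y⁻¹≈ε⇒x≈y _ _

    times-0 : ∀ x {y} → y ≈ 0# → x * y ≈ 0#
    times-0 x p = trans (*-congˡ p) (zeroʳ x)

    plus-0 : ∀ {x y} → x ≈ 0# → y ≈ 0# → x + y ≈ 0#
    plus-0 p q = trans (+-cong p q) (+-identityˡ 0#)

  seriesAlgebra : ℤ-Algebra → ℤ-Algebra
  seriesAlgebra R = record
    { ring = P.series
    ; ⟨_⟩ = λ m → P.constant R.⟨ m ⟩
    ; ⟨+⟩ = λ { m n zero → R.⟨+⟩ m n ; m n (suc _) → R.sym (R.+-identityˡ R.0#) }
    ; ⟨*⟩ = λ m n k → R.sym (R.trans (P.constant-⊠ R.⟨ m ⟩ (P.constant R.⟨ n ⟩) k) (product m n k))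
    ; ⟨-⟩ = λ { m zero → R.⟨-⟩ m ; m (suc _) → R.sym (R.trans (R.sym (R.+-identityˡ _)) (R.-‿inverseʳ R.0#)) }
    ; ⟨0⟩ = λ { zero → R.⟨0⟩ ; (suc _) → R.refl }
    ; ⟨1⟩ = λ { zero → R.⟨1⟩ ; (suc _) → R.refl } }
    where
    module R = ℤ-Algebra R
    module P = PowerSeries R.ring
    product : ∀ m n k → R.⟨ m ⟩ R.* P.constant R.⟨ n ⟩ k R.≈ P.constant R.⟨ m ℤ.* n ⟩ k
    product m n zero    = R.sym (R.⟨*⟩ m n)
    product m n (suc k) = R.zeroʳ _

  ℤ-algebra : ℤ-Algebra
  ℤ-algebra = record
    { ring = ℤ.+-*-commutativeRing ; ⟨_⟩ = λ m → m ; ⟨+⟩ = λ _ _ → ≡.refl ; ⟨*⟩ = λ _ _ → ≡.refl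
    ; ⟨-⟩ = λ _ → ≡.refl ; ⟨0⟩ = ≡.refl ; ⟨1⟩ = ≡.refl }

  module ℤR = ℤ-Algebra ℤ-algebra
  module KS = PowerSeries ℤR.ring
  -- Two levels of series: in `K` the variable `Z` marks vertices, and in `BS`, over `K`, the index
  -- is half the number of legs.
  K-algebra : ℤ-Algebra
  K-algebra = seriesAlgebra ℤ-algebra
  module K = ℤ-Algebra K-algebra
  module BS = PowerSeries K.ring
  module B = ℤ-Algebra (seriesAlgebra K-algebra)

  open K using (_≈_; _+_; _*_; _-_; -_; 0#; 1#; ⟨_⟩; con; _:+_; _:*_; _:-_; :-_; _:=_)
  open KS using (_≈[_]_; Z)

  Series′ : Set
  Series′ = K.Carrier

  u : Series′
  u = 1# + Z

  two three : Series′
  two   = ⟨ + 2 ⟩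
  three = ⟨ + 3 ⟩

  -- All statements hold for an arbitrary `k`; only later is it set to a series that involves the
  -- unknown counts.
  module Renormalised (k : Series′) where

    l g : Series′
    l = u - Z * k
    g = Z * (1# - Z)

    private
      -- The equation `l t = 1 + 3 g u t²`, solved for the term `t` of its left side, where `l - 1`
      -- and `g` are multiples of `Z`; this makes it a contraction. For `l = u = 1` it is the
      -- classical parametrisation `t = 1 + 3 g t²` of 4-regular planar maps.
      G : Series′ → Series′
      G f = (k - 1#) * f + three * ((1# - Z) * (u * (f * f)))

      G-local : ∀ {f f′ n} → f ≈[ n ] f′ → G f ≈[ n ] G f′
      G-local {f} {f′} p {i} i<n = ≡.cong₂ ℤ._+_ (KS.⊠-local {k - 1#} {k - 1#} (λ _ → ≡.refl) p i<n)
        (KS.⊠-local {three} {three} (λ _ → ≡.refl) (KS.⊠-local {1# - Z} {1# - Z} (λ _ → ≡.refl)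
          (KS.⊠-local {u} {u} (λ _ → ≡.refl) (KS.⊠-local p p))) i<n)

      module F = KS.Fix 1ℤ G G-local

    t : Series′
    t = F.solution

    v w : Series′
    v = g * (u * (t * t))
    w = u * t

    t-fixed : t ≈ 1# + Z * G t
    t-fixed zero    = ≡.sym (≡.cong (λ z → 1ℤ ℤ.+ z) (KS.Z-⊠ (G t) 0))
    t-fixed (suc n) = ≡.trans (F.solution-tail n)
      (≡.sym (≡.trans (≡.cong (λ z → 0ℤ ℤ.+ z) (KS.Z-⊠ (G t) (suc n))) (ℤ.+-identityˡ _)))

    l-t : l * t ≈ 1# + three * v
    l-t = K.undiff (K.trans
      (K.solve 3 (λ k t Z →
          let one = con (+ 1) ; u = one :+ Z
              G = (k :- one) :* t :+ con (+ 3) :* ((one :- Z) :* (u :* (t :* t)))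
          in (u :- Z :* k) :* t :- (one :+ con (+ 3) :* (Z :* (one :- Z) :* (u :* (t :* t)))) := (t :- (one :+ Z :* G)))
         K.refl k t Z)
      (K.diff t-fixed))

    private module C = BS.Fix 1# (λ f → w BS.· (f BS.⊠ f)) (λ p i<n → K.*-congˡ {w} (BS.⊠-local p p i<n))

    c : BS.Ser
    c = C.solution

    -- The solution of the loop equation: with c = 1 + w z c², it is c - v c (c - 1).
    Ã : BS.Ser
    Ã = ((1# + v) BS.· c) BS.⊞ BS.neg (v BS.· (c BS.⊠ c))

    private
      ι : Series′ → BS.Ser
      ι = BS.constant

      scalar : ∀ κ f → κ BS.· f B.≈ ι κ B.* f
      scalar κ f = B.sym {ι κ B.* f} {κ BS.· f} (BS.constant-⊠ κ f)

      tail-c : BS.tail c B.≈ ι w B.* (c B.* c)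
      tail-c = B.trans {BS.tail c} {w BS.· (c B.* c)} {ι w B.* (c B.* c)} C.solution-tail (scalar w (c B.* c))

      tail-c0 : BS.tail c 0 ≈ w
      tail-c0 = K.trans (C.solution-tail 0) (K.trans (K.*-congˡ {w} (K.*-identityˡ 1#)) (K.*-identityʳ w))

      tail-cc : BS.tail (c B.* c) B.≈ BS.tail c B.+ BS.tail c B.* c
      tail-cc n = K.+-congʳ (K.*-identityˡ (BS.tail c n))

      -- First and second tails of `c` and of `c * c` as polynomials in `c`. Since `c` has constant
      -- term 1 and tail `w c²`, division by the leg variable never leaves the polynomials in `c`.
      S1 SCC S2 S2CC : BS.Ser
      S1   = ι w B.* (c B.* c)
      SCC  = S1 B.+ S1 B.* c
      S2   = ι w B.* SCC
      S2CC = S2 B.+ (ι w B.* S1 B.+ S2 B.* c)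

      tail-cc′ : BS.tail (c B.* c) B.≈ SCC
      tail-cc′ = B.trans {BS.tail (c B.* c)} {BS.tail c B.+ BS.tail c B.* c} {SCC} tail-cc
        (B.+-cong {BS.tail c} {S1} {BS.tail c B.* c} {S1 B.* c} tail-c (B.*-congʳ {c} {BS.tail c} {S1} tail-c))

      tail²-c : BS.tail (BS.tail c) B.≈ S2
      tail²-c n = K.trans (C.solution-tail (suc n)) (K.trans (K.*-congˡ {w} (tail-cc′ n)) (scalar w SCC n))

      tail²-cc : BS.tail (BS.tail (c B.* c)) B.≈ S2CC
      tail²-cc n = K.+-cong (K.trans (K.*-identityˡ _) (tail²-c n))
        (K.+-cong (K.trans (K.*-cong tail-c0 (tail-c n)) (scalar w S1 n))
                  (B.*-congʳ {c} {BS.tail (BS.tail c)} {S2} tail²-c n))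

      A₀ A₁ A₂ : BS.Ser
      A₀ = ι (1# + v) B.* c B.- ι v B.* (c B.* c)
      A₁ = ι (1# + v) B.* S1 B.- ι v B.* SCC
      A₂ = ι (1# + v) B.* S2 B.- ι v B.* S2CC

      Ã₀ : Ã B.≈ A₀
      Ã₀ n = K.+-cong (scalar (1# + v) c n) (K.-‿cong (scalar v (c B.* c) n))

      Ã₁ : BS.tail Ã B.≈ A₁
      Ã₁ n = K.+-cong (K.trans (K.*-congˡ {1# + v} (tail-c n)) (scalar (1# + v) S1 n))
        (K.-‿cong (K.trans (K.*-congˡ {v} (tail-cc′ n)) (scalar v SCC n)))

      Ã₂ : BS.tail (BS.tail Ã) B.≈ A₂
      Ã₂ n = K.+-cong (K.trans (K.*-congˡ {1# + v} (tail²-c n)) (scalar (1# + v) S2 n))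
        (K.-‿cong (K.trans (K.*-congˡ {v} (tail²-cc n)) (scalar v S2CC n)))

    Ã-0 : Ã 0 ≈ 1#
    Ã-0 = K.solve 1 (λ v → (con (+ 1) :+ v) :* con (+ 1) :- v :* (con (+ 1) :* con (+ 1)) := con (+ 1)) K.refl v

    Ã-1 : Ã 1 ≈ w * (1# - v)
    Ã-1 = K.trans (K.+-cong (K.*-congˡ {1# + v} tail-c0) (K.-‿cong (K.*-congˡ {v}
        (K.trans (tail-cc 0) (K.+-cong tail-c0 (K.*-congʳ tail-c0))))))
      (K.solve 2 (λ w v → (con (+ 1) :+ v) :* w :- v :* (w :+ w :* con (+ 1)) := w :* (con (+ 1) :- v)) K.refl w v)

    private
      w-cc : Series′
      w-cc = w * (1# * w + w * 1#)

    Ã-2 : Ã 2 ≈ w * w * (two - three * v)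
    Ã-2 = K.trans (K.+-cong (K.*-congˡ {1# + v} c2) (K.-‿cong (K.*-congˡ {v}
        (K.+-cong (K.*-congˡ {1#} c2) (K.+-cong (K.*-cong tail-c0 tail-c0) (K.*-congʳ c2))))))
      (K.solve 2 (λ w v → let one = con (+ 1) ; cc = w :* (one :* w :+ w :* one) in
         (one :+ v) :* cc :- v :* (one :* cc :+ (w :* w :+ cc :* one)) := w :* w :* (con (+ 2) :- con (+ 3) :* v)) K.refl w v)
      where
      c2 : c 2 ≈ w-cc
      c2 = K.trans (C.solution-tail 1) (K.*-congˡ {w} (K.+-cong (K.*-congˡ {1#} tail-c0) (K.*-congʳ tail-c0)))

    private
      ι-* : ∀ x y → ι (x * y) B.≈ ι x B.* ι y
      ι-* x y n = K.sym (K.trans (BS.constant-⊠ x (ι y) n) (pointwise n))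
        where
        pointwise : ∀ n → (x BS.· ι y) n ≈ ι (x * y) n
        pointwise zero    = K.refl
        pointwise (suc n) = K.zeroʳ x

      ι-+ : ∀ x y → ι (x + y) B.≈ ι x B.+ ι y
      ι-+ x y zero    = K.refl
      ι-+ x y (suc n) = K.sym (K.+-identityˡ 0#)

      -- The constants `v` and `w` are unfolded into products of `L`, `U`, `Γ`, `T`, so that the
      -- loop equation becomes an identity between polynomials in five independent series.
      L U Γ T V W : BS.Ser
      L = ι l
      U = ι u
      Γ = ι g
      T = ι t
      V = Γ B.* (U B.* (T B.* T))
      W = U B.* T

      V≈ : ι v B.≈ V
      V≈ = B.trans {ι v} {Γ B.* ι (u * (t * t))} {V} (ι-* g (u * (t * t)))
        (B.*-congˡ {Γ} {ι (u * (t * t))} {U B.* (T B.* T)}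
          (B.trans {ι (u * (t * t))} {U B.* ι (t * t)} {U B.* (T B.* T)} (ι-* u (t * t)) (B.*-congˡ {U} {ι (t * t)} {T B.* T} (ι-* t t))))

      W≈ : ι w B.≈ W
      W≈ = ι-* u t

      1+V≈ : ι (1# + v) B.≈ B.1# B.+ V
      1+V≈ = B.trans {ι (1# + v)} {B.1# B.+ ι v} {B.1# B.+ V} (ι-+ 1# v) (B.+-congˡ {B.1#} {ι v} {V} V≈)

      LT≈ : L B.* T B.≈ B.1# B.+ B.⟨ + 3 ⟩ B.* V
      LT≈ = B.trans {L B.* T} {ι (l * t)} {B.1# B.+ B.⟨ + 3 ⟩ B.* V} (B.sym {ι (l * t)} {L B.* T} (ι-* l t))
        (B.trans {ι (l * t)} {ι (1# + three * v)} {B.1# B.+ B.⟨ + 3 ⟩ B.* V} ι-cong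
        (B.trans {ι (1# + three * v)} {B.1# B.+ ι (three * v)} {B.1# B.+ B.⟨ + 3 ⟩ B.* V} (ι-+ 1# (three * v))
          (B.+-congˡ {B.1#} {ι (three * v)} {B.⟨ + 3 ⟩ B.* V}
            (B.trans {ι (three * v)} {ι three B.* ι v} {B.⟨ + 3 ⟩ B.* V} (ι-* three v) (B.*-congˡ {ι three} {ι v} {V} V≈)))))
        where
        ι-cong : ι (l * t) B.≈ ι (1# + three * v)
        ι-cong zero    = l-t
        ι-cong (suc n) = K.refl

      module Shape (p q r : BS.Ser) where
        S1′ SCC′ S2′ S2CC′ A₀′ A₁′ A₂′ : BS.Ser
        S1′ = r B.* (c B.* c)
        SCC′ = S1′ B.+ S1′ B.* c
        S2′ = r B.* SCC′
        S2CC′ = S2′ B.+ (r B.* S1′ B.+ S2′ B.* c)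
        A₀′ = p B.* c B.- q B.* (c B.* c)
        A₁′ = p B.* S1′ B.- q B.* SCC′
        A₂′ = p B.* S2′ B.- q B.* S2CC′

      module Sh = Shape (B.1# B.+ V) V W

      open import Relation.Binary.Reasoning.Setoid B.setoid

      sub-cong : ∀ {x x′ y y′} → x B.≈ x′ → y B.≈ y′ → (x B.- y) B.≈ (x′ B.- y′)
      sub-cong p q n = K.+-cong (p n) (K.-‿cong (q n))

      cc : BS.Ser
      cc = c B.* c

      S1≈ : S1 B.≈ Sh.S1′
      S1≈ = B.*-congʳ {cc} {ι w} {W} W≈

      SCC≈ : SCC B.≈ Sh.SCC′
      SCC≈ = B.+-cong {S1} {Sh.S1′} {S1 B.* c} {Sh.S1′ B.* c} S1≈ (B.*-congʳ {c} {S1} {Sh.S1′} S1≈)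

      S2≈ : S2 B.≈ Sh.S2′
      S2≈ = B.*-cong {ι w} {W} {SCC} {Sh.SCC′} W≈ SCC≈

      S2CC≈ : S2CC B.≈ Sh.S2CC′
      S2CC≈ = B.+-cong {S2} {Sh.S2′} {ι w B.* S1 B.+ S2 B.* c} {W B.* Sh.S1′ B.+ Sh.S2′ B.* c} S2≈
        (B.+-cong {ι w B.* S1} {W B.* Sh.S1′} {S2 B.* c} {Sh.S2′ B.* c}
          (B.*-cong {ι w} {W} {S1} {Sh.S1′} W≈ S1≈) (B.*-congʳ {c} {S2} {Sh.S2′} S2≈))

      A₀≈ : Ã B.≈ Sh.A₀′
      A₀≈ = B.trans {Ã} {A₀} {Sh.A₀′} Ã₀ (sub-cong {ι (1# + v) B.* c} {(B.1# B.+ V) B.* c} {ι v B.* cc} {V B.* cc}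
        (B.*-congʳ {c} {ι (1# + v)} {B.1# B.+ V} 1+V≈) (B.*-congʳ {cc} {ι v} {V} V≈))

      A₁≈ : BS.tail Ã B.≈ Sh.A₁′
      A₁≈ = B.trans {BS.tail Ã} {A₁} {Sh.A₁′} Ã₁ (sub-cong {ι (1# + v) B.* S1} {(B.1# B.+ V) B.* Sh.S1′} {ι v B.* SCC} {V B.* Sh.SCC′}
        (B.*-cong {ι (1# + v)} {B.1# B.+ V} {S1} {Sh.S1′} 1+V≈ S1≈) (B.*-cong {ι v} {V} {SCC} {Sh.SCC′} V≈ SCC≈))

      A₂≈ : BS.tail (BS.tail Ã) B.≈ Sh.A₂′
      A₂≈ = B.trans {BS.tail (BS.tail Ã)} {A₂} {Sh.A₂′} Ã₂ (sub-cong {ι (1# + v) B.* S2} {(B.1# B.+ V) B.* Sh.S2′} {ι v B.* S2CC} {V B.* Sh.S2CC′}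
        (B.*-cong {ι (1# + v)} {B.1# B.+ V} {S2} {Sh.S2′} 1+V≈ S2≈) (B.*-cong {ι v} {V} {S2CC} {Sh.S2CC′} V≈ S2CC≈))

      -- The defect of the loop equation is a multiple of `l t - (1 + 3 v)`. Its vanishing is
      -- precisely the quadratic equation imposed on `t`.
      identity : (L B.* Sh.A₁′ B.- (U B.* (Sh.A₀′ B.* Sh.A₀′) B.+ Γ B.* Sh.A₂′)) B.≈
                 (U B.* cc B.* (B.1# B.- V B.* c)) B.* (L B.* T B.- (B.1# B.+ B.⟨ + 3 ⟩ B.* V))
      identity = B.solve 5 (λ L U Γ T c →
        let one = B.con (+ 1)
            V = Γ B.:* (U B.:* (T B.:* T)) ; W = U B.:* T ; cc = c B.:* c ; p = one B.:+ V
            S1 = W B.:* cc ; SCC = S1 B.:+ S1 B.:* c ; S2 = W B.:* SCC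
            S2CC = S2 B.:+ (W B.:* S1 B.:+ S2 B.:* c)
            A₀ = p B.:* c B.:- V B.:* cc ; A₁ = p B.:* S1 B.:- V B.:* SCC ; A₂ = p B.:* S2 B.:- V B.:* S2CC
        in L B.:* A₁ B.:- (U B.:* (A₀ B.:* A₀) B.:+ Γ B.:* A₂) B.:=
           U B.:* cc B.:* (one B.:- V B.:* c) B.:* (L B.:* T B.:- (one B.:+ B.con (+ 3) B.:* V)))
        (λ _ → K.refl) L U Γ T c

    loop : ∀ h → l * Ã (suc h) ≈ u * (Ã BS.⊠ Ã) h + g * Ã (suc (suc h))
    loop h = K.trans (K.sym (BS.constant-⊠ l (BS.tail Ã) h)) (K.trans (whole h)
        (K.+-cong (BS.constant-⊠ u (Ã BS.⊠ Ã) h) (BS.constant-⊠ g (BS.tail (BS.tail Ã)) h)))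
      where
      whole : L B.* BS.tail Ã B.≈ U B.* (Ã B.* Ã) B.+ Γ B.* BS.tail (BS.tail Ã)
      whole = begin
        L B.* BS.tail Ã
          ≈⟨ B.*-congˡ {L} {BS.tail Ã} {Sh.A₁′} A₁≈ ⟩
        L B.* Sh.A₁′
          ≈⟨ B.undiff {L B.* Sh.A₁′} {U B.* (Sh.A₀′ B.* Sh.A₀′) B.+ Γ B.* Sh.A₂′}
              (B.trans {L B.* Sh.A₁′ B.- (U B.* (Sh.A₀′ B.* Sh.A₀′) B.+ Γ B.* Sh.A₂′)}
                {(U B.* cc B.* (B.1# B.- V B.* c)) B.* (L B.* T B.- (B.1# B.+ B.⟨ + 3 ⟩ B.* V))} {B.0#} identity
                (B.times-0 (U B.* cc B.* (B.1# B.- V B.* c)) {L B.* T B.- (B.1# B.+ B.⟨ + 3 ⟩ B.* V)}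
                  (B.diff {L B.* T} {B.1# B.+ B.⟨ + 3 ⟩ B.* V} LT≈))) ⟩
        U B.* (Sh.A₀′ B.* Sh.A₀′) B.+ Γ B.* Sh.A₂′
          ≈⟨ B.+-cong {U B.* (Sh.A₀′ B.* Sh.A₀′)} {U B.* (Ã B.* Ã)} {Γ B.* Sh.A₂′} {Γ B.* BS.tail (BS.tail Ã)}
               (B.*-congˡ {U} {Sh.A₀′ B.* Sh.A₀′} {Ã B.* Ã} (B.*-cong {Sh.A₀′} {Ã} {Sh.A₀′} {Ã} (B.sym {Ã} {Sh.A₀′} A₀≈) (B.sym {Ã} {Sh.A₀′} A₀≈)))
               (B.*-congˡ {Γ} {Sh.A₂′} {BS.tail (BS.tail Ã)} (B.sym {BS.tail (BS.tail Ã)} {Sh.A₂′} A₂≈)) ⟩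
        U B.* (Ã B.* Ã) B.+ Γ B.* BS.tail (BS.tail Ã) ∎

  -- Solutions are determined by induction on the power of Z, since l - 1 and g are divisible by Z.
  module Unique (k : Series′) where
    open Renormalised k using (l; g)

    module _ {A Ã : BS.Ser} (A0 : A 0 ≈ 1#) (Ã0 : Ã 0 ≈ 1#)
      (loopA : ∀ h → l * A (suc h) ≈ u * (A BS.⊠ A) h + g * A (suc (suc h)))
      (loopÃ : ∀ h → l * Ã (suc h) ≈ u * (Ã BS.⊠ Ã) h + g * Ã (suc (suc h))) where

      private
        next : Series′ → Series′ → Series′ → Series′
        next s y y′ = u * s + Z * ((1# - Z) * y′ + (k - 1#) * y)

        rearrange : ∀ {F : BS.Ser} → (∀ h → l * F (suc h) ≈ u * (F BS.⊠ F) h + g * F (suc (suc h))) →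
                    ∀ h → F (suc h) ≈ next ((F BS.⊠ F) h) (F (suc h)) (F (suc (suc h)))
        rearrange {F} loop h = K.undiff (K.trans
          (K.solve 5 (λ k Z y y′ s → let one = con (+ 1) ; u = one :+ Z in
             y :- (u :* s :+ Z :* ((one :- Z) :* y′ :+ (k :- one) :* y)) :=
             (u :- Z :* k) :* y :- (u :* s :+ Z :* (one :- Z) :* y′)) K.refl k Z (F (suc h)) (F (suc (suc h))) ((F BS.⊠ F) h))
          (K.diff (loop h)))

        ≈⇒local : ∀ {f g n} → f ≈ g → f ≈[ n ] g
        ≈⇒local p {i} _ = p i

        ⊠-upto : ∀ {n} {F G : BS.Ser} h → (∀ i → i ≤ h → F i ≈[ n ] G i) → (F BS.⊠ F) h ≈[ n ] (G BS.⊠ G) h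
        ⊠-upto {n} h p = general h p p
          where
          general : ∀ {F G F′ G′ : BS.Ser} h → (∀ i → i ≤ h → F i ≈[ n ] G i) → (∀ i → i ≤ h → F′ i ≈[ n ] G′ i) →
                    (F BS.⊠ F′) h ≈[ n ] (G BS.⊠ G′) h
          general zero    p q = KS.⊠-local (p 0 z≤n) (q 0 z≤n)
          general (suc h) p q i<n = ≡.cong₂ ℤ._+_ (KS.⊠-local (p 0 z≤n) (q (suc h) ℕ.≤-refl) i<n)
            (general h (λ i i≤h → p (suc i) (s≤s i≤h)) (λ i i≤h → q i (ℕ.≤-trans i≤h (ℕ.n≤1+n h))) i<n)

        agree : ∀ n h → A h ≈[ n ] Ã h
        agree zero    h ()
        agree (suc n) h = upto h h ℕ.≤-refl
          where
          upto : ∀ m h → h ≤ m → A h ≈[ suc n ] Ã h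
          upto m zero h≤m = ≈⇒local (K.trans A0 (K.sym Ã0))
          -- The convolution involves indices up to `h` at the same order, which the induction on
          -- `h` covers. The higher index `suc (suc h)` occurs only behind a factor `Z`, hence at a
          -- lower order.
          upto (suc m) (suc h) (s≤s h≤m) {i} i<n = ≡.trans (rearrange loopA h i) (≡.trans
            (≡.cong₂ ℤ._+_
              (KS.⊠-local {u} {u} (λ _ → ≡.refl) (⊠-upto h (λ j j≤h → upto m j (ℕ.≤-trans j≤h h≤m))) i<n)
              (KS.Z-local {(1# - Z) * A (suc (suc h)) + (k - 1#) * A (suc h)} {(1# - Z) * Ã (suc (suc h)) + (k - 1#) * Ã (suc h)}
                (λ j<n → ≡.cong₂ ℤ._+_
                  (KS.⊠-local {1# - Z} {1# - Z} (λ _ → ≡.refl) (agree n (suc (suc h))) j<n)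
                  (KS.⊠-local {k - 1#} {k - 1#} (λ _ → ≡.refl) (agree n (suc h)) j<n)) i<n))
            (≡.sym (rearrange loopÃ h i)))

      unique : ∀ h → A h ≈ Ã h
      unique h n = agree (suc n) h (ℕ.n<1+n n)

-- The recurrences as equations between series, and the closed form of `A 1` and `A 2`.

module CountingSeries where

  open Counting
  open Recurrences
  open FourLegs
  open FormalSeries
  open LoopEquation
  open import Data.Nat as ℕ using (ℕ; zero; suc)
  open import Data.Integer using (ℤ; +_)
  import Data.Integer as ℤ
  import Data.Integer.Properties as ℤ
  import Relation.Binary.PropositionalEquality as ≡
  open ≡ using (_≡_)

  open K using (_≈_; _+_; _*_; _-_; -_; 0#; 1#; ⟨_⟩; con; _:+_; _:*_; _:-_; :-_; _:=_)
  open KS using (Z)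

  ⟦_⟧ : (ℕ → ℕ) → Series′
  ⟦ f ⟧ n = + f n

  ⟦+⟧ : ∀ f g → ⟦ (λ n → f n ℕ.+ g n) ⟧ ≈ ⟦ f ⟧ + ⟦ g ⟧
  ⟦+⟧ f g n = ℤ.pos-+ (f n) (g n)

  ⟦convolution⟧ : ∀ f g → ⟦ convolution f g ⟧ ≈ ⟦ f ⟧ * ⟦ g ⟧
  ⟦convolution⟧ f g zero    = ℤ.pos-* (f 0) (g 0)
  ⟦convolution⟧ f g (suc n) = ≡.trans (ℤ.pos-+ (f 0 ℕ.* g (suc n)) _)
    (≡.cong₂ ℤ._+_ (ℤ.pos-* (f 0) (g (suc n))) (⟦convolution⟧ (λ i → f (suc i)) g n))

  ⟦shift⟧ : ∀ f → ⟦ shift f ⟧ ≈ Z * ⟦ f ⟧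
  ⟦shift⟧ f zero    = ≡.sym (KS.Z-⊠ ⟦ f ⟧ 0)
  ⟦shift⟧ f (suc n) = ≡.sym (KS.Z-⊠ ⟦ f ⟧ (suc n))

  ⟦shift-convolution⟧ : ∀ f g → ⟦ shift (convolution f g) ⟧ ≈ Z * (⟦ f ⟧ * ⟦ g ⟧)
  ⟦shift-convolution⟧ f g = K.trans (⟦shift⟧ (convolution f g)) (K.*-congˡ {Z} (⟦convolution⟧ f g))

  ⟦Σ⁺⟧ : ∀ (f g : ℕ → ℕ → ℕ) h n →
    + Σ⁺ h (λ i j → convolution (f i) (g j) n) ≡ ((λ i → ⟦ f i ⟧) BS.⊠ (λ j → ⟦ g j ⟧)) h n
  ⟦Σ⁺⟧ f g zero    n = ⟦convolution⟧ (f 0) (g 0) n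
  ⟦Σ⁺⟧ f g (suc h) n = ≡.trans (ℤ.pos-+ (convolution (f 0) (g (suc h)) n) _)
    (≡.cong₂ ℤ._+_ (⟦convolution⟧ (f 0) (g (suc h)) n) (⟦Σ⁺⟧ (λ i → f (suc i)) g h n))

  ⟦δ⟧ : ⟦ δ ⟧ ≈ 1#
  ⟦δ⟧ zero    = ≡.refl
  ⟦δ⟧ (suc n) = ≡.refl

  ⟦cong⟧ : ∀ {f g} → (∀ n → f n ≡ g n) → ⟦ f ⟧ ≈ ⟦ g ⟧
  ⟦cong⟧ p n = ≡.cong +_ (p n)

  A Β Γ : ℕ → Series′
  A h = ⟦ a h ⟧
  Β h = ⟦ β h ⟧
  Γ h = ⟦ γ h ⟧

  Σₛ : ℕ → Series′
  Σₛ h = ⟦ ς h ⟧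

  A-0 : A 0 ≈ 1#
  A-0 zero    = ≡.cong +_ a-0-0
  A-0 (suc n) = ≡.cong +_ (a-0-suc n)

  private
    add : ∀ {f g x y} → ⟦ f ⟧ ≈ x → ⟦ g ⟧ ≈ y → ⟦ (λ n → f n ℕ.+ g n) ⟧ ≈ x + y
    add {f} {g} p q = K.trans (⟦+⟧ f g) (K.+-cong p q)

    is : ∀ f → ⟦ f ⟧ ≈ ⟦ f ⟧
    is f = K.refl

  A-suc : ∀ h → A (suc h) ≈ (A BS.⊠ A) h + Z * Σₛ (suc (suc h))
  A-suc h = K.trans (⟦cong⟧ (a-suc h))
    (add {λ n → Σ⁺ h (λ i j → convolution (a i) (a j) n)} {shift (ς (suc (suc h)))} (⟦Σ⁺⟧ a a h) (⟦shift⟧ (ς (suc (suc h)))))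

  Σ-eq : ∀ h → Σₛ (suc (suc h)) + (Β (suc (suc h)) + (Β (suc (suc h)) + Z * (A 1 * A (suc h)))) ≈
         A (suc (suc h)) + (Z * A (suc h) + Z * A (suc h))
  Σ-eq h = K.trans (K.sym left) (K.trans (⟦cong⟧ (ς-count h)) right)
    where
    b = β (suc (suc h))
    s = shift (convolution (a 1) (a (suc h)))
    x = shift (a (suc h))
    left = add {ς (suc (suc h))} {λ n → b n ℕ.+ (b n ℕ.+ s n)} (is _) (add {b} {λ n → b n ℕ.+ s n} (is _)
             (add {b} {s} (is _) (⟦shift-convolution⟧ (a 1) (a (suc h)))))
    right = add {a (suc (suc h))} {λ n → x n ℕ.+ x n} (is _) (add {x} {x} (⟦shift⟧ (a (suc h))) (⟦shift⟧ (a (suc h))))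

  Β-suc : ∀ h → Β (suc h) ≈ A h + (Z * Γ (suc h) + Z * (A h * Γ 1))
  Β-suc h = K.trans (⟦cong⟧ (β-suc h))
    (add {a h} {λ n → s n ℕ.+ x n} (is _) (add {s} {x} (⟦shift⟧ (γ (suc h))) (⟦shift-convolution⟧ (a h) (γ 1))))
    where
    s = shift (γ (suc h))
    x = shift (convolution (a h) (γ 1))

  Γ+Β : ∀ h → Γ h + Β h ≈ A h
  Γ+Β h = K.trans (K.sym (⟦+⟧ (γ h) (β h))) (⟦cong⟧ (γ+β h))

  Ρ Π Ε : Series′
  Ρ = ⟦ N both? 2 ⟧
  Π = ⟦ N other? 2 ⟧
  Ε = ⟦ ε ⟧

  Ρ-eq : Ρ ≈ Β 1 + (Z * Π + Z * (Β 1 * Γ 1))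
  Ρ-eq = K.trans (⟦cong⟧ both-count)
    (add {β 1} {λ n → s n ℕ.+ x n} (is _) (add {s} {x} (⟦shift⟧ (N other? 2)) (⟦shift-convolution⟧ (β 1) (γ 1))))
    where
    s = shift (N other? 2)
    x = shift (convolution (β 1) (γ 1))

  Π-eq : Π + Ρ ≈ Β 2 + 1#
  Π-eq = K.trans (K.sym (⟦+⟧ (N other? 2) (N both? 2))) (K.trans (⟦cong⟧ other-count) (add {β 2} {δ} (is _) ⟦δ⟧))

  Ε-eq : let b = Β 2 ; s = Z * (A 1 * A 1) ; x = Z * 1# ; t = Z * A 1 in
    Ε + (b + (b + (b + (b + (s + (s + (x + (x + (x + (x + x)))))))))) ≈
    A 2 + (t + (t + (t + (t + (t + (t + (t + (t + (Ρ + Ρ)))))))))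
  Ε-eq = K.trans (K.sym left) (K.trans (⟦cong⟧ ε-count) right)
    where
    s = Z * (A 1 * A 1)
    x = Z * 1#
    t = Z * A 1
    s≈ : ⟦ N (clashes? 0 2) 2 ⟧ ≈ s
    s≈ = K.trans (⟦cong⟧ (clash₀₂-count 0)) (⟦shift-convolution⟧ (a 1) (a 1))
    x≈ : ⟦ shift δ ⟧ ≈ x
    x≈ = K.trans (⟦shift⟧ δ) (K.*-congˡ {Z} ⟦δ⟧)
    t≈ : ⟦ shift (a 1) ⟧ ≈ t
    t≈ = ⟦shift⟧ (a 1)
    S = N (clashes? 0 2) 2
    X = shift δ
    Τ = shift (a 1)
    twice four′ : (ℕ → ℕ) → (ℕ → ℕ) → ℕ → ℕ
    twice f g n = f n ℕ.+ (f n ℕ.+ g n)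
    four′ f g = twice f (twice f g)
    add₂ : ∀ {f g x y} → ⟦ f ⟧ ≈ x → ⟦ g ⟧ ≈ y → ⟦ twice f g ⟧ ≈ x + (x + y)
    add₂ {f} {g} p q = add {f} {λ n → f n ℕ.+ g n} p (add {f} {g} p q)
    left = add {ε} {four′ (β 2) (twice S (four′ X X))} (is _)
      (add₂ {β 2} {twice (β 2) (twice S (four′ X X))} (is _) (add₂ {β 2} {twice S (four′ X X)} (is _)
        (add₂ {S} {four′ X X} s≈ (add₂ {X} {twice X X} x≈ (add₂ {X} {X} x≈ x≈)))))
    P = N both? 2
    P₂ : ℕ → ℕ
    P₂ n = P n ℕ.+ P n
    right = add {a 2} {four′ Τ (four′ Τ P₂)} (is _)
      (add₂ {Τ} {twice Τ (four′ Τ P₂)} t≈ (add₂ {Τ} {four′ Τ P₂} t≈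
        (add₂ {Τ} {twice Τ P₂} t≈ (add₂ {Τ} {P₂} t≈ (add {P} {P} (is _) (is _))))))

  -- The denominator of `Β 1` and `Γ 1`.
  d : Series′
  d = 1# + two * Z

  -- Inclusion-exclusion turns the decomposition by the first leg into the equation of all 4-regular maps,
  -- with renormalised weights.
  κ : Series′
  κ = two * (u * Z) - two - two * (Z * Γ 1) - u * (Z * A 1)

  open Renormalised κ public using (l; g; t; v; w; l-t; Ã; Ã-0; Ã-1; Ã-2; loop)

  -- Four linear relations hold for the series of spread, clashing and clash-free regions at
  -- `suc (suc h)`. Eliminating these, after multiplication by `u`, leaves `Z (1 - Z)` as
  -- coefficient of `A (suc (suc h))`, while the coefficients of `A (suc h)` behind a factor `Z` add
  -- up to `κ`.
  A-loop : ∀ h → l * A (suc h) ≈ u * (A BS.⊠ A) h + g * A (suc (suc h))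
  A-loop h = K.undiff (K.trans
    (K.solve 9 (λ Z A₁ Γ₁ A′ A″ S Σ′ B C →
      let one = con (+ 1) ; two = con (+ 2) ; u = one :+ Z
          κ = two :* (u :* Z) :- two :- two :* (Z :* Γ₁) :- u :* (Z :* A₁)
          e₁ = A′ :- (S :+ Z :* Σ′)
          e₂ = Σ′ :+ (B :+ (B :+ Z :* (A₁ :* A′))) :- (A″ :+ (Z :* A′ :+ Z :* A′))
          e₃ = B :- (A′ :+ (Z :* C :+ Z :* (A′ :* Γ₁)))
          e₄ = C :+ B :- A″
      in (u :- Z :* κ) :* A′ :- (u :* S :+ Z :* (one :- Z) :* A″) :=
         u :* e₁ :+ (u :* Z :* e₂ :+ ((:- (two :* Z)) :* e₃ :+ (:- (two :* Z :* Z)) :* e₄)))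
      K.refl Z (A 1) (Γ 1) (A (suc h)) (A (suc (suc h))) ((A BS.⊠ A) h) (Σₛ (suc (suc h))) (Β (suc (suc h))) (Γ (suc (suc h))))
    (K.plus-0 (K.times-0 u (K.diff (A-suc h))) (K.plus-0 (K.times-0 (u * Z) (K.diff (Σ-eq h)))
      (K.plus-0 (K.times-0 (- (two * Z)) (K.diff (Β-suc (suc h)))) (K.times-0 (- (two * Z * Z)) (K.diff (Γ+Β (suc (suc h)))))))))

  A≈Ã : ∀ h → A h ≈ Ã h
  A≈Ã = Unique.unique κ A-0 Ã-0 A-loop loop

  A₁-t : A 1 ≈ w * (1# - v)
  A₁-t = K.trans (A≈Ã 1) Ã-1

  A₂-t : A 2 ≈ w * w * (two - three * v)
  A₂-t = K.trans (A≈Ã 2) Ã-2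

  -- With two legs, `A 0 = 1` makes the digon and the pocket contribute the same term `Z * Γ 1` to
  -- `Β 1`, whence the `2` in `d`.
  dΓ₁ : d * Γ 1 ≈ A 1 - 1#
  dΓ₁ = K.undiff (K.trans
    (K.solve 5 (λ Z A₀ A₁ B C → let one = con (+ 1) in
       (one :+ con (+ 2) :* Z) :* C :- (A₁ :- one) :=
       (C :+ B :- A₁) :+ ((:- one) :* (B :- (A₀ :+ (Z :* C :+ Z :* (A₀ :* C)))) :+ (:- (one :+ Z :* C)) :* (A₀ :- one)))
     K.refl Z (A 0) (A 1) (Β 1) (Γ 1))
    (K.plus-0 (K.diff (Γ+Β 1)) (K.plus-0 (K.times-0 (- 1#) (K.diff (Β-suc 0))) (K.times-0 (- (1# + Z * Γ 1)) (K.diff A-0)))))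

  dΒ₁ : d * Β 1 ≈ two * (Z * A 1) + 1#
  dΒ₁ = K.undiff (K.trans
    (K.solve 4 (λ Z A₁ B C → let one = con (+ 1) ; two = con (+ 2) ; d = one :+ two :* Z in
       d :* B :- (two :* (Z :* A₁) :+ one) := d :* (C :+ B :- A₁) :+ (:- one) :* (d :* C :- (A₁ :- one)))
     K.refl Z (A 1) (Β 1) (Γ 1))
    (K.plus-0 (K.times-0 d (K.diff (Γ+Β 1))) (K.times-0 (- 1#) (K.diff dΓ₁))))

  duΒ₂ : d * (u * Β 2) ≈ d * A 1 + d * (Z * A 2) + Z * (A 1 * (A 1 - 1#))
  duΒ₂ = K.undiff (K.trans
    (K.solve 6 (λ Z A₁ A₂ B₂ C₂ C → let one = con (+ 1) ; d = one :+ con (+ 2) :* Z ; u = one :+ Z in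
       d :* (u :* B₂) :- (d :* A₁ :+ d :* (Z :* A₂) :+ Z :* (A₁ :* (A₁ :- one))) :=
       d :* (B₂ :- (A₁ :+ (Z :* C₂ :+ Z :* (A₁ :* C)))) :+ (d :* Z :* (C₂ :+ B₂ :- A₂) :+ Z :* A₁ :* (d :* C :- (A₁ :- one))))
     K.refl Z (A 1) (A 2) (Β 2) (Γ 2) (Γ 1))
    (K.plus-0 (K.times-0 d (K.diff (Β-suc 1))) (K.plus-0 (K.times-0 (d * Z) (K.diff (Γ+Β 2))) (K.times-0 (Z * A 1) (K.diff dΓ₁)))))

  -- Eliminating `Π` from the two relations between `Ρ` and `Π` gives `Ρ` with denominator `u`; a
  -- further `d * u` comes from `Β 2`, and `d * d` from the product of `Β 1` and `Γ 1`.
  dduuΡ : d * d * (u * u * Ρ) ≈ u * (d * (two * (Z * A 1) + 1#)) + Z * (d * (d * A 1 + d * (Z * A 2) + Z * (A 1 * (A 1 - 1#))) +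
          u * (d * d) + u * ((two * (Z * A 1) + 1#) * (A 1 - 1#)))
  dduuΡ = K.undiff (K.trans
    (K.solve 8 (λ Z A₁ A₂ B₁ B₂ C P Q → let one = con (+ 1) ; two = con (+ 2) ; d = one :+ two :* Z ; u = one :+ Z
                                            b = two :* (Z :* A₁) :+ one ; c = A₁ :- one
                                            b₂ = d :* A₁ :+ d :* (Z :* A₂) :+ Z :* (A₁ :* c) in
       d :* d :* (u :* u :* P) :- (u :* (d :* b) :+ Z :* (d :* b₂ :+ u :* (d :* d) :+ u :* (b :* c))) :=
       d :* d :* u :* (P :- (B₁ :+ (Z :* Q :+ Z :* (B₁ :* C)))) :+ (d :* d :* u :* Z :* (Q :+ P :- (B₂ :+ one)) :+
       (Z :* d :* (d :* (u :* B₂) :- b₂) :+ ((u :* d :+ Z :* u :* d :* C) :* (d :* B₁ :- b) :+ Z :* u :* b :* (d :* C :- c)))))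
     K.refl Z (A 1) (A 2) (Β 1) (Β 2) (Γ 1) Ρ Π)
    (K.plus-0 (K.times-0 (d * d * u) (K.diff Ρ-eq)) (K.plus-0 (K.times-0 (d * d * u * Z) (K.diff Π-eq))
      (K.plus-0 (K.times-0 (Z * d) (K.diff duΒ₂)) (K.plus-0 (K.times-0 (u * d + Z * u * d * Γ 1) (K.diff dΒ₁))
        (K.times-0 (Z * u * (two * (Z * A 1) + 1#)) (K.diff dΓ₁)))))))

-- Elimination of `t` by exact polynomial arithmetic.

module Elimination where

  open import Defs hiding (_⊕_; _⊗_; zeroS)
  import Defs
  open Recurrences using (shift)
  open FourLegs using (ε)
  open FormalSeries
  open LoopEquation
  open CountingSeries
  open import Data.Bool using (Bool; true; false; _∧_)
  import Data.Bool.Properties as Bool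
  open import Data.Nat using (ℕ; zero; suc; _∸_)
  open import Data.Integer using (ℤ; +_; -[1+_]; 0ℤ; 1ℤ)
  import Data.Integer as ℤ
  import Data.Integer.Properties as ℤ
  open import Data.List using (List; []; _∷_; map; applyUpTo; length)
  import Data.List.Properties as List
  open import Data.Product using (_,_)
  import Relation.Binary.PropositionalEquality as ≡
  open ≡ using (_≡_)

  open K using (_≈_; _+_; _*_; _-_; -_; 0#; 1#; ⟨_⟩; con; _:+_; _:*_; _:-_; :-_; _:=_)
  open KS using (Z)

  -- Abstracting over the coefficients lets the same Horner arithmetic be used twice: for
  -- polynomials in `t` over the integers, and for polynomials in `Z` over those.
  record Coefficients : Set₁ where
    field
      C          : Set
      zeroᶜ oneᶜ : C
      addᶜ mulᶜ  : C → C → C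
      negᶜ       : C → C
      isZeroᶜ    : C → Bool
      ev         : C → Series′
      ev-zero    : ev zeroᶜ ≈ 0#
      ev-one     : ev oneᶜ ≈ 1#
      ev-add     : ∀ c d → ev (addᶜ c d) ≈ ev c + ev d
      ev-mul     : ∀ c d → ev (mulᶜ c d) ≈ ev c * ev d
      ev-neg     : ∀ c → ev (negᶜ c) ≈ - ev c
      ev-isZero  : ∀ c → isZeroᶜ c ≡ true → ev c ≈ 0#

  module Horner (R : Coefficients) (x : Series′) where
    open Coefficients R

    eval : List C → Series′
    eval []      = 0#
    eval (c ∷ p) = ev c + x * eval p

    add : List C → List C → List C
    add []      q       = q
    add (c ∷ p) []      = c ∷ p
    add (c ∷ p) (d ∷ q) = addᶜ c d ∷ add p q

    mul : List C → List C → List C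
    mul []      q = []
    mul (c ∷ p) q = add (map (mulᶜ c) q) (zeroᶜ ∷ mul p q)

    neg : List C → List C
    neg = map negᶜ

    isZero : List C → Bool
    isZero []      = true
    isZero (c ∷ p) = isZeroᶜ c ∧ isZero p

    eval-add : ∀ p q → eval (add p q) ≈ eval p + eval q
    eval-add []      q       = K.sym (K.+-identityˡ _)
    eval-add (c ∷ p) []      = K.sym (K.+-identityʳ _)
    eval-add (c ∷ p) (d ∷ q) = K.trans (K.+-cong (ev-add c d) (K.*-congˡ {x} (eval-add p q)))
      (K.solve 5 (λ c d p q x → (c :+ d) :+ x :* (p :+ q) := (c :+ x :* p) :+ (d :+ x :* q)) K.refl (ev c) (ev d) (eval p) (eval q) x)

    eval-scale : ∀ c q → eval (map (mulᶜ c) q) ≈ ev c * eval q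
    eval-scale c []      = K.sym (K.zeroʳ (ev c))
    eval-scale c (d ∷ q) = K.trans (K.+-cong (ev-mul c d) (K.*-congˡ {x} (eval-scale c q)))
      (K.solve 4 (λ c d q x → c :* d :+ x :* (c :* q) := c :* (d :+ x :* q)) K.refl (ev c) (ev d) (eval q) x)

    eval-mul : ∀ p q → eval (mul p q) ≈ eval p * eval q
    eval-mul []      q = K.sym (K.zeroˡ (eval q))
    eval-mul (c ∷ p) q = K.trans (eval-add (map (mulᶜ c) q) (zeroᶜ ∷ mul p q))
      (K.trans (K.+-cong (eval-scale c q) (K.+-cong ev-zero (K.*-congˡ {x} (eval-mul p q))))
      (K.solve 4 (λ c p q x → c :* q :+ (con 0ℤ :+ x :* (p :* q)) := (c :+ x :* p) :* q) K.refl (ev c) (eval p) (eval q) x))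

    eval-neg : ∀ p → eval (neg p) ≈ - eval p
    eval-neg []      = K.solve 0 (con 0ℤ := :- con 0ℤ) K.refl
    eval-neg (c ∷ p) = K.trans (K.+-cong (ev-neg c) (K.*-congˡ {x} (eval-neg p)))
      (K.solve 3 (λ c p x → :- c :+ x :* :- p := :- (c :+ x :* p)) K.refl (ev c) (eval p) x)

    eval-isZero : ∀ p → isZero p ≡ true → eval p ≈ 0#
    eval-isZero []      _ = K.refl
    eval-isZero (c ∷ p) h = K.trans (K.+-cong (ev-isZero c (Bool.∧-conicalˡ _ _ h))
        (K.trans (K.*-congˡ {x} (eval-isZero p (Bool.∧-conicalʳ (isZeroᶜ c) _ h))) (K.zeroʳ x)))
      (K.+-identityˡ 0#)

    coefficients : Coefficients
    coefficients = record
      { C = List C ; zeroᶜ = [] ; oneᶜ = oneᶜ ∷ [] ; addᶜ = add ; mulᶜ = mul ; negᶜ = neg ; isZeroᶜ = isZero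
      ; ev = eval ; ev-zero = K.refl ; ev-one = K.trans (K.+-cong ev-one (K.zeroʳ x)) (K.+-identityʳ _)
      ; ev-add = eval-add ; ev-mul = eval-mul ; ev-neg = eval-neg ; ev-isZero = eval-isZero }

  isZeroℤ : ℤ → Bool
  isZeroℤ (+ zero) = true
  isZeroℤ _        = false

  integers : Coefficients
  integers = record
    { C = ℤ ; zeroᶜ = 0ℤ ; oneᶜ = 1ℤ ; addᶜ = ℤ._+_ ; mulᶜ = ℤ._*_ ; negᶜ = ℤ.-_ ; isZeroᶜ = isZeroℤ
    ; ev = ⟨_⟩ ; ev-zero = K.⟨0⟩ ; ev-one = K.⟨1⟩ ; ev-add = K.⟨+⟩ ; ev-mul = K.⟨*⟩ ; ev-neg = K.⟨-⟩
    ; ev-isZero = λ { (+ zero) _ → K.⟨0⟩ } }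

  -- Polynomials in Z whose coefficients are polynomials in t.
  module In-t = Horner integers t
  open Horner In-t.coefficients Z

  Poly : Set
  Poly = List (List ℤ)

  -- Reflected formulas with two readings, as series and as polynomials; `normal-sound` relates
  -- them, so that the large identities can be decided by computing with coefficients.
  data Expr : Set where
    var     : ℕ → Expr
    num     : ℤ → Expr
    _⊕_ _⊗_ : Expr → Expr → Expr
    ⊝_      : Expr → Expr

  infixl 6 _⊕_ _⊖_
  infixl 7 _⊗_
  infix 8 ⊝_

  _⊖_ : Expr → Expr → Expr
  e ⊖ f = e ⊕ ⊝ f

  value : (ℕ → Series′) → Expr → Series′
  value ρ (var i) = ρ i
  value ρ (num m) = ⟨ m ⟩
  value ρ (e ⊕ f) = value ρ e + value ρ f
  value ρ (e ⊗ f) = value ρ e * value ρ f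
  value ρ (⊝ e)   = - value ρ e

  normal : (ℕ → Poly) → Expr → Poly
  normal s (var i) = s i
  normal s (num m) = (m ∷ []) ∷ []
  normal s (e ⊕ f) = add (normal s e) (normal s f)
  normal s (e ⊗ f) = mul (normal s e) (normal s f)
  normal s (⊝ e)   = neg (normal s e)

  normal-sound : ∀ {ρ s} → (∀ i → ρ i ≈ eval (s i)) → ∀ e → value ρ e ≈ eval (normal s e)
  normal-sound h (var i) = h i
  normal-sound h (num m) = K.solve 3 (λ m t z → m := (m :+ t :* con 0ℤ) :+ z :* con 0ℤ) K.refl ⟨ m ⟩ t Z
  normal-sound {s = s} h (e ⊕ f) = K.trans (K.+-cong (normal-sound h e) (normal-sound h f)) (K.sym (eval-add (normal s e) (normal s f)))
  normal-sound {s = s} h (e ⊗ f) = K.trans (K.*-cong (normal-sound h e) (normal-sound h f)) (K.sym (eval-mul (normal s e) (normal s f)))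
  normal-sound {s = s} h (⊝ e)   = K.trans (K.-‿cong (normal-sound h e)) (K.sym (eval-neg (normal s e)))

  module Expressions (zᵉ tᵉ : Expr) where
    oneᵉ uᵉ dᵉ vᵉ a₁ᵉ a₂ᵉ : Expr
    oneᵉ = num 1ℤ
    uᵉ   = oneᵉ ⊕ zᵉ
    dᵉ   = oneᵉ ⊕ num (+ 2) ⊗ zᵉ
    vᵉ   = zᵉ ⊗ (oneᵉ ⊖ zᵉ) ⊗ (uᵉ ⊗ (tᵉ ⊗ tᵉ))
    a₁ᵉ  = uᵉ ⊗ tᵉ ⊗ (oneᵉ ⊖ vᵉ)
    a₂ᵉ  = uᵉ ⊗ tᵉ ⊗ (uᵉ ⊗ tᵉ) ⊗ (num (+ 2) ⊖ num (+ 3) ⊗ vᵉ)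

  open Expressions (var 0) (var 1)

  env : ℕ → Series′
  env 0 = Z
  env 1 = t
  env 2 = A 1
  env 3 = A 2
  env _ = 0#

  base : ℕ → Poly
  base 0 = [] ∷ (1ℤ ∷ []) ∷ []
  base 1 = (0ℤ ∷ 1ℤ ∷ []) ∷ []
  base _ = []

  polys : ℕ → Poly
  polys 2 = normal base a₁ᵉ
  polys 3 = normal base a₂ᵉ
  polys i = base i

  base-0 : Z ≈ eval (base 0)
  base-0 = K.solve 2 (λ z t → z := con 0ℤ :+ z :* ((con 1ℤ :+ t :* con 0ℤ) :+ z :* con 0ℤ)) K.refl Z t

  base-1 : t ≈ eval (base 1)
  base-1 = K.solve 2 (λ z t → t := (con 0ℤ :+ t :* (con 1ℤ :+ t :* con 0ℤ)) :+ z :* con 0ℤ) K.refl Z t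

  env-base : ℕ → Series′
  env-base 0 = Z
  env-base 1 = t
  env-base _ = 0#

  base-sound : ∀ i → env-base i ≈ eval (base i)
  base-sound 0             = base-0
  base-sound 1             = base-1
  base-sound (suc (suc i)) = K.refl

  polys-sound : ∀ i → env i ≈ eval (polys i)
  polys-sound 0 = base-0
  polys-sound 1 = base-1
  polys-sound 2 = K.trans A₁-t (normal-sound {env-base} {base} base-sound a₁ᵉ)
  polys-sound 3 = K.trans A₂-t (normal-sound {env-base} {base} base-sound a₂ᵉ)
  polys-sound (suc (suc (suc (suc i)))) = K.refl

  zᵉ tᵉ A₁ᵉ A₂ᵉ fᵉ b₁ᵉ b₂ᵉ pᵉ Wᵉ Nᵉ : Expr
  zᵉ  = var 0
  tᵉ  = var 1
  A₁ᵉ = var 2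
  A₂ᵉ = var 3
  fᵉ  = dᵉ ⊗ (oneᵉ ⊕ num (+ 3) ⊗ vᵉ) ⊖
        (dᵉ ⊗ uᵉ ⊖ zᵉ ⊗ (dᵉ ⊗ (num (+ 2) ⊗ (uᵉ ⊗ zᵉ) ⊖ num (+ 2) ⊖ uᵉ ⊗ (zᵉ ⊗ A₁ᵉ)) ⊖ num (+ 2) ⊗ (zᵉ ⊗ (A₁ᵉ ⊖ oneᵉ)))) ⊗ tᵉ
  b₁ᵉ = num (+ 2) ⊗ (zᵉ ⊗ A₁ᵉ) ⊕ oneᵉ
  b₂ᵉ = dᵉ ⊗ A₁ᵉ ⊕ dᵉ ⊗ (zᵉ ⊗ A₂ᵉ) ⊕ zᵉ ⊗ (A₁ᵉ ⊗ (A₁ᵉ ⊖ oneᵉ))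
  pᵉ  = uᵉ ⊗ (dᵉ ⊗ b₁ᵉ) ⊕ zᵉ ⊗ (dᵉ ⊗ b₂ᵉ ⊕ uᵉ ⊗ (dᵉ ⊗ dᵉ) ⊕ uᵉ ⊗ (b₁ᵉ ⊗ (A₁ᵉ ⊖ oneᵉ)))
  Wᵉ  = dᵉ ⊗ dᵉ ⊗ (uᵉ ⊗ uᵉ)
  Nᵉ  = zᵉ ⊗ (Wᵉ ⊗ A₂ᵉ ⊕ num (+ 8) ⊗ (zᵉ ⊗ (Wᵉ ⊗ A₁ᵉ)) ⊕ num (+ 2) ⊗ pᵉ ⊖ num (+ 4) ⊗ (dᵉ ⊗ (uᵉ ⊗ b₂ᵉ)) ⊖
        num (+ 2) ⊗ (zᵉ ⊗ (Wᵉ ⊗ (A₁ᵉ ⊗ A₁ᵉ))) ⊖ num (+ 5) ⊗ (zᵉ ⊗ Wᵉ))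

  -- The quadratic equation of `t`, with `κ` written out and multiplied by `-d`, so that `Γ 1` can
  -- be replaced by means of `dΓ₁`. Once `A 1` is expressed by `t`, it relates `Z` and `t` alone.
  f≈0 : value env fᵉ ≈ 0#
  f≈0 = K.trans
    (K.solve 4 (λ Z t A₁ Γ₁ →
      let one = con 1ℤ ; two = con (+ 2) ; u = one :+ Z ; d = one :+ two :* Z
          v = Z :* (one :- Z) :* (u :* (t :* t))
          κ = two :* (u :* Z) :- two :- two :* (Z :* Γ₁) :- u :* (Z :* A₁)
      in d :* (one :+ con (+ 3) :* v) :-
         (d :* u :- Z :* (d :* (two :* (u :* Z) :- two :- u :* (Z :* A₁)) :- two :* (Z :* (A₁ :- one)))) :* t :=
         (:- d) :* ((u :- Z :* κ) :* t :- (one :+ con (+ 3) :* v)) :+ two :* Z :* Z :* t :* (d :* Γ₁ :- (A₁ :- one)))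
      K.refl Z t (A 1) (Γ 1))
    (K.plus-0 (K.times-0 (- d) (K.diff l-t)) (K.times-0 (two * Z * Z * t) (K.diff dΓ₁)))

  M : Series′
  M = ⟦ shift ε ⟧

  M≈ : M ≈ Z * Ε
  M≈ = ⟦shift⟧ ε

  -- `W` is the square of `d * u`: the denominator of `Ρ`, which also clears that of `Β 2`. The
  -- remaining series in the count of scattered regions are polynomials in `Z`, `A 1` and `A 2`.
  WM≈N : value env Wᵉ * M ≈ value env Nᵉ
  WM≈N = K.trans (K.*-congˡ {value env Wᵉ} M≈) (K.undiff (K.trans
    (K.solve 6 (λ Z A₁ A₂ B₂ P E →
      let one = con 1ℤ ; two = con (+ 2) ; u = one :+ Z ; d = one :+ two :* Z ; c = A₁ :- one
          b₁ = two :* (Z :* A₁) :+ one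
          b₂ = d :* A₁ :+ d :* (Z :* A₂) :+ Z :* (A₁ :* c)
          p = u :* (d :* b₁) :+ Z :* (d :* b₂ :+ u :* (d :* d) :+ u :* (b₁ :* c))
          W = d :* d :* (u :* u)
          N = Z :* (W :* A₂ :+ con (+ 8) :* (Z :* (W :* A₁)) :+ two :* p :- con (+ 4) :* (d :* (u :* b₂)) :-
                two :* (Z :* (W :* (A₁ :* A₁))) :- con (+ 5) :* (Z :* W))
          s = Z :* (A₁ :* A₁) ; x = Z :* one ; t = Z :* A₁
          e = (E :+ (B₂ :+ (B₂ :+ (B₂ :+ (B₂ :+ (s :+ (s :+ (x :+ (x :+ (x :+ (x :+ x))))))))))) :-
              (A₂ :+ (t :+ (t :+ (t :+ (t :+ (t :+ (t :+ (t :+ (t :+ (P :+ P))))))))))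
      in W :* (Z :* E) :- N :=
         W :* Z :* e :+ (two :* Z :* (d :* d :* (u :* u :* P) :- p) :+ (:- (con (+ 4) :* Z :* d :* u)) :* (d :* (u :* B₂) :- b₂)))
      K.refl Z (A 1) (A 2) (Β 2) Ρ Ε)
    (K.plus-0 (K.times-0 (value env Wᵉ * Z) (K.diff Ε-eq)) (K.plus-0 (K.times-0 (two * Z) (K.diff dduuΡ))
      (K.times-0 (- (⟨ + 4 ⟩ * Z * d * u)) (K.diff duΒ₂))))))

  -- Obtained by eliminating t between W M = N and f = 0, with A 1 and A 2 expressed in Z and t.
  p₀ p₁ p₂ p₃ p₄ : List ℤ
  p₀ =
    + 0 ∷ + 0 ∷ + 0 ∷ + 0 ∷ + 0 ∷ + 0 ∷ + 459 ∷ -[1+ 323 ] ∷ -[1+ 5291 ] ∷ -[1+ 15065 ] ∷ -[1+ 5057 ] ∷ + 84816 ∷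
    + 271088 ∷ + 416694 ∷ + 371013 ∷ -[1+ 61799 ] ∷ -[1+ 2189051 ] ∷ -[1+ 8676065 ] ∷ -[1+ 20346824 ] ∷
    -[1+ 34438679 ] ∷ -[1+ 50865759 ] ∷ -[1+ 70445789 ] ∷ -[1+ 77700707 ] ∷ -[1+ 53902539 ] ∷ -[1+ 11487415 ] ∷
    + 32903780 ∷ + 88013855 ∷ + 137254720 ∷ + 136685808 ∷ + 89642496 ∷ + 40666912 ∷ + 13296640 ∷ + 3085056 ∷
    + 470016 ∷ + 34560 ∷ []
  p₁ =
    -[1+ 458 ] ∷ + 324 ∷ + 7128 ∷ + 16524 ∷ -[1+ 12086 ] ∷ -[1+ 162683 ] ∷ -[1+ 403801 ] ∷ -[1+ 359147 ] ∷
    + 376451 ∷ + 1789698 ∷ + 4981646 ∷ + 13829270 ∷ + 30123737 ∷ + 47872440 ∷ + 64208240 ∷ + 87522160 ∷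
    + 106528060 ∷ + 85642174 ∷ + 35144838 ∷ -[1+ 4508469 ] ∷ -[1+ 60806217 ] ∷ -[1+ 150578623 ] ∷
    -[1+ 188029217 ] ∷ -[1+ 139619343 ] ∷ -[1+ 90931243 ] ∷ -[1+ 83606367 ] ∷ -[1+ 77433727 ] ∷ -[1+ 52342143 ] ∷
    -[1+ 25175679 ] ∷ -[1+ 8765951 ] ∷ -[1+ 2170367 ] ∷ -[1+ 350207 ] ∷ -[1+ 27647 ] ∷ []
  p₂ =
    + 0 ∷ + 0 ∷ -[1+ 14822 ] ∷ -[1+ 177875 ] ∷ -[1+ 1036637 ] ∷ -[1+ 3949073 ] ∷ -[1+ 10931381 ] ∷
    -[1+ 23056811 ] ∷ -[1+ 38235887 ] ∷ -[1+ 50916941 ] ∷ -[1+ 53212817 ] ∷ -[1+ 34699787 ] ∷ + 14070132 ∷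
    + 87445170 ∷ + 157987004 ∷ + 198291668 ∷ + 192963208 ∷ + 117599270 ∷ -[1+ 31944174 ] ∷ -[1+ 174247271 ] ∷
    -[1+ 205925901 ] ∷ -[1+ 133851191 ] ∷ -[1+ 49602397 ] ∷ -[1+ 6531743 ] ∷ + 4427104 ∷ + 4253056 ∷ + 2314432 ∷
    + 918016 ∷ + 263168 ∷ + 49152 ∷ + 4608 ∷ []
  p₃ =
    + 0 ∷ + 0 ∷ + 0 ∷ + 0 ∷ + 2916 ∷ + 21870 ∷ + 30618 ∷ -[1+ 320273 ] ∷ -[1+ 2248559 ] ∷ -[1+ 7728371 ] ∷
    -[1+ 16732601 ] ∷ -[1+ 22581827 ] ∷ -[1+ 13286375 ] ∷ + 15223446 ∷ + 46840566 ∷ + 55276038 ∷ + 31178064 ∷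
    -[1+ 6549935 ] ∷ -[1+ 30535413 ] ∷ -[1+ 30748271 ] ∷ -[1+ 17405371 ] ∷ -[1+ 4833567 ] ∷ + 1002240 ∷
    + 1843072 ∷ + 1059200 ∷ + 383488 ∷ + 93696 ∷ + 14336 ∷ + 1024 ∷ []
  p₄ =
    + 0 ∷ + 0 ∷ + 0 ∷ + 0 ∷ + 0 ∷ + 0 ∷ -[1+ 728 ] ∷ -[1+ 8747 ] ∷ -[1+ 48113 ] ∷ -[1+ 160379 ] ∷ -[1+ 356966 ] ∷
    -[1+ 538487 ] ∷ -[1+ 495179 ] ∷ -[1+ 79703 ] ∷ + 575721 ∷ + 1075140 ∷ + 1073646 ∷ + 586836 ∷ -[1+ 37800 ] ∷
    -[1+ 439583 ] ∷ -[1+ 506575 ] ∷ -[1+ 362879 ] ∷ -[1+ 185567 ] ∷ -[1+ 69119 ] ∷ -[1+ 18175 ] ∷ -[1+ 3071 ] ∷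
    -[1+ 255 ] ∷ []

  inZ : List ℤ → Poly
  inZ = map (_∷ [])

  -- Exact division by a polynomial F = 1 - t + Z F′, starting from the lowest power of Z.
  quotient : ℕ → Poly → Poly → Poly
  quotient zero    F′ R        = []
  quotient (suc n) F′ []       = []
  quotient (suc n) F′ (r ∷ R) = q ∷ quotient n F′ (map trim (add R (map (λ f → In-t.neg (In-t.mul q f)) F′)))
    where
    sums : ℤ → List ℤ → List ℤ
    sums s []       = []
    sums s (c ∷ cs) = (s ℤ.+ c) ∷ sums (s ℤ.+ c) cs
    cons : ℤ → List ℤ → List ℤ
    cons (+ zero) [] = []
    cons c        cs = c ∷ cs
    trim : List ℤ → List ℤ
    trim []       = []
    trim (c ∷ cs) = cons c (trim cs)
    q : List ℤ
    -- Dividing by `1 - t` replaces coefficients by their partial sums; when the division is exact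
    -- the last sum is zero, and trimming drops it.
    q = trim (sums 0ℤ r)

  tailᴾ : Poly → Poly
  tailᴾ []      = []
  tailᴾ (_ ∷ P) = P

  divisible : Poly → Poly → Bool
  divisible F R = isZero (add R (neg (mul (quotient (length R) (tailᴾ F) R) F)))

  -- The quotient is a proposal that the check multiplies back and compares, so the argument rests
  -- on `isZero` alone.
  divisible-sound : ∀ F R → divisible F R ≡ true → eval F ≈ 0# → eval R ≈ 0#
  divisible-sound F R h F≈0 = K.trans (K.undiff (K.trans (K.sym (K.trans (eval-add R (neg (mul Q F)))
      (K.+-congˡ {eval R} (eval-neg (mul Q F))))) (eval-isZero (add R (neg (mul Q F))) h)))
    (K.trans (eval-mul Q F) (K.trans (K.*-congˡ {eval Q} F≈0) (K.zeroʳ (eval Q))))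
    where Q = quotient (length R) (tailᴾ F) R

  fᴾ Wᴾ Nᴾ : Poly
  fᴾ = normal polys fᵉ
  Wᴾ = normal polys Wᵉ
  Nᴾ = normal polys Nᵉ

  -- `W⁴` times the polynomial with coefficients `p₀` to `p₄` at `N / W`, in Horner form and free of
  -- division.
  resultant : Poly → Poly → Poly
  resultant W N = add (mul W³ (mul W (inZ p₀))) (mul N (add (mul W³ (inZ p₁)) (mul N (add (mul W² (inZ p₂))
    (mul N (add (mul W (inZ p₃)) (mul N (inZ p₄))))))))
    where W² = mul W W
          W³ = mul W W²

  -- Evaluation carries out the division: as a polynomial in `Z` and `t`, the cleared equation for
  -- `M` is a multiple of the equation of `t`.
  certificate : divisible fᴾ (resultant Wᴾ Nᴾ) ≡ true
  certificate = ≡.refl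

  abstract
    resultant≈0 : eval (resultant Wᴾ Nᴾ) ≈ 0#
    resultant≈0 = divisible-sound fᴾ (resultant Wᴾ Nᴾ) certificate
      (K.trans (K.sym (normal-sound {env} {polys} polys-sound fᵉ)) f≈0)

  zero-at : ∀ n → 0# n ≡ 0ℤ
  zero-at zero    = ≡.refl
  zero-at (suc n) = ≡.refl

  coeff-eval : ∀ p → coeff p ≈ eval (inZ p)
  coeff-eval []      n = ≡.sym (zero-at n)
  coeff-eval (c ∷ p) n = ≡.trans (split n) (≡.cong₂ ℤ._+_
    (K.solve 2 (λ c t → c := c :+ t :* con 0ℤ) K.refl ⟨ c ⟩ t n) (K.*-congˡ {Z} (coeff-eval p) n))
    where
    split : coeff (c ∷ p) ≈ ⟨ c ⟩ + Z * coeff p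
    split zero    = ≡.sym (≡.trans (≡.cong (λ z → c ℤ.+ z) (KS.Z-⊠ (coeff p) 0)) (ℤ.+-identityʳ c))
    split (suc n) = ≡.sym (≡.trans (≡.cong (λ z → 0ℤ ℤ.+ z) (KS.Z-⊠ (coeff p) (suc n))) (ℤ.+-identityˡ _))

  ⊗-⊠ : ∀ f g → (f Defs.⊗ g) ≈ f * g
  ⊗-⊠ f g n = ≡.trans (≡.cong sumℤ (List.map-applyUpTo (λ i → i) (λ i → f i ℤ.* g (n ∸ i)) (suc n))) (go f n)
    where
    go : ∀ f n → sumℤ (applyUpTo (λ i → f i ℤ.* g (n ∸ i)) (suc n)) ≡ (f KS.⊠ g) n
    go f zero    = ℤ.+-identityʳ _
    go f (suc n) = ≡.cong (λ z → f 0 ℤ.* g (suc n) ℤ.+ z) (go (λ i → f (suc i)) n)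

  evalP-∷ : ∀ p ps F {y} → evalP ps F ≈ y → evalP (p ∷ ps) F ≈ eval (inZ p) + F * y
  evalP-∷ p ps F h = K.+-cong (coeff-eval p) (K.trans (⊗-⊠ F (evalP ps F)) (K.*-congˡ {F} h))

  annihilator : List (List ℤ)
  annihilator = p₀ ∷ p₁ ∷ p₂ ∷ p₃ ∷ p₄ ∷ []

  private
    mulᴱ : ∀ {x y} p q → x ≈ eval p → y ≈ eval q → x * y ≈ eval (mul p q)
    mulᴱ p q h k = K.trans (K.*-cong h k) (K.sym (eval-mul p q))

    addᴱ : ∀ {x y} p q → x ≈ eval p → y ≈ eval q → x + y ≈ eval (add p q)
    addᴱ p q h k = K.trans (K.+-cong h k) (K.sym (eval-add p q))

  resultant-sound : ∀ {w n} W N → w ≈ eval W → n ≈ eval N →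
    w * (w * w) * (w * eval (inZ p₀)) + n * (w * (w * w) * eval (inZ p₁) + n * (w * w * eval (inZ p₂) +
      n * (w * eval (inZ p₃) + n * eval (inZ p₄)))) ≈ eval (resultant W N)
  resultant-sound W N hw hn =
    addᴱ (mul W³ (mul W q₀)) (mul N r₁) (mulᴱ W³ (mul W q₀) h³ (mulᴱ W q₀ hw K.refl)) (mulᴱ N r₁ hn
    (addᴱ (mul W³ q₁) (mul N r₂) (mulᴱ W³ q₁ h³ K.refl) (mulᴱ N r₂ hn
    (addᴱ (mul W² q₂) (mul N r₃) (mulᴱ W² q₂ h² K.refl) (mulᴱ N r₃ hn
    (addᴱ (mul W q₃) (mul N q₄) (mulᴱ W q₃ hw K.refl) (mulᴱ N q₄ hn K.refl)))))))
    where
    q₀ = inZ p₀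
    q₁ = inZ p₁
    q₂ = inZ p₂
    q₃ = inZ p₃
    q₄ = inZ p₄
    W² = mul W W
    W³ = mul W W²
    r₃ = add (mul W q₃) (mul N q₄)
    r₂ = add (mul W² q₂) (mul N r₃)
    r₁ = add (mul W³ q₁) (mul N r₂)
    h² = mulᴱ W W hw hw
    h³ = mulᴱ W W² hw h²

  cleared : let W = value env Wᵉ in W * (W * (W * W)) * evalP annihilator M ≈ 0#
  cleared = K.trans (K.*-congˡ {W * (W * (W * W))} expand) (K.trans
    (K.solve 7 (λ W M p₀ p₁ p₂ p₃ p₄ → let N = W :* M ; W³ = W :* (W :* W) in
       W :* (W :* (W :* W)) :* (p₀ :+ M :* (p₁ :+ M :* (p₂ :+ M :* (p₃ :+ M :* (p₄ :+ M :* con 0ℤ))))) :=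
       W³ :* (W :* p₀) :+ N :* (W³ :* p₁ :+ N :* (W :* W :* p₂ :+ N :* (W :* p₃ :+ N :* p₄))))
     K.refl W M P₀ P₁ P₂ P₃ P₄)
    (K.trans (resultant-sound Wᴾ Nᴾ (normal-sound {env} {polys} polys-sound Wᵉ)
       (K.trans WM≈N (normal-sound {env} {polys} polys-sound Nᵉ))) resultant≈0))
    where
    W P₀ P₁ P₂ P₃ P₄ : Series′
    W = value env Wᵉ
    P₀ = eval (inZ p₀)
    P₁ = eval (inZ p₁)
    P₂ = eval (inZ p₂)
    P₃ = eval (inZ p₃)
    P₄ = eval (inZ p₄)
    expand : evalP annihilator M ≈ P₀ + M * (P₁ + M * (P₂ + M * (P₃ + M * (P₄ + M * ⟨ 0ℤ ⟩))))
    expand = evalP-∷ p₀ (p₁ ∷ p₂ ∷ p₃ ∷ p₄ ∷ []) M (evalP-∷ p₁ (p₂ ∷ p₃ ∷ p₄ ∷ []) M (evalP-∷ p₂ (p₃ ∷ p₄ ∷ []) M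
      (evalP-∷ p₃ (p₄ ∷ []) M (evalP-∷ p₄ [] M (λ n → ≡.sym (zero-at n))))))

  algebraic : Algebraic M
  -- The nonzero coefficient is the `459` of `p₀` at exponent 6. As `p₁` begins with `-459` and `M`
  -- has no constant term, the equation makes `M` begin with the sixth power of the variable, the
  -- rooted octahedron. The factor `W⁴` can be cancelled since `d` and `u` have constant term 1.
  algebraic = annihilator , (0 , 6 , λ ()) , λ n → ≡.trans
    (KS.unit-cancel (W * (W * (W * W))) (evalP annihilator M) ≡.refl
      (λ n → ≡.trans (cleared n) (zero-at n)) n) ≡.refl
    where
    W = value env Wᵉ

-- Peeling in arbitrary genus, Euler's relation and the covering of faces.

module AnyGenus where

  open import Defs using (iter; SameOrbit; HasOrbits; here)
  open Trees
  open Models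
  open import Algebra.Bundles using (CommutativeMonoid)
  open import Data.Nat using (ℕ; zero; suc; _+_; _≤_)
  import Data.Nat.Properties as ℕ
  open import Data.Nat.Tactic.RingSolver using (solve-∀)
  open import Data.Fin as Fin using (Fin; toℕ)
  import Data.Fin.Properties as Fin
  open import Data.List using (List; []; _∷_; _++_; length; concat; lookup)
  import Data.List.Properties as List
  open import Data.List.Membership.Propositional using (_∈_)
  import Data.List.Membership.Propositional.Properties as ∈
  open import Data.List.Relation.Unary.Any as Any using (Any; here; there)
  import Data.List.Relation.Unary.Any.Properties as Any
  open import Data.List.Relation.Unary.All using ([]; _∷_)
  open import Data.List.Relation.Unary.AllPairs using ([]; _∷_)
  open import Data.List.Relation.Binary.Pointwise using (Pointwise; []; _∷_)
  open import Data.List.Relation.Binary.Permutation.Propositional using (_↭_)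
  import Data.List.Relation.Binary.Permutation.Propositional.Properties as ↭
  open import Data.Product using (∃; _×_; _,_)
  open import Data.Sum using (inj₁; inj₂)
  open import Relation.Binary.PropositionalEquality

  module Orbits {N : ℕ} (f : Fin N → Fin N) (injective : ∀ {x y} → f x ≡ f y → x ≡ y) where

    iter-+ : ∀ m n x → iter f (m + n) x ≡ iter f m (iter f n x)
    iter-+ zero    n x = refl
    iter-+ (suc m) n x = cong f (iter-+ m n x)

    iter-suc : ∀ m x → iter f m (f x) ≡ f (iter f m x)
    iter-suc zero    x = refl
    iter-suc (suc m) x = cong f (iter-suc m x)

    iter-injective : ∀ m {x y} → iter f m x ≡ iter f m y → x ≡ y
    iter-injective zero    eq = eq
    iter-injective (suc m) eq = iter-injective m (injective eq)

    period : ∀ x → ∃ λ k → iter f (suc k) x ≡ x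
    period x with Fin.pigeonhole (ℕ.n<1+n N) (λ (i : Fin (suc N)) → iter f (toℕ i) x)
    ... | i , j , i<j , eq with ℕ.m≤n⇒∃[o]m+o≡n i<j
    ... | o , eq′ = o , iter-injective (toℕ i) (begin
      iter f (toℕ i) (iter f (suc o) x)  ≡⟨ sym (iter-+ (toℕ i) (suc o) x) ⟩
      iter f (toℕ i + suc o) x           ≡⟨ cong (λ n → iter f n x) (trans (ℕ.+-suc (toℕ i) o) eq′) ⟩
      iter f (toℕ j) x                   ≡⟨ sym eq ⟩
      iter f (toℕ i) x                   ∎)
      where open ≡-Reasoning

    orbit-refl : ∀ {x} → SameOrbit f x x
    orbit-refl = 0 , refl

    orbit-step : ∀ {x} → SameOrbit f x (f x)
    orbit-step = 1 , refl

    orbit-trans : ∀ {x y z} → SameOrbit f x y → SameOrbit f y z → SameOrbit f x z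
    orbit-trans {x} (m , refl) (n , refl) = n + m , iter-+ n m x

    orbit-back : ∀ {x} → SameOrbit f (f x) x
    orbit-back {x} with period x
    ... | k , eq = k , trans (iter-suc k x) eq

    orbit-sym : ∀ {x y} → SameOrbit f x y → SameOrbit f y x
    orbit-sym (zero  , refl) = 0 , refl
    orbit-sym (suc k , refl) = orbit-trans orbit-back (orbit-sym (k , refl))

    orbits-bounded : ∀ {k} (reps : List (Fin N)) → HasOrbits f k → (∀ x → Any (SameOrbit f x) reps) → k ≤ length reps
    orbits-bounded {k} reps (rep , _ , distinct) covers = Fin.injective⇒≤ {f = λ i → Any.index (covers (rep i))} λ {i} {j} eq →
      distinct i j (orbit-trans (Any.lookup-index (covers (rep i)))
        (orbit-sym (subst (λ k → SameOrbit f (rep j) (lookup reps k)) (sym eq) (Any.lookup-index (covers (rep j))))))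

  ++-monoid : Set → CommutativeMonoid _ _
  ++-monoid A = record { isCommutativeMonoid = ↭.++-isCommutativeMonoid {A = A} }

  -- Peeling a map of arbitrary genus: the unexplored part is bounded by several cycles of legs,
  -- and joining legs of two different cycles merges them.
  module Peeling {D : Set} (σ α : D → D) (σ⁴ : ∀ x → σ (σ (σ (σ x))) ≡ x) where
    open Explored σ α

    data Peel : List (List D) → List D → ℕ → ℕ → Set where
      done  : Peel [] [] 0 0
      face  : ∀ {cs es f g} → Peel cs es f g → Peel ([] ∷ cs) es (suc f) g
      split : ∀ {d u xs ys cs es f g} → α d ≡ u → α u ≡ d →
              Peel (xs ∷ ys ∷ cs) es f g → Peel ((d ∷ xs ++ u ∷ ys) ∷ cs) es f g
      new   : ∀ {d e s cs es f g} → α d ≡ e → α e ≡ d →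
              Peel ((σ e ∷ σ (σ e) ∷ σ (σ (σ e)) ∷ s) ∷ cs) es f g → Peel ((d ∷ s) ∷ cs) (e ∷ es) f g
      merge : ∀ {d u s xs ys cs cs′ es f g} → α d ≡ u → α u ≡ d →
              Peel ((ys ++ xs ++ s) ∷ cs ++ cs′) es f g → Peel ((d ∷ s) ∷ cs ++ (xs ++ u ∷ ys) ∷ cs′) es f (suc g)

    private
      legCount : List (List D) → ℕ
      legCount cs = length (concat cs)

      legCount-++ : ∀ cs cs′ → legCount (cs ++ cs′) ≡ legCount cs + legCount cs′
      legCount-++ cs cs′ = trans (cong length (sym (List.concat-++ cs cs′))) (List.length-++ (concat cs))

    -- Each peeling step changes both sides equally: a face closes one cycle, a split trades two
    -- legs for a cycle, a merge loses two legs and a cycle. For one initial cycle of four legs, the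
    -- vertex they belong to included, it reads V - E + f = 2 - 2 g.
    euler : ∀ {cs es f g} → Peel cs es f g →
            length (concat cs) + (length es + length es) + (length cs + length cs) ≡ (f + f) + (g + g + (g + g))
    euler done = refl
    euler (face {cs} {es} {f} {g} p) = trans (lemma₁ (legCount cs) (length es) (length cs)) (trans (cong (2 +_) (euler p)) (lemma₂ f g))
      where
      lemma₁ : ∀ x e c → x + (e + e) + (suc c + suc c) ≡ 2 + (x + (e + e) + (c + c))
      lemma₁ = solve-∀
      lemma₂ : ∀ f g → 2 + (f + f + (g + g + (g + g))) ≡ suc f + suc f + (g + g + (g + g))
      lemma₂ = solve-∀
    euler (split {d} {u} {xs} {ys} {cs} {es} _ _ p) = trans
      (cong (λ n → n + (length es + length es) + (suc (length cs) + suc (length cs)))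
        (trans (List.length-++ (d ∷ xs ++ u ∷ ys)) (cong (λ n → suc n + legCount cs) (List.length-++ xs))))
      (trans (lemma (length xs) (length ys) (legCount cs) (length es) (length cs))
      (trans (cong (λ n → n + (length es + length es) + (suc (suc (length cs)) + suc (suc (length cs))))
        (sym (trans (List.length-++ xs) (cong (length xs +_) (List.length-++ ys))))) (euler p)))
      where
      lemma : ∀ x y r e c → suc (x + suc y) + r + (e + e) + (suc c + suc c) ≡ x + (y + r) + (e + e) + (suc (suc c) + suc (suc c))
      lemma = solve-∀
    euler (new {s = s} {cs} {es} _ _ p) = trans
      (lemma (length (s ++ concat cs)) (length es) (length cs)) (euler p)
      where
      lemma : ∀ x e c → suc x + (suc e + suc e) + (suc c + suc c) ≡ suc (suc (suc x)) + (e + e) + (suc c + suc c)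
      lemma = solve-∀
    euler (merge {d} {u} {s} {xs} {ys} {cs} {cs′} {es} {f} {g} _ _ p) = trans
      (cong₂ (λ n k → n + (length es + length es) + (suc k + suc k))
        (trans (cong suc (trans (List.length-++ s) (cong (length s +_) (trans (legCount-++ cs _)
          (cong (legCount cs +_) (trans (List.length-++ (xs ++ u ∷ ys)) (cong (_+ legCount cs′) (List.length-++ xs)))))))) refl)
        (List.length-++ cs))
      (trans (lemma (length s) (length xs) (length ys) (legCount cs) (legCount cs′) (length es) (length cs) (length cs′))
      (trans (cong (4 +_) (trans (cong₂ (λ n k → n + (length es + length es) + (suc k + suc k))
        (sym (trans (List.length-++ (ys ++ xs ++ s)) (cong₂ _+_ (trans (List.length-++ ys) (cong (length ys +_) (List.length-++ xs)))
          (legCount-++ cs cs′)))) (sym (List.length-++ cs))) (euler p))) (lemma′ f g)))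
      where
      lemma : ∀ s x y c c′ e k k′ → suc (s + (c + (x + suc y + c′))) + (e + e) + (suc (k + suc k′) + suc (k + suc k′)) ≡
              4 + (y + (x + s) + (c + c′) + (e + e) + (suc (k + k′) + suc (k + k′)))
      lemma = solve-∀
      lemma′ : ∀ f g → 4 + (f + f + (g + g + (g + g))) ≡ f + f + (suc g + suc g + (suc g + suc g))
      lemma′ = solve-∀

    data Forest : List (List D) → List D → Set where
      []  : Forest [] []
      _∷_ : ∀ {t c cs es fs} → Real t c es → Forest cs fs → Forest (c ∷ cs) (es ++ fs)

    -- Without merges no edge ever connects two boundary cycles, so each cycle bounds a region of
    -- its own.
    forest : ∀ {cs es f} → Peel cs es f 0 → Forest cs es
    forest done     = []
    forest (face p) = nil ∷ forest p
    forest (split {d} {u} {xs} {ys} {cs} du ud p) = go refl (forest p)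
      where
      go : ∀ {cs″ es} → cs″ ≡ xs ∷ ys ∷ cs → Forest cs″ es → Forest ((d ∷ xs ++ u ∷ ys) ∷ cs) es
      go refl (_∷_ {es = es} a (_∷_ {es = fs} {gs} b r)) =
        subst (Forest ((d ∷ xs ++ u ∷ ys) ∷ cs)) (List.++-assoc es fs gs) (join du ud a b ∷ r)
    forest (new {d} {e} {s} {cs} de ed p) = go refl (forest p)
      where
      go : ∀ {cs″ es} → cs″ ≡ (σ e ∷ σ (σ e) ∷ σ (σ (σ e)) ∷ s) ∷ cs → Forest cs″ es → Forest ((d ∷ s) ∷ cs) (e ∷ es)
      go refl (a ∷ r) = new de ed a ∷ r

    single-tree : ∀ {w es} → Forest (w ∷ []) es → ∃ λ t → Real t w es
    single-tree (_∷_ {es = es} a []) = _ , subst (Real _ _) (sym (List.++-identityʳ es)) a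

    -- φ = σ ∘ α permutes the darts around each face.
    module Faces (_≈_ : D → D → Set) (≈-refl : ∀ {x} → x ≈ x) (≈-sym : ∀ {x y} → x ≈ y → y ≈ x)
      (≈-trans : ∀ {x y z} → x ≈ y → y ≈ z → x ≈ z) (≈-φ : ∀ {x} → x ≈ σ (α x)) where

      φ : ∀ {x y} → α x ≡ y → x ≈ σ y
      φ refl = ≈-φ

      -- The corners between consecutive legs belong to the same face.
      data Chain (a : D) : List D → D → Set where
        end : ∀ {b} → a ≈ b → Chain a [] b
        _∷_ : ∀ {x xs b} → a ≈ x → Chain (σ x) xs b → Chain a (x ∷ xs) b

      chain-≈ : ∀ {a a′ xs b} → a′ ≈ a → Chain a xs b → Chain a′ xs b
      chain-≈ p (end q) = end (≈-trans p q)
      chain-≈ p (q ∷ c) = ≈-trans p q ∷ c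

      chain-++ : ∀ {a b c} xs {ys} → Chain a xs b → Chain b ys c → Chain a (xs ++ ys) c
      chain-++ []       (end p) d = chain-≈ p d
      chain-++ (x ∷ xs) (p ∷ c) d = p ∷ chain-++ xs c d

      chain-split : ∀ {a b u} xs {ys} → Chain a (xs ++ u ∷ ys) b → Chain a xs u × Chain (σ u) ys b
      chain-split []       (p ∷ c) = end p , c
      chain-split (x ∷ xs) (p ∷ c) with chain-split xs c
      ... | l , r = p ∷ l , r

      -- The dart `o` marks the face at the corner before the first leg. When the legs are used up
      -- it is all that remembers the face which the empty cycle bounds.
      Boundary : D → List D → Set
      Boundary o c = Chain o c o

      chain-start : ∀ {P : D → Set} {a xs b} → (∀ {x y} → x ≈ y → P y → P x) → Chain a xs b → (∀ {x} → x ∈ xs → P x) → P b → P a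
      chain-start r (end p) h pb = r p pb
      chain-start r (p ∷ c) h pb = r p (h (here refl))

      Covered : List D → D → Set
      Covered reps x = Any (x ≈_) reps

      covered-≈ : ∀ {reps x y} → x ≈ y → Covered reps y → Covered reps x
      covered-≈ p = Any.map (≈-trans p)

      -- The list bounds the number of faces from above. For a given map the opposite bound is the
      -- assumption of planarity; for a map built from a tree it is supplied by labels.
      record Cover (os : List D) (cs : List (List D)) (es : List D) (f : ℕ) : Set where
        field
          reps  : List D
          size  : length reps ≡ f
          os⊆   : ∀ {x} → x ∈ os → Covered reps x
          cs⊆   : ∀ {x} → x ∈ concat cs → Covered reps x
          es⊆   : ∀ {x} → x ∈ darts es → Covered reps x
      open Cover

      pointwise-split : ∀ {os c} cs {cs′} → Pointwise Boundary os (cs ++ c ∷ cs′) →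
        ∃ λ os₁ → ∃ λ o → ∃ λ os₂ → os ≡ os₁ ++ o ∷ os₂ × Boundary o c × Pointwise Boundary (os₁ ++ os₂) (cs ++ cs′)
      pointwise-split []       (b ∷ bs) = [] , _ , _ , refl , b , bs
      pointwise-split (c ∷ cs) (b ∷ bs) with pointwise-split cs bs
      ... | os₁ , o , os₂ , refl , b′ , bs′ = _ ∷ os₁ , o , os₂ , refl , b′ , b ∷ bs′

      cover : ∀ {cs es f g os} → Peel cs es f g → Pointwise Boundary os cs → Cover os cs es f
      cover done [] = record { reps = [] ; size = refl ; os⊆ = λ () ; cs⊆ = λ () ; es⊆ = λ () }
      cover (face p) (_∷_ {x = o} b bs) = record
        { reps = o ∷ reps c ; size = cong suc (size c)
        ; os⊆ = λ { (here refl) → here ≈-refl ; (there m) → there (os⊆ c m) }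
        ; cs⊆ = λ m → there (cs⊆ c m) ; es⊆ = λ m → there (es⊆ c m) }
        where c = cover p bs
      cover (split {d} {u} {xs} {ys} {cs} du ud p) (_∷_ {x = o} (o≈d ∷ ch) bs) with chain-split xs ch
      ... | left , right = record
        { reps = reps c ; size = size c ; os⊆ = λ { (here refl) → os⊆ c (there (here refl)) ; (there m) → os⊆ c (there (there m)) }
        ; cs⊆ = legs⊆ ; es⊆ = es⊆ c }
        where
        c = cover p (chain-≈ (φ ud) left ∷ chain-≈ (≈-trans o≈d (φ du)) right ∷ bs)
        legs⊆ : ∀ {x} → x ∈ d ∷ (xs ++ u ∷ ys) ++ concat cs → Covered (reps c) x
        legs⊆ (here refl) = covered-≈ (≈-sym o≈d) (os⊆ c (there (here refl)))
        legs⊆ (there m) with ∈.∈-++⁻ (xs ++ u ∷ ys) m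
        ... | inj₂ k = cs⊆ c (∈.∈-++⁺ʳ xs (∈.∈-++⁺ʳ ys k))
        ... | inj₁ k with ∈.∈-++⁻ xs k
        ... | inj₁ i = cs⊆ c (∈.∈-++⁺ˡ i)
        ... | inj₂ (here refl) = os⊆ c (here refl)
        ... | inj₂ (there i) = cs⊆ c (∈.∈-++⁺ʳ xs (∈.∈-++⁺ˡ i))
      cover (new {d} {e} {s} {cs} {es} de ed p) (_∷_ {x = o} (o≈d ∷ ch) bs) = record
        { reps = reps c ; size = size c ; os⊆ = os⊆ c ; cs⊆ = legs⊆ ; es⊆ = darts⊆ }
        where
        c = cover p ((≈-trans o≈d (φ de) ∷ ≈-refl ∷ ≈-refl ∷
          subst (λ z → Chain z s o) (sym (σ⁴ e)) (chain-≈ (φ ed) ch)) ∷ bs)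
        legs⊆ : ∀ {x} → x ∈ d ∷ s ++ concat cs → Covered (reps c) x
        legs⊆ (here refl) = covered-≈ (≈-sym o≈d) (os⊆ c (here refl))
        legs⊆ (there m) = cs⊆ c (there (there (there m)))
        darts⊆ : ∀ {x} → x ∈ block e ++ darts es → Covered (reps c) x
        darts⊆ (here refl) = covered-≈ (φ ed)
          (chain-start covered-≈ ch (λ m → cs⊆ c (there (there (there (∈.∈-++⁺ˡ m))))) (os⊆ c (here refl)))
        darts⊆ (there (here refl)) = cs⊆ c (here refl)
        darts⊆ (there (there (here refl))) = cs⊆ c (there (here refl))
        darts⊆ (there (there (there (here refl)))) = cs⊆ c (there (there (here refl)))
        darts⊆ (there (there (there (there m)))) = es⊆ c m
      cover (merge {d} {u} {s} {xs} {ys} {cs} {cs′} du ud p) (_∷_ {x = o} (o≈d ∷ ch) bs) with pointwise-split cs bs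
      ... | os₁ , o′ , os₂ , refl , b′ , bs′ with chain-split xs b′
      ... | left , right = record
        { reps = reps c ; size = size c ; os⊆ = starts⊆ ; cs⊆ = legs⊆ ; es⊆ = es⊆ c }
        where
        c = cover p (chain-++ ys (chain-≈ (≈-trans o≈d (φ du)) right) (chain-++ xs left (chain-≈ (φ ud) ch)) ∷ bs′)
        s⊆ : ∀ {x} → x ∈ s → Covered (reps c) x
        s⊆ m = cs⊆ c (∈.∈-++⁺ˡ (∈.∈-++⁺ʳ ys (∈.∈-++⁺ʳ xs m)))
        xs⊆ : ∀ {x} → x ∈ xs → Covered (reps c) x
        xs⊆ m = cs⊆ c (∈.∈-++⁺ˡ (∈.∈-++⁺ʳ ys (∈.∈-++⁺ˡ m)))
        u⊆ : Covered (reps c) u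
        u⊆ = covered-≈ (φ ud) (chain-start covered-≈ ch s⊆ (os⊆ c (here refl)))
        starts⊆ : ∀ {x} → x ∈ o ∷ os₁ ++ o′ ∷ os₂ → Covered (reps c) x
        starts⊆ (here refl) = os⊆ c (here refl)
        starts⊆ (there m) with ∈.∈-++⁻ os₁ m
        ... | inj₁ k = os⊆ c (there (∈.∈-++⁺ˡ k))
        ... | inj₂ (here refl) = chain-start covered-≈ left xs⊆ u⊆
        ... | inj₂ (there k) = os⊆ c (there (∈.∈-++⁺ʳ os₁ k))
        legs⊆ : ∀ {x} → x ∈ d ∷ s ++ concat (cs ++ (xs ++ u ∷ ys) ∷ cs′) → Covered (reps c) x
        legs⊆ (here refl) = covered-≈ (≈-sym o≈d) (os⊆ c (here refl))
        legs⊆ (there m) with ∈.∈-++⁻ s m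
        ... | inj₁ k = s⊆ k
        ... | inj₂ k with ∈.∈-++⁻ (concat cs) (subst (_ ∈_) (sym (List.concat-++ cs _)) k)
        ... | inj₁ i = cs⊆ c (∈.∈-++⁺ʳ (ys ++ xs ++ s) (subst (_ ∈_) (List.concat-++ cs cs′) (∈.∈-++⁺ˡ i)))
        ... | inj₂ i with ∈.∈-++⁻ (xs ++ u ∷ ys) i
        ... | inj₂ j = cs⊆ c (∈.∈-++⁺ʳ (ys ++ xs ++ s) (subst (_ ∈_) (List.concat-++ cs cs′) (∈.∈-++⁺ʳ (concat cs) j)))
        ... | inj₁ j with ∈.∈-++⁻ xs j
        ... | inj₁ h = xs⊆ h
        ... | inj₂ (here refl) = u⊆
        ... | inj₂ (there h) = cs⊆ c (∈.∈-++⁺ˡ (∈.∈-++⁺ˡ h))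

-- From a rooted map to its tree.

module MapToTree where

  open import Defs using (SameOrbit; Reach; here; viaσ; viaα; RootedS4Map)
  open Trees
  open Models
  open AnyGenus
  open Counting using (∈-split)
  open import Algebra.Bundles using (CommutativeMonoid)
  open import Data.Nat using (ℕ; zero; suc; _+_; _*_; _≤_; z≤n; s≤s)
  import Data.Nat.Properties as ℕ
  open import Data.Nat.Tactic.RingSolver using (solve-∀)
  open import Data.Fin using (Fin)
  open import Data.List using (List; []; _∷_; _++_; length; concat; allFin)
  import Data.List.Properties as List
  open import Data.List.Membership.Propositional using (_∈_)
  import Data.List.Membership.Propositional.Properties as ∈
  open import Data.List.Relation.Unary.Any using (here; there)
  open import Data.List.Relation.Unary.All using ([]; _∷_)
  open import Data.List.Relation.Unary.AllPairs using ([]; _∷_)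
  open import Data.List.Relation.Unary.Unique.Propositional using (Unique)
  import Data.List.Relation.Unary.Unique.Propositional.Properties as Unique
  open import Data.List.Relation.Binary.Pointwise using ([]; _∷_)
  open import Data.List.Relation.Binary.Permutation.Propositional
    using (_↭_; ↭-refl; ↭-sym; ↭-trans; ↭-reflexive; prep)
  import Data.List.Relation.Binary.Permutation.Propositional.Properties as ↭
  open import Data.Product using (∃; _×_; _,_; proj₁; proj₂)
  open import Data.Sum using (_⊎_; inj₁; inj₂)
  open import Data.Empty using (⊥; ⊥-elim)
  open import Relation.Binary.PropositionalEquality
  import Algebra.Solver.CommutativeMonoid
  open import Function using (_∘_)

  module Exploration {D : Set} (σ α : D → D) (σ⁴ : ∀ x → σ (σ (σ (σ x))) ≡ x)
    (α² : ∀ x → α (α x) ≡ x) (α-fpf : ∀ x → α x ≢ x) where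
    open Peeling σ α σ⁴
    open Explored σ α
    private module CM = Algebra.Solver.CommutativeMonoid (++-monoid D)

    Closed : List D → Set
    Closed S = ∀ {x} → x ∈ S → α x ∈ S

    closed-↭ : ∀ {S T} → S ↭ T → Closed S → Closed T
    closed-↭ p c m = ↭.∈-resp-↭ p (c (↭.∈-resp-↭ (↭-sym p) m))

    closed-edge : ∀ {d u S} → α d ≡ u → Unique (d ∷ u ∷ S) → Closed (d ∷ u ∷ S) → Closed S
    closed-edge {d} {u} {S} du uq c {x} m = drop (c (there (there m)))
      where
      drop : α x ∈ d ∷ u ∷ S → α x ∈ S
      drop (here eq) = ⊥-elim (unique-∉ (unique-tail uq) (subst (_∈ S) (trans (sym (α² x)) (trans (cong α eq) du)) m))
      drop (there (here eq)) = ⊥-elim (unique-∉ uq (there (subst (_∈ S)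
        (trans (sym (α² x)) (trans (cong α (trans eq (sym du))) (α² d))) m)))
      drop (there (there k)) = k

    block-from : ∀ {e v} → e ∈ block v → block v ↭ block e
    block-from (here refl) = ↭-refl
    block-from {v = v} (there (here refl)) = block-turn σ⁴ v
    block-from {v = v} (there (there (here refl))) = ↭-trans (block-turn σ⁴ v) (block-turn σ⁴ (σ v))
    block-from {v = v} (there (there (there (here refl)))) =
      ↭-trans (block-turn σ⁴ v) (↭-trans (block-turn σ⁴ (σ v)) (block-turn σ⁴ (σ (σ v))))

    -- Vertices that peeling does not reach are kept in `rest`, whose darts are closed under `α`;
    -- connectedness will make it empty.
    record Result (cs : List (List D)) (U : List D) : Set where
      constructor result
      field
        es rest   : List D
        {f g}     : ℕ
        peel      : Peel cs es f g
        explored  : darts es ++ darts rest ↭ darts U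
        closed    : Closed (darts rest)

    private
      shrink : ∀ {S : List D} (d u : D) (T : List D) k {f} → S ↭ d ∷ u ∷ T → length S + k ≤ suc f → length T + suc k ≤ f
      shrink {S} d u T k {f} p le = ℕ.≤-pred (subst (_≤ suc f)
        (trans (cong (_+ k) (↭.↭-length p)) (cong suc (sym (ℕ.+-suc (length T) k)))) le)

      split-↭ : ∀ d u (xs ys C V : List D) → (d ∷ (xs ++ u ∷ ys) ++ C) ++ V ↭ d ∷ u ∷ (xs ++ ys ++ C) ++ V
      split-↭ d u xs ys C V = CM.solve 6 (λ D U X Y C V → (D CM.⊕ ((X CM.⊕ (U CM.⊕ Y)) CM.⊕ C)) CM.⊕ V CM.⊜
        D CM.⊕ (U CM.⊕ ((X CM.⊕ (Y CM.⊕ C)) CM.⊕ V))) ↭-refl (d ∷ []) (u ∷ []) xs ys C V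

      merge-↭ : ∀ d u (s xs ys C C′ V : List D) → (d ∷ s ++ (C ++ ((xs ++ u ∷ ys) ++ C′))) ++ V ↭
                d ∷ u ∷ ((ys ++ xs ++ s) ++ (C ++ C′)) ++ V
      merge-↭ d u s xs ys C C′ V = CM.solve 8 (λ D U S X Y C C′ V →
        (D CM.⊕ (S CM.⊕ (C CM.⊕ ((X CM.⊕ (U CM.⊕ Y)) CM.⊕ C′)))) CM.⊕ V CM.⊜
        D CM.⊕ (U CM.⊕ (((Y CM.⊕ (X CM.⊕ S)) CM.⊕ (C CM.⊕ C′)) CM.⊕ V))) ↭-refl (d ∷ []) (u ∷ []) s xs ys C C′ V

      new-cycle-↭ : ∀ d e (s C V : List D) → (d ∷ s ++ C) ++ (block e ++ V) ↭
                    d ∷ e ∷ ((σ e ∷ σ (σ e) ∷ σ (σ (σ e)) ∷ s) ++ C) ++ V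
      new-cycle-↭ d e s C V = CM.solve 6 (λ D E T S C V → (D CM.⊕ (S CM.⊕ C)) CM.⊕ ((E CM.⊕ T) CM.⊕ V) CM.⊜
        D CM.⊕ (E CM.⊕ (((T CM.⊕ S) CM.⊕ C) CM.⊕ V))) ↭-refl (d ∷ []) (e ∷ []) (σ e ∷ σ (σ e) ∷ σ (σ (σ e)) ∷ []) s C V

    -- The fuel bounds the number of darts plus the number of cycles: closing a face removes a
    -- cycle, and every other step removes the two darts of an edge while adding at most one cycle.
    explore : ∀ fuel cs U → length (concat cs ++ darts U) + length cs ≤ fuel →
              Unique (concat cs ++ darts U) → Closed (concat cs ++ darts U) → Result cs U
    explore fuel [] U le uq c = result [] U done ↭-refl (λ {x} → c {x})
    explore (suc fuel) ([] ∷ cs) U le uq c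
      with explore fuel cs U (ℕ.≤-pred (subst (_≤ suc fuel) (ℕ.+-suc (length (concat cs ++ darts U)) (length cs)) le)) uq c
    ... | result es rest p q r = result es rest (face p) q (λ {x} → r {x})
    explore zero ([] ∷ cs) U le uq c =
      ⊥-elim (ℕ.n≮0 (subst (_≤ 0) (ℕ.+-suc (length (concat cs ++ darts U)) (length cs)) le))
    explore (suc fuel) ((d ∷ s) ∷ cs) U le uq c with ∈.∈-++⁻ (d ∷ s ++ concat cs) (c (here refl))
    ... | inj₁ (here eq) = ⊥-elim (α-fpf d eq)
    ... | inj₁ (there m) with ∈.∈-++⁻ s m
    ... | inj₁ k with ∈.∈-∃++ k
    ... | xs , ys , refl = go (explore fuel (xs ∷ ys ∷ cs) U
            (shrink d (α d) ((xs ++ ys ++ concat cs) ++ darts U) (suc (length cs)) perm le)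
            (unique-tail (unique-tail uq′)) (closed-edge refl uq′ (λ {x} → closed-↭ perm (λ {y} → c {y}) {x})))
      where
      perm : (d ∷ (xs ++ α d ∷ ys) ++ concat cs) ++ darts U ↭ d ∷ α d ∷ (xs ++ ys ++ concat cs) ++ darts U
      perm = split-↭ d (α d) xs ys (concat cs) (darts U)
      uq′ : Unique (d ∷ α d ∷ (xs ++ ys ++ concat cs) ++ darts U)
      uq′ = unique-↭ perm uq
      go : Result (xs ∷ ys ∷ cs) U → Result ((d ∷ xs ++ α d ∷ ys) ∷ cs) U
      go (result es rest p q r) = result es rest (split refl (α² d) p) q (λ {x} → r {x})
    explore (suc fuel) ((d ∷ s) ∷ cs) U le uq c | inj₁ (there m) | inj₂ k with ∈.∈-concat⁻′ cs k
    ... | cyc , i , j with ∈.∈-∃++ i | ∈.∈-∃++ j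
    ... | xs , ys , refl | cs₁ , cs₂ , refl = go (explore fuel ((ys ++ xs ++ s) ∷ cs₁ ++ cs₂) U
            (ℕ.≤-trans (ℕ.+-monoʳ-≤ (length (concat ((ys ++ xs ++ s) ∷ cs₁ ++ cs₂) ++ darts U)) shorter)
              (shrink d (α d) (concat ((ys ++ xs ++ s) ∷ cs₁ ++ cs₂) ++ darts U) (length ((d ∷ s) ∷ cs₁ ++ (xs ++ α d ∷ ys) ∷ cs₂)) perm le))
            (unique-tail (unique-tail uq′)) (closed-edge refl uq′ (λ {x} → closed-↭ perm (λ {y} → c {y}) {x})))
      where
      perm : (d ∷ s ++ concat (cs₁ ++ (xs ++ α d ∷ ys) ∷ cs₂)) ++ darts U ↭
             d ∷ α d ∷ concat ((ys ++ xs ++ s) ∷ cs₁ ++ cs₂) ++ darts U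
      perm = ↭-trans (↭-reflexive (cong (λ C → (d ∷ s ++ C) ++ darts U) (sym (List.concat-++ cs₁ ((xs ++ α d ∷ ys) ∷ cs₂)))))
        (↭-trans (merge-↭ d (α d) s xs ys (concat cs₁) (concat cs₂) (darts U))
          (↭-reflexive (cong (λ C → d ∷ α d ∷ ((ys ++ xs ++ s) ++ C) ++ darts U) (List.concat-++ cs₁ cs₂))))
      uq′ : Unique (d ∷ α d ∷ concat ((ys ++ xs ++ s) ∷ cs₁ ++ cs₂) ++ darts U)
      uq′ = unique-↭ perm uq
      shorter : length ((ys ++ xs ++ s) ∷ cs₁ ++ cs₂) ≤ suc (length ((d ∷ s) ∷ cs₁ ++ (xs ++ α d ∷ ys) ∷ cs₂))
      shorter = s≤s (ℕ.≤-trans (ℕ.≤-trans (ℕ.≤-reflexive (List.length-++ cs₁)) (ℕ.≤-trans (ℕ.+-monoʳ-≤ (length cs₁) (ℕ.n≤1+n _))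
        (ℕ.≤-reflexive (sym (List.length-++ cs₁))))) (ℕ.n≤1+n _))
      go : Result ((ys ++ xs ++ s) ∷ cs₁ ++ cs₂) U → Result ((d ∷ s) ∷ cs₁ ++ (xs ++ α d ∷ ys) ∷ cs₂) U
      go (result es rest p q r) = result es rest (merge refl (α² d) p) q (λ {x} → r {x})
    explore (suc fuel) ((d ∷ s) ∷ cs) U le uq c | inj₂ m with darts⇒block U m
    ... | v , v∈ , e∈ with ∈-split v∈
    ... | V , U↭ = go (explore fuel (cyc ∷ cs) V
            (ℕ.≤-trans (ℕ.+-monoʳ-≤ (length ((cyc ++ concat cs) ++ darts V)) (ℕ.n≤1+n _)) (shrink d e ((cyc ++ concat cs) ++ darts V) (suc (length cs)) perm le))
            (unique-tail (unique-tail uq′)) (closed-edge refl uq′ (λ {x} → closed-↭ perm (λ {y} → c {y}) {x})))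
      where
      e : D
      e = α d
      cyc : List D
      cyc = σ e ∷ σ (σ e) ∷ σ (σ (σ e)) ∷ s
      U-↭ : darts U ↭ block e ++ darts V
      U-↭ = ↭-trans (darts-↭ U↭) (↭.++⁺ʳ (darts V) (block-from e∈))
      perm : (d ∷ s ++ concat cs) ++ darts U ↭ d ∷ e ∷ (cyc ++ concat cs) ++ darts V
      perm = ↭-trans (↭.++⁺ˡ (d ∷ s ++ concat cs) U-↭) (new-cycle-↭ d e s (concat cs) (darts V))
      uq′ : Unique (d ∷ e ∷ (cyc ++ concat cs) ++ darts V)
      uq′ = unique-↭ perm uq
      go : Result (cyc ∷ cs) V → Result ((d ∷ s) ∷ cs) U
      go (result es rest p q r) = result (e ∷ es) rest (new refl (α² d) p)
        (↭-trans (↭.++⁺ˡ (block e) q) (↭-sym U-↭)) (λ {x} → r {x})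
    explore zero ((d ∷ s) ∷ cs) U () uq c

    explore-all : ∀ cs U → Unique (concat cs ++ darts U) → Closed (concat cs ++ darts U) → Result cs U
    explore-all cs U = explore (length (concat cs ++ darts U) + length cs) cs U ℕ.≤-refl

    SClosed : List D → Set
    SClosed S = ∀ {x} → x ∈ S → σ x ∈ S

    module _ (σ²≢ : ∀ x → σ (σ x) ≢ x) where

      block-unique : ∀ x → Unique (block x)
      block-unique x =
        (σ≢ x ∷ (λ eq → σ²≢ x (sym eq)) ∷ (λ eq → σ≢ x (sym (trans (cong σ eq) (σ⁴ x)))) ∷ []) ∷
        (σ≢ (σ x) ∷ (λ eq → σ²≢ (σ x) (sym eq)) ∷ []) ∷ (σ≢ (σ (σ x)) ∷ []) ∷ [] ∷ []
        where
        σ≢ : ∀ x → x ≢ σ x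
        σ≢ x eq = σ²≢ x (trans (cong σ (sym eq)) (sym eq))

      remove : ∀ xs {S : List D} → Unique xs → (∀ {x} → x ∈ xs → x ∈ S) → ∃ λ T → S ↭ xs ++ T
      remove []       u sub = _ , ↭-refl
      remove (x ∷ xs) u sub with ∈-split (sub (here refl))
      ... | T , p with remove xs (unique-tail u) (λ m → drop m (↭.∈-resp-↭ p (sub (there m))))
        where
        drop : ∀ {y} → y ∈ xs → y ∈ x ∷ T → y ∈ T
        drop m (here refl) = ⊥-elim (unique-∉ u m)
        drop m (there k)   = k
      ... | T′ , q = T′ , ↭-trans p (prep x q)

      block-σ³ : ∀ {x y} → σ y ∈ block x → y ∈ block x
      block-σ³ {x} {y} m = subst (_∈ block x) (σ⁴ y) (turn (turn (turn m)))
        where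
        turn : ∀ {z} → z ∈ block x → σ z ∈ block x
        turn (here refl) = there (here refl)
        turn (there (here refl)) = there (there (here refl))
        turn (there (there (here refl))) = there (there (there (here refl)))
        turn (there (there (there (here refl)))) = here (σ⁴ x)

      block⊆ : ∀ x {S : List D} → SClosed S → x ∈ S → ∀ {y} → y ∈ block x → y ∈ S
      block⊆ x c m (here refl)                         = m
      block⊆ x c m (there (here refl))                 = c m
      block⊆ x c m (there (there (here refl)))         = c (c m)
      block⊆ x c m (there (there (there (here refl)))) = c (c (c m))

      sclosed-rest : ∀ x S T → Unique S → SClosed S → S ↭ block x ++ T → SClosed T
      sclosed-rest x S T u c p {y} k = drop (∈.∈-++⁻ (block x) {T} (↭.∈-resp-↭ p (c (↭.∈-resp-↭ (↭-sym p) (∈.∈-++⁺ʳ (block x) k)))))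
        where
        drop : σ y ∈ block x ⊎ σ y ∈ T → σ y ∈ T
        drop (inj₁ i) = ⊥-elim (unique-disjoint (block x) {T} (unique-↭ p u) (block-σ³ i) k)
        drop (inj₂ i) = i

      remove-block : ∀ x S → Unique S → SClosed S → x ∈ S → ∃ λ T → S ↭ block x ++ T × Unique T × SClosed T
      remove-block x S u c m = add (remove (block x) (block-unique x) (block⊆ x (λ {y} → c {y}) m))
        where
        add : (∃ λ T → S ↭ block x ++ T) → ∃ λ T → S ↭ block x ++ T × Unique T × SClosed T
        add (T , p) = T , p , unique-++ʳ (block x) (unique-↭ p u) , λ {y} → sclosed-rest x S T u (λ {y} → c {y}) p {y}

      -- Chooses one dart at every vertex, which turns a set of darts closed under `σ` into the list
      -- of vertices that exploration consumes.
      partition : ∀ fuel S → length S ≤ fuel → Unique S → SClosed S → ∃ λ U → S ↭ darts U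
      partition fuel [] le u c = [] , ↭-refl
      partition (suc fuel) (x ∷ S) le u c = step (remove-block x (x ∷ S) u (λ {y} → c {y}) (here refl))
        where
        shorter : ∀ T → x ∷ S ↭ block x ++ T → length T ≤ fuel
        shorter T p = ℕ.≤-trans (ℕ.m≤n+m (length T) 3)
          (ℕ.≤-pred (ℕ.≤-trans (ℕ.≤-reflexive (sym (↭.↭-length p))) le))
        step : (∃ λ T → x ∷ S ↭ block x ++ T × Unique T × SClosed T) → ∃ λ U → x ∷ S ↭ darts U
        step (T , p , uT , cT) = x ∷ proj₁ rest , ↭-trans p (↭.++⁺ˡ (block x) (proj₂ rest))
          where
          rest : ∃ λ U → T ↭ darts U
          rest = partition fuel T (shorter T p) uT (λ {y} → cT {y})

  module FromMap {n : ℕ} (m : RootedS4Map n) where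
    open RootedS4Map m

    D : Set
    D = Fin (4 * n)

    φ : D → D
    φ = σ ∘ α

    σ-injective : ∀ {x y} → σ x ≡ σ y → x ≡ y
    σ-injective {x} {y} eq = trans (sym (σ-order4 x)) (trans (cong (σ ∘ σ ∘ σ) eq) (σ-order4 y))

    α-injective : ∀ {x y} → α x ≡ α y → x ≡ y
    α-injective {x} {y} eq = trans (sym (α-invol x)) (trans (cong α eq) (α-invol y))

    open Orbits φ (α-injective ∘ σ-injective) public
    open Peeling σ α σ-order4
    open Explored σ α
    open Exploration σ α σ-order4 α-invol α-fpf
    open Faces (SameOrbit φ) orbit-refl orbit-sym orbit-trans orbit-step

    ∈-all : ∀ x → x ∈ allFin (4 * n)
    ∈-all = ∈.∈-allFin

    -- The root vertex itself is cut open: its four darts, in rotation order from the root, are the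
    -- legs, and it is not listed among `vertices`.
    record TreeOf : Set where
      field
        tree     : Tree
        vertices : List D
        real     : Real tree (block root) vertices
        uniq     : Unique (support (block root) vertices)
        complete : ∀ x → x ∈ support (block root) vertices
        count    : suc (length vertices) ≡ n

    length-darts : ∀ es → length (darts es) ≡ 4 * length es
    length-darts []       = refl
    length-darts (e ∷ es) = trans (cong (4 +_) (length-darts es)) (sym (ℕ.*-suc 4 (length es)))

    all-unique : Unique (allFin (4 * n))
    all-unique = Unique.allFin⁺ (4 * n)

    abstract
      vertex-list : ∃ λ U → allFin (4 * n) ↭ block root ++ darts U
      vertex-list = finish (remove-block σ-noshort root (allFin (4 * n)) all-unique (λ {x} _ → ∈-all (σ x)) (∈-all root))
        where
        finish : (∃ λ S → allFin (4 * n) ↭ block root ++ S × Unique S × SClosed S) →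
                 ∃ λ U → allFin (4 * n) ↭ block root ++ darts U
        finish (S , p , u , c) = proj₁ rest , ↭-trans p (↭.++⁺ˡ (block root) (proj₂ rest))
          where
          rest : ∃ λ U → S ↭ darts U
          rest = partition σ-noshort (length S) S ℕ.≤-refl u (λ {y} → c {y})

    sclosed : ∀ es → SClosed (darts es)
    sclosed es {x} k with darts⇒block es k
    ... | e , e∈ , here refl = block⊆darts e∈ (there (here refl))
    ... | e , e∈ , there (here refl) = block⊆darts e∈ (there (there (here refl)))
    ... | e , e∈ , there (there (here refl)) = block⊆darts e∈ (there (there (there (here refl))))
    ... | e , e∈ , there (there (there (here refl))) = subst (_∈ darts es) (sym (σ-order4 e)) (block⊆darts e∈ (here refl))

    reach : ∀ es {v y} → v ∈ darts es → Closed (darts es) → Reach σ α v y → y ∈ darts es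
    reach es m c here     = m
    reach es m c (viaσ h) = sclosed es (reach es m c h)
    reach es m c (viaα h) = c (reach es m c h)

    module Finish (es : List D) {f g : ℕ} (p : Peel (block root ∷ []) es f g) (perm : allFin (4 * n) ↭ block root ++ darts es) where

      size≡ : suc (length es) ≡ n
      size≡ = ℕ.*-cancelˡ-≡ (suc (length es)) n 4 (begin
        4 * suc (length es)                    ≡⟨ sym (length-darts (root ∷ es)) ⟩
        length (darts (root ∷ es))             ≡⟨ sym (↭.↭-length perm) ⟩
        length (allFin (4 * n))                ≡⟨ List.length-tabulate (λ x → x) ⟩
        4 * n                                  ∎)
        where open ≡-Reasoning

      complete : ∀ x → x ∈ block root ++ darts es
      complete x = ↭.∈-resp-↭ perm (∈-all x)

      cov : Cover (root ∷ []) (block root ∷ []) es f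
      cov = cover p ((orbit-refl ∷ orbit-refl ∷ orbit-refl ∷ orbit-refl ∷ end (0 , σ-order4 root)) ∷ [])

      covers : ∀ x → Covered (Cover.reps cov) x
      covers x with ∈.∈-++⁻ (block root) (complete x)
      ... | inj₁ k = Cover.cs⊆ cov (∈.∈-++⁺ˡ {ys = []} k)
      ... | inj₂ k = Cover.es⊆ cov k

      enough : n + 2 ≤ f
      enough = subst (n + 2 ≤_) (Cover.size cov) (orbits-bounded (Cover.reps cov) planar covers)

      -- With `n - 1` vertices besides the root, Euler's relation says `2 f + 4 g = 2 (n + 2)`,
      -- whereas the `n + 2` faces of the map force `n + 2 ≤ f`.
      no-merge : ∀ g → 4 + (length es + length es) + 2 ≡ f + f + (g + g + (g + g)) → g ≡ 0
      no-merge zero    _  = refl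
      no-merge (suc g) eq = ⊥-elim (ℕ.<-irrefl eq (ℕ.≤-trans (ℕ.≤-reflexive bound₁)
        (ℕ.≤-trans (s≤s (ℕ.+-mono-≤ enough enough)) bound₂)))
        where
        lemma : ∀ e → suc (4 + (e + e) + 2) ≡ suc ((suc e + 2) + (suc e + 2))
        lemma = solve-∀
        bound₁ : suc (4 + (length es + length es) + 2) ≡ suc ((n + 2) + (n + 2))
        bound₁ = trans (lemma (length es)) (cong (λ n → suc ((n + 2) + (n + 2))) size≡)
        bound₂ : suc (f + f) ≤ f + f + (suc g + suc g + (suc g + suc g))
        bound₂ = ℕ.≤-trans (ℕ.≤-reflexive (ℕ.+-comm 1 (f + f))) (ℕ.+-monoʳ-≤ (f + f) (s≤s z≤n))

      tree-real : ∃ λ t → Real t (block root) es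
      tree-real = single-tree (forest (subst (Peel (block root ∷ []) es f) (no-merge g (euler p)) p))

      result-tree : TreeOf
      result-tree = record
        { tree = proj₁ tree-real ; vertices = es ; real = proj₂ tree-real
        ; uniq = unique-↭ perm all-unique ; complete = complete ; count = size≡ }

    module FromVertices (U : List D) (all↭ : allFin (4 * n) ↭ block root ++ darts U) where

      start-unique : Unique (block root ++ darts U)
      start-unique = unique-↭ all↭ all-unique

      start-closed : Closed (block root ++ darts U)
      start-closed {x} _ = ↭.∈-resp-↭ all↭ (∈-all (α x))

      -- Starting at an unexplored vertex, neither `σ` nor `α` leaves the unexplored darts, yet
      -- connectedness provides a path from there to the root.
      outside : ∀ es v rest → darts es ++ darts (v ∷ rest) ↭ darts U → Closed (darts (v ∷ rest)) → ⊥
      outside es v rest q r = unique-disjoint (block root) {darts U} start-unique (here refl)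
        (↭.∈-resp-↭ q (∈.∈-++⁺ʳ (darts es) (reach (v ∷ rest) (here refl) (λ {x} → r {x}) (connected v root))))

      all-explored : ∀ es → darts es ++ [] ↭ darts U → allFin (4 * n) ↭ block root ++ darts es
      all-explored es q = ↭-trans all↭ (↭.++⁺ˡ (block root) (↭-trans (↭-sym q) (↭-reflexive (List.++-identityʳ (darts es)))))

      tree-from : Result (block root ∷ []) U → TreeOf
      tree-from (result es (v ∷ rest) p q r) = ⊥-elim (outside es v rest q (λ {x} → r {x}))
      tree-from (result es [] p q r) = Finish.result-tree es p (all-explored es q)

      tree-of-vertices : TreeOf
      tree-of-vertices = tree-from (explore-all (block root ∷ []) U start-unique (λ {x} → start-closed {x}))

    abstract
      treeOf : TreeOf
      treeOf = FromVertices.tree-of-vertices (proj₁ vertex-list) (proj₂ vertex-list)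

-- A map glued from a tree has the number of faces that Euler's formula requires.

module Planarity where

  open import Defs using (SameOrbit; HasOrbits; here)
  open Trees
  open Models
  open AnyGenus
  open import Data.Nat using (ℕ; zero; suc; _+_; _*_; _≤_; _<_; z≤n)
  import Data.Nat.Properties as ℕ
  open import Data.Nat.Tactic.RingSolver using (solve-∀)
  open import Data.Fin as Fin using (Fin; toℕ)
  import Data.Fin.Properties as Fin
  open import Data.List using (List; []; _∷_; _++_; length; lookup)
  import Data.List.Properties as List
  open import Data.List.Membership.Propositional using (_∈_)
  import Data.List.Membership.Propositional.Properties as ∈
  open import Data.List.Relation.Unary.Any as Any using (Any; here; there)
  import Data.List.Relation.Unary.Any.Properties as Any
  open import Data.List.Relation.Unary.All using ([]; _∷_)
  open import Data.List.Relation.Unary.AllPairs using ([]; _∷_)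
  open import Data.List.Relation.Unary.Unique.Propositional using (Unique)
  open import Data.List.Relation.Binary.Pointwise using ([]; _∷_)
  open import Data.Product using (∃; _×_; _,_; proj₁; proj₂)
  open import Data.Sum using (_⊎_; inj₁; inj₂)
  open import Data.Empty using (⊥-elim)
  open import Relation.Nullary using (yes; no)
  open import Relation.Binary.PropositionalEquality
  open import Data.List using (map)
  open import Data.Unit using (⊤; tt)

  -- Each `nil` is a region without legs left, that is, one completed face.
  leaves : Tree → ℕ
  leaves nil        = 1
  leaves (join l r) = leaves l + leaves r
  leaves (new t)    = leaves t

  module Labelling {D : Set} (σ α : D → D) (σ⁴ : ∀ x → σ (σ (σ (σ x))) ≡ x) where
    open Explored σ α
    open Peeling σ α σ⁴ using (Peel; face; split; new)

    real-peel : ∀ {t w es cs fs f g} → Real t w es → Peel cs fs f g → Peel (w ∷ cs) (es ++ fs) (leaves t + f) g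
    real-peel nil p = face p
    real-peel {cs = cs} {fs} {f} {g} (join {l} {r} {xs = xs} {ys} {es} {gs} du ud a b) p = split du ud
      (subst₂ (λ hs k → Peel (xs ∷ ys ∷ cs) hs k g) (sym (List.++-assoc es gs fs)) (sym (ℕ.+-assoc (leaves l) (leaves r) f))
        (real-peel a (real-peel b p)))
    real-peel (new de ed a) p = new de ed (real-peel a p)

    Label : Set
    Label = List (D × ℕ)

    first : ℕ → Label → ℕ
    first o []            = o
    first o ((_ , l) ∷ _) = l

    -- The corner after each leg carries the label of the next one.
    Around : (D × ℕ → Set) → Label → ℕ → Set
    Around Λ []             o = ⊤
    Around Λ ((x , _) ∷ zs) o = Λ (σ x , first o zs) × Around Λ zs o

    around-split : ∀ {Λ o u l} zs {zs′} → Around Λ (zs ++ (u , l) ∷ zs′) o →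
                   Around Λ zs l × Λ (σ u , first o zs′) × Around Λ zs′ o
    around-split []                        (p , q) = tt , p , q
    around-split ((x , _) ∷ [])            (p , r , s) = (p , tt) , r , s
    around-split ((x , _) ∷ zs@(_ ∷ _))    (p , q) with around-split zs q
    ... | a , r , s = (p , a) , r , s

    first-++ : ∀ {o u l} zs {zs′} → first o (zs ++ (u , l) ∷ zs′) ≡ first l zs
    first-++ []      = refl
    first-++ (_ ∷ _) = refl

    -- Each dart is labelled by the face on whose boundary φ = σ ∘ α moves it; the labels k, ..., k + f - 1
    -- are the leaves of the tree.
    record FaceLabels (w es : List D) (k f : ℕ) : Set₁ where
      field
        o       : ℕ
        wz vz   : Label
        wz-fst  : map proj₁ wz ≡ w
        vz-fst  : map proj₁ vz ≡ darts es
        start   : first o wz ≡ o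
        onto    : ∀ {l} → k ≤ l → l < k + f → l ≡ o ⊎ ∃ λ x → (x , l) ∈ wz ++ vz
        stable  : ∀ {Λ : D × ℕ → Set} → (∀ {z} → z ∈ wz → Λ z) → (∀ {z} → z ∈ vz → Λ z) → Around Λ wz o →
                  ∀ {x l} → (x , l) ∈ wz ++ vz → Λ (σ (α x) , l)
    open FaceLabels

    -- Inside a region it is unknown where `σ` leads from a leg. Therefore `stable` is proved for
    -- every predicate `Λ` for which `Around` supplies this; on the whole map `Λ` becomes membership
    -- in the list of labels.
    faces : ∀ {t w es} k → Real t w es → FaceLabels w es k (leaves t)
    faces k nil = record
      { o = k ; wz = [] ; vz = [] ; wz-fst = refl ; vz-fst = refl ; start = refl
      ; onto = λ {l} p q → inj₁ (ℕ.≤-antisym (ℕ.≤-pred (subst (l <_) (ℕ.+-comm k 1) q)) p) ; stable = λ _ _ _ () }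
    faces k (join {l} {r} {d} {u} {xs} {ys} {es} {fs} du ud p q) = record
      { o = o R ; wz = WZ ; vz = vz L ++ vz R
      ; wz-fst = cong (d ∷_) (trans (List.map-++ proj₁ (wz L) _) (cong₂ _++_ (wz-fst L) (cong (u ∷_) (wz-fst R))))
      ; vz-fst = trans (List.map-++ proj₁ (vz L) (vz R)) (trans (cong₂ _++_ (vz-fst L) (vz-fst R)) (sym (darts-++ es fs)))
      ; start = refl ; onto = onto′ ; stable = stable′ }
      where
      L = faces k p
      R = faces (k + leaves l) q
      WZ : Label
      WZ = (d , o R) ∷ wz L ++ (u , o L) ∷ wz R
      inˡ : ∀ {z} → z ∈ wz L ++ vz L → z ∈ WZ ++ (vz L ++ vz R)
      inˡ m with ∈.∈-++⁻ (wz L) m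
      ... | inj₁ k = there (∈.∈-++⁺ˡ (∈.∈-++⁺ˡ k))
      ... | inj₂ k = ∈.∈-++⁺ʳ WZ (∈.∈-++⁺ˡ k)
      inʳ : ∀ {z} → z ∈ wz R ++ vz R → z ∈ WZ ++ (vz L ++ vz R)
      inʳ m with ∈.∈-++⁻ (wz R) m
      ... | inj₁ k = there (∈.∈-++⁺ˡ (∈.∈-++⁺ʳ (wz L) (there k)))
      ... | inj₂ k = ∈.∈-++⁺ʳ WZ (∈.∈-++⁺ʳ (vz L) k)
      onto′ : ∀ {m} → k ≤ m → m < k + (leaves l + leaves r) → m ≡ o R ⊎ ∃ λ x → (x , m) ∈ WZ ++ (vz L ++ vz R)
      onto′ {m} k≤m m< with m ℕ.<? k + leaves l
      ... | yes m<′ with onto L k≤m m<′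
      ... | inj₁ refl = inj₂ (u , ∈.∈-++⁺ˡ (there (∈.∈-++⁺ʳ (wz L) (here refl))))
      ... | inj₂ (x , h) = inj₂ (x , inˡ h)
      onto′ {m} k≤m m< | no m≮ with onto R (ℕ.≮⇒≥ m≮) (subst (m <_) (sym (ℕ.+-assoc k (leaves l) (leaves r))) m<)
      ... | inj₁ refl = inj₁ refl
      ... | inj₂ (x , h) = inj₂ (x , inʳ h)
      stable′ : ∀ {Λ : D × ℕ → Set} → (∀ {z} → z ∈ WZ → Λ z) → (∀ {z} → z ∈ vz L ++ vz R → Λ z) → Around Λ WZ (o R) →
                ∀ {x m} → (x , m) ∈ WZ ++ (vz L ++ vz R) → Λ (σ (α x) , m)
      stable′ {Λ} wΛ vΛ (a₀ , a) {x} {m} h with around-split (wz L) a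
      ... | aL , au , aR with ∈.∈-++⁻ WZ h
      ... | inj₂ i with ∈.∈-++⁻ (vz L) i
      ... | inj₁ j = stable L (λ z → wΛ (there (∈.∈-++⁺ˡ z))) (λ z → vΛ (∈.∈-++⁺ˡ z)) aL (∈.∈-++⁺ʳ (wz L) j)
      ... | inj₂ j = stable R (λ z → wΛ (there (∈.∈-++⁺ʳ (wz L) (there z)))) (λ z → vΛ (∈.∈-++⁺ʳ (vz L) z)) aR (∈.∈-++⁺ʳ (wz R) j)
      stable′ {Λ} wΛ vΛ (a₀ , a) h | aL , au , aR | inj₁ (here refl) =
        subst (λ y → Λ (σ y , o R)) (sym du) (subst (λ m → Λ (σ u , m)) (start R) au)
      stable′ {Λ} wΛ vΛ (a₀ , a) h | aL , au , aR | inj₁ (there i) with ∈.∈-++⁻ (wz L) i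
      ... | inj₁ j = stable L (λ z → wΛ (there (∈.∈-++⁺ˡ z))) (λ z → vΛ (∈.∈-++⁺ˡ z)) aL (∈.∈-++⁺ˡ j)
      ... | inj₂ (here refl) =
        subst (λ y → Λ (σ y , o L)) (sym ud) (subst (λ m → Λ (σ d , m)) (trans (first-++ (wz L)) (start L)) a₀)
      ... | inj₂ (there j) = stable R (λ z → wΛ (there (∈.∈-++⁺ʳ (wz L) (there z)))) (λ z → vΛ (∈.∈-++⁺ʳ (vz L) z)) aR (∈.∈-++⁺ˡ j)
    faces k (new {t} {d} {e} {xs} {es} de ed p) = go (faces k p)
      where
      go : FaceLabels (σ e ∷ σ (σ e) ∷ σ (σ (σ e)) ∷ xs) es k (leaves t) → FaceLabels (d ∷ xs) (e ∷ es) k (leaves t)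
      go record { wz = [] ; wz-fst = () }
      go record { wz = _ ∷ [] ; wz-fst = () }
      go record { wz = _ ∷ _ ∷ [] ; wz-fst = () }
      go record { o = o ; wz = (_ , l₀) ∷ (_ , l₁) ∷ (_ , l₂) ∷ zs ; vz = vz ; wz-fst = refl ; vz-fst = vz-fst ; start = start
                ; onto = onto ; stable = stable } = record
        { o = o ; wz = (d , o) ∷ zs ; vz = (e , first o zs) ∷ (σ e , l₀) ∷ (σ (σ e) , l₁) ∷ (σ (σ (σ e)) , l₂) ∷ vz
        ; wz-fst = refl ; vz-fst = cong (λ r → e ∷ σ e ∷ σ (σ e) ∷ σ (σ (σ e)) ∷ r) vz-fst ; start = refl
        ; onto = onto′ ; stable = stable′ }
        where
        WZ VZ : Label
        WZ = (d , o) ∷ zs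
        VZ = (e , first o zs) ∷ (σ e , l₀) ∷ (σ (σ e) , l₁) ∷ (σ (σ (σ e)) , l₂) ∷ vz
        move : ∀ {z} → z ∈ (σ e , l₀) ∷ (σ (σ e) , l₁) ∷ (σ (σ (σ e)) , l₂) ∷ zs ++ vz → z ∈ WZ ++ VZ
        move (here refl) = there (∈.∈-++⁺ʳ zs (there (here refl)))
        move (there (here refl)) = there (∈.∈-++⁺ʳ zs (there (there (here refl))))
        move (there (there (here refl))) = there (∈.∈-++⁺ʳ zs (there (there (there (here refl)))))
        move (there (there (there m))) with ∈.∈-++⁻ zs m
        ... | inj₁ i = there (∈.∈-++⁺ˡ i)
        ... | inj₂ i = there (∈.∈-++⁺ʳ zs (there (there (there (there i)))))
        onto′ : ∀ {l} → k ≤ l → l < k + leaves t → l ≡ o ⊎ ∃ λ x → (x , l) ∈ WZ ++ VZ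
        onto′ a b with onto a b
        ... | inj₁ q = inj₁ q
        ... | inj₂ (x , h) = inj₂ (x , move h)
        stable′ : ∀ {Λ : D × ℕ → Set} → (∀ {z} → z ∈ WZ → Λ z) → (∀ {z} → z ∈ VZ → Λ z) → Around Λ WZ o →
                  ∀ {x m} → (x , m) ∈ WZ ++ VZ → Λ (σ (α x) , m)
        stable′ {Λ} wΛ vΛ (a₀ , a) {x} {m} h = cases h
          where
          inner : ∀ {x m} → (x , m) ∈ (σ e , l₀) ∷ (σ (σ e) , l₁) ∷ (σ (σ (σ e)) , l₂) ∷ zs ++ vz → Λ (σ (α x) , m)
          inner = stable {Λ}
            (λ { (here refl) → vΛ (there (here refl)) ; (there (here refl)) → vΛ (there (there (here refl)))
               ; (there (there (here refl))) → vΛ (there (there (there (here refl)))) ; (there (there (there z))) → wΛ (there z) })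
            (λ z → vΛ (there (there (there (there z)))))
            (vΛ (there (there (here refl))) , vΛ (there (there (there (here refl)))) ,
             subst (λ y → Λ (y , first o zs)) (sym (σ⁴ e)) (vΛ (here refl)) , a)
          cases : ∀ {x m} → (x , m) ∈ WZ ++ VZ → Λ (σ (α x) , m)
          cases (here refl) = subst (λ y → Λ (σ y , o)) (sym de) (subst (λ l → Λ (σ e , l)) start (vΛ (there (here refl))))
          cases (there h) with ∈.∈-++⁻ zs h
          ... | inj₁ i = inner (there (there (there (∈.∈-++⁺ˡ i))))
          ... | inj₂ (here refl) = subst (λ y → Λ (σ y , first o zs)) (sym ed) a₀
          ... | inj₂ (there (here refl)) = inner (here refl)
          ... | inj₂ (there (there (here refl))) = inner (there (here refl))
          ... | inj₂ (there (there (there (here refl)))) = inner (there (there (here refl)))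
          ... | inj₂ (there (there (there (there i)))) = inner (there (there (there (∈.∈-++⁺ʳ zs i))))

  injective⇒surjective : ∀ {k} (f : Fin k → Fin k) → (∀ {i j} → f i ≡ f j → i ≡ j) → ∀ j → ∃ λ i → f i ≡ j
  injective⇒surjective {suc k} f inj j with Fin.any? (λ i → f i Fin.≟ j)
  ... | yes p = p
  ... | no ¬p = ⊥-elim (ℕ.1+n≰n (Fin.injective⇒≤ {f = λ i → Fin.punchOut {i = j} {j = f i} (λ eq → ¬p (i , sym eq))}
                  (λ {x} {y} eq → inj (Fin.punchOut-injective (λ e → ¬p (x , sym e)) (λ e → ¬p (y , sym e)) eq))))

  module Planar {n : ℕ} (σ α : Fin (4 * n) → Fin (4 * n)) (σ⁴ : ∀ x → σ (σ (σ (σ x))) ≡ x)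
    (φ-injective : ∀ {x y} → σ (α x) ≡ σ (α y) → x ≡ y)
    {t : Tree} {root : Fin (4 * n)} {es : List (Fin (4 * n))}
    (real : Realisation.Real σ α t (Realisation.block σ α root) es)
    (uniq : Unique (Explored.support σ α (Realisation.block σ α root) es))
    (complete : ∀ x → x ∈ Explored.support σ α (Realisation.block σ α root) es)
    (count : suc (length es) ≡ n) where

    open Explored σ α
    open Peeling σ α σ⁴ using (Peel; euler; module Faces)
    open Labelling σ α σ⁴
    open Orbits (λ x → σ (α x)) φ-injective
    private
      module F = FaceLabels (faces 0 real)
      module G = Faces (SameOrbit (λ x → σ (α x))) orbit-refl orbit-sym orbit-trans orbit-step

      peel : Peel (block root ∷ []) (es ++ []) (leaves t + 0) 0
      peel = real-peel real Peel.done

      cov : G.Cover (root ∷ []) (block root ∷ []) (es ++ []) (leaves t + 0)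
      cov = G.cover peel ((orbit-refl G.∷ (orbit-refl G.∷ (orbit-refl G.∷ (orbit-refl G.∷ G.end (0 , σ⁴ root))))) ∷ [])

      reps : List (Fin (4 * n))
      reps = G.Cover.reps cov

      reps-length : length reps ≡ leaves t
      reps-length = trans (G.Cover.size cov) (ℕ.+-identityʳ (leaves t))

      covers : ∀ x → Any (SameOrbit (λ x → σ (α x)) x) reps
      covers x with ∈.∈-++⁻ (block root) (complete x)
      ... | inj₁ k = G.Cover.cs⊆ cov (∈.∈-++⁺ˡ {ys = []} k)
      ... | inj₂ k = G.Cover.es⊆ cov (subst (x ∈_) (cong darts (sym (List.++-identityʳ es))) k)

      labels : List (Fin (4 * n) × ℕ)
      labels = F.wz ++ F.vz

      labels-unique : Unique (map proj₁ labels)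
      labels-unique = subst Unique (sym (trans (List.map-++ proj₁ F.wz F.vz) (cong₂ _++_ F.wz-fst F.vz-fst))) uniq

      functional : ∀ {x l l′} → (x , l) ∈ labels → (x , l′) ∈ labels → l ≡ l′
      functional a b = cong proj₂ (unique-map-injective proj₁ labels-unique a b refl)

      step : ∀ {x l} → (x , l) ∈ labels → (σ (α x) , l) ∈ labels
      step = F.stable {_∈ labels} ∈.∈-++⁺ˡ (∈.∈-++⁺ʳ F.wz) (around F.wz F.wz-fst F.start (λ z → ∈.∈-++⁺ˡ z))
        where
        around : ∀ zs → map proj₁ zs ≡ block root → first F.o zs ≡ F.o → (∀ {z} → z ∈ zs → z ∈ labels) → Around (_∈ labels) zs F.o
        around ((_ , l) ∷ _ ∷ _ ∷ _ ∷ []) refl refl h =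
          h (there (here refl)) , h (there (there (here refl))) , h (there (there (there (here refl)))) ,
          subst (λ y → (y , l) ∈ labels) (sym (σ⁴ root)) (h (here refl)) , tt

      orbit-label : ∀ {x y l} → SameOrbit (λ x → σ (α x)) x y → (x , l) ∈ labels → (y , l) ∈ labels
      orbit-label (zero  , refl) h = h
      orbit-label (suc k , refl) h = step (orbit-label (k , refl) h)

      labelled : ∀ l → l < leaves t → ∃ λ x → (x , l) ∈ labels
      labelled l l< with F.onto z≤n l<
      ... | inj₂ p = p
      ... | inj₁ refl = root , head F.wz F.wz-fst F.start (λ z → ∈.∈-++⁺ˡ z)
        where
        head : ∀ zs → map proj₁ zs ≡ block root → first F.o zs ≡ F.o → (∀ {z} → z ∈ zs → z ∈ labels) → (root , F.o) ∈ labels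
        head ((x , l) ∷ zs) p eq h = subst₂ (λ x l → (x , l) ∈ labels) (List.∷-injectiveˡ p) eq (h (here refl))

      rep : Fin (leaves t) → Fin (4 * n)
      rep i = proj₁ (labelled (toℕ i) (Fin.toℕ<n i))

      distinct : ∀ i j → SameOrbit (λ x → σ (α x)) (rep i) (rep j) → i ≡ j
      distinct i j p = Fin.toℕ-injective (functional (orbit-label p (proj₂ (labelled (toℕ i) (Fin.toℕ<n i))))
        (proj₂ (labelled (toℕ j) (Fin.toℕ<n j))))

      index : Fin (4 * n) → Fin (leaves t)
      index x = Fin.cast reps-length (Any.index (covers x))

      index-≈ : ∀ {x y} → index x ≡ index y → SameOrbit (λ x → σ (α x)) x y
      index-≈ {x} {y} eq = orbit-trans (Any.lookup-index (covers x)) (orbit-sym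
        (subst (λ k → SameOrbit (λ x → σ (α x)) y (lookup reps k)) (sym same) (Any.lookup-index (covers y))))
        where
        same : Any.index (covers x) ≡ Any.index (covers y)
        same = Fin.toℕ-injective (trans (sym (Fin.toℕ-cast reps-length _)) (trans (cong toℕ eq) (Fin.toℕ-cast reps-length _)))

    -- Labels are constant on orbits, so one dart per label gives `leaves t` distinct orbits, while
    -- the covering list allows no more. An injection between finite sets of equal size is onto, so
    -- the chosen darts meet every orbit.
    hasOrbits-leaves : HasOrbits (λ x → σ (α x)) (leaves t)
    hasOrbits-leaves = rep , hit , distinct
      where
      hit : ∀ e → ∃ λ i → SameOrbit (λ x → σ (α x)) (rep i) e
      hit e with injective⇒surjective (λ i → index (rep i)) (λ {i} {j} eq → distinct i j (index-≈ eq)) (index e)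
      ... | i , eq = i , index-≈ eq

    leaves-count : leaves t ≡ n + 2
    leaves-count = half (trans (sym (ℕ.+-identityʳ (leaves t + leaves t))) (trans (sym (trans (euler peel)
        (cong (λ k → k + k + 0) (ℕ.+-identityʳ (leaves t))))) (trans
      (cong (λ k → 4 + (k + k) + 2) (cong length (List.++-identityʳ es))) (trans (lemma (length es)) (cong (λ n → n + 2 + (n + 2)) count)))))
      where
      lemma : ∀ e → 4 + (e + e) + 2 ≡ suc e + 2 + (suc e + 2)
      lemma = solve-∀
      half : ∀ {a b} → a + a ≡ b + b → a ≡ b
      half {zero}  {zero}  _ = refl
      half {suc a} {suc b} p = cong suc (half (ℕ.suc-injective (trans (sym (ℕ.+-suc a a)) (trans (ℕ.suc-injective p) (ℕ.+-suc b b)))))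

    hasOrbits : HasOrbits (λ x → σ (α x)) (n + 2)
    hasOrbits = subst (HasOrbits (λ x → σ (α x))) leaves-count hasOrbits-leaves

-- From trees back to rooted maps; equal trees correspond to isomorphic maps.

module TreeToMap where

  open import Defs using (SameOrbit; Reach; here; viaσ; viaα; RootedS4Map; RootedIso)
  open Trees
  open Models
  open Charts
  open Rotation using (wf-unique; at-≢)
  open HeadClashes using (Region)
  open FourLegs using (Scattered)
  open AnyGenus
  open MapToTree
  open Planarity using (module Planar)
  open import Data.Nat using (ℕ; zero; suc; _+_; _*_; _≤_; _<_; z≤n; s≤s)
  import Data.Nat.Properties as ℕ
  open import Data.Fin as Fin using (Fin; toℕ; fromℕ<)
  import Data.Fin.Properties as Fin
  open import Data.List using (List; []; _∷_; _++_; length; map; zip)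
  import Data.List.Properties as List
  open import Data.List.Membership.Propositional using (_∈_)
  import Data.List.Membership.Propositional.Properties as ∈
  open import Data.List.Relation.Unary.Any using (here; there)
  open import Data.List.Relation.Unary.All as All using ([]; _∷_)
  open import Data.List.Relation.Unary.AllPairs using ([]; _∷_)
  open import Data.List.Relation.Unary.Unique.Propositional using (Unique)
  import Data.List.Relation.Unary.Unique.Propositional.Properties as Unique
  open import Data.Product using (∃; _×_; _,_; proj₁; proj₂)
  open import Data.Sum using (_⊎_; inj₁; inj₂)
  open import Data.Empty using (⊥-elim)
  open import Function using (_∘_)
  open import Function.Bundles using (mk↔ₛ′; Inverse)
  open import Relation.Nullary using (¬_)
  open import Relation.Binary.PropositionalEquality

  module SquareBlocks {D : Set} (σ α : D → D) (σ⁴ : ∀ x → σ (σ (σ (σ x))) ≡ x) where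
    open Explored σ α

    block-σ : ∀ {e x} → x ∈ block e → σ x ∈ block e
    block-σ (here refl) = there (here refl)
    block-σ (there (here refl)) = there (there (here refl))
    block-σ (there (there (here refl))) = there (there (there (here refl)))
    block-σ {e} (there (there (there (here refl)))) = here (σ⁴ e)

    darts-σ : ∀ es {x} → x ∈ darts es → σ x ∈ darts es
    darts-σ es m with darts⇒block es m
    ... | e , e∈ , k = block⊆darts e∈ (block-σ k)

  scattered-model : {D : Set} {σ α : D → D} {t : Tree} {root : D} {es : List D} →
    Realisation.Real σ α t (Realisation.block σ α root) es → Unique (Explored.support σ α (Realisation.block σ α root) es) →
    Scattered t → ∀ {x y} → x ≢ y → x ∈ Realisation.block σ α root → y ∈ Realisation.block σ α root →
    ¬ Explored.Clash σ α es x y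
  scattered-model {σ = σ} {α} {root = root} {es} real uniq (c₀₁ , c₁₂ , c₂₃ , c₃₀ , c₀₂ , c₁₃) = go
    where
    open Explored σ α
    open AnyModel real uniq using (clash⁺)
    0ᵢ : block root [ 0 ]= root
    0ᵢ = zero
    1ᵢ : block root [ 1 ]= σ root
    1ᵢ = suc zero
    2ᵢ : block root [ 2 ]= σ (σ root)
    2ᵢ = suc (suc zero)
    3ᵢ : block root [ 3 ]= σ (σ (σ root))
    3ᵢ = suc (suc (suc zero))
    sym′ : ∀ {x y} → x ∈ block root → Clash es x y → Clash es y x
    sym′ = Rotation.Local.clash-sym σ α real uniq
    go : ∀ {x y} → x ≢ y → x ∈ block root → y ∈ block root → ¬ Clash es x y
    go ne (here refl) (here refl) k = ne refl
    go ne (here refl) (there (here refl)) k = c₀₁ (clash⁺ 0ᵢ 1ᵢ k)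
    go ne (here refl) (there (there (here refl))) k = c₀₂ (clash⁺ 0ᵢ 2ᵢ k)
    go ne m@(here refl) (there (there (there (here refl)))) k = c₃₀ (clash⁺ 3ᵢ 0ᵢ (sym′ m k))
    go ne m@(there (here refl)) (here refl) k = c₀₁ (clash⁺ 0ᵢ 1ᵢ (sym′ m k))
    go ne (there (here refl)) (there (here refl)) k = ne refl
    go ne (there (here refl)) (there (there (here refl))) k = c₁₂ (clash⁺ 1ᵢ 2ᵢ k)
    go ne (there (here refl)) (there (there (there (here refl)))) k = c₁₃ (clash⁺ 1ᵢ 3ᵢ k)
    go ne m@(there (there (here refl))) (here refl) k = c₀₂ (clash⁺ 0ᵢ 2ᵢ (sym′ m k))
    go ne m@(there (there (here refl))) (there (here refl)) k = c₁₂ (clash⁺ 1ᵢ 2ᵢ (sym′ m k))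
    go ne (there (there (here refl))) (there (there (here refl))) k = ne refl
    go ne (there (there (here refl))) (there (there (there (here refl)))) k = c₂₃ (clash⁺ 2ᵢ 3ᵢ k)
    go ne (there (there (there (here refl)))) (here refl) k = c₃₀ (clash⁺ 3ᵢ 0ᵢ k)
    go ne m@(there (there (there (here refl)))) (there (here refl)) k = c₁₃ (clash⁺ 1ᵢ 3ᵢ (sym′ m k))
    go ne m@(there (there (there (here refl)))) (there (there (here refl))) k = c₂₃ (clash⁺ 2ᵢ 3ᵢ (sym′ m k))
    go ne (there (there (there (here refl)))) (there (there (there (here refl)))) k = ne refl

  model-scattered : {D : Set} {σ α : D → D} {t : Tree} {root : D} {es : List D} →
    Realisation.Real σ α t (Realisation.block σ α root) es → Unique (Explored.support σ α (Realisation.block σ α root) es) →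
    (∀ {x y} → x ≢ y → x ∈ Realisation.block σ α root → y ∈ Realisation.block σ α root → ¬ Explored.Clash σ α es x y) →
    Scattered t
  model-scattered {σ = σ} {α} {root = root} {es} real uniq h =
    no zero (suc zero) (λ ()) , no (suc zero) (suc (suc zero)) (λ ()) , no (suc (suc zero)) (suc (suc (suc zero))) (λ ()) ,
    no (suc (suc (suc zero))) zero (λ ()) , no zero (suc (suc zero)) (λ ()) , no (suc zero) (suc (suc (suc zero))) (λ ())
    where
    open Explored σ α
    no : ∀ {i j x y} → block root [ i ]= x → block root [ j ]= y → i ≢ j → ¬ ClashTree i j _
    no p q i≢j k = h (at-≢ (unique-++ˡ (block root) uniq) i≢j p q) (at-∈ p) (at-∈ q) (AnyModel.clash⁻ real uniq p q k)

  module SimpleMap {n : ℕ} (m : RootedS4Map n) (T : FromMap.TreeOf m) where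
    open RootedS4Map m
    open FromMap m using (σ-injective)
    open FromMap.TreeOf T
    open Explored σ α
    private module O = Orbits σ σ-injective

    block-orbit : ∀ {e x} → x ∈ block e → SameOrbit σ e x
    block-orbit (here refl)                         = 0 , refl
    block-orbit (there (here refl))                 = 1 , refl
    block-orbit (there (there (here refl)))         = 2 , refl
    block-orbit (there (there (there (here refl)))) = 3 , refl

    same-block-orbit : ∀ {e x y} → x ∈ block e → y ∈ block e → SameOrbit σ x y
    same-block-orbit p q = O.orbit-trans (O.orbit-sym (block-orbit p)) (block-orbit q)

    -- At one vertex, two darts joined to each other form a loop, and two darts ending at a common
    -- vertex form a double edge.
    no-clash : ∀ {x y} → x ≢ y → SameOrbit σ x y → ¬ Clash vertices x y
    no-clash x≢y o (inj₁ refl) = loopless _ o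
    no-clash {x} {y} x≢y o (inj₂ (e , _ , p , q)) =
      no-multi x y (λ eq → x≢y (sym eq)) (λ { refl → loopless x o }) o (same-block-orbit p q)

    simple : Simple vertices
    simple x≢y (e , _ , p , q) = no-clash x≢y (same-block-orbit p q)

    simpleTree : SimpleTree tree
    simpleTree = AnyModel.simple⁺ real uniq simple

    scatteredTree : Scattered tree
    scatteredTree = model-scattered real uniq (λ x≢y p q → no-clash x≢y (same-block-orbit p q))

    region : ∀ {n′} → n ≡ suc n′ → Region 2 n′ tree
    region refl = subst (WF tree 2) (ℕ.suc-injective count) (real-wf real refl) , simpleTree

  module TwoMaps {n : ℕ} {m m′ : RootedS4Map n} (T : FromMap.TreeOf m) (T′ : FromMap.TreeOf m′) where
    private
      module M  = RootedS4Map m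
      module M′ = RootedS4Map m′
      module T  = FromMap.TreeOf T
      module T′ = FromMap.TreeOf T′
      D : Set
      D = Fin (4 * n)

    module FromTree (same : T.tree ≡ T′.tree) where
      private
        module Pr = Product M.σ M.α M′.σ M′.α
        es×es′ : List (D × D)
        es×es′ = zip T.vertices T′.vertices

        real′ : Realisation.Real M′.σ M′.α T.tree (Realisation.block M′.σ M′.α M′.root) T′.vertices
        real′ = subst (λ t → Realisation.Real M′.σ M′.α t _ _) (sym same) T′.real

        real× : Pr.P.Real T.tree (Pr.P.block (M.root , M′.root)) es×es′
        real× = Pr.real-zip T.real real′

        -- The darts of the common tree in the product of the two maps. Since both projections list
        -- every dart exactly once, this list is the graph of a bijection, and closure under both
        -- permutations makes it an isomorphism.
        L : List (D × D)
        L = Pr.P.darts ((M.root , M′.root) ∷ es×es′)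

        module F = Morphism (Pr.σ×α× M.σ M′.σ) (Pr.σ×α× M.α M′.α) M.σ M.α proj₁ (λ _ → refl) (λ _ → refl)
        module G = Morphism (Pr.σ×α× M.σ M′.σ) (Pr.σ×α× M.α M′.α) M′.σ M′.α proj₂ (λ _ → refl) (λ _ → refl)

        L₁ : map proj₁ L ≡ Explored.support M.σ M.α (Realisation.block M.σ M.α M.root) T.vertices
        L₁ = trans (F.map-darts ((M.root , M′.root) ∷ es×es′)) (cong (λ es → Realisation.darts M.σ M.α (M.root ∷ es))
          (zip-proj₁ T.vertices T′.vertices (Pr.real-length-vertices T.real real′)))

        L₂ : map proj₂ L ≡ Explored.support M′.σ M′.α (Realisation.block M′.σ M′.α M′.root) T′.vertices
        L₂ = trans (G.map-darts ((M.root , M′.root) ∷ es×es′)) (cong (λ es → Realisation.darts M′.σ M′.α (M′.root ∷ es))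
          (zip-proj₂ T.vertices T′.vertices (Pr.real-length-vertices T.real real′)))

        u₁ : Unique (map proj₁ L)
        u₁ = subst Unique (sym L₁) T.uniq

        u₂ : Unique (map proj₂ L)
        u₂ = subst Unique (sym L₂) T′.uniq

        find₁ : ∀ x → ∃ λ p → p ∈ L × x ≡ proj₁ p
        find₁ x = ∈.∈-map⁻ proj₁ (subst (x ∈_) (sym L₁) (T.complete x))

        find₂ : ∀ x → ∃ λ p → p ∈ L × x ≡ proj₂ p
        find₂ x = ∈.∈-map⁻ proj₂ (subst (x ∈_) (sym L₂) (T′.complete x))

        f g : D → D
        f x = proj₂ (proj₁ (find₁ x))
        g x = proj₁ (proj₁ (find₂ x))

        f-graph : ∀ x → (x , f x) ∈ L
        f-graph x with find₁ x
        ... | (_ , _) , m , refl = m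

        g-graph : ∀ x → (g x , x) ∈ L
        g-graph x with find₂ x
        ... | (_ , _) , m , refl = m

        f-unique : ∀ {x y} → (x , y) ∈ L → f x ≡ y
        f-unique {x} m = cong proj₂ (unique-map-injective proj₁ u₁ (f-graph x) m refl)

        g-unique : ∀ {x y} → (x , y) ∈ L → g y ≡ x
        g-unique {y = y} m = cong proj₁ (unique-map-injective proj₂ u₂ (g-graph y) m refl)

        σ-closed : ∀ {x y} → (x , y) ∈ L → (M.σ x , M′.σ y) ∈ L
        σ-closed = SquareBlocks.darts-σ (Pr.σ×α× M.σ M′.σ) (Pr.σ×α× M.α M′.α)
          (λ (x , y) → cong₂ _,_ (M.σ-order4 x) (M′.σ-order4 y)) ((M.root , M′.root) ∷ es×es′)

        α-closed : ∀ {x y} → (x , y) ∈ L → (M.α x , M′.α y) ∈ L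
        α-closed m = proj₂ (Pr.P.real-α real× m)

      iso : RootedIso m m′
      iso = mk↔ₛ′ f g (λ y → f-unique (g-graph y)) (λ x → g-unique (f-graph x)) ,
        (λ d → f-unique (σ-closed (f-graph d))) , (λ d → f-unique (α-closed (f-graph d))) , f-unique (here refl)

    -- The isomorphism carries the first realisation to one on the legs of the second map, and legs
    -- determine the tree.
    iso⇒tree : RootedIso m m′ → T.tree ≡ T′.tree
    iso⇒tree (φ , f-σ , f-α , f-root) = Explored.real-determined M′.σ M′.α mapped T′.real mapped-unique T′.uniq
      where
      f : D → D
      f = Inverse.to φ
      module F = Morphism M.σ M.α M′.σ M′.α f (λ x → sym (f-σ x)) (λ x → sym (f-α x))
      root-block : map f (Realisation.block M.σ M.α M.root) ≡ Realisation.block M′.σ M′.α M′.root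
      root-block = trans (F.map-block M.root) (cong (Realisation.block M′.σ M′.α) f-root)
      mapped : Realisation.Real M′.σ M′.α T.tree (Realisation.block M′.σ M′.α M′.root) (map f T.vertices)
      mapped = subst (λ w → Realisation.Real M′.σ M′.α T.tree w (map f T.vertices)) root-block (F.real-map T.real)
      f-injective : ∀ {x y} → f x ≡ f y → x ≡ y
      f-injective {x} {y} eq = trans (sym (Inverse.strictlyInverseʳ φ x)) (trans (cong (Inverse.from φ) eq) (Inverse.strictlyInverseʳ φ y))
      mapped-unique : Unique (Explored.support M′.σ M′.α (Realisation.block M′.σ M′.α M′.root) (map f T.vertices))
      mapped-unique = subst Unique (trans (F.map-support (Realisation.block M.σ M.α M.root) T.vertices)
        (cong (_++ Realisation.darts M′.σ M′.α (map f T.vertices)) root-block)) (Unique.map⁺ f-injective T.uniq)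

  module ToMap {n : ℕ} (σ α : Fin (4 * n) → Fin (4 * n)) (σ⁴ : ∀ x → σ (σ (σ (σ x))) ≡ x) (σ²≢ : ∀ x → σ (σ x) ≢ x)
    {t : Tree} (root : Fin (4 * n)) (es : List (Fin (4 * n)))
    (real : Realisation.Real σ α t (Realisation.block σ α root) es)
    (uniq : Unique (Explored.support σ α (Realisation.block σ α root) es))
    (complete : ∀ x → x ∈ Explored.support σ α (Realisation.block σ α root) es)
    (count : suc (length es) ≡ n)
    (simple : Explored.Simple σ α es)
    (scattered : ∀ {x y} → x ≢ y → x ∈ Realisation.block σ α root → y ∈ Realisation.block σ α root →
                 ¬ Explored.Clash σ α es x y) where
    open Explored σ α
    open SquareBlocks σ α σ⁴

    D : Set
    D = Fin (4 * n)

    α² : ∀ x → α (α x) ≡ x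
    α² x = proj₁ (real-α real (complete x))

    α-fpf : ∀ x → α x ≢ x
    α-fpf x = real-α-fpf real uniq (complete x)

    φ-injective : ∀ {x y} → σ (α x) ≡ σ (α y) → x ≡ y
    φ-injective {x} {y} eq = trans (sym (α² x)) (trans (cong α
      (trans (sym (σ⁴ (α x))) (trans (cong (σ ∘ σ ∘ σ) eq) (σ⁴ (α y))))) (α² y))

    reach-trans : ∀ {x y z} → Reach σ α x y → Reach σ α y z → Reach σ α x z
    reach-trans p here     = p
    reach-trans p (viaσ q) = viaσ (reach-trans p q)
    reach-trans p (viaα q) = viaα (reach-trans p q)

    reach-sym : ∀ {x y} → Reach σ α x y → Reach σ α y x
    reach-sym here = here
    reach-sym (viaσ {e} p) = reach-trans (subst (Reach σ α (σ e)) (σ⁴ e) (viaσ (viaσ (viaσ here)))) (reach-sym p)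
    reach-sym (viaα {e} p) = reach-trans (subst (Reach σ α (α e)) (α² e) (viaα here)) (reach-sym p)

    reach-all : ∀ {r t w es} → Real t w es → (∀ {x} → x ∈ w → Reach σ α r x) → ∀ {x} → x ∈ support w es → Reach σ α r x
    reach-all nil h ()
    reach-all {r} (join {d = d} {u} {xs} {ys} {es} {fs} du ud p q) h m
      with ∈.∈-++⁻ (d ∷ xs ++ u ∷ ys) m
    ... | inj₁ k = h k
    ... | inj₂ k with ∈.∈-++⁻ (darts es) (subst (_ ∈_) (darts-++ es fs) k)
    ... | inj₁ i = reach-all p (λ j → h (there (∈.∈-++⁺ˡ j))) (∈.∈-++⁺ʳ xs i)
    ... | inj₂ i = reach-all q (λ j → h (there (∈.∈-++⁺ʳ xs (there j)))) (∈.∈-++⁺ʳ ys i)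
    reach-all {r} (new {d = d} {e} {xs} {es} de ed p) h {x} m = cases (∈.∈-++⁻ (d ∷ xs) m)
      where
      re : Reach σ α r e
      re = subst (Reach σ α r) de (viaα (h (here refl)))
      inner : ∀ {x} → x ∈ support (σ e ∷ σ (σ e) ∷ σ (σ (σ e)) ∷ xs) es → Reach σ α r x
      inner = reach-all p λ { (here refl) → viaσ re ; (there (here refl)) → viaσ (viaσ re)
                            ; (there (there (here refl))) → viaσ (viaσ (viaσ re)) ; (there (there (there j))) → h (there j) }
      cases : x ∈ d ∷ xs ⊎ x ∈ block e ++ darts es → Reach σ α r x
      cases (inj₁ k) = h k
      cases (inj₂ (here refl)) = re
      cases (inj₂ (there (here refl))) = viaσ re
      cases (inj₂ (there (there (here refl)))) = viaσ (viaσ re)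
      cases (inj₂ (there (there (there (here refl))))) = viaσ (viaσ (viaσ re))
      cases (inj₂ (there (there (there (there k))))) = inner (∈.∈-++⁺ʳ (σ e ∷ σ (σ e) ∷ σ (σ (σ e)) ∷ xs) k)

    reach-root : ∀ x → Reach σ α root x
    reach-root x = reach-all real
      (λ { (here refl) → here ; (there (here refl)) → viaσ here ; (there (there (here refl))) → viaσ (viaσ here)
         ; (there (there (there (here refl)))) → viaσ (viaσ (viaσ here)) }) (complete x)

    block-of : ∀ x → ∃ λ e → e ∈ root ∷ es × x ∈ block e
    block-of x = darts⇒block (root ∷ es) (complete x)

    orbit-block : ∀ {e x y} → SameOrbit σ x y → x ∈ block e → y ∈ block e
    orbit-block (zero  , refl) m = m
    orbit-block (suc k , refl) m = block-σ (orbit-block (k , refl) m)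

    no-clash : ∀ {e x y} → e ∈ root ∷ es → x ≢ y → x ∈ block e → y ∈ block e → ¬ Clash es x y
    no-clash (here refl) x≢y p q = scattered x≢y p q
    no-clash (there m)   x≢y p q = simple x≢y (_ , m , p , q)

    loopless : ∀ d → ¬ SameOrbit σ d (α d)
    loopless d o with block-of d
    ... | e , m , p = no-clash m (λ eq → α-fpf d (sym eq)) p (orbit-block o p) (inj₁ refl)

    no-multi : ∀ d e → e ≢ d → e ≢ α d → SameOrbit σ d e → ¬ SameOrbit σ (α d) (α e)
    no-multi d e e≢d _ o o′ with block-of d | block-of (α d)
    ... | f , fm , p | g , there gm , q = no-clash fm (λ eq → e≢d (sym eq)) p (orbit-block o p) (inj₂ (g , gm , q , orbit-block o′ q))
    ... | f , here refl , p | g , here refl , q = no-clash (here refl) (λ eq → α-fpf d (sym eq)) p q (inj₁ refl)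
    -- The edges of `d` and `e` run from an explored vertex to the root vertex, so the clash is
    -- found at their other ends: `α d` and `α e` are darts of the root vertex that end at a common
    -- explored vertex.
    ... | f , there fm , p | g , here refl , q = no-clash (here refl) (λ eq → e≢d (trans (sym (α² e)) (trans (cong α (sym eq)) (α² d))))
          q (orbit-block o′ q) (inj₂ (f , fm , subst (_∈ block f) (sym (α² d)) p , subst (_∈ block f) (sym (α² e)) (orbit-block o p)))

    rootedMap : RootedS4Map n
    rootedMap = record
      { σ = σ ; α = α ; root = root ; α-invol = α² ; α-fpf = α-fpf ; σ-order4 = σ⁴ ; σ-noshort = σ²≢
      ; connected = λ d e → reach-trans (reach-sym (reach-root d)) (reach-root e)
      ; planar = Planar.hasOrbits σ α σ⁴ φ-injective real uniq complete count
      ; loopless = loopless ; no-multi = no-multi }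

    rootedTree : FromMap.TreeOf rootedMap
    rootedTree = record { tree = t ; vertices = es ; real = real ; uniq = uniq ; complete = complete ; count = count }

  quad≡ : ∀ n → quad n ≡ 4 * n
  quad≡ zero    = refl
  quad≡ (suc n) = trans (cong (4 +_) (quad≡ n)) (sym (ℕ.*-suc 4 n))

  σ₄-< : ∀ {x} n → x < quad n → σ₄ x < quad n
  σ₄-< {0} (suc n) _ = s≤s (s≤s z≤n)
  σ₄-< {1} (suc n) _ = s≤s (s≤s (s≤s z≤n))
  σ₄-< {2} (suc n) _ = s≤s (s≤s (s≤s (s≤s z≤n)))
  σ₄-< {3} (suc n) _ = s≤s z≤n
  σ₄-< {suc (suc (suc (suc x)))} (suc n) (s≤s (s≤s (s≤s (s≤s p)))) = s≤s (s≤s (s≤s (s≤s (σ₄-< n p))))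

  σ₄²-≢ : ∀ x → σ₄ (σ₄ x) ≢ x
  σ₄²-≢ (suc (suc (suc (suc x)))) eq = σ₄²-≢ x (ℕ.suc-injective (ℕ.suc-injective (ℕ.suc-injective (ℕ.suc-injective eq))))

  upFrom-∈ : ∀ m n {x} → m ≤ x → x < m + n → x ∈ upFrom m n
  upFrom-∈ m zero    {x} p q = ⊥-elim (ℕ.<⇒≱ q (subst (_≤ x) (sym (ℕ.+-identityʳ m)) p))
  upFrom-∈ m (suc n) {x} p q with ℕ.m≤n⇒m<n∨m≡n p
  ... | inj₂ refl = here refl
  ... | inj₁ m<x  = there (upFrom-∈ (suc m) n m<x (subst (x <_) (ℕ.+-suc m n) q))

  upFrom-< : ∀ m n {x} → x ∈ upFrom m n → x < m + n
  upFrom-< m (suc n) (here refl) = ℕ.≤-trans (s≤s (ℕ.m≤m+n m n)) (ℕ.≤-reflexive (sym (ℕ.+-suc m n)))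
  upFrom-< m (suc n) {x} (there p) = subst (x <_) (sym (ℕ.+-suc m n)) (upFrom-< (suc m) n p)

  module Restrict {N : ℕ} (f : ℕ → ℕ) (f-< : ∀ {x} → x < N → f x < N) where
    restrict : Fin N → Fin N
    restrict i = fromℕ< (f-< (Fin.toℕ<n i))

    toℕ-restrict : ∀ i → toℕ (restrict i) ≡ f (toℕ i)
    toℕ-restrict i = Fin.toℕ-fromℕ< (f-< (Fin.toℕ<n i))

  module Lift {D D′ : Set} (σ α : D → D) (σ′ α′ : D′ → D′) (f : D → D′)
    (f-σ : ∀ x → σ′ (f x) ≡ f (σ x)) (f-α : ∀ x → α′ (f x) ≡ f (α x)) (f-injective : ∀ {x y} → f x ≡ f y → x ≡ y) where
    module M  = Realisation σ α
    module M′ = Realisation σ′ α′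

    map-split : ∀ w xs {u ys} → map f w ≡ xs ++ u ∷ ys →
      ∃ λ xs₀ → ∃ λ u₀ → ∃ λ ys₀ → w ≡ xs₀ ++ u₀ ∷ ys₀ × map f xs₀ ≡ xs × f u₀ ≡ u × map f ys₀ ≡ ys
    map-split (x ∷ w) []       refl = [] , x , w , refl , refl , refl , refl
    map-split (x ∷ w) (_ ∷ xs) eq with List.∷-injective eq
    ... | refl , eq′ with map-split w xs eq′
    ... | xs₀ , u₀ , ys₀ , refl , refl , p , q = x ∷ xs₀ , u₀ , ys₀ , refl , refl , p , q

    -- Only the legs need a preimage to begin with: a partner is found among the lifted legs, and a
    -- new vertex is entered at the `α` image of a lifted leg, so the realisation lifts step by
    -- step.
    lift : ∀ {t w′ es′} → M′.Real t w′ es′ → ∀ w → map f w ≡ w′ → ∃ λ es → map f es ≡ es′ × M.Real t w es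
    lift M′.nil [] refl = [] , refl , M.nil
    lift (M′.join {xs = xs} du ud p q) (d ∷ w) eq with List.∷-injective eq
    ... | refl , eq′ with map-split w xs eq′
    ... | xs₀ , u₀ , ys₀ , refl , eq₁ , refl , eq₂ with lift p xs₀ eq₁ | lift q ys₀ eq₂
    ... | es , refl , a | fs , refl , b = es ++ fs , List.map-++ f es fs ,
      M.join (f-injective (trans (sym (f-α d)) du)) (f-injective (trans (sym (f-α u₀)) ud)) a b
    lift (M′.new {e = e} de ed p) (d ∷ w) refl
      with lift p (σ (α d) ∷ σ (σ (α d)) ∷ σ (σ (σ (α d))) ∷ w) (cong₂ _∷_ e₁ (cong₂ _∷_ e₂ (cong₂ _∷_ e₃ refl)))
      where
      e₀ : f (α d) ≡ e
      e₀ = trans (sym (f-α d)) de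
      e₁ = trans (sym (f-σ (α d))) (cong σ′ e₀)
      e₂ = trans (sym (f-σ (σ (α d)))) (cong σ′ e₁)
      e₃ = trans (sym (f-σ (σ (σ (α d))))) (cong σ′ e₂)
    ... | es , refl , a = α d ∷ es , cong (_∷ map f es) (trans (sym (f-α d)) de) ,
      M.new refl (f-injective (trans (sym (f-α (α d))) (trans (cong α′ (trans (sym (f-α d)) de)) ed))) a

  unique-map⁻ : {A B : Set} (f : A → B) {xs : List A} → Unique (map f xs) → Unique xs
  unique-map⁻ f {[]}     u = []
  unique-map⁻ f {x ∷ xs} u = All.tabulate (λ {y} m eq → unique-∉ u (subst (λ z → f z ∈ map f xs) (sym eq) (∈.∈-map⁺ f m))) ∷
    unique-map⁻ f (unique-tail u)

  module Transport {N : ℕ} (σ α : Fin N → Fin N) (α₀ : ℕ → ℕ) (σ-toℕ : ∀ x → toℕ (σ x) ≡ σ₄ (toℕ x))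
    (α-toℕ : ∀ x → toℕ (α x) ≡ α₀ (toℕ x)) (root : Fin N) (root-toℕ : toℕ root ≡ 0) {t : Tree} {es₀ : List ℕ}
    (real₀ : Realisation.Real σ₄ α₀ t (0 ∷ 1 ∷ 2 ∷ 3 ∷ []) es₀)
    (uniq₀ : Unique (Explored.support σ₄ α₀ (0 ∷ 1 ∷ 2 ∷ 3 ∷ []) es₀))
    (complete₀ : ∀ (x : Fin N) → toℕ x ∈ Explored.support σ₄ α₀ (0 ∷ 1 ∷ 2 ∷ 3 ∷ []) es₀) where
    open Explored σ α

    σ⁴ : ∀ x → σ (σ (σ (σ x))) ≡ x
    σ⁴ x = Fin.toℕ-injective (trans (σ-toℕ (σ (σ (σ x)))) (trans (cong σ₄ (trans (σ-toℕ (σ (σ x)))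
      (cong σ₄ (trans (σ-toℕ (σ x)) (cong σ₄ (σ-toℕ x)))))) (σ₄⁴ (toℕ x))))

    σ²≢ : ∀ x → σ (σ x) ≢ x
    σ²≢ x eq = σ₄²-≢ (toℕ x) (trans (sym (trans (σ-toℕ (σ x)) (cong σ₄ (σ-toℕ x)))) (cong toℕ eq))

    private
      module Mo = Morphism σ α σ₄ α₀ toℕ (λ x → sym (σ-toℕ x)) (λ x → sym (α-toℕ x))

      root-block : map toℕ (block root) ≡ 0 ∷ 1 ∷ 2 ∷ 3 ∷ []
      root-block = trans (Mo.map-block root) (cong (Realisation.block σ₄ α₀) root-toℕ)

    lifted : ∃ λ es → map toℕ es ≡ es₀ × Real t (block root) es
    lifted = Lift.lift σ α σ₄ α₀ toℕ (λ x → sym (σ-toℕ x)) (λ x → sym (α-toℕ x)) Fin.toℕ-injective real₀ (block root) root-block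

    module _ (es : List (Fin N)) (es-toℕ : map toℕ es ≡ es₀) where
      support-map : map toℕ (support (block root) es) ≡ Explored.support σ₄ α₀ (0 ∷ 1 ∷ 2 ∷ 3 ∷ []) es₀
      support-map = trans (Mo.map-support (block root) es)
        (cong₂ (λ w es → w ++ Realisation.darts σ₄ α₀ es) root-block es-toℕ)

      uniq : Unique (support (block root) es)
      uniq = unique-map⁻ toℕ (subst Unique (sym support-map) uniq₀)

      complete : ∀ x → x ∈ support (block root) es
      complete x with ∈.∈-map⁻ toℕ (subst (toℕ x ∈_) (sym support-map) (complete₀ x))
      ... | y , m , eq = subst (_∈ support (block root) es) (sym (Fin.toℕ-injective eq)) m

  module FromTree {n : ℕ} {t : Tree} (wf : WF t 2 n) (simpleTree : SimpleTree t) (scattered : Scattered t) where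

    Planted : Set
    Planted = ∃ λ (m : RootedS4Map (suc n)) → ∃ λ (T : FromMap.TreeOf m) → FromMap.TreeOf.tree T ≡ t

    module Chosen (N : ℕ) (N≡ : N ≡ 4 * suc n) (α₀ : ℕ → ℕ) (es₀ : List ℕ)
      (real₀ : Realisation.Real σ₄ α₀ t (0 ∷ 1 ∷ 2 ∷ 3 ∷ []) es₀)
      (uniq₀ : Unique (Explored.support σ₄ α₀ (0 ∷ 1 ∷ 2 ∷ 3 ∷ []) es₀))
      (darts₀ : Explored.darts σ₄ α₀ es₀ ≡ upFrom 4 (quad n)) where

      private
        S : List ℕ
        S = Explored.support σ₄ α₀ (0 ∷ 1 ∷ 2 ∷ 3 ∷ []) es₀

        size : N ≡ quad (suc n)
        size = trans N≡ (sym (quad≡ (suc n)))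

        in-support : ∀ {x} → x < N → x ∈ S
        in-support {x} p = subst (λ ds → x ∈ 0 ∷ 1 ∷ 2 ∷ 3 ∷ ds) (sym darts₀)
          (upFrom-∈ 0 (quad (suc n)) z≤n (subst (x <_) size p))

        support-< : ∀ {x} → x ∈ S → x < N
        support-< {x} m = subst (x <_) (sym size) (upFrom-< 0 (quad (suc n)) (subst (λ ds → x ∈ 0 ∷ 1 ∷ 2 ∷ 3 ∷ ds) darts₀ m))

      module Sσ = Restrict {N} σ₄ (λ {x} p → subst (σ₄ x <_) (sym size) (σ₄-< (suc n) (subst (x <_) size p)))
      module Sα = Restrict {N} α₀ (λ p → support-< (proj₂ (Explored.real-α σ₄ α₀ real₀ (in-support p))))

      root : Fin N
      root = fromℕ< (support-< (here refl))

      module T = Transport {N} Sσ.restrict Sα.restrict α₀ Sσ.toℕ-restrict Sα.toℕ-restrict root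
        (Fin.toℕ-fromℕ< (support-< (here refl))) real₀ uniq₀ (λ x → in-support (Fin.toℕ<n x))

    module Assemble (σ α : Fin (4 * suc n) → Fin (4 * suc n)) (σ⁴ : ∀ x → σ (σ (σ (σ x))) ≡ x) (σ²≢ : ∀ x → σ (σ x) ≢ x)
      (root : Fin (4 * suc n)) (es : List (Fin (4 * suc n)))
      (real : Realisation.Real σ α t (Realisation.block σ α root) es)
      (uniq : Unique (Explored.support σ α (Realisation.block σ α root) es))
      (complete : ∀ x → x ∈ Explored.support σ α (Realisation.block σ α root) es) where

      private
        module M = ToMap {suc n} σ α σ⁴ σ²≢ root es real uniq complete
          (cong suc (proj₂ (wf-unique (Realisation.real-wf σ α real refl) wf)))
          (AnyModel.simple⁻ real uniq simpleTree) (scattered-model real uniq scattered)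

      planted : Planted
      planted = M.rootedMap , M.rootedTree , refl

    abstract
      planted : Planted
      -- The legs 0 to 3 are the first block and the other vertices start at block 1. Hence `σ₄`
      -- turns the legs as the darts of a vertex too, the root, and the darts fill the numbers below
      -- `4 * suc n`.
      planted with chart-on wf (0 ∷ 1 ∷ 2 ∷ 3 ∷ []) refl (upFrom-unique 0 4) 1 (λ m → upFrom-< 0 4 m)
      ... | α₀ , es₀ , real₀ , uniq₀ , darts₀ = go (4 * suc n) refl
        where
        go : ∀ N → N ≡ 4 * suc n → Planted
        go N refl = Assemble.planted C.Sσ.restrict C.Sα.restrict C.T.σ⁴ C.T.σ²≢ C.root (proj₁ C.T.lifted)
          (proj₂ (proj₂ C.T.lifted)) (C.T.uniq (proj₁ C.T.lifted) (proj₁ (proj₂ C.T.lifted)))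
          (C.T.complete (proj₁ C.T.lifted) (proj₁ (proj₂ C.T.lifted)))
          where module C = Chosen N refl α₀ es₀ real₀ uniq₀ darts₀

-- Counting rooted maps by scattered four-legged regions.

open import Defs
open Trees using (Tree)
open Models using (unique-∉; unique-tail)
open HeadClashes using (Region)
open Counting using (Count; module Count; count)
open Recurrences using (countN; shift)
open FourLegs using (Scattered; scattered?; ε)
open Elimination using (algebraic)
open MapToTree using (module FromMap)
open TreeToMap
open import Data.Nat using (ℕ; zero; suc)
open import Data.Integer using (+_)
open import Data.Empty using (⊥-elim)
open import Data.Fin as Fin using (Fin)
open import Data.List using (List; _∷_; lookup; length)
open import Data.List.Membership.Propositional using (_∈_)
import Data.List.Membership.Propositional.Properties as ∈
open import Data.List.Relation.Unary.Any using (index)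
import Data.List.Relation.Unary.Any.Properties as Any
open import Data.List.Relation.Unary.Unique.Propositional using (Unique)
open import Data.Product using (Σ; ∃; _×_; _,_; proj₁; proj₂)
open import Relation.Binary.PropositionalEquality

lookup-injective : {A : Set} {xs : List A} → Unique xs → ∀ i j → lookup xs i ≡ lookup xs j → i ≡ j
lookup-injective {xs = _ ∷ xs} u Fin.zero    Fin.zero    eq = refl
lookup-injective {xs = _ ∷ xs} u Fin.zero    (Fin.suc j) eq = ⊥-elim (unique-∉ u (subst (_∈ xs) (sym eq) (∈.∈-lookup j)))
lookup-injective {xs = _ ∷ xs} u (Fin.suc i) Fin.zero    eq = ⊥-elim (unique-∉ u (subst (_∈ xs) eq (∈.∈-lookup i)))
lookup-injective {xs = _ ∷ xs} u (Fin.suc i) (Fin.suc j) eq = cong Fin.suc (lookup-injective (unique-tail u) i j eq)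

-- Removing the root vertex leaves a region with four legs, that is, of half-length 2.
counted-by-trees : ∀ n {k} → Count (λ t → Region 2 n t × Scattered t) k → CountsRootedS4Maps (suc n) k
counted-by-trees n (count ts unique sound complete refl) = rep , hit , distinct
  where
  Planted : Tree → Set
  Planted t = ∃ λ (m : RootedS4Map (suc n)) → ∃ λ (T : FromMap.TreeOf m) → FromMap.TreeOf.tree T ≡ t

  planted : ∀ i → Planted (lookup ts i)
  planted i = FromTree.planted (proj₁ r) (proj₂ r) s
    where r = proj₁ (sound (∈.∈-lookup {xs = ts} i))
          s = proj₂ (sound (∈.∈-lookup {xs = ts} i))

  rep : Fin (length ts) → RootedS4Map (suc n)
  rep i = proj₁ (planted i)

  treeOf-rep : ∀ i → FromMap.TreeOf (rep i)
  treeOf-rep i = proj₁ (proj₂ (planted i))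

  tree-rep : ∀ i → FromMap.TreeOf.tree (treeOf-rep i) ≡ lookup ts i
  tree-rep i = proj₂ (proj₂ (planted i))

  hit : ∀ m → ∃ λ i → RootedIso m (rep i)
  hit m = index t∈ , TwoMaps.FromTree.iso T (treeOf-rep (index t∈)) (trans (Any.lookup-index t∈) (sym (tree-rep (index t∈))))
    where
    T = FromMap.treeOf m
    t∈ = complete (SimpleMap.region m T refl , SimpleMap.scatteredTree m T)

  distinct : ∀ i j → RootedIso (rep i) (rep j) → i ≡ j
  distinct i j φ = lookup-injective unique i j
    (trans (sym (tree-rep i)) (trans (TwoMaps.iso⇒tree (treeOf-rep i) (treeOf-rep j) φ) (tree-rep j)))

countsRootedMaps : ∀ n → CountsRootedS4Maps n (shift ε n)
-- A map without vertices has no dart to be its root, in agreement with the default value 0 of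
-- `shift` at 0; in general the shift accounts for the root vertex that was cut away.
countsRootedMaps zero    = (λ ()) , (λ m → noRoot (RootedS4Map.root m)) , λ ()
  where
  noRoot : ∀ {A : Set} → Fin 0 → A
  noRoot ()
countsRootedMaps (suc n) = counted-by-trees n (countN scattered? 2 n)

theorem4 : Σ (ℕ → ℕ) λ M →
    ((n : ℕ) → CountsRootedS4Maps n (M n)) ×
    Algebraic (λ n → + M n)
theorem4 = shift ε , countsRootedMaps , algebraic
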